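{- For every cap-free graph $G=(V,E)$ with no even hole, the stable set polytope of $G$ admits a compact extended formulation.
   Context: A hole is a chordless cycle of length greater than three; an even hole is a hole with an even number of nodes. A cap is a hole together with an additional node adjacent to two adjacent nodes of the hole and to no other node of the hole; a graph is cap-free if it has no cap as an induced subgraph. The stable set polytope of $G$ is the convex hull in $\mathbb{R}^V$ of the characteristic vectors of the stable sets of $G$. An extended formulation for a polytope $P\subseteq\mathbb{R}^n$ is a system of linear inequalities $Ax+By\le d$ such that $P=\{x\in\mathbb{R}^n:\exists y\,[Ax+By\le d]\}$; it is compact if its encoding has size polynomial in $n$.
   Formalization: The stable set polytope and its extended formulation are taken over rational points (x and y rational, convex weights rational) instead of in real space; the linear system has rational data and size polynomial in n. -}

module Defs where

open import Data.Nat as ℕ using (ℕ; zero; suc)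
open import Data.Nat.Logarithm using (⌊log₂_⌋)
open import Data.Fin using (Fin; toℕ)
open import Data.Bool using (Bool; true; false; if_then_else_)
open import Data.Integer using (∣_∣)
open import Data.Rational as ℚ using (ℚ; 0ℚ; 1ℚ; _+_; _*_; _≤_)
open import Data.List using (List; []; _∷_; map)
open import Data.List.Relation.Unary.All using (All)
open import Data.Product using (Σ; _×_; _,_; proj₁; proj₂; ∃)
open import Data.Sum using (_⊎_)
open import Relation.Binary.PropositionalEquality using (_≡_; _≢_)
open import Relation.Nullary using (¬_)

record Graph (n : ℕ) : Set where
  field
    adj    : Fin n → Fin n → Bool
    sym    : ∀ i j → adj i j ≡ adj j i
    irrefl : ∀ i → adj i i ≡ false
open Graph public

CycAdj : (k : ℕ) → Fin k → Fin k → Set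
CycAdj k i j =
  (toℕ j ≡ suc (toℕ i)) ⊎ (toℕ i ≡ suc (toℕ j)) ⊎
  ((toℕ i ≡ 0 × suc (toℕ j) ≡ k) ⊎ (toℕ j ≡ 0 × suc (toℕ i) ≡ k))

record Hole {n : ℕ} (G : Graph n) : Set where
  field
    len     : ℕ
    len>3   : 3 ℕ.< len
    node    : Fin len → Fin n
    inj     : ∀ i j → node i ≡ node j → i ≡ j
    induced : ∀ i j → (adj G (node i) (node j) ≡ true → CycAdj len i j)
                    × (CycAdj len i j → adj G (node i) (node j) ≡ true)
open Hole public

Even : ℕ → Set
Even k = ∃ λ m → k ≡ m ℕ.+ m

EvenHoleFree : ∀ {n} → Graph n → Set
EvenHoleFree G = ¬ (Σ (Hole G) λ H → Even (len H))

record Cap {n : ℕ} (G : Graph n) : Set where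
  field
    hole   : Hole G
    v      : Fin n
    i i'   : Fin (len hole)
    i~i'   : CycAdj (len hole) i i'
    v∉H    : ∀ j → v ≢ node hole j
    nbrs   : ∀ j → (adj G v (node hole j) ≡ true → (j ≡ i ⊎ j ≡ i'))
                 × ((j ≡ i ⊎ j ≡ i') → adj G v (node hole j) ≡ true)

CapFree : ∀ {n} → Graph n → Set
CapFree G = ¬ Cap G

Stable : ∀ {n} → Graph n → (Fin n → Bool) → Set
Stable G S = ∀ i j → S i ≡ true → S j ≡ true → adj G i j ≡ false

χ : ∀ {n} → (Fin n → Bool) → Fin n → ℚ
χ S i = if S i then 1ℚ else 0ℚ

sumL : List ℚ → ℚ
sumL []       = 0ℚ
sumL (q ∷ qs) = q + sumL qs

sumFin : ∀ {k} → (Fin k → ℚ) → ℚ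
sumFin {zero}  f = 0ℚ
sumFin {suc k} f = f Data.Fin.zero + sumFin (λ i → f (Data.Fin.suc i))

sumFinℕ : ∀ {k} → (Fin k → ℕ) → ℕ
sumFinℕ {zero}  f = 0
sumFinℕ {suc k} f = f Data.Fin.zero ℕ.+ sumFinℕ (λ i → f (Data.Fin.suc i))

InSTAB : ∀ {n} → Graph n → (Fin n → ℚ) → Set
InSTAB {n} G x =
  Σ (List (ℚ × (Fin n → Bool))) λ ws →
      All (λ w → (0ℚ ≤ proj₁ w) × Stable G (proj₂ w)) ws
    × sumL (map proj₁ ws) ≡ 1ℚ
    × (∀ i → x i ≡ sumL (map (λ w → proj₁ w * χ (proj₂ w) i) ws))

record System (n : ℕ) : Set where
  field
    rows aux : ℕ
    A : Fin rows → Fin n → ℚ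
    B : Fin rows → Fin aux → ℚ
    d : Fin rows → ℚ
open System public

Satisfies : ∀ {n} (S : System n) → (Fin n → ℚ) → (Fin (aux S) → ℚ) → Set
Satisfies S x y = ∀ r →
  sumFin (λ j → A S r j * x j) + sumFin (λ l → B S r l * y l) ≤ d S r

IsExtendedFormulation : ∀ {n} → Graph n → System n → Set
IsExtendedFormulation G S = ∀ x →
  (InSTAB G x → ∃ λ y → Satisfies S x y) × ((∃ λ y → Satisfies S x y) → InSTAB G x)

bitsℕ : ℕ → ℕ
bitsℕ a = suc ⌊log₂ a ⌋

bitsℚ : ℚ → ℕ
bitsℚ q = bitsℕ ∣ ℚ.numerator q ∣ ℕ.+ bitsℕ (ℚ.denominatorℕ q)

size : ∀ {n} → System n → ℕ
size {n} S = rows S ℕ.+ aux S ℕ.+ sumFinℕ (λ r →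
    sumFinℕ (λ j → bitsℚ (A S r j))
  ℕ.+ sumFinℕ (λ l → bitsℚ (B S r l))
  ℕ.+ bitsℚ (d S r))

{-# OPTIONS --safe #-}

-- The graph has a chordal completion all of whose cliques have stability number at
-- most 6.  Along a perfect elimination order of it, the formulation has, for every
-- bag, one variable per stable subset of the bag (a 6-tuple of vertices), constrained
-- to be a probability distribution, and asks two bags to agree on the part they share.
-- Conversely such distributions are glued bag by bag, conditioning on the shared part.
--
-- The completion is found by induction on the vertex set.  Completions are glued along
-- clique cutsets.  If there is a proper wheel, that is a hole with a vertex y that has
-- at least two, pairwise nonadjacent, neighbours (spokes) on it, parity arguments show
-- that the part attached to the rim between two consecutive spokes u, u' is separated
-- from the rest by three cliques: the vertices complete to all spokes, and the twins of
-- u and of u' relative to the hole; these pieces are arranged in a fan around the rim.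
-- The ends u and u' must then share a bag in the completion of the piece, so the
-- induction carries a class of pairs (Nice) that are to be joined.  With neither a
-- wheel nor a clique cutset, the graph is complete or a hole blown up to cliques plus a
-- universal clique, and a fan of bags of six cliques works.
-- The graph arguments are classical; they live under a double negation, which is
-- removed at the end because a completion can be searched for.

module Submission where

open import Defs hiding (A; B; d)
open import Algebra.Bundles using (CommutativeMonoid)
import Algebra.Properties.Group as GroupProperties
import Algebra.Solver.CommutativeMonoid as MonoidSolver
open import Algebra.Structures using (IsCommutativeMonoid)
open import Data.Bool using (Bool; true; false; not; _xor_; _∧_; if_then_else_)
open import Data.Bool.Properties using (¬-not) renaming (_≟_ to _≟ᵇ_)
open import Data.Empty using (⊥; ⊥-elim)
open import Data.Fin using (Fin; toℕ; fromℕ<; inject≤; remQuot; combine; finToFun; funToFin) renaming (zero to fz; suc to fs)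
import Data.Fin.Properties as Finₚ
import Data.Integer as ℤ
open import Data.List using (List; []; _∷_; _++_; map; length; reverse; lookup; filter; allFin; concatMap; tabulate)
import Data.List.Membership.DecPropositional as DecMembership
open import Data.List.Membership.Propositional using (_∈_; _∉_; find; lose)
import Data.List.Membership.Propositional.Properties as ∈ₚ
import Data.List.Properties as Listₚ
open import Data.List.Relation.Unary.All as All using (All; []; _∷_)
import Data.List.Relation.Unary.All.Properties as Allₚ
import Data.List.Relation.Unary.AllPairs as AllPairs
open import Data.List.Relation.Unary.Any using (Any; here; there)
import Data.List.Relation.Unary.Any.Properties as Anyₚ
import Data.List.Relation.Unary.Unique.Propositional as Uniq
import Data.List.Relation.Unary.Unique.Propositional.Properties as Uniqₚ
open import Data.Maybe using (Maybe; just; nothing; is-just)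
open import Data.Nat as ℕ using (ℕ; zero; suc; _+_; _*_; _^_; _≤_; _<_; z≤n; s≤s)
import Data.Nat.Properties as ℕₚ
open import Data.Product using (Σ; _×_; _,_; proj₁; proj₂; ∃)
open import Data.Rational as ℚ using (ℚ; 0ℚ; 1ℚ) renaming (_≤_ to _≼_)
import Data.Rational.Properties as ℚₚ
open import Data.Sum using (_⊎_; inj₁; inj₂; swap)
open import Data.Unit using (⊤; tt)
open import Data.Vec as Vec using (Vec; []; _∷_; toList; fromList)
import Data.Vec.Properties as Vecₚ
open import Function using (_∘_; id; case_of_)
open import Level using (Level)
open import Relation.Binary.PropositionalEquality
  using (_≡_; _≢_; refl; trans; cong; cong₂; subst; subst₂) renaming (sym to ≡-sym)
open import Relation.Nullary using (¬_; Dec; yes; no)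
open import Relation.Nullary.Decidable
  using (_×-dec_; _⊎-dec_; _→-dec_; ¬?; map′; ⌊_⌋; does; dec-true; dec-false; decidable-stable)

-- Most of the graph theory rests on one parity fact: a vertex off a hole that sees the hole sees an
-- odd number of its vertices (`odd-contacts`). Its companion for paths is `two-ends`. As 4-holes
-- are even, two nonadjacent vertices have no two nonadjacent common neighbours, which is why
-- separators tend to be cliques. The delicate choice is the class `Nice`. A pair in it must
-- survive, within a single part, both a clique cutset and the splitting by a wheel. The second is
-- the obstacle: the hole that witnesses the pair may run through several pieces. It is then
-- rerouted through the wheel centre, and the parity clause of `Nice` excludes the one situation in
-- which the rerouting fails. Six comes from the blown-up hole: the ends of a nice pair may lie in
-- classes at distance two, so a bag holds three consecutive classes, besides the universal clique
-- and the two classes at which the fan is fixed. The exponent 16 is 2 + 7 + 7: there are about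
-- `n ^ 7` variables (a bag and a 6-tuple), a row is indexed by two more vertices and a variable,
-- and each row has a coefficient for every variable.

-- Double negation, splitting of lists, counting modulo 2

_>>=_ : ∀ {a} {A : Set a} → ¬ ¬ A → (A → ⊥) → ⊥
m >>= k = m k

em : ∀ {a} (A : Set a) → ¬ ¬ Dec A
em A k = k (no λ a → k (yes a))

private variable
  𝓧 : Set

data First (P Q : 𝓧 → Set) (l : List 𝓧) : Set where
  none : All Q l → First P Q l
  some : ∀ A x B → l ≡ A ++ x ∷ B → All Q A → P x → First P Q l

first? : {P Q : 𝓧 → Set} → (∀ x → P x ⊎ Q x) → ∀ l → First P Q l
first? d [] = none []
first? d (x ∷ l) with d x
... | inj₁ p = some [] x l refl [] p
... | inj₂ q with first? d l
...   | none qs = none (q ∷ qs)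
...   | some A y B refl qs p = some (x ∷ A) y B refl (q ∷ qs) p

data Last (P Q : 𝓧 → Set) (l : List 𝓧) : Set where
  none : All Q l → Last P Q l
  some : ∀ A x B → l ≡ A ++ x ∷ B → P x → All Q B → Last P Q l

last? : {P Q : 𝓧 → Set} → (∀ x → P x ⊎ Q x) → ∀ l → Last P Q l
last? d [] = none []
last? d (x ∷ l) with last? d l
... | some A y B refl p qs = some (x ∷ A) y B refl p qs
... | none qs with d x
...   | inj₁ p = some [] x l refl p qs
...   | inj₂ q = none (q ∷ qs)

data Split (x : 𝓧) : List 𝓧 → Set where
  split : ∀ A B → Split x (A ++ x ∷ B)

rev-mid : ∀ (A : List 𝓧) {x B} → reverse (A ++ x ∷ B) ≡ reverse B ++ x ∷ reverse A
rev-mid A {x} {B} = trans (Listₚ.reverse-++ A (x ∷ B))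
  (trans (cong (_++ reverse A) (Listₚ.unfold-reverse x B)) (Listₚ.++-assoc (reverse B) (x ∷ []) (reverse A)))

split∈ : ∀ {x : 𝓧} {l} → x ∈ l → Split x l
split∈ (here refl) = split [] _
split∈ (there {x = y} i) with split∈ i
... | split A B = split (y ∷ A) B

∈l : ∀ {x : 𝓧} {A B} → x ∈ A → x ∈ A ++ B
∈l = ∈ₚ.∈-++⁺ˡ

∈r : ∀ {x : 𝓧} A {B} → x ∈ B → x ∈ A ++ B
∈r A = ∈ₚ.∈-++⁺ʳ A

∈m : ∀ {x : 𝓧} A {B} → x ∈ A ++ x ∷ B
∈m A = ∈r A (here refl)

∈-++ : ∀ {x : 𝓧} A {B} → x ∈ A ++ B → x ∈ A ⊎ x ∈ B
∈-++ A = ∈ₚ.∈-++⁻ A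

∈≡ : ∀ {x : 𝓧} {A B} → x ∈ A → A ≡ B → x ∈ B
∈≡ {x = x} i e = subst (x ∈_) e i

All-++ : ∀ {P : 𝓧 → Set} {A B} → All P A → All P B → All P (A ++ B)
All-++ = Allₚ.++⁺

All-l : ∀ {P : 𝓧 → Set} A {B} → All P (A ++ B) → All P A
All-l A = Allₚ.++⁻ˡ A

All-r : ∀ {P : 𝓧 → Set} A {B} → All P (A ++ B) → All P B
All-r A = Allₚ.++⁻ʳ A

tab : ∀ {P : 𝓧 → Set} {l} → (∀ {x} → x ∈ l → P x) → All P l
tab = All.tabulate

at : ∀ {P : 𝓧 → Set} {l x} → All P l → x ∈ l → P x
at a i = All.lookup a i

snoc-assoc : ∀ (A : List 𝓧) {x B} → (A ++ x ∷ []) ++ B ≡ A ++ x ∷ B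
snoc-assoc A {x} {B} = Listₚ.++-assoc A (x ∷ []) B

snoc-inj : ∀ (A B : List 𝓧) {x y} → A ++ x ∷ [] ≡ B ++ y ∷ [] → A ≡ B × x ≡ y
snoc-inj A B = Listₚ.∷ʳ-injective A B

rev-snoc : ∀ (A : List 𝓧) {x} → reverse (A ++ x ∷ []) ≡ x ∷ reverse A
rev-snoc A {x} = Listₚ.reverse-++ A (x ∷ [])

rev-cons : ∀ (x : 𝓧) A → reverse (x ∷ A) ≡ reverse A ++ x ∷ []
rev-cons x A = Listₚ.unfold-reverse x A

∈-rev : ∀ {x : 𝓧} {A} → x ∈ A → x ∈ reverse A
∈-rev = Anyₚ.reverse⁺

∈-rev⁻ : ∀ {x : 𝓧} {A} → x ∈ reverse A → x ∈ A
∈-rev⁻ = Anyₚ.reverse⁻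

data Snoc {𝓧 : Set} : List 𝓧 → Set where
  []   : Snoc []
  _∷ʳ_ : ∀ A x → Snoc (A ++ x ∷ [])

snoc? : ∀ (l : List 𝓧) → Snoc l
snoc? [] = []
snoc? (x ∷ l) with snoc? l
... | [] = [] ∷ʳ x
... | A ∷ʳ y = (x ∷ A) ∷ʳ y

-- Counts the entries satisfying `f` modulo 2. Only parities of neighbourhoods and of lengths
-- (`par`) matter, so `xor` takes the place of addition.
lc : (𝓧 → Bool) → List 𝓧 → Bool
lc f [] = false
lc f (x ∷ l) = f x xor lc f l

par : List 𝓧 → Bool
par = lc (λ _ → true)

xor-assoc : ∀ a b c → (a xor b) xor c ≡ a xor (b xor c)
xor-assoc false b c = refl
xor-assoc true false c = refl
xor-assoc true true false = refl
xor-assoc true true true = refl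

xor-comm : ∀ a b → a xor b ≡ b xor a
xor-comm false false = refl
xor-comm false true = refl
xor-comm true false = refl
xor-comm true true = refl

lc-++ : ∀ (f : 𝓧 → Bool) A {B} → lc f (A ++ B) ≡ lc f A xor lc f B
lc-++ f [] = refl
lc-++ f (x ∷ A) {B} = trans (cong (f x xor_) (lc-++ f A)) (≡-sym (xor-assoc (f x) (lc f A) (lc f B)))

lc-rev : ∀ (f : 𝓧 → Bool) A → lc f (reverse A) ≡ lc f A
lc-rev f [] = refl
lc-rev f (x ∷ A) rewrite rev-cons x A | lc-++ f (reverse A) {x ∷ []} | lc-rev f A =
  trans (xor-comm (lc f A) (f x xor false)) (cong (_xor lc f A) (xor-comm (f x) false))

lc-none : ∀ {f : 𝓧 → Bool} {l} → All (λ x → f x ≡ false) l → lc f l ≡ false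
lc-none [] = refl
lc-none (p ∷ ps) rewrite p = lc-none ps

lc-cong : ∀ {f g : 𝓧 → Bool} {l} → All (λ x → f x ≡ g x) l → lc f l ≡ lc g l
lc-cong [] = refl
lc-cong (p ∷ ps) = cong₂ _xor_ p (lc-cong ps)

lc-true : ∀ (f : 𝓧 → Bool) l → lc f l ≡ true → ∃ λ x → x ∈ l × f x ≡ true
lc-true f (x ∷ l) e with f x in fx
... | true = x , here refl , fx
... | false with lc-true f l e
...   | y , i , q = y , there i , q

fin-choice : ∀ {n} {P : Fin n → Set} → (∀ i → ¬ ¬ P i) → ¬ ¬ (∀ i → P i)
fin-choice {zero} f k = k λ ()
fin-choice {suc n} f k = do
  p ← f fz
  ps ← fin-choice {n} (f ∘ fs)
  k λ { fz → p ; (fs i) → ps i }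

decAll : ∀ {n} (P : Fin n → Set) → ¬ ¬ (∀ i → Dec (P i))
decAll P = fin-choice (λ i → em (P i))

true≢false : ∀ {b : Bool} → b ≡ true → b ≡ false → ⊥
true≢false refl ()

-- Induced paths and holes as lists of vertices

module Paths {n : ℕ} (G : Graph n) where
  V : Set
  V = Fin n

  infix 4 _~_ _≁_ _#_
  _~_ _≁_ _#_ : V → V → Set
  a ~ b = adj G a b ≡ true
  a ≁ b = adj G a b ≡ false
  a # b = a ≢ b × a ≁ b

  ~sym : ∀ {a b} → a ~ b → b ~ a
  ~sym {a} {b} p = trans (Graph.sym G b a) p

  ≁sym : ∀ {a b} → a ≁ b → b ≁ a
  ≁sym {a} {b} p = trans (Graph.sym G b a) p

  #sym : ∀ {a b} → a # b → b # a
  #sym (p , q) = p ∘ ≡-sym , ≁sym q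

  ~≁ : ∀ {a b} → a ~ b → a ≁ b → ⊥
  ~≁ = true≢false

  ~# : ∀ {a b} → a ~ b → a # b → ⊥
  ~# p q = ~≁ p (proj₂ q)

  ~⇒≢ : ∀ {a b} → a ~ b → a ≢ b
  ~⇒≢ {a} p refl = ~≁ p (irrefl G a)

  ~? : ∀ a b → a ~ b ⊎ a ≁ b
  ~? a b with adj G a b
  ... | true = inj₁ refl
  ... | false = inj₂ refl

  ¬~ : ∀ {a b} → ¬ a ~ b → a ≁ b
  ¬~ {a} {b} p with ~? a b
  ... | inj₁ q = ⊥-elim (p q)
  ... | inj₂ q = q

  cmp : ∀ a b → (a ≡ b ⊎ a ~ b) ⊎ a # b
  cmp a b with a Finₚ.≟ b
  ... | yes p = inj₁ (inj₁ p)
  ... | no p with ~? a b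
  ...   | inj₁ q = inj₁ (inj₂ q)
  ...   | inj₂ q = inj₂ (p , q)

  ∈? : ∀ (a : V) l → a ∈ l ⊎ a ∉ l
  ∈? a [] = inj₂ λ ()
  ∈? a (x ∷ l) with a Finₚ.≟ x | ∈? a l
  ... | yes e | _ = inj₁ (here e)
  ... | no _ | inj₁ i = inj₁ (there i)
  ... | no d | inj₂ j = inj₂ λ { (here e) → d e ; (there i) → j i }

  Hd : V → List V → Set
  Hd x [] = ⊤
  Hd x (y ∷ l) = x ~ y × All (x #_) l

  -- the list is the vertex sequence of an induced path
  Ind : List V → Set
  Ind [] = ⊤
  Ind (x ∷ l) = Hd x l × Ind l

  ind-drop : ∀ A {B} → Ind (A ++ B) → Ind B
  ind-drop [] p = p
  ind-drop (x ∷ A) (_ , p) = ind-drop A p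

  ind-take : ∀ A {B} → Ind (A ++ B) → Ind A
  ind-take [] p = tt
  ind-take (x ∷ []) p = tt , tt
  ind-take (x ∷ y ∷ A) ((q , qs) , p) = (q , All-l A qs) , ind-take (y ∷ A) p

  ind-cross : ∀ A {x B a b} → Ind (A ++ x ∷ B) → a ∈ A → b ∈ B → a # b
  ind-cross (a ∷ []) (h , _) (here refl) j = at (proj₂ h) j
  ind-cross (a ∷ c ∷ A) ((_ , h) , _) (here refl) j = at h (∈r A (there j))
  ind-cross (a ∷ A) (_ , p) (there i) j = ind-cross A p i j

  ind-link : ∀ A {a b B} → Ind (A ++ a ∷ b ∷ B) → a ~ b
  ind-link A p = proj₁ (proj₁ (ind-drop A p))

  ind-join : ∀ A {x B} → Ind (A ++ x ∷ []) → Ind (x ∷ B) →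
             (∀ {a b} → a ∈ A → b ∈ B → a # b) → Ind (A ++ x ∷ B)
  ind-join [] p q c = q
  ind-join (a ∷ []) ((r , _) , p) q c = (r , tab (c (here refl))) , q
  ind-join (a ∷ d ∷ A) ((r , rs) , p) q c =
    (r , All-++ (All-l A rs) (All.head (All-r A rs) ∷ tab (c (here refl))))
    , ind-join (d ∷ A) p q (c ∘ there)

  ind-hd≢ : ∀ {x l y} → Ind (x ∷ l) → y ∈ l → x ≢ y
  ind-hd≢ ((p , _) , _) (here refl) = ~⇒≢ p
  ind-hd≢ ((_ , ps) , _) (there i) = proj₁ (at ps i)

  ind-snoc : ∀ A {x y} → Ind (A ++ x ∷ []) → x ~ y → All (y #_) A → Ind (A ++ x ∷ y ∷ [])
  ind-snoc A p q r = ind-join A p ((q , []) , tt , tt) λ { i (here refl) → #sym (at r i) }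

  ind-rev : ∀ A → Ind A → Ind (reverse A)
  ind-rev [] p = tt
  ind-rev (x ∷ []) p = tt , tt
  ind-rev (x ∷ y ∷ l) ((q , qs) , p) = subst Ind eq
    (ind-snoc (reverse l) (subst Ind (rev-cons y l) (ind-rev (y ∷ l) p)) (~sym q)
      (tab (λ i → at qs (∈-rev⁻ i))))
    where
    eq : reverse l ++ y ∷ x ∷ [] ≡ reverse (x ∷ y ∷ l)
    eq = ≡-sym (trans (rev-cons x (y ∷ l))
           (trans (cong (_++ x ∷ []) (rev-cons y l)) (snoc-assoc (reverse l))))

  -- Hol v P: v followed by P is the cyclic vertex sequence of a hole
  data Hol (v : V) : List V → Set where
    hol : ∀ {a L b} → Ind (a ∷ L ++ b ∷ []) → v ~ a → v ~ b → All (v #_) L → a # b →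
          Hol v (a ∷ L ++ b ∷ [])

  hol-ind : ∀ {v P} → Hol v P → Ind P
  hol-ind (hol p _ _ _ _) = p

  hol-hd : ∀ {v a P} → Hol v (a ∷ P) → v ~ a
  hol-hd (hol _ p _ _ _) = p

  hol-inv : ∀ {v P} a L b → Hol v P → P ≡ a ∷ L ++ b ∷ [] → v ~ b × All (v #_) L × a # b
  hol-inv a L b (hol {L = L'} p va vb vL ab) e with snoc-inj (_ ∷ L') (a ∷ L) e
  ... | refl , refl = vb , vL , ab

  hol-last : ∀ {v b} A → Hol v (A ++ b ∷ []) → v ~ b
  hol-last {v} {b} A h = go h refl
    where
    go : ∀ {P} → Hol v P → P ≡ A ++ b ∷ [] → v ~ b
    go (hol {a} {L} _ _ vb _ _) e with snoc-inj (a ∷ L) A e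
    ... | _ , refl = vb

  hol-rot₁ : ∀ {v h D} → Hol v (h ∷ D) → Hol h (D ++ v ∷ [])
  hol-rot₁ (hol {a} {[]} {b} ((p , _) , _) va vb vL ab) = ⊥-elim (~# p ab)
  hol-rot₁ {v} (hol {a} {c ∷ L} {b} ((p , ps) , q) va vb (vc ∷ vL) ab) =
    hol (subst Ind (cong (c ∷_) (≡-sym (snoc-assoc L))) (ind-snoc (c ∷ L) q (~sym vb) (vc ∷ vL)))
        p (~sym va) ps (#sym vc)

  hol-rot : ∀ {v h D} A → Hol v (A ++ h ∷ D) → Hol h (D ++ v ∷ A)
  hol-rot [] p = hol-rot₁ p
  hol-rot {v} {h} {D} (x ∷ A) p =
    subst (Hol h) (snoc-assoc D)
      (hol-rot A (subst (Hol x) (Listₚ.++-assoc A (h ∷ D) (v ∷ [])) (hol-rot₁ p)))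

  hol-pre : ∀ {v d D} A → Hol v (A ++ d ∷ D) → Ind (v ∷ A)
  hol-pre {D = D} A p = ind-drop D (hol-ind (hol-rot A p))

  hol-≢ : ∀ {v P} → Hol v P → All (v ≢_) P
  hol-≢ (hol p va vb vL ab) = ~⇒≢ va ∷ All-++ (All.map proj₁ vL) (~⇒≢ vb ∷ [])

  hol-rev : ∀ {v P} → Hol v P → Hol v (reverse P)
  hol-rev {v} (hol {a} {L} {b} p va vb vL ab) =
    subst (Hol v) (≡-sym eq)
      (hol (subst Ind eq (ind-rev (a ∷ L ++ b ∷ []) p)) vb va (tab (λ i → at vL (∈-rev⁻ i))) (#sym ab))
    where
    eq : reverse (a ∷ L ++ b ∷ []) ≡ b ∷ reverse L ++ a ∷ []
    eq = trans (rev-snoc (a ∷ L)) (cong (b ∷_) (rev-cons a L))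

  hol-join : ∀ {v a A C c} → Ind (v ∷ a ∷ A) → Ind (C ++ c ∷ v ∷ []) →
             Ind ((a ∷ A) ++ C ++ c ∷ []) → a # c → Hol v ((a ∷ A) ++ C ++ c ∷ [])
  hol-join {v} {a} {A} {C} {c} ((va , vA) , _) q r ac =
    subst (Hol v) (cong (a ∷_) (Listₚ.++-assoc A C (c ∷ [])))
      (hol (subst Ind (cong (a ∷_) (≡-sym (Listₚ.++-assoc A C (c ∷ [])))) r) va
        (~sym (ind-link C q))
        (All-++ vA (tab (λ i → #sym (ind-cross C q i (here refl))))) ac)

  -- Only the first vertex of `A` and the last of `C` have to be nonadjacent. The last hypothesis
  -- speaks of all neighbours of `v`, so that a caller need not know which vertex ends `C`.
  hol-cyc : ∀ {v A C x z} → Ind (v ∷ A) → Ind (C ++ v ∷ []) → Ind (A ++ C) → x ∈ A → z ∈ C →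
            (∀ {a c} → a ∈ A → c ∈ C → v ~ a → v ~ c → a # c) → Hol v (A ++ C)
  hol-cyc {v} {a ∷ A} {C} {z = z} p q r i j f with snoc? C
  ... | [] = case j of λ ()
  ... | C' ∷ʳ c = hol-join p q' r (f (here refl) (∈m C') (proj₁ (proj₁ p)) (~sym (ind-link C' q')))
    where
    q' : Ind (C' ++ c ∷ v ∷ [])
    q' = subst Ind (snoc-assoc C') q

  data Path (Y : V → Set) : V → V → Set where
    edge : ∀ {a b} → a ~ b → Path Y a b
    step : ∀ {a c b} → a ~ c → Y c → Path Y c b → Path Y a b

  path-++ : ∀ {Y a c b} → Path Y a c → Y c → Path Y c b → Path Y a b
  path-++ (edge p) y q = step p y q
  path-++ (step p z r) y q = step p z (path-++ r y q)

  path-sym : ∀ {Y a b} → Path Y a b → Path Y b a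
  path-sym (edge p) = edge (~sym p)
  path-sym (step p y q) = path-++ (path-sym q) y (edge (~sym p))

  path-map : ∀ {Y Z : V → Set} {a b} → (∀ {x} → Y x → Z x) → Path Y a b → Path Z a b
  path-map f (edge p) = edge p
  path-map f (step p y q) = step p (f y) (path-map f q)

  ind-path : ∀ {Y a b} L → Ind (a ∷ L ++ b ∷ []) → All Y L → Path Y a b
  ind-path [] ((p , _) , _) ys = edge p
  ind-path (c ∷ L) ((p , _) , q) (y ∷ ys) = step p y (ind-path L q ys)

  -- A walk is shortened from its far end: once the rest is induced, `a` jumps to the last vertex of
  -- it that it equals or sees. The walk may be closed, hence the first alternative.
  induce : ∀ {Y a b} → Path Y a b → a ≡ b ⊎ Σ (List V) λ L → All Y L × Ind (a ∷ L ++ b ∷ [])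
  induce (edge p) = inj₂ ([] , [] , (p , []) , tt , tt)
  induce {Y} {a} {b} (step {c = c} p y q) with cmp a b
  ... | inj₁ (inj₁ e) = inj₁ e
  ... | inj₁ (inj₂ r) = inj₂ ([] , [] , (r , []) , tt , tt)
  ... | inj₂ ab with induce q
  ...   | inj₁ refl = ⊥-elim (~# p ab)
  ...   | inj₂ (L , ys , r) with last? {P = λ x → a ≡ x ⊎ a ~ x} {Q = a #_} (cmp a) (c ∷ L)
  ...     | none (q ∷ _) = ⊥-elim (~# p q)
  ...     | some [] _ D refl (inj₁ refl) as = ⊥-elim (~⇒≢ p refl)
  ...     | some [] _ D refl (inj₂ p) as = inj₂ (c ∷ D , y ∷ ys , (p , All-++ as (ab ∷ [])) , r)
  ...     | some (_ ∷ A) x D refl (inj₁ refl) as =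
    inj₂ (D , All.tail (All-r A ys) ,
          ind-drop (c ∷ A) (subst Ind (cong (c ∷_) (Listₚ.++-assoc A (x ∷ D) (b ∷ []))) r))
  ...     | some (_ ∷ A) x D refl (inj₂ p) as =
    inj₂ (x ∷ D , All-r A ys , (p , All-++ as (ab ∷ [])) ,
          ind-drop (c ∷ A) (subst Ind (cong (c ∷_) (Listₚ.++-assoc A (x ∷ D) (b ∷ []))) r))

-- From holes as lists to the forbidden `Hole` and `Cap`

par-even : {X : Set} (l : List X) → (par l ≡ false → Even (length l)) × (par l ≡ true → Even (suc (length l)))
par-even [] = (λ _ → 0 , refl) , λ ()
par-even (x ∷ l) with par l | par-even l
... | true | _ , f = (λ _ → f refl) , λ ()
... | false | f , _ = (λ ()) , λ _ → suc (proj₁ (f refl)) ,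
  cong suc (trans (cong suc (proj₂ (f refl))) (≡-sym (ℕₚ.+-suc (proj₁ (f refl)) (proj₁ (f refl)))))

module Forbidden {n : ℕ} (G : Graph n) where
  open Paths G

  Consec : ℕ → ℕ → Set
  Consec i j = j ≡ suc i ⊎ i ≡ suc j

  consec-suc : ∀ {i j} → Consec i j → Consec (suc i) (suc j)
  consec-suc (inj₁ e) = inj₁ (cong suc e)
  consec-suc (inj₂ e) = inj₂ (cong suc e)

  consec-pred : ∀ {i j} → Consec (suc i) (suc j) → Consec i j
  consec-pred (inj₁ e) = inj₁ (ℕₚ.suc-injective e)
  consec-pred (inj₂ e) = inj₂ (ℕₚ.suc-injective e)

  ind-adj : ∀ L → Ind L → ∀ i j →
            (lookup L i ~ lookup L j → Consec (toℕ i) (toℕ j)) × (Consec (toℕ i) (toℕ j) → lookup L i ~ lookup L j)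
  ind-adj (x ∷ l) p fz fz = (λ q → ⊥-elim (~⇒≢ q refl)) , λ { (inj₁ ()) ; (inj₂ ()) }
  ind-adj (x ∷ y ∷ l) ((q , _) , _) fz (fs fz) = (λ _ → inj₁ refl) , λ _ → q
  ind-adj (x ∷ y ∷ l) ((_ , qs) , _) fz (fs (fs j)) =
    (λ r → ⊥-elim (~# r (at qs (∈ₚ.∈-lookup j)))) , λ { (inj₁ ()) ; (inj₂ ()) }
  ind-adj (x ∷ y ∷ l) ((q , _) , _) (fs fz) fz = (λ _ → inj₂ refl) , λ _ → ~sym q
  ind-adj (x ∷ y ∷ l) ((_ , qs) , _) (fs (fs j)) fz =
    (λ r → ⊥-elim (~# (~sym r) (at qs (∈ₚ.∈-lookup j)))) , λ { (inj₁ ()) ; (inj₂ ()) }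
  ind-adj (x ∷ l) (_ , p) (fs i) (fs j) with ind-adj l p i j
  ... | f , g = consec-suc ∘ f , g ∘ consec-pred

  ind-inj : ∀ L → Ind L → ∀ i j → lookup L i ≡ lookup L j → i ≡ j
  ind-inj (x ∷ l) p fz fz e = refl
  ind-inj (x ∷ l) p fz (fs j) e = ⊥-elim (ind-hd≢ p (∈ₚ.∈-lookup j) e)
  ind-inj (x ∷ l) p (fs i) fz e = ⊥-elim (ind-hd≢ p (∈ₚ.∈-lookup i) (≡-sym e))
  ind-inj (x ∷ l) (_ , p) (fs i) (fs j) e = cong fs (ind-inj l p i j e)

  last-adj : ∀ {v b} L → All (v #_) L → v ~ b → ∀ i → let M = L ++ b ∷ [] in
             (v ~ lookup M i → suc (toℕ i) ≡ length M) × (suc (toℕ i) ≡ length M → v ~ lookup M i)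
  last-adj [] ps p fz = (λ _ → refl) , λ _ → p
  last-adj (c ∷ []) (q ∷ ps) p fz = (λ r → ⊥-elim (~# r q)) , λ ()
  last-adj (c ∷ d ∷ L) (q ∷ ps) p fz = (λ r → ⊥-elim (~# r q)) , λ ()
  last-adj (c ∷ L) (q ∷ ps) p (fs i) with last-adj L ps p i
  ... | f , g = cong suc ∘ f , g ∘ ℕₚ.suc-injective

  cyc-suc : ∀ {k i j} → Consec (toℕ {k} i) (toℕ {k} j) → CycAdj (suc k) (fs i) (fs j)
  cyc-suc (inj₁ e) = inj₁ (cong suc e)
  cyc-suc (inj₂ e) = inj₂ (inj₁ (cong suc e))

  cyc-pred : ∀ {k i j} → CycAdj (suc k) (fs i) (fs j) → Consec (toℕ {k} i) (toℕ {k} j)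
  cyc-pred (inj₁ e) = inj₁ (ℕₚ.suc-injective e)
  cyc-pred (inj₂ (inj₁ e)) = inj₂ (ℕₚ.suc-injective e)
  cyc-pred (inj₂ (inj₂ (inj₁ (() , _))))
  cyc-pred (inj₂ (inj₂ (inj₂ (() , _))))

  cyc-sym : ∀ {k} {i j : Fin k} → CycAdj k i j → CycAdj k j i
  cyc-sym (inj₁ e) = inj₂ (inj₁ e)
  cyc-sym (inj₂ (inj₁ e)) = inj₁ e
  cyc-sym (inj₂ (inj₂ (inj₁ e))) = inj₂ (inj₂ (inj₂ e))
  cyc-sym (inj₂ (inj₂ (inj₂ e))) = inj₂ (inj₂ (inj₁ e))

  hole : ∀ {v P} → Hol v P → Σ (Hole G) λ H → Σ (len H ≡ suc (length P)) λ e →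
           ∀ i → node H i ≡ lookup (v ∷ P) (subst Fin e i)
  hole {v} h@(hol {a} {L} {b} p va vb vL ab) = H , refl , λ _ → refl
    where
    P = a ∷ L ++ b ∷ []
    long : ∀ L → Ind (a ∷ L ++ b ∷ []) → 3 < suc (length (a ∷ L ++ b ∷ []))
    long [] ((q , _) , _) = ⊥-elim (~# q ab)
    long (c ∷ []) _ = s≤s (s≤s (s≤s (s≤s z≤n)))
    long (c ∷ d ∷ L) _ = s≤s (s≤s (s≤s (s≤s z≤n)))
    v-adj : ∀ j → (v ~ lookup P j → CycAdj (suc (length P)) fz (fs j)) ×
                  (CycAdj (suc (length P)) fz (fs j) → v ~ lookup P j)
    v-adj fz = (λ _ → inj₁ refl) , λ _ → va
    v-adj (fs j) with last-adj L vL vb j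
    ... | f , g = (λ q → inj₂ (inj₂ (inj₁ (refl , cong (suc ∘ suc) (f q))))) ,
      λ { (inj₁ ()) ; (inj₂ (inj₁ ())) ; (inj₂ (inj₂ (inj₁ (_ , e)))) → g (ℕₚ.suc-injective (ℕₚ.suc-injective e))
        ; (inj₂ (inj₂ (inj₂ (() , _)))) }
    nd : Fin (suc (length P)) → V
    nd = lookup (v ∷ P)
    nd-inj : ∀ i j → nd i ≡ nd j → i ≡ j
    nd-inj fz fz e = refl
    nd-inj fz (fs j) e = ⊥-elim (at (hol-≢ h) (∈ₚ.∈-lookup j) e)
    nd-inj (fs i) fz e = ⊥-elim (at (hol-≢ h) (∈ₚ.∈-lookup i) (≡-sym e))
    nd-inj (fs i) (fs j) e = cong fs (ind-inj P p i j e)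
    nd-ind : ∀ i j → (nd i ~ nd j → CycAdj (suc (length P)) i j) × (CycAdj (suc (length P)) i j → nd i ~ nd j)
    nd-ind fz fz = (λ q → ⊥-elim (~⇒≢ q refl)) ,
      λ { (inj₁ ()) ; (inj₂ (inj₁ ())) ; (inj₂ (inj₂ (inj₁ (_ , ())))) ; (inj₂ (inj₂ (inj₂ (_ , ())))) }
    nd-ind fz (fs j) = v-adj j
    nd-ind (fs i) fz with v-adj i
    ... | f , g = (λ q → cyc-sym {i = fz} (f (~sym q))) , λ q → ~sym (g (cyc-sym {i = fs i} q))
    nd-ind (fs i) (fs j) with ind-adj P p i j
    ... | f , g = (λ q → cyc-suc (f q)) , λ q → g (cyc-pred q)
    H : Hole G
    H = record { len = suc (length P) ; len>3 = long L p ; node = nd ; inj = nd-inj ; induced = nd-ind }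

module Free {n : ℕ} (G : Graph n) (cf : CapFree G) (ehf : EvenHoleFree G) where
  open Paths G public
  open Forbidden G

  -- The hole has one vertex more than `P`.
  even-path : ∀ {v P} → Hol v P → par P ≡ false
  even-path {v} {P} h with par P in e
  ... | false = refl
  ... | true with hole h
  ...   | H , refl , _ = ⊥-elim (ehf (H , proj₂ (par-even P) e))

  no-cap : ∀ {v d P q} → Hol v (d ∷ P) → All (q ≢_) (v ∷ d ∷ P) → q ~ v → q ~ d → All (q ≁_) P → ⊥
  no-cap {v} {d} {P} {q} h out qv qd qP with hole h
  ... | H , refl , f = cf (record
    { hole = H ; v = q ; i = fz ; i' = fs fz ; i~i' = inj₁ refl
    ; v∉H = λ j e → at out (∈ₚ.∈-lookup j) (trans e (f j))
    ; nbrs = λ j → subst (λ z → (q ~ z → (j ≡ fz ⊎ j ≡ fs fz)) × ((j ≡ fz ⊎ j ≡ fs fz) → q ~ z)) (≡-sym (f j)) (go j) })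
    where
    go : ∀ j → (q ~ lookup (v ∷ d ∷ P) j → (j ≡ fz ⊎ j ≡ fs fz)) × ((j ≡ fz ⊎ j ≡ fs fz) → q ~ lookup (v ∷ d ∷ P) j)
    go fz = (λ _ → inj₁ refl) , λ _ → qv
    go (fs fz) = (λ _ → inj₂ refl) , λ _ → qd
    go (fs (fs j)) = (λ r → ⊥-elim (~≁ r (at qP (∈ₚ.∈-lookup j)))) , λ { (inj₁ ()) ; (inj₂ ()) }

  no-C₄ : ∀ {a b c d} → a ~ b → b ~ c → c ~ d → d ~ a → a # c → b # d → ⊥
  no-C₄ ab bc cd da ac bd with even-path (hol ((bc , bd ∷ []) , (cd , []) , tt , tt) ab (~sym da) (ac ∷ []) bd)
  ... | ()

-- Parity of the contacts of vertices and paths with a hole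

module Scan {n : ℕ} (G : Graph n) (cf : CapFree G) (ehf : EvenHoleFree G) where
  open Free G cf ehf public

  private
    bool₁ : ∀ i j k s p m → m ≡ (i xor k) ∧ s → p ≡ (k xor j) ∧ s → ∀ q r → q xor r ≡ p →
            m xor ((true xor q) xor (true xor r)) ≡ (i xor j) ∧ s
    bool₁ i j k s _ _ refl refl q r e with (trans (cong (((i xor k) ∧ s) xor_) (lem q r)) (trans (cong (((i xor k) ∧ s) xor_) e) (lem₂ i j k s)))
      where
      lem : ∀ q r → (true xor q) xor (true xor r) ≡ q xor r
      lem false false = refl
      lem false true = refl
      lem true false = refl
      lem true true = refl
      lem₂ : ∀ i j k s → ((i xor k) ∧ s) xor ((k xor j) ∧ s) ≡ (i xor j) ∧ s
      lem₂ false false false s = refl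
      lem₂ false false true false = refl
      lem₂ false false true true = refl
      lem₂ false true false s = refl
      lem₂ false true true false = refl
      lem₂ false true true true = refl
      lem₂ true false false false = refl
      lem₂ true false false true = refl
      lem₂ true false true s = refl
      lem₂ true true false false = refl
      lem₂ true true false true = refl
      lem₂ true true true s = refl
    ... | p = p

    bool₂ : ∀ i j s m r → m ≡ (i xor j) ∧ s → r ≡ (j xor i) ∧ s → m xor (true xor r) ≡ false → ⊥
    bool₂ false false s _ _ refl refl ()
    bool₂ false true false _ _ refl refl ()
    bool₂ false true true _ _ refl refl ()
    bool₂ true false false _ _ refl refl ()
    bool₂ true false true _ _ refl refl ()
    bool₂ true true s _ _ refl refl ()

    bool₃ : ∀ i j k s m r p q → m ≡ (i xor j) ∧ s → r ≡ (k xor i) ∧ s → p xor q ≡ (j xor k) ∧ s →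
            m xor (true xor (p xor (true xor r))) ≡ false → q ≡ false
    bool₃ i j k s _ _ p q refl refl e f = go i j k s p q e f
      where
      go : ∀ i j k s p q → p xor q ≡ (j xor k) ∧ s →
           ((i xor j) ∧ s) xor (true xor (p xor (true xor ((k xor i) ∧ s)))) ≡ false → q ≡ false
      go i j k s p false _ _ = refl
      go false false false _ false true () f
      go false false false _ true true e ()
      go false false true false false true () f
      go false false true false true true e ()
      go false false true true false true e ()
      go false false true true true true () f
      go false true false false false true () f
      go false true false false true true e ()
      go false true false true false true e ()
      go false true false true true true () f
      go false true true false false true () f
      go false true true false true true e ()
      go false true true true false true () f
      go false true true true true true e ()
      go true false false false false true () f
      go true false false false true true e ()
      go true false false true false true () f
      go true false false true true true e ()
      go true false true false false true () f
      go true false true false true true e ()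
      go true false true true false true e ()
      go true false true true true true () f
      go true true false false false true () f
      go true true false false true true e ()
      go true true false true false true e ()
      go true true false true true true () f
      go true true true _ false true () f
      go true true true _ true true e ()

  -- Contacts carry one of two labels; an arc between consecutive contacts has
  -- even or σ-parity interior according to whether its end labels agree.
  module Labelled (X : V → Set) (ℓ : V → Maybe Bool) (σ : Bool)
    (arcs : ∀ {a b M i j} → Ind (a ∷ M ++ b ∷ []) → All X (a ∷ M ++ b ∷ []) → ℓ a ≡ just i → ℓ b ≡ just j →
            All (λ x → ℓ x ≡ nothing) M → par M ≡ (i xor j) ∧ σ) where

    con : V → Bool
    con x = is-just (ℓ x)

    -- An inner contact adds one to the length and one to the number of contacts, which cancel
    -- modulo 2. What is left is a telescoping sum of label differences.
    scan : ∀ {a b i j} M L → Ind (a ∷ M ++ L ++ b ∷ []) → All X (a ∷ M ++ L ++ b ∷ []) → ℓ a ≡ just i → ℓ b ≡ just j →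
           All (λ x → ℓ x ≡ nothing) M → par M xor (par L xor lc con L) ≡ (i xor j) ∧ σ
    scan M [] p x la lb lM = trans (xor-comm (par M) false) (arcs p x la lb lM)
    scan {a} {b} {i} {j} M (c ∷ L) p x la lb lM with ℓ c in lc≡
    ... | nothing = trans (eq (par M) (par L) (lc con L))
        (trans (cong (_xor (par L xor lc con L)) (≡-sym (lc-++ (λ _ → true) M)))
          (scan (M ++ c ∷ []) L (subst Ind assoc p) (subst (All X) assoc x) la lb (All-++ lM (lc≡ ∷ []))))
      where
      assoc : a ∷ M ++ c ∷ L ++ b ∷ [] ≡ a ∷ (M ++ c ∷ []) ++ L ++ b ∷ []
      assoc = cong (a ∷_) (≡-sym (snoc-assoc M))
      eq : ∀ m p q → m xor ((true xor p) xor q) ≡ (m xor true) xor (p xor q)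
      eq false false q = refl
      eq false true false = refl
      eq false true true = refl
      eq true false false = refl
      eq true false true = refl
      eq true true q = refl
    ... | just k = bool₁ i j k σ _ _
        (arcs (ind-take (a ∷ M ++ c ∷ []) (subst Ind assoc p)) (All-l (a ∷ M ++ c ∷ []) (subst (All X) assoc x)) la lc≡ lM)
        (scan [] L (ind-drop (a ∷ M) p) (All-r (a ∷ M) x) lc≡ lb []) (par L) (lc con L) refl
      where
      assoc : a ∷ M ++ c ∷ L ++ b ∷ [] ≡ (a ∷ M ++ c ∷ []) ++ L ++ b ∷ []
      assoc = cong (a ∷_) (≡-sym (snoc-assoc M))

    label? : ∀ x → (∃ λ i → ℓ x ≡ just i) ⊎ ℓ x ≡ nothing
    label? x with ℓ x
    ... | just i = inj₁ (i , refl)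
    ... | nothing = inj₂ refl

    -- `odd` refers to the whole hole: the base vertex is a contact too, so evenly many contacts on
    -- `P` are oddly many in all. In `hd` and `tl` the only possible further contact `d` is next to
    -- the base vertex.
    data Contacts (P : List V) : Set where
      none : All (λ x → ℓ x ≡ nothing) P → Contacts P
      odd : lc con P ≡ false → Contacts P
      hd : ∀ d R → P ≡ d ∷ R → All (λ x → ℓ x ≡ nothing) R → Contacts P
      tl : ∀ d R → P ≡ R ++ d ∷ [] → All (λ x → ℓ x ≡ nothing) R → Contacts P

    con-none : ∀ {M} → All (λ x → ℓ x ≡ nothing) M → lc con M ≡ false
    con-none ps = lc-none (All.map (λ e → cong is-just e) ps)

    -- `P` has even length. If `v` has a single fellow contact, not adjacent to it, the two arcs
    -- between them have equal parity and the contact itself makes `P` odd. If the two are adjacent,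
    -- the long arc is no induced path and nothing follows. With more contacts the label differences
    -- cancel around the hole, and the number of contacts on `P` gets the parity of `P`.
    contacts : ∀ {v P i} → Hol v P → All X (v ∷ P) → ℓ v ≡ just i → Contacts P
    contacts {v} {P} {i} h xs lv with first? label? P
    ... | none p = none p
    ... | some M₁ a R refl p₁ (j , la) with last? label? R
    ...   | none p₂ = single M₁ R h xs p₁ p₂
      where
      single : ∀ M₁ R → Hol v (M₁ ++ a ∷ R) → All X (v ∷ M₁ ++ a ∷ R) → All (λ x → ℓ x ≡ nothing) M₁ →
               All (λ x → ℓ x ≡ nothing) R → Contacts (M₁ ++ a ∷ R)
      single [] R h xs p₁ p₂ = hd a R refl p₂
      single M₁ [] h xs p₁ p₂ = tl a M₁ refl p₁
      single M₁@(m ∷ M) R@(r ∷ R') h (xv ∷ xs) p₁ p₂ = ⊥-elim (bool₂ i j σ _ _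
        (arcs (hol-pre (M₁ ++ a ∷ []) (subst (Hol v) (≡-sym (snoc-assoc M₁)) h))
              (xv ∷ All-l (M₁ ++ a ∷ []) (subst (All X) (≡-sym (snoc-assoc M₁)) xs)) lv la p₁)
        (arcs (hol-pre (R ++ v ∷ []) (subst (Hol a) (≡-sym (snoc-assoc R)) (hol-rot M₁ h)))
              (All-++ (All-r M₁ xs) (xv ∷ [])) la lv p₂)
        (trans (≡-sym (lc-++ (λ _ → true) M₁)) (even-path h)))
    ...   | some L b M₂ refl (k , lb) p₂ = odd (begin-eq)
      where
      h' : Hol b (M₂ ++ v ∷ M₁ ++ a ∷ L)
      h' = hol-rot (M₁ ++ a ∷ L) (subst (Hol v) (≡-sym (Listₚ.++-assoc M₁ (a ∷ L) (b ∷ M₂))) h)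
      i₁ : Ind (v ∷ M₁ ++ a ∷ L)
      i₁ = hol-pre (M₁ ++ a ∷ L) (subst (Hol v) (≡-sym (Listₚ.++-assoc M₁ (a ∷ L) (b ∷ M₂))) h)
      xP : All X (M₁ ++ a ∷ L ++ b ∷ M₂)
      xP = All.tail xs
      xR : All X (a ∷ L ++ b ∷ M₂)
      xR = All-r M₁ xP
      e₁ : par M₁ ≡ (i xor j) ∧ σ
      e₁ = arcs (ind-take (v ∷ M₁ ++ a ∷ []) (subst Ind (cong (v ∷_) (≡-sym (snoc-assoc M₁))) i₁))
             (All.head xs ∷ All-++ (All-l M₁ xP) (All.head xR ∷ [])) lv la p₁
      e₂ : par M₂ ≡ (k xor i) ∧ σ
      e₂ = arcs (ind-take (b ∷ M₂ ++ v ∷ []) (subst Ind (cong (b ∷_) (≡-sym (snoc-assoc M₂)))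
               (hol-pre (M₂ ++ v ∷ M₁) (subst (Hol b) (≡-sym (Listₚ.++-assoc M₂ (v ∷ M₁) (a ∷ L))) h'))))
             (All-++ (All-r (a ∷ L) xR) (All.head xs ∷ [])) lb lv p₂
      xL : All X (a ∷ L ++ b ∷ [])
      xL = All-l (a ∷ L ++ b ∷ []) (subst (All X) (cong (a ∷_) (≡-sym (snoc-assoc L))) xR)
      e₃ : par L xor lc con L ≡ (j xor k) ∧ σ
      e₃ = scan [] L (ind-take (a ∷ L ++ b ∷ []) (subst Ind (cong (a ∷_) (≡-sym (snoc-assoc L))) (ind-drop M₁ (hol-ind h))))
             xL la lb []
      e₄ : par M₁ xor (true xor (par L xor (true xor par M₂))) ≡ false
      e₄ = trans (≡-sym (trans (lc-++ _ M₁) (cong (λ z → par M₁ xor (true xor z)) (lc-++ _ L)))) (even-path h)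
      e₅ : lc con L ≡ false
      e₅ = bool₃ i j k σ _ _ (par L) (lc con L) e₁ e₂ e₃ e₄
      begin-eq : lc con (M₁ ++ a ∷ L ++ b ∷ M₂) ≡ false
      begin-eq rewrite lc-++ con M₁ {a ∷ L ++ b ∷ M₂} | lc-++ con L {b ∷ M₂} | con-none p₁ | con-none p₂ | la | lb | e₅ = refl

  record Rebase (v : V) (P : List V) (c : V) : Set where
    field
      P' : List V
      isHol : Hol c P'
      to : ∀ {x} → x ∈ v ∷ P → x ∈ c ∷ P'
      from : ∀ {x} → x ∈ c ∷ P' → x ∈ v ∷ P
      lc≡ : ∀ f → lc f (v ∷ P) ≡ lc f (c ∷ P')

  rot-∈ : ∀ {v c : V} {B x} A → x ∈ v ∷ A ++ c ∷ B → x ∈ c ∷ B ++ v ∷ A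
  rot-∈ {v} {c} {B} A i with ∈-++ (v ∷ A) i
  ... | inj₁ j = ∈r (c ∷ B) j
  ... | inj₂ (here e) = here e
  ... | inj₂ (there j) = there (∈l j)

  rebase : ∀ {v P c} → Hol v P → c ∈ v ∷ P → Rebase v P c
  rebase h (here refl) = record { P' = _ ; isHol = h ; to = id ; from = id ; lc≡ = λ _ → refl }
  rebase {v} {P} {c} h (there i) with split∈ i
  ... | split A B = record
    { P' = B ++ v ∷ A ; isHol = hol-rot A h ; to = rot-∈ A ; from = rot-∈ B
    ; lc≡ = λ f → trans (lc-++ f (v ∷ A)) (trans (xor-comm (lc f (v ∷ A)) _) (≡-sym (lc-++ f (c ∷ B)))) }

  -- One label and σ = `false` are enough: `q` closes the arc between consecutive neighbours to a
  -- hole, so the interior of the arc is even. The exceptional outcome, just two neighbours that are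
  -- adjacent, is a cap.
  odd-base : ∀ {c P q} → Hol c P → All (q ≢_) (c ∷ P) → q ~ c → lc (adj G q) (c ∷ P) ≡ true
  odd-base {c} {P} {q} h out qc = res (contacts h out ℓc)
    where
    ℓ : V → Maybe Bool
    ℓ x = if adj G q x then just true else nothing
    ℓ⁻ : ∀ {x} → ℓ x ≡ nothing → q ≁ x
    ℓ⁻ {x} e with adj G q x
    ... | false = refl
    ℓj : ∀ {x i} → ℓ x ≡ just i → q ~ x × i ≡ true
    ℓj {x} e with adj G q x
    ℓj refl | true = refl , refl
    arcs : ∀ {a b M i j} → Ind (a ∷ M ++ b ∷ []) → All (q ≢_) (a ∷ M ++ b ∷ []) → ℓ a ≡ just i → ℓ b ≡ just j →
            All (λ x → ℓ x ≡ nothing) M → par M ≡ (i xor j) ∧ false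
    arcs {a} {b} {[]} p x la lb lM with ℓj la | ℓj lb
    ... | _ , refl | _ , refl = refl
    arcs {a} {b} {m ∷ M} p x la lb lM with ℓj la | ℓj lb
    ... | qa , refl | qb , refl = eq (par (m ∷ M)) (trans (cong not (≡-sym (lc-++ _ (m ∷ M)))) (even-path
          (hol {L = m ∷ M} p qa qb (All.zipWith (λ { (e , r) → r , ℓ⁻ e }) (lM , All-l (m ∷ M) (All.tail x)))
            (ind-cross (a ∷ []) p (here refl) (∈m M)))))
      where
      eq : ∀ p → not (p xor (true xor false)) ≡ false → p ≡ false
      eq false e = refl
      eq true ()
    open Labelled (q ≢_) ℓ false arcs
    con≡ : ∀ x → con x ≡ adj G q x
    con≡ x with adj G q x
    ... | true = refl
    ... | false = refl
    lc-con : ∀ l → lc con l ≡ lc (adj G q) l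
    lc-con l = lc-cong (tab {l = l} (λ _ → con≡ _))
    ℓc : ℓ c ≡ just true
    ℓc rewrite qc = refl
    res : Contacts P → lc (adj G q) (c ∷ P) ≡ true
    res (none p) rewrite qc = cong not (lc-none (All.map ℓ⁻ p))
    res (odd e) rewrite qc = cong not (trans (≡-sym (lc-con P)) e)
    res (hd d R refl p) with ~? q d
    ... | inj₁ qd = ⊥-elim (no-cap h out qc qd (All.map ℓ⁻ p))
    ... | inj₂ qd rewrite qc | qd = cong not (lc-none (All.map ℓ⁻ p))
    res (tl d R refl p) with ~? q d
    ... | inj₁ qd = ⊥-elim (no-cap (subst (Hol c) (rev-snoc R) (hol-rev h))
              (All.head out ∷ All.head (All-r R (All.tail out)) ∷ tab (λ i → at (All-l R (All.tail out)) (∈-rev⁻ i)))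
              qc qd (tab (λ i → ℓ⁻ (at p (∈-rev⁻ i)))))
    ... | inj₂ qd rewrite qc | lc-++ (adj G q) R {d ∷ []} | qd | lc-none (All.map ℓ⁻ p) = refl

  odd-contacts : ∀ {v P q c} → Hol v P → (∀ {h} → h ∈ v ∷ P → q ≢ h) → c ∈ v ∷ P → q ~ c → lc (adj G q) (v ∷ P) ≡ true
  odd-contacts {q = q} h out i qc = trans (lc≡ (adj G q)) (odd-base isHol (tab (λ i → out (from i))) qc)
    where
    open Rebase (rebase h i)

  module _ {q r : V} {M : List V} (pq : Ind (q ∷ M ++ r ∷ [])) where

    private
      ℓ : V → Maybe Bool
      ℓ x = if adj G q x then just true else (if adj G r x then just false else nothing)

      ℓ⁻ : ∀ {x} → ℓ x ≡ nothing → q ≁ x × r ≁ x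
      ℓ⁻ {x} e with adj G q x | adj G r x
      ... | false | false = refl , refl

      ℓt : ∀ {x} → ℓ x ≡ just true → q ~ x
      ℓt {x} e with adj G q x | adj G r x
      ... | true | _ = refl
      ℓt () | false | false
      ℓt () | false | true

      ℓf : ∀ {x} → ℓ x ≡ just false → r ~ x
      ℓf {x} e with adj G q x | adj G r x
      ... | false | true = refl
      ℓf () | true | _
      ℓf () | false | false

      Off : V → Set
      Off h = (q ≢ h × r ≢ h) × All (_# h) M × ¬ (q ~ h × r ~ h)

      same : ∀ {s a b M} → Ind (a ∷ M ++ b ∷ []) → s ~ a → s ~ b → All (s #_) M → par M ≡ false
      same {M = []} p _ _ _ = refl
      same {M = m ∷ M} p sa sb sM = eq (par (m ∷ M)) (trans (cong not (≡-sym (lc-++ _ (m ∷ M))))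
          (even-path (hol {L = m ∷ M} p sa sb sM (ind-cross (_ ∷ []) p (here refl) (∈m M)))))
        where
        eq : ∀ p → not (p xor (true xor false)) ≡ false → p ≡ false
        eq false e = refl
        eq true ()

      -- The arc and the path from `q` to `r` together form a hole, with four vertices besides `L`
      -- and `M`, so these two have different parity.
      diff : ∀ {a b L} → Ind (a ∷ L ++ b ∷ []) → All Off (a ∷ L ++ b ∷ []) → q ~ a → r ~ b →
             All (λ x → ℓ x ≡ nothing) L → par L ≡ true xor par M
      diff {a} {b} {L} p offs qa rb lL = go (snoc? (reverse M)) refl
        where
        oa = All.head offs
        oL = All-l L (All.tail offs)
        ob = All.head (All-r L (All.tail offs))
        rq : Ind (r ∷ reverse M ++ q ∷ [])
        rq = subst Ind (trans (rev-snoc (q ∷ M)) (cong (r ∷_) (rev-cons q M))) (ind-rev _ pq)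
        rM : ∀ {m} → m ∈ reverse M → ∀ {h} → Off h → m # h
        rM i (_ , o , _) = at o (∈-rev⁻ i)
        q# : ∀ {x} → x ∈ L → q # x
        q# i = proj₁ (proj₁ (at oL i)) , proj₁ (ℓ⁻ (at lL i))
        r# : ∀ {x} → x ∈ L → r # x
        r# i = proj₂ (proj₁ (at oL i)) , proj₂ (ℓ⁻ (at lL i))
        r#a : r # a
        r#a = proj₂ (proj₁ oa) , ¬~ (λ ra → proj₂ (proj₂ oa) (qa , ra))
        q#b : q # b
        q#b = proj₁ (proj₁ ob) , ¬~ (λ qb → proj₂ (proj₂ ob) (qb , rb))
        fst : Ind (q ∷ a ∷ L ++ b ∷ [])
        fst = (qa , All-++ (tab q#) (q#b ∷ [])) , p
        whole : Ind ((a ∷ L ++ b ∷ []) ++ r ∷ reverse M)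
        whole = subst Ind (≡-sym (snoc-assoc (a ∷ L)))
          (ind-join (a ∷ L) p ((~sym rb , tab (λ i → #sym (rM i ob))) , ind-take (r ∷ reverse M) rq) cross)
          where
          cross : ∀ {x y} → x ∈ a ∷ L → y ∈ r ∷ reverse M → x # y
          cross (here refl) (here refl) = #sym r#a
          cross (here refl) (there j) = #sym (rM j oa)
          cross (there i) (here refl) = #sym (r# i)
          cross (there i) (there j) = #sym (rM j (at oL i))
        calc : par ((a ∷ L ++ b ∷ []) ++ r ∷ reverse M) ≡ false → par L ≡ true xor par M
        calc e = eq (par L) (par M) (trans (≡-sym
             (trans (lc-++ _ (a ∷ L ++ b ∷ [])) (cong₂ _xor_ (cong not (lc-++ _ L)) (cong not (lc-rev _ M))))) e)
          where
          eq : ∀ l m → not (l xor (true xor false)) xor (not m) ≡ false → l ≡ true xor m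
          eq false true e = refl
          eq true false e = refl
          eq false false ()
          eq true true ()
        go : ∀ {R} → Snoc R → R ≡ reverse M → par L ≡ true xor par M
        go [] e = calc (subst (λ z → par ((a ∷ L ++ b ∷ []) ++ r ∷ z) ≡ false) e
          (even-path (hol-join {C = []} fst (subst (λ z → Ind (r ∷ z ++ q ∷ [])) (≡-sym e) rq)
             (subst (λ z → Ind ((a ∷ L ++ b ∷ []) ++ r ∷ z)) (≡-sym e) whole) (#sym r#a))))
        go (C ∷ʳ m) e = calc (subst (λ z → par ((a ∷ L ++ b ∷ []) ++ r ∷ z) ≡ false) e
          (even-path (hol-join {C = r ∷ C} fst
             (subst (λ z → Ind (r ∷ z)) (snoc-assoc C) (subst (λ z → Ind (r ∷ z ++ q ∷ [])) (≡-sym e) rq))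
             (subst (λ z → Ind ((a ∷ L ++ b ∷ []) ++ r ∷ z)) (≡-sym e) whole)
             (#sym (rM (subst (m ∈_) e (∈m C)) oa)))))

      arcs : ∀ {a b L i j} → Ind (a ∷ L ++ b ∷ []) → All Off (a ∷ L ++ b ∷ []) → ℓ a ≡ just i → ℓ b ≡ just j →
             All (λ x → ℓ x ≡ nothing) L → par L ≡ (i xor j) ∧ (true xor par M)
      arcs {L = L} {true} {true} p o la lb lL = same p (ℓt la) (ℓt lb)
        (All.zipWith (λ { (o , e) → proj₁ (proj₁ o) , proj₁ (ℓ⁻ e) }) (All-l L (All.tail o) , lL))
      arcs {L = L} {false} {false} p o la lb lL = same p (ℓf la) (ℓf lb)
        (All.zipWith (λ { (o , e) → proj₂ (proj₁ o) , proj₂ (ℓ⁻ e) }) (All-l L (All.tail o) , lL))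
      arcs {i = true} {false} p o la lb lL = diff p o (ℓt la) (ℓf lb) lL
      arcs {a} {b} {L} {i = false} {true} p o la lb lL = trans (≡-sym (lc-rev _ L))
        (diff (subst Ind eq (ind-rev _ p)) (subst (All Off) eq (tab (λ i → at o (∈-rev⁻ i)))) (ℓt lb) (ℓf la)
          (tab (λ i → at lL (∈-rev⁻ i))))
        where
        eq : reverse (a ∷ L ++ b ∷ []) ≡ b ∷ reverse L ++ a ∷ []
        eq = trans (rev-snoc (a ∷ L)) (cong (b ∷_) (rev-cons a L))

      open Labelled Off ℓ (true xor par M) arcs

      lc-con : ∀ l → All Off l → lc con l ≡ lc (adj G q) l xor lc (adj G r) l
      lc-con [] _ = refl
      lc-con (x ∷ l) (o ∷ os) rewrite lc-con l os with adj G q x | adj G r x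
      ... | true | true = ⊥-elim (proj₂ (proj₂ o) (refl , refl))
      ... | true | false = ≡-sym (xor-assoc true (lc (adj G q) l) (lc (adj G r) l))
      ... | false | true = eq (lc (adj G q) l) (lc (adj G r) l) where
        eq : ∀ a b → true xor (a xor b) ≡ a xor (true xor b)
        eq false b = refl
        eq true false = refl
        eq true true = refl
      ... | false | false = refl

    -- `q` and `r` each have an odd number of neighbours on the hole and share none, so the number
    -- of contacts is even. This leaves only the outcomes `hd` and `tl`, where everything but `c`
    -- and one vertex next to it is free of contacts.
    two-ends-base : ∀ {c d P} → Hol c P → All Off (c ∷ P) → q ~ c → d ∈ c ∷ P → r ~ d →
                    c ~ d × (∀ {h} → h ∈ c ∷ P → q ~ h → h ≡ c) × (∀ {h} → h ∈ c ∷ P → r ~ h → h ≡ d)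
    two-ends-base {c} {d} {P} h offs qc id rd = res (contacts h offs ℓc)
      where
      ℓc : ℓ c ≡ just true
      ℓc rewrite qc = refl
      ¬ℓ : ∀ {x} → ℓ x ≡ nothing → ¬ (q ~ x ⊎ r ~ x)
      ¬ℓ e (inj₁ p) = ~≁ p (proj₁ (ℓ⁻ e))
      ¬ℓ e (inj₂ p) = ~≁ p (proj₂ (ℓ⁻ e))
      r≁c : ¬ r ~ c
      r≁c rc = proj₂ (proj₂ (All.head offs)) (qc , rc)
      R : Set
      R = c ~ d × (∀ {h} → h ∈ c ∷ P → q ~ h → h ≡ c) × (∀ {h} → h ∈ c ∷ P → r ~ h → h ≡ d)
      finish : ∀ e → c ~ e → (∀ {x} → x ∈ P → x ≡ e ⊎ ℓ x ≡ nothing) → R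
      finish e ce f with ed id
        where
        ed : d ∈ c ∷ P → d ≡ e
        ed (here refl) = ⊥-elim (r≁c rd)
        ed (there i) with f i
        ... | inj₁ e = e
        ... | inj₂ e = ⊥-elim (¬ℓ e (inj₂ rd))
      ... | refl = ce , go₁ , go₂
        where
        go₁ : ∀ {h} → h ∈ c ∷ P → q ~ h → h ≡ c
        go₁ (here p) _ = p
        go₁ (there i) qh with f i
        ... | inj₁ refl = ⊥-elim (proj₂ (proj₂ (at offs (there i))) (qh , rd))
        ... | inj₂ e = ⊥-elim (¬ℓ e (inj₁ qh))
        go₂ : ∀ {h} → h ∈ c ∷ P → r ~ h → h ≡ d
        go₂ (here refl) rh = ⊥-elim (r≁c rh)
        go₂ (there i) rh with f i
        ... | inj₁ e = e
        ... | inj₂ e = ⊥-elim (¬ℓ e (inj₂ rh))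
      d∈P : d ∈ c ∷ P → d ∈ P
      d∈P (here refl) = ⊥-elim (r≁c rd)
      d∈P (there i) = i
      res : Contacts P → R
      res (none p) = ⊥-elim (¬ℓ (at p (d∈P id)) (inj₂ rd))
      res (odd e) = ⊥-elim (true≢false {b = lc con (c ∷ P)} (cong₂ _xor_ (cong is-just ℓc) e)
        (trans (lc-con (c ∷ P) offs) (cong₂ _xor_ (odd-base h (All.map (proj₁ ∘ proj₁) offs) qc)
          (odd-contacts h (λ i → proj₂ (proj₁ (at offs i))) id rd))))
      res (hd e R refl p) = finish e (hol-hd h) λ { (here x) → inj₁ x ; (there i) → inj₂ (at p i) }
      res (tl e R refl p) = finish e (hol-last R h) λ i → case ∈-++ R i of
        λ { (inj₁ j) → inj₂ (at p j) ; (inj₂ (here x)) → inj₁ x }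

    -- Mostly used for a contradiction: a path attached to a hole at both of its ends, and nowhere
    -- between, cannot be attached at two nonadjacent vertices.
    two-ends : ∀ {v P c d} → Hol v P →
      (∀ {h} → h ∈ v ∷ P → q ≢ h) → (∀ {h} → h ∈ v ∷ P → r ≢ h) → (∀ {h} → h ∈ v ∷ P → All (_# h) M) →
      (∀ {h} → h ∈ v ∷ P → q ~ h → r ~ h → ⊥) → c ∈ v ∷ P → q ~ c → d ∈ v ∷ P → r ~ d →
      c ~ d × (∀ {h} → h ∈ v ∷ P → q ~ h → h ≡ c) × (∀ {h} → h ∈ v ∷ P → r ~ h → h ≡ d)
    two-ends h oq or oM dis ic qc id rd =
      let cd , f , g = two-ends-base isHol (tab λ i → let j = from i in (oq j , or j) , oM j , λ { (a , b) → dis j a b })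
                         qc (to id) rd
      in cd , (λ i → f (to i)) , λ i → g (to i)
      where
      open Rebase (rebase h ic)

  -- Otherwise `two-ends` with empty interior makes the neighbours `c` and `d` adjacent, and `q`,
  -- `c`, `d`, `r` form a 4-hole.
  common : ∀ {v P q r c d} → Hol v P → q ~ r → (∀ {h} → h ∈ v ∷ P → q ≢ h) → (∀ {h} → h ∈ v ∷ P → r ≢ h) →
           c ∈ v ∷ P → q ~ c → d ∈ v ∷ P → r ~ d → ∃ λ z → z ∈ v ∷ P × q ~ z × r ~ z
  common {v} {P} {q} {r} {c} {d} h qr oq or ic qc id rd with first? both? (v ∷ P)
    where
    both? : ∀ x → (q ~ x × r ~ x) ⊎ ¬ (q ~ x × r ~ x)
    both? x with ~? q x | ~? r x
    ... | inj₁ a | inj₁ b = inj₁ (a , b)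
    ... | inj₂ a | _ = inj₂ λ { (b , _) → ~≁ b a }
    ... | inj₁ _ | inj₂ a = inj₂ λ { (_ , b) → ~≁ b a }
  ... | some A x B e _ (a , b) = x , subst (x ∈_) (≡-sym e) (∈m A) , a , b
  ... | none p with two-ends {M = []} ((qr , []) , tt , tt) h oq or (λ _ → []) (λ i a b → at p i (a , b)) ic qc id rd
  ...   | cd , f , g = ⊥-elim (no-C₄ qc cd (~sym rd) (~sym qr)
            (oq id , ¬~ (λ qd → at p id (qd , rd))) ((λ e → or ic (≡-sym e)) , ¬~ (λ cr → at p ic (qc , ~sym cr))))

  -- In other words, `q` sees exactly three consecutive vertices of the hole, with `m` in the
  -- middle.
  Star : V → V → List V → V → Set
  Star q v P m = m ∈ v ∷ P × q ~ m × (∀ {h} → h ∈ v ∷ P → q ~ h → h ≡ m ⊎ h ~ m) ×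
                 (∀ {h} → h ∈ v ∷ P → h ~ m → q ~ h)

  private
    -- Let `c` be the first neighbour of `q` after `z`. If there is none before `x`, then `q` makes
    -- a cap with the edge from `x` to `y`. If `c` is not next to `x`, then `q` closes the stretch
    -- from `y` to `c` to a hole on which `x` sees just `q` and `y`, again a cap.
    star-base : ∀ {y z x N q} → Hol y (z ∷ N ++ x ∷ []) → All (q ≢_) (y ∷ z ∷ N ++ x ∷ []) →
                q ~ y → q ~ x → q ≁ z → Star q y (z ∷ N ++ x ∷ []) x
    star-base {y} {z} {x} {N} {q} h out qy qx qz with first? (~? q) N
    ... | none p = ⊥-elim (no-cap (hol-rot (z ∷ N) h) (All.head (All-r (y ∷ z ∷ N) out) ∷ All-l (y ∷ z ∷ N) out) qx qy
                     (qz ∷ p))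
    ... | some N₁ c [] refl p qc = ∈r (y ∷ z ∷ N) (here refl) , qx , f , g
      where
      P≡ : z ∷ (N₁ ++ c ∷ []) ++ x ∷ [] ≡ (z ∷ N₁) ++ c ∷ x ∷ []
      P≡ = cong (z ∷_) (snoc-assoc N₁)
      h' : Hol y ((z ∷ N₁) ++ c ∷ x ∷ [])
      h' = subst (Hol y) P≡ h
      cx : c ~ x
      cx = ind-link (z ∷ N₁) (hol-ind h')
      zN#x : ∀ {a} → a ∈ z ∷ N₁ → a # x
      zN#x i = ind-cross (z ∷ N₁) (hol-ind h') i (here refl)
      f : ∀ {a} → a ∈ y ∷ z ∷ (N₁ ++ c ∷ []) ++ x ∷ [] → q ~ a → a ≡ x ⊎ a ~ x
      f (here refl) _ = inj₂ (hol-last (z ∷ N) h)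
      f (there i) qa with ∈-++ (z ∷ N₁) (∈≡ i P≡)
      ... | inj₁ j = ⊥-elim (~≁ qa (at (qz ∷ p) j))
      ... | inj₂ (here refl) = inj₂ cx
      ... | inj₂ (there (here e)) = inj₁ e
      g : ∀ {a} → a ∈ y ∷ z ∷ (N₁ ++ c ∷ []) ++ x ∷ [] → a ~ x → q ~ a
      g (here refl) _ = qy
      g (there i) ax with ∈-++ (z ∷ N₁) (∈≡ i P≡)
      ... | inj₁ j = ⊥-elim (~# ax (zN#x j))
      ... | inj₂ (here refl) = qc
      ... | inj₂ (there (here refl)) = ⊥-elim (~⇒≢ ax refl)
    ... | some N₁ c (e ∷ N₂) refl p qc = ⊥-elim (no-cap O xout xq (~sym xy) x#)
      where
      P≡ : z ∷ (N₁ ++ c ∷ e ∷ N₂) ++ x ∷ [] ≡ (z ∷ N₁ ++ c ∷ []) ++ e ∷ N₂ ++ x ∷ []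
      P≡ = cong (z ∷_) (trans (Listₚ.++-assoc N₁ (c ∷ e ∷ N₂) (x ∷ [])) (≡-sym (snoc-assoc N₁)))
      h' : Hol y ((z ∷ N₁ ++ c ∷ []) ++ e ∷ N₂ ++ x ∷ [])
      h' = subst (Hol y) P≡ h
      path : Ind (y ∷ z ∷ N₁ ++ c ∷ [])
      path = hol-pre (z ∷ N₁ ++ c ∷ []) h'
      out' : All (q ≢_) ((z ∷ N₁ ++ c ∷ []) ++ e ∷ N₂ ++ x ∷ [])
      out' = subst (All (q ≢_)) P≡ (All.tail out)
      O : Hol q (y ∷ z ∷ N₁ ++ c ∷ [])
      O = hol {L = z ∷ N₁} path qy qc
            (All.zipWith id (All-l (z ∷ N₁) (All-l (z ∷ N₁ ++ c ∷ []) out') , qz ∷ p))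
            (ind-cross (y ∷ []) path (here refl) (∈m N₁))
      xq : x ~ q
      xq = ~sym qx
      xy : y ~ x
      xy = hol-last (z ∷ N) h
      zc#x : ∀ {a} → a ∈ z ∷ N₁ ++ c ∷ [] → a # x
      zc#x i = ind-cross (z ∷ N₁ ++ c ∷ []) (hol-ind h') i (∈m N₂)
      x# : All (x ≁_) (z ∷ N₁ ++ c ∷ [])
      x# = tab λ i → ≁sym (proj₂ (zc#x i))
      xout : All (x ≢_) (q ∷ y ∷ z ∷ N₁ ++ c ∷ [])
      xout = ~⇒≢ xq ∷ ~⇒≢ (~sym xy) ∷ tab λ i → proj₁ (#sym (zc#x i))

    -- The base point moves along the run `C` of neighbours of `q` until the next vertex is the
    -- nonneighbour `z`, as `star-base` wants it.
    star-scan : ∀ {c d z R' q} C → Hol c (d ∷ C ++ z ∷ R') → All (q ≢_) (c ∷ d ∷ C ++ z ∷ R') →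
                q ~ c → q ~ d → All (q ~_) C → q ≁ z → ∃ λ m → Star q c (d ∷ C ++ z ∷ R') m
    star-scan {c} {d} {z} {R'} {q} [] h out qc qd [] qz with star-base (hol-rot₁ h) (All.tail (All-++ out (All.head out ∷ []))) qd qc qz
    ... | i , qm , f , g = c , here refl , qc , (λ j → f (rot j)) , λ j → g (rot j)
      where
      rot : ∀ {a} → a ∈ c ∷ d ∷ z ∷ R' → a ∈ (d ∷ z ∷ R') ++ c ∷ []
      rot (here e) = ∈r (d ∷ z ∷ R') (here e)
      rot (there j) = ∈l j
    star-scan {c} {d} {z} {R'} {q} (r ∷ C) h out qc qd (qr ∷ qC) qz
      with star-scan C (subst (Hol d) eq (hol-rot₁ h)) (subst (λ l → All (q ≢_) (d ∷ l)) eq (All.tail (All-++ out (All.head out ∷ []))))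
             qd qr qC qz
      where
      eq : (r ∷ C ++ z ∷ R') ++ c ∷ [] ≡ r ∷ C ++ z ∷ R' ++ c ∷ []
      eq = cong (r ∷_) (Listₚ.++-assoc C (z ∷ R') (c ∷ []))
    ... | m , i , qm , f , g = m , rot⁻ i , qm , (λ j → f (rot j)) , λ j → g (rot j)
      where
      eq : (r ∷ C ++ z ∷ R') ++ c ∷ [] ≡ r ∷ C ++ z ∷ R' ++ c ∷ []
      eq = cong (r ∷_) (Listₚ.++-assoc C (z ∷ R') (c ∷ []))
      rot : ∀ {a} → a ∈ c ∷ d ∷ r ∷ C ++ z ∷ R' → a ∈ d ∷ r ∷ C ++ z ∷ R' ++ c ∷ []
      rot (here e) = there (∈≡ (∈r (r ∷ C ++ z ∷ R') (here e)) eq)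
      rot (there (here e)) = here e
      rot (there (there j)) = there (∈≡ (∈l j) eq)
      rot⁻ : ∀ {a} → a ∈ d ∷ r ∷ C ++ z ∷ R' ++ c ∷ [] → a ∈ c ∷ d ∷ r ∷ C ++ z ∷ R'
      rot⁻ (here e) = there (here e)
      rot⁻ (there j) with ∈-++ (r ∷ C ++ z ∷ R') (∈≡ j (≡-sym eq))
      ... | inj₁ k = there (there k)
      ... | inj₂ (here e) = here e

    star-hd : ∀ {c d R q e} → Hol c (d ∷ R) → All (q ≢_) (c ∷ d ∷ R) → q ~ c → q ~ d → e ∈ c ∷ d ∷ R → q ≁ e →
              ∃ λ m → Star q c (d ∷ R) m
    star-hd {q = q} h out qc qd (here refl) qe = ⊥-elim (~≁ qc qe)
    star-hd {q = q} h out qc qd (there (here refl)) qe = ⊥-elim (~≁ qd qe)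
    star-hd {R = R} {q} h out qc qd (there (there i)) qe with first? {P = q ≁_} {Q = q ~_} (λ x → swap (~? q x)) R
    ... | none p = ⊥-elim (~≁ (at p i) qe)
    ... | some A z B refl p qz = star-scan A h out qc qd p qz

  star : ∀ {v P q c d e} → Hol v P → (∀ {h} → h ∈ v ∷ P → q ≢ h) → c ∈ v ∷ P → d ∈ v ∷ P → c ~ d → q ~ c → q ~ d →
         e ∈ v ∷ P → q ≁ e → ∃ λ m → Star q v P m
  star {v} {P₀} {q} {c} {d} {e} h₀ out ic id cd qc qd ie qe = fin (go isHol (tab λ i → out (from i)) (to id) (to ie))
    where
    open Rebase (rebase h₀ ic)
    fin : ∃ (λ m → Star q c P' m) → ∃ λ m → Star q v P₀ m
    fin (m , i , qm , f , g) = m , from i , qm , (λ j → f (to j)) , λ j → g (to j)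
    go : ∀ {P} → Hol c P → All (q ≢_) (c ∷ P) → d ∈ c ∷ P → e ∈ c ∷ P → ∃ λ m → Star q c P m
    go h out (here refl) ie = ⊥-elim (~⇒≢ cd refl)
    go h out (there (here refl)) ie = star-hd h out qc qd ie qe
    go h@(hol {a} {L} {b} _ _ _ cL _) out (there (there i)) ie with ∈-++ L i
    ... | inj₁ j = ⊥-elim (~# cd (at cL j))
    ... | inj₂ (here refl) with star-hd (subst (Hol c) (rev-snoc (a ∷ L)) (hol-rev h))
             (All.head out ∷ subst (All (q ≢_)) (rev-snoc (a ∷ L)) (tab (λ i → at (All.tail out) (∈-rev⁻ i)))) qc qd (rv ie) qe
      where
      rv : ∀ {x} → x ∈ c ∷ (a ∷ L) ++ b ∷ [] → x ∈ c ∷ b ∷ reverse (a ∷ L)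
      rv (here e) = here e
      rv (there i) = there (∈≡ (∈-rev i) (rev-snoc (a ∷ L)))
    ...   | m , i' , qm , f , g = m , vr i' , qm , (λ j → f (rv j)) , λ j → g (rv j)
      where
      rv : ∀ {x} → x ∈ c ∷ (a ∷ L) ++ b ∷ [] → x ∈ c ∷ b ∷ reverse (a ∷ L)
      rv (here e) = here e
      rv (there i) = there (∈≡ (∈-rev i) (rev-snoc (a ∷ L)))
      vr : ∀ {x} → x ∈ c ∷ b ∷ reverse (a ∷ L) → x ∈ c ∷ (a ∷ L) ++ b ∷ []
      vr (here e) = here e
      vr (there i) = there (∈-rev⁻ (∈≡ i (≡-sym (rev-snoc (a ∷ L)))))

-- Twins of the vertices of a hole

iff-≡ : ∀ {a b : Bool} → (a ≡ true → b ≡ true) → (b ≡ true → a ≡ true) → a ≡ b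
iff-≡ {false} {false} f g = refl
iff-≡ {false} {true} f g = g refl
iff-≡ {true} {false} f g = ≡-sym (f refl)
iff-≡ {true} {true} f g = refl

-- The twins of m are the vertices that can replace m on the hole C.
module Twins {n : ℕ} (G : Graph n) (cf : CapFree G) (ehf : EvenHoleFree G) (v₀ : Paths.V G) (P₀ : List (Paths.V G))
             (H₀ : Paths.Hol G v₀ P₀) where
  open Scan G cf ehf public

  C : List V
  C = v₀ ∷ P₀

  Off : V → Set
  Off q = ∀ {h} → h ∈ C → q ≢ h

  Twin : V → V → Set
  Twin m q = q ≡ m ⊎ (Off q × q ~ m × (∀ {h} → h ∈ C → h ≢ m → adj G q h ≡ adj G m h))

  twin-adj : ∀ {m q h} → Twin m q → h ∈ C → h ≢ m → adj G q h ≡ adj G m h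
  twin-adj (inj₁ refl) i d = refl
  twin-adj (inj₂ (_ , _ , f)) i d = f i d

  twin-≢ : ∀ {m q h} → Twin m q → h ∈ C → m ≢ h → q ≢ h
  twin-≢ (inj₁ refl) i d = d
  twin-≢ (inj₂ (f , _)) i d = f i

  twin-# : ∀ {m q h} → Twin m q → h ∈ C → m # h → q # h
  twin-# t i (d , e) = twin-≢ t i d , trans (twin-adj t i (d ∘ ≡-sym)) e

  twin-~ : ∀ {m q h} → Twin m q → h ∈ C → m ~ h → q ~ h
  twin-~ t i e = trans (twin-adj t i (~⇒≢ (~sym e))) e

  twin-hol : ∀ {m P q} → Twin m q → (∀ {h} → h ∈ P → h ∈ C) → Hol m P → Hol q P
  twin-hol {m} {_} {q} t sub (hol {a} {L} {b} p ma mb mL ab) =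
    hol p (twin-~ t (sub (here refl)) ma) (twin-~ t (sub (∈m (a ∷ L))) mb)
      (tab λ i → twin-# t (sub (there (∈l i))) (at mL i)) ab

  -- Two nonadjacent twins would form a 4-hole with the two neighbours of `m` on the hole.
  twin-clique : ∀ {m q r} → m ∈ C → Twin m q → Twin m r → q ≢ r → q ~ r
  twin-clique {m} {q} {r} i tq tr q≢r with ~? q r | rebase H₀ i
  ... | inj₁ e | _ = e
  ... | inj₂ e | record { isHol = hol {a} {L} {b} p ma mb mL ab ; from = from } =
    ⊥-elim (no-C₄ (twin-~ tq ia ma) (~sym (twin-~ tr ia ma)) (twin-~ tr ib mb) (~sym (twin-~ tq ib mb)) (q≢r , e) ab)
    where
    ia = from (there (here refl))
    ib = from (∈m (m ∷ a ∷ L))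

  -- The parities of the numbers of neighbours on the hole and on the swapped hole agree.
  twin-see : ∀ {m q r h} → m ∈ C → Twin m q → Off r → r ≢ q → h ∈ C → h ≢ m → r ~ h → adj G r q ≡ adj G r m
  twin-see {m} {q} {r} {h} i t off r≢q ih h≢m rh = xor-cancel (adj G r q) (adj G r m) _ (trans e₁ (≡-sym e₂))
    where
    open Rebase (rebase H₀ i)
    h∈P : h ∈ P'
    h∈P with to ih
    ... | here e = ⊥-elim (h≢m e)
    ... | there j = j
    e₂ : lc (adj G r) (m ∷ P') ≡ true
    e₂ = odd-contacts isHol (λ j → off (from j)) (there h∈P) rh
    e₁ : lc (adj G r) (q ∷ P') ≡ true
    e₁ = odd-contacts (twin-hol t (from ∘ there) isHol) (λ { (here refl) → r≢q ; (there j) → off (from (there j)) })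
           (there h∈P) rh
    xor-cancel : ∀ a b c → a xor c ≡ b xor c → a ≡ b
    xor-cancel false false c e = refl
    xor-cancel false true false ()
    xor-cancel false true true ()
    xor-cancel true false false ()
    xor-cancel true false true ()
    xor-cancel true true c e = refl

  star-twin : ∀ {q m} → Off q → Star q v₀ P₀ m → Twin m q
  star-twin {q} {m} off (i , qm , f , g) = inj₂ (off , qm , λ {h} j h≢m →
    iff-≡ (λ qh → [_] (f j qh) h≢m) (λ mh → g j (~sym mh)))
    where
    [_] : ∀ {h} → h ≡ m ⊎ h ~ m → h ≢ m → m ~ h
    [ inj₁ e ] d = ⊥-elim (d e)
    [ inj₂ e ] d = ~sym e

  -- When both are proper twins, `p` sees `u`, a vertex of the hole other than `w`. By `twin-see` it
  -- then treats `q` as it treats `w`, which it misses.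
  twin-twin : ∀ {u w p q} → u ∈ C → w ∈ C → u # w → Twin u p → Twin w q → p # q
  twin-twin {u} {w} {p} {q} iu iw u#w tp (inj₁ refl) = twin-# tp iw u#w
  twin-twin {u} {w} {p} {q} iu iw u#w (inj₁ refl) tq@(inj₂ _) = #sym (twin-# tq iu (#sym u#w))
  twin-twin {u} {w} {p} {q} iu iw u#w tp@(inj₂ (offp , pu , fp)) tq@(inj₂ (offq , qw , fq)) = p≢q ,
    trans (twin-see iw tq offp p≢q iu (proj₁ u#w) pu) (proj₂ (twin-# tp iw u#w))
    where
    p≢q : p ≢ q
    p≢q refl = ~# pu (twin-# tq iu (#sym u#w))

-- Paths through vertices with at most one neighbour on a hole

module Detour {n : ℕ} (G : Graph n) (cf : CapFree G) (ehf : EvenHoleFree G) where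
  open Scan G cf ehf public

  Thin : V → List V → V → Set
  Thin v P x = (∀ {h} → h ∈ v ∷ P → x ≢ h) × (∀ {c d} → c ∈ v ∷ P → d ∈ v ∷ P → x ~ c → x ~ d → c ≡ d)

  -- The one way in which such vertices can connect nonadjacent vertices of the hole: the path
  -- replaces the stretch `a`, `w`, `b`, and the skipped `w` is seen from it.
  record Bypass (T : V → Set) (v : V) (P : List V) : Set where
    field
      a b w x : V
      L : List V
      a∈ : a ∈ v ∷ P
      b∈ : b ∈ v ∷ P
      w∈ : w ∈ v ∷ P
      a#b : a # b
      path : Ind (a ∷ L ++ b ∷ [])
      thin : All T L
      x∈ : x ∈ L
      x~w : x ~ w
      w~a : w ~ a
      w~b : w ~ b
      only : ∀ {z c} → z ∈ L → c ∈ v ∷ P → z ~ c → (c ≡ a ⊎ c ≡ b) ⊎ (c ~ a × c ~ b)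

  -- Induction on the length. If the interior sees a further hole vertex `c` that is not next to
  -- both ends, then `c` and the end it misses are joined by a shorter path. If the interior sees no
  -- further hole vertex at all, `two-ends` makes `a` and `b` adjacent.
  bypass : ∀ {T v P} → Hol v P → (∀ {x} → T x → Thin v P x) → ∀ k {a b} L → length L ≤ k → a ∈ v ∷ P → b ∈ v ∷ P → a # b →
           Ind (a ∷ L ++ b ∷ []) → All T L → ¬ ¬ Bypass T v P
  bypass h th k [] le a∈ b∈ ab ((e , _) , _) ts ret = ~# e ab
  bypass {T} {v} {P} h th (suc k) {a} {b} L@(q ∷ L') (s≤s le) a∈ b∈ ab p ts ret = do
      no ¬bad ← em (∃ λ x → x ∈ L × ∃ λ c → c ∈ v ∷ P × x ~ c × c ≢ a × c ≢ b × ¬ (c ~ a × c ~ b))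
        where yes (x , x∈ , c , c∈ , xc , ca , cb , ncc) → shorten x∈ c∈ xc ca cb ncc
      no isol ← em (∃ λ x → x ∈ L × ∃ λ c → c ∈ v ∷ P × x ~ c × c ≢ a × c ≢ b)
        where yes (x , x∈ , c , c∈ , xc , ca , cb) → do
                yes (wa , wb) ← em (c ~ a × c ~ b)
                  where no n → ¬bad (x , x∈ , c , c∈ , xc , ca , cb , n)
                classify ← only?
                ret (record { a = a ; b = b ; w = c ; x = x ; L = L ; a∈ = a∈ ; b∈ = b∈ ; w∈ = c∈ ; a#b = ab ; path = p
                            ; thin = ts ; x∈ = x∈ ; x~w = xc ; w~a = wa ; w~b = wb
                            ; only = λ i j e → classify ¬bad i j e })
      direct isol (snoc? L') refl
    where
    aq : a ~ q
    aq = proj₁ (proj₁ p)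
    T' : ∀ {x} → x ∈ L → Thin v P x
    T' i = th (at ts i)
    Bad = ∃ λ x → x ∈ L × ∃ λ c → c ∈ v ∷ P × x ~ c × c ≢ a × c ≢ b × ¬ (c ~ a × c ~ b)
    only? : ¬ ¬ (¬ Bad → ∀ {z c} → z ∈ L → c ∈ v ∷ P → z ~ c → (c ≡ a ⊎ c ≡ b) ⊎ (c ~ a × c ~ b))
    only? k = k λ nb {z} {c} i j e → go nb i j e
      where
      go : ∀ {z c} → ¬ Bad → z ∈ L → c ∈ v ∷ P → z ~ c → (c ≡ a ⊎ c ≡ b) ⊎ (c ~ a × c ~ b)
      go {z} {c} nb i j e with c Finₚ.≟ a | c Finₚ.≟ b | ~? c a | ~? c b
      ... | yes f | _ | _ | _ = inj₁ (inj₁ f)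
      ... | no _ | yes f | _ | _ = inj₁ (inj₂ f)
      ... | no _ | no _ | inj₁ f | inj₁ g = inj₂ (f , g)
      ... | no f | no g | inj₂ f' | _ = ⊥-elim (nb (z , i , c , j , e , f , g , λ { (r , _) → ~≁ r f' }))
      ... | no f | no g | inj₁ _ | inj₂ g' = ⊥-elim (nb (z , i , c , j , e , f , g , λ { (_ , r) → ~≁ r g' }))
    from-a : ∀ {x c} → x ∈ L → c ∈ v ∷ P → x ~ c → c ≢ b → a # c → ⊥
    from-a {x} {c} x∈ c∈ xc cb ac with first? {P = c ~_} {Q = c ≁_} (~? c) L
    ... | none n = ~≁ (~sym xc) (at n x∈)
    -- The last interior vertex sees `b` already, and a thin vertex has no second neighbour on the
    -- hole. So `z` comes earlier and the new path is strictly shorter.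
    ... | some E z [] eq n cz = cb (proj₂ (T' (∈≡ (∈m E) (≡-sym eq))) c∈ b∈ (~sym cz)
            (ind-link (a ∷ E) (subst Ind (cong (a ∷_) (trans (cong (_++ b ∷ []) eq) (snoc-assoc E))) p)))
    ... | some E z (f ∷ F) eq n cz = bypass h th k (E ++ z ∷ []) (ℕₚ.≤-trans (ℕₚ.≤-pred lt) le) a∈ c∈ ac
            (subst Ind (cong (a ∷_) (≡-sym (snoc-assoc E))) (ind-snoc (a ∷ E)
              (ind-take (a ∷ E ++ z ∷ []) (subst Ind eq' p)) (~sym cz)
              (#sym ac ∷ tab λ i → (λ e → proj₁ (T' (∈≡ (∈l i) (≡-sym eq))) c∈ (≡-sym e)) , at n i)))
            (All-l (E ++ z ∷ []) (subst (All T) (trans eq (≡-sym (snoc-assoc E))) ts)) ret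
      where
      eq' : a ∷ L ++ b ∷ [] ≡ (a ∷ E ++ z ∷ []) ++ f ∷ F ++ b ∷ []
      eq' = cong (a ∷_) (trans (cong (_++ b ∷ []) (trans eq (≡-sym (snoc-assoc E)))) (Listₚ.++-assoc (E ++ z ∷ []) (f ∷ F) (b ∷ [])))
      lt : length (E ++ z ∷ []) < suc (length L')
      lt = subst (length (E ++ z ∷ []) <_) (≡-sym (trans (cong length (trans eq (≡-sym (snoc-assoc E)))) (Listₚ.length-++ (E ++ z ∷ []))))
             (ℕₚ.m<m+n _ (s≤s z≤n))
    from-b : ∀ {x c} → x ∈ L → c ∈ v ∷ P → x ~ c → c ≢ a → c # b → ⊥
    from-b {x} {c} x∈ c∈ xc ca cb with last? {P = c ~_} {Q = c ≁_} (~? c) L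
    ... | none n = ~≁ (~sym xc) (at n x∈)
    ... | some [] z F refl cz n = ca (proj₂ (T' (here refl)) c∈ a∈ (~sym cz) (~sym aq))
    ... | some (e ∷ E) z F refl cz n = bypass h th k (z ∷ F) (ℕₚ.≤-trans lt le) c∈ b∈ cb
            ((cz , All-++ (tab λ i → (λ g → proj₁ (T' (∈r (e ∷ E) (there i))) c∈ (≡-sym g)) , at n i) (cb ∷ []))
             , ind-drop (a ∷ e ∷ E) (subst Ind (cong (a ∷_) (Listₚ.++-assoc (e ∷ E) (z ∷ F) (b ∷ []))) p))
            (All-r (e ∷ E) ts) ret
      where
      lt : length (z ∷ F) ≤ length (E ++ z ∷ F)
      lt = subst (length (z ∷ F) ≤_) (≡-sym (Listₚ.length-++ E)) (ℕₚ.m≤n+m _ (length E))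
    shorten : ∀ {x c} → x ∈ L → c ∈ v ∷ P → x ~ c → c ≢ a → c ≢ b → ¬ (c ~ a × c ~ b) → ⊥
    shorten {x} {c} x∈ c∈ xc ca cb ncc with ~? c a | ~? c b
    ... | inj₁ e | inj₁ f = ncc (e , f)
    ... | inj₂ e | _ = from-a x∈ c∈ xc cb (ca ∘ ≡-sym , ≁sym e)
    ... | inj₁ _ | inj₂ f = from-b x∈ c∈ xc ca (cb , f)
    direct : ¬ (∃ λ x → x ∈ L × ∃ λ c → c ∈ v ∷ P × x ~ c × c ≢ a × c ≢ b) → ∀ {R} → Snoc R → R ≡ L' → ⊥
    direct isol [] refl = proj₁ ab (proj₂ (T' (here refl)) a∈ b∈ (~sym aq) (proj₁ (proj₁ (proj₂ p))))
    direct isol (M ∷ʳ r) refl with two-ends {M = M} (ind-take (q ∷ M ++ r ∷ []) (proj₂ p)) h (proj₁ (T' (here refl)))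
          (proj₁ (T' (there (∈m M)))) mid
          (λ i qh rh → proj₁ ab (trans (proj₂ (T' (here refl)) a∈ i (~sym aq) qh) (proj₂ (T' (there (∈m M))) i b∈ rh rb)))
          a∈ (~sym aq) b∈ rb
      where
      p' : Ind (a ∷ q ∷ M ++ r ∷ b ∷ [])
      p' = subst Ind (cong (λ z → a ∷ q ∷ z) (snoc-assoc M)) p
      rb : r ~ b
      rb = ind-link (a ∷ q ∷ M) p'
      mid : ∀ {h} → h ∈ v ∷ P → All (_# h) M
      mid {h} hi = tab λ {m} i → proj₁ (T' (there (∈l i))) hi , ¬~ λ mh → isol (m , there (∈l i) , h , hi , mh ,
        (λ { refl → ~# (~sym mh) (ind-cross (a ∷ []) p' (here refl) (∈l i)) }) ,
        (λ { refl → ~# mh (ind-cross (a ∷ q ∷ M) p' (there (there i)) (here refl)) }))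
    ... | e , _ = ~# e ab

module Exchange {n : ℕ} (G : Graph n) (cf : CapFree G) (ehf : EvenHoleFree G) (v₀ : Paths.V G) (P₀ : List (Paths.V G))
             (H₀ : Paths.Hol G v₀ P₀) where
  open Twins G cf ehf v₀ P₀ H₀
  open Detour G cf ehf using (Thin; Bypass; bypass)

  record Exchanged (a a' : V) : Set where
    field
      P : List V
      isHol : Hol a' P
      sub : ∀ {h} → h ∈ P → h ∈ C × h ≢ a
      sup : ∀ {h} → h ∈ C → h ≢ a → h ∈ P
      thin : ∀ {x} → x ≢ a' → Thin v₀ P₀ x → Thin a' P x

  exchange : ∀ {a a'} → a ∈ C → Twin a a' → Exchanged a a'
  exchange {a} {a'} a∈ t = record
    { P = P' ; isHol = twin-hol t (from ∘ there) isHol ; sub = sub ; sup = sup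
    ; thin = λ x≢ (off , one) → (λ { (here refl) → x≢ ; (there i) → off (from (there i)) }) , λ where
        (here refl) (here refl) _ _ → refl
        (there i) (there j) xc xd → one (from (there i)) (from (there j)) xc xd
        (here refl) (there j) xa' xd → ⊥-elim (mixed x≢ off one j xa' xd)
        (there i) (here refl) xc xa' → ⊥-elim (mixed x≢ off one i xa' xc) }
    where
    open Rebase (rebase H₀ a∈)
    sub : ∀ {h} → h ∈ P' → h ∈ C × h ≢ a
    sub i = from (there i) , λ { refl → at (hol-≢ isHol) i refl }
    sup : ∀ {h} → h ∈ C → h ≢ a → h ∈ P'
    sup i ne with to i
    ... | here e = ⊥-elim (ne e)
    ... | there j = j
    mixed : ∀ {x d} → x ≢ a' → Off x → (∀ {c d} → c ∈ C → d ∈ C → x ~ c → x ~ d → c ≡ d) → d ∈ P' → x ~ a' → x ~ d → ⊥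
    mixed x≢ off one j xa' xd with sub j
    ... | d∈ , d≢a = d≢a (one d∈ a∈ xd (trans (≡-sym (twin-see a∈ t off x≢ d∈ d≢a xd)) xa'))

  twin-not-thin : ∀ {a a'} → a ∈ C → Twin a a' → ¬ Thin v₀ P₀ a'
  twin-not-thin {a} {a'} a∈ t (off , one) with rebase H₀ a∈
  ... | record { isHol = hol {c} {L} {d} p ac ad _ cd ; from = from } =
    proj₁ cd (one ic id' (twin-~ t ic ac) (twin-~ t id' ad))
    where
    ic = from (there (here refl))
    id' = from (∈m (a ∷ c ∷ L))

module Detours {n : ℕ} (G : Graph n) (cf : CapFree G) (ehf : EvenHoleFree G) (v₀ : Paths.V G) (P₀ : List (Paths.V G))
             (H₀ : Paths.Hol G v₀ P₀) where
  open Twins G cf ehf v₀ P₀ H₀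
  open Detour G cf ehf using (Thin; Bypass; bypass)

  record Result (T : V → Set) (a b a' b' : V) : Set where
    field
      v : V
      P : List V
      isHol : Hol v P
      kind : ∀ {h} → h ∈ v ∷ P → (h ≡ a' ⊎ h ≡ b') ⊎ (h ∈ C × h ≢ a × h ≢ b)
      thin : ∀ {x} → T x → Thin v P x
      found : Bypass T v P

  -- Both twins are put on the hole in place of `a` and `b`. Thin vertices stay thin there: by
  -- `twin-see`, a vertex with another neighbour on the hole sees the twin only if it sees the
  -- original.
  detour : ∀ {T a b a' b'} → (∀ {x} → T x → Thin v₀ P₀ x) → a ∈ C → b ∈ C → a # b → Twin a a' → Twin b b' → a' # b' →
           Path T a' b' → ¬ ¬ Result T a b a' b'
  detour {T} {a} {b} {a'} {b'} th a∈ b∈ ab ta tb a'b' p ret with induce p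
  ... | inj₁ e = proj₁ a'b' e
  ... | inj₂ (L , ts , ind) = do
    r ← bypass E₂.isHol thin (length L) L ℕₚ.≤-refl (there a'∈) (here refl) a'b' ind ts
    ret (record { isHol = E₂.isHol ; kind = kind ; thin = thin ; found = r })
    where
    module E₁ = Exchange.Exchanged (Exchange.exchange G cf ehf v₀ P₀ H₀ a∈ ta)
    b∈₁ : b ∈ a' ∷ E₁.P
    b∈₁ = there (E₁.sup b∈ (proj₁ (#sym ab)))
    a'≢b : a' ≢ b
    a'≢b = proj₁ (twin-# ta b∈ ab)
    tb₁ : Twins.Twin G cf ehf a' E₁.P E₁.isHol b b'
    tb₁ = conv tb
      where
      conv : Twin b b' → Twins.Twin G cf ehf a' E₁.P E₁.isHol b b'
      conv (inj₁ e) = inj₁ e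
      conv (inj₂ (off , bb , f)) = inj₂ ((λ { (here refl) → a'b' .proj₁ ∘ ≡-sym ; (there i) → off (proj₁ (E₁.sub i)) }) , bb , λ where
        (here refl) _ → trans (proj₂ (#sym a'b')) (≡-sym (proj₂ (#sym (twin-# ta b∈ ab))))
        (there i) ne → f (proj₁ (E₁.sub i)) ne)
    module E₂ = Exchange.Exchanged (Exchange.exchange G cf ehf a' E₁.P E₁.isHol b∈₁ tb₁)
    a'∈ : a' ∈ E₂.P
    a'∈ = E₂.sup (here refl) a'≢b
    thin : ∀ {x} → T x → Thin b' E₂.P x
    thin t = E₂.thin (λ { refl → Exchange.twin-not-thin G cf ehf v₀ P₀ H₀ b∈ tb (th t) })
               (E₁.thin (λ { refl → Exchange.twin-not-thin G cf ehf v₀ P₀ H₀ a∈ ta (th t) }) (th t))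
    kind : ∀ {h} → h ∈ b' ∷ E₂.P → (h ≡ a' ⊎ h ≡ b') ⊎ (h ∈ C × h ≢ a × h ≢ b)
    kind (here e) = inj₁ (inj₂ e)
    kind (there i) with E₂.sub i
    ... | here e , _ = inj₁ (inj₁ e)
    ... | there j , ne = inj₂ (proj₁ (E₁.sub j) , proj₂ (E₁.sub j) , ne)

-- Chordal completions, gluing along cliques, required pairs

enumerate : ∀ {n} {S Q : Fin n → Set} → (∀ i → Dec (S i)) → (∀ i → Dec (Q i)) →
  Σ (List (Fin n)) λ l → Σ (List (Fin n)) λ m → Uniq.Unique (l ++ m) × (∀ {x} → S x → ¬ Q x → x ∈ l) ×
    (∀ {x} → x ∈ l → S x × ¬ Q x) × (∀ {x} → Q x → x ∈ m) × (∀ {x} → x ∈ m → Q x)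
enumerate {n} {S} {Q} S? Q? = filter d (allFin n) , filter Q? (allFin n) ,
    Uniqₚ.++⁺ (Uniqₚ.filter⁺ d (Uniqₚ.allFin⁺ n)) (Uniqₚ.filter⁺ Q? (Uniqₚ.allFin⁺ n))
      (λ (i , j) → proj₂ (proj₂ (∈ₚ.∈-filter⁻ d {xs = allFin n} i)) (proj₂ (∈ₚ.∈-filter⁻ Q? {xs = allFin n} j))) ,
    (λ s nq → ∈ₚ.∈-filter⁺ d (∈ₚ.∈-allFin _) (s , nq)) , (λ i → proj₂ (∈ₚ.∈-filter⁻ d {xs = allFin n} i)) ,
    (λ q → ∈ₚ.∈-filter⁺ Q? (∈ₚ.∈-allFin _) q) , λ i → proj₂ (∈ₚ.∈-filter⁻ Q? {xs = allFin n} i)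
  where
  d = λ i → S? i ×-dec ¬? (Q? i)

module Completions {n : ℕ} (G : Graph n) where
  open Paths G

  -- perfect elimination orders, eliminating from the head
  data PEO (R : V → V → Set) : List V → Set where
    []  : PEO R []
    peo : ∀ {x l} → x ∉ l → (∀ {a b} → a ∈ l → b ∈ l → R x a → R x b → R a b) → PEO R l → PEO R (x ∷ l)

  peo-drop : ∀ {R} l {m} → PEO R (l ++ m) → PEO R m
  peo-drop [] p = p
  peo-drop (x ∷ l) (peo _ _ p) = peo-drop l p

  record Order (R : V → V → Set) (S Q : V → Set) : Set where
    field
      l m : List V
      isPEO : PEO R (l ++ m)
      all : ∀ {x} → S x → x ∈ l ++ m
      sound : ∀ {x} → x ∈ l ++ m → S x
      m⊂ : ∀ {x} → x ∈ m → Q x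
      ⊂m : ∀ {x} → Q x → x ∈ m

  -- Chordality (order) is stated so that it is preserved by gluing along a clique.
  record Completion (S : V → Set) (Req : V → V → Set) : Set₁ where
    field
      R : V → V → Set
      R-sym : ∀ {a b} → R a b → R b a
      R-in : ∀ {a b} → R a b → S a × S b
      R-req : ∀ {a b} → S a → S b → Req a b → R a b
      order : ∀ (Q : V → Set) → (∀ {x} → Q x → S x) → (∀ {a b} → Q a → Q b → R a b) → ¬ ¬ Order R S Q
      no7 : ∀ (f : Fin 7 → V) → (∀ i j → i ≢ j → R (f i) (f j) × f i # f j) → ⊥

  order-cong : ∀ {R S S' Q} → (∀ {x} → S x → S' x) → (∀ {x} → S' x → S x) → Order R S Q → Order R S' Q
  order-cong f g o = record { l = l ; m = m ; isPEO = isPEO ; all = all ∘ g ; sound = f ∘ sound ; m⊂ = m⊂ ; ⊂m = ⊂m }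
    where
    open Order o

  Comp : (S : V → Set) (Req : V → V → Set) → Set₁
  Comp S Req = ¬ ¬ Completion S Req

  mono : ∀ {S S' Req Req'} → (∀ {x} → S x → S' x) → (∀ {x} → S' x → S x) → (∀ {a b} → S a → S b → Req' a b → Req a b) →
         Completion S Req → Completion S' Req'
  mono f g h c = record
    { R = R ; R-sym = R-sym ; R-in = λ r → f (proj₁ (R-in r)) , f (proj₂ (R-in r))
    ; R-req = λ a b r → R-req (g a) (g b) (h (g a) (g b) r)
    ; order = λ Q q c k → order Q (g ∘ q) c λ o → k (order-cong f g o)
    ; no7 = no7 }
    where
    open Completion c

  module Glue {S₁ S₂ : V → Set} {Req₁ Req₂ : V → V → Set}
    (k₁ : ∀ {a b} → S₁ a → S₂ a → S₁ b → S₂ b → Req₁ a b) (k₂ : ∀ {a b} → S₁ a → S₂ a → S₁ b → S₂ b → Req₂ a b)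
    (c₁ : Completion S₁ Req₁) (c₂ : Completion S₂ Req₂) where
    private
      module C₁ = Completion c₁
      module C₂ = Completion c₂

    -- The vertices outside `S₁` are eliminated first, in an order of the second completion that
    -- ends with the shared clique; an order of the first one that ends with `Q` follows. An
    -- `R`-neighbour of an early vertex that comes in the second phase must be shared, hence lies in
    -- the final part of the former order.
    merge : ∀ {R Q} → (∀ {a b} → C₁.R a b → R a b) → (∀ {a b} → C₂.R a b → R a b) → (∀ {a b} → R a b → C₁.R a b ⊎ C₂.R a b) →
            (∀ {x} → Q x → S₁ x) → (∀ {a b} → Q a → Q b → R a b) → (∀ x → Dec (S₁ x)) → ¬ ¬ Order R (λ x → S₁ x ⊎ S₂ x) Q
    merge {R} {Q} in₁ in₂ out Q⊂ Qc S₁? ret = do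
        o₁ ← C₁.order Q Q⊂ (λ a b → to₁ (Q⊂ a) (Q⊂ b) (Qc a b))
        o₂ ← C₂.order (λ x → S₁ x × S₂ x) proj₂ (λ (a , a') (b , b') → C₂.R-req a' b' (k₂ a a' b b'))
        ret (assemble o₁ o₂)
      where
      to₁ : ∀ {a b} → S₁ a → S₁ b → R a b → C₁.R a b
      to₁ a b r with out r
      ... | inj₁ r = r
      ... | inj₂ r = C₁.R-req a b (k₁ a (proj₁ (C₂.R-in r)) b (proj₂ (C₂.R-in r)))
      assemble : Order C₁.R S₁ Q → Order C₂.R S₂ (λ x → S₁ x × S₂ x) → Order R (λ x → S₁ x ⊎ S₂ x) Q
      assemble o₁ o₂ = record
          { l = O₂.l ++ O₁.l ; m = O₁.m ; isPEO = subst (PEO R) (≡-sym (Listₚ.++-assoc O₂.l O₁.l O₁.m))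
              (second O₂.l O₂.isPEO (λ i → O₂.sound (∈l i)))
          ; all = λ { (inj₁ s) → assoc (∈r O₂.l (O₁.all s)) ; (inj₂ s) → assoc (case ∈-++ O₂.l (O₂.all s) of λ where
              (inj₁ i) → ∈l i
              (inj₂ i) → ∈r O₂.l (O₁.all (proj₁ (O₂.m⊂ i)))) }
          ; sound = λ i → case ∈-++ O₂.l (∈≡ i (Listₚ.++-assoc O₂.l O₁.l O₁.m)) of λ where
              (inj₁ j) → inj₂ (O₂.sound (∈l j))
              (inj₂ j) → inj₁ (O₁.sound j)
          ; m⊂ = O₁.m⊂ ; ⊂m = O₁.⊂m }
        where
        module O₁ = Order o₁
        module O₂ = Order o₂
        assoc : ∀ {x} → x ∈ O₂.l ++ O₁.l ++ O₁.m → x ∈ (O₂.l ++ O₁.l) ++ O₁.m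
        assoc i = ∈≡ i (≡-sym (Listₚ.++-assoc O₂.l O₁.l O₁.m))
        first : ∀ {l} → PEO C₁.R l → (∀ {x} → x ∈ l → S₁ x) → PEO R l
        first [] f = []
        first (peo x∉ cl p) f = peo x∉
          (λ i j xa xb → in₁ (cl i j (to₁ (f (here refl)) (f (there i)) xa) (to₁ (f (here refl)) (f (there j)) xb)))
          (first p (f ∘ there))
        second : ∀ l → PEO C₂.R (l ++ O₂.m) → (∀ {x} → x ∈ l → S₂ x) → PEO R (l ++ O₁.l ++ O₁.m)
        second [] _ _ = first O₁.isPEO O₁.sound
        second (x ∷ l) (peo x∉ cl p) f = peo
            (λ i → case ∈-++ l i of λ { (inj₁ j) → x∉ (∈l j) ; (inj₂ j) → ¬S₁ (O₁.sound j) })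
            (λ i j xa xb → let ra , i' = nbr i xa ; rb , j' = nbr j xb in in₂ (cl i' j' ra rb))
            (second l p (f ∘ there))
          where
          ¬S₁ : ¬ S₁ x
          ¬S₁ s = x∉ (∈r l (O₂.⊂m (s , f (here refl))))
          nbr : ∀ {a} → a ∈ l ++ O₁.l ++ O₁.m → R x a → C₂.R x a × a ∈ l ++ O₂.m
          nbr i r with out r
          ... | inj₁ r₁ = ⊥-elim (¬S₁ (proj₁ (C₁.R-in r₁)))
          ... | inj₂ r₂ with ∈-++ l i
          ...   | inj₁ j = r₂ , ∈l j
          ...   | inj₂ j = r₂ , ∈r l (O₂.⊂m (O₁.sound j , proj₂ (C₂.R-in r₂)))

  -- Every clique of the union lies on one side, because a vertex missing from `S₁` and a vertex
  -- missing from `S₂` are never related. This settles both the choice of the side for `merge` and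
  -- the bound on stable sets.
  glue : ∀ {S₁ S₂ Req₁ Req₂} → (∀ {a b} → S₁ a → S₂ a → S₁ b → S₂ b → Req₁ a b) →
         (∀ {a b} → S₁ a → S₂ a → S₁ b → S₂ b → Req₂ a b) → Completion S₁ Req₁ → Completion S₂ Req₂ →
         Comp (λ x → S₁ x ⊎ S₂ x) (λ a b → (S₁ a × S₁ b × Req₁ a b) ⊎ (S₂ a × S₂ b × Req₂ a b))
  glue {S₁} {S₂} {Req₁} {Req₂} k₁ k₂ c₁ c₂ ret = do
      d₁ ← decAll S₁
      d₂ ← decAll S₂
      ret (record
        { R = R ; R-sym = λ { (inj₁ r) → inj₁ (C₁.R-sym r) ; (inj₂ r) → inj₂ (C₂.R-sym r) }
        ; R-in = λ { (inj₁ r) → inj₁ (proj₁ (C₁.R-in r)) , inj₁ (proj₂ (C₁.R-in r))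
                   ; (inj₂ r) → inj₂ (proj₁ (C₂.R-in r)) , inj₂ (proj₂ (C₂.R-in r)) }
        ; R-req = λ { _ _ (inj₁ (a , b , r)) → inj₁ (C₁.R-req a b r) ; _ _ (inj₂ (a , b , r)) → inj₂ (C₂.R-req a b r) }
        ; order = λ Q Q⊂ Qc ret' → do
            no n₁ ← em (∀ {x} → Q x → S₁ x)
              where yes q → Glue.merge k₁ k₂ c₁ c₂ inj₁ inj₂ id q Qc d₁ ret'
            no n₂ ← em (∀ {x} → Q x → S₂ x)
              where yes q → Glue.merge (λ a a' b b' → k₂ a' a b' b) (λ a a' b b' → k₁ a' a b' b) c₂ c₁ inj₂ inj₁ swap q Qc d₂
                              λ o → ret' (order-cong swap swap o)
            n₁ λ {a} qa → case d₁ a of λ where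
              (yes s) → s
              (no ¬a) → ⊥-elim (n₂ λ {b} qb → case d₂ b of λ where
                (yes s) → s
                (no ¬b) → ⊥-elim (apart ¬a ¬b (Qc qa qb)))
        ; no7 = λ f p → case Finₚ.all? (λ i → d₁ (f i)) of λ where
            (yes s) → C₁.no7 f λ i j ij → in₁ (s i) (s j) (proj₁ (p i j ij)) , proj₂ (p i j ij)
            (no n₁) → case Finₚ.all? (λ i → d₂ (f i)) of λ where
              (yes s) → C₂.no7 f λ i j ij → in₂ (s i) (s j) (proj₁ (p i j ij)) , proj₂ (p i j ij)
              (no n₂) → n₁ λ i → case d₁ (f i) of λ where
                (yes s) → s
                (no ¬a) → ⊥-elim (n₂ λ j → case d₂ (f j) of λ where
                  (yes s) → s
                  (no ¬b) → ⊥-elim (case i Finₚ.≟ j of λ where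
                    (no ij) → apart ¬a ¬b (proj₁ (p i j ij))
                    (yes refl) → lone f p ¬a ¬b)) })
    where
    module C₁ = Completion c₁
    module C₂ = Completion c₂
    R : V → V → Set
    R a b = C₁.R a b ⊎ C₂.R a b
    apart : ∀ {a b} → ¬ S₁ a → ¬ S₂ b → ¬ R a b
    apart na nb (inj₁ r) = na (proj₁ (C₁.R-in r))
    apart na nb (inj₂ r) = nb (proj₂ (C₂.R-in r))
    in₁ : ∀ {a b} → S₁ a → S₁ b → R a b → C₁.R a b
    in₁ a b (inj₁ r) = r
    in₁ a b (inj₂ r) = C₁.R-req a b (k₁ a (proj₁ (C₂.R-in r)) b (proj₂ (C₂.R-in r)))
    in₂ : ∀ {a b} → S₂ a → S₂ b → R a b → C₂.R a b
    in₂ a b (inj₂ r) = r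
    in₂ a b (inj₁ r) = C₂.R-req a b (k₂ (proj₁ (C₁.R-in r)) a (proj₂ (C₁.R-in r)) b)
    other : (i : Fin 7) → ∃ λ j → i ≢ j
    other fz = fs fz , λ ()
    other (fs i) = fz , λ ()
    lone : (f : Fin 7 → V) → (∀ i j → i ≢ j → R (f i) (f j) × f i # f j) → ∀ {i} → ¬ S₁ (f i) → ¬ S₂ (f i) → ⊥
    lone f p {i} na nb with other i
    ... | j , ij with proj₁ (p i j ij)
    ...   | inj₁ r = na (proj₁ (C₁.R-in r))
    ...   | inj₂ r = nb (proj₁ (C₂.R-in r))

  -- `S` becomes a single bag. Seven pairwise nonadjacent vertices would put two into one of the six
  -- cliques.
  leaf : ∀ {S} (Cl : Fin 6 → V → Set) → (∀ {x} → S x → ¬ ¬ ∃ λ c → Cl c x) →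
         (∀ {c x y} → S x → S y → Cl c x → Cl c y → x # y → ⊥) → Comp S (λ _ _ → ⊤)
  leaf {S} Cl cover clique ret = ret (record
      { R = λ a b → S a × S b ; R-sym = λ (a , b) → b , a ; R-in = id ; R-req = λ a b _ → a , b
      ; order = λ Q Q⊂ _ ret' → do
          S? ← decAll S
          Q? ← decAll Q
          let l , m , uniq , S⊂l , l⊂S , Q⊂m , m⊂Q = enumerate S? Q?
              sound : ∀ {x} → x ∈ l ++ m → S x
              sound = λ i → case ∈-++ l i of λ { (inj₁ j) → proj₁ (l⊂S j) ; (inj₂ j) → Q⊂ (m⊂Q j) }
          ret' (record { l = l ; m = m ; isPEO = any-order uniq sound ; all = λ {x} s → case Q? x of λ where
                           (yes q) → ∈r l (Q⊂m q)
                           (no nq) → ∈l (S⊂l s nq)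
                       ; sound = sound ; m⊂ = m⊂Q ; ⊂m = Q⊂m })
      ; no7 = λ f p → do
          col ← fin-choice (λ i → cover (proj₁ (proj₁ (proj₂ (mem f p i)))))
          let i , j , i<j , e = Finₚ.pigeonhole ℕₚ.≤-refl (λ i → proj₁ (col i))
              q = p i j (Finₚ.<⇒≢ i<j)
          clique (proj₁ (proj₁ q)) (proj₂ (proj₁ q)) (proj₂ (col i)) (subst (λ c → Cl c (f j)) (≡-sym e) (proj₂ (col j))) (proj₂ q) })
    where
    mem : (f : Fin 7 → V) → (∀ i j → i ≢ j → (S (f i) × S (f j)) × f i # f j) → ∀ i → ∃ λ j → (S (f i) × S (f j)) × f i # f j
    mem f p fz = fs fz , p fz (fs fz) λ ()
    mem f p (fs i) = fz , p (fs i) fz λ ()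
    any-order : ∀ {l} → Uniq.Unique l → (∀ {x} → x ∈ l → S x) → PEO (λ a b → S a × S b) l
    any-order AllPairs.[] f = []
    any-order (x∉ AllPairs.∷ u) f = peo (λ i → at x∉ i refl) (λ i j _ _ → f (there i) , f (there j)) (any-order u (f ∘ there))

  -- The two ends of a sector of a wheel are such a pair in the piece of that sector:
  -- a path joining them inside the piece closes a hole with the rest of the rim.
  Nice : (V → Set) → V → V → Set
  Nice S x z = Σ V λ v → Σ (List V) λ L → (S v × S x × S z × All S L) × Hol v (x ∷ L ++ z ∷ []) ×
    (∀ K → All S K → Ind (x ∷ K ++ z ∷ []) → par K ≡ true → ∃ λ m → K ≡ m ∷ [])

  Req : (V → Set) → V → V → Set
  Req S a b = (a ≡ b ⊎ a ~ b) ⊎ Nice S a b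

  nice-sym : ∀ {S x z} → Nice S x z → Nice S z x
  nice-sym {S} {x} {z} (v , L , (sv , sx , sz , sL) , h , odd) = v , reverse L , (sv , sz , sx , tab (λ i → at sL (∈-rev⁻ i))) ,
      subst (Hol v) (flip x z L) (hol-rev h) , λ K sK p e →
        let m , eq = odd (reverse K) (tab (λ i → at sK (∈-rev⁻ i))) (subst Ind (flip z x K) (ind-rev _ p)) (trans (lc-rev _ K) e)
        in m , trans (≡-sym (Listₚ.reverse-involutive K)) (cong reverse eq)
    where
    flip : ∀ x z L → reverse (x ∷ L ++ z ∷ []) ≡ z ∷ reverse L ++ x ∷ []
    flip x z L = trans (rev-snoc (x ∷ L)) (cong (z ∷_) (rev-cons x L))

-- `c` and `e` witness that each side, `D` with `K` and the complement of `D`, misses a vertex of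
-- `S`, as the induction needs. `K` may be empty, so disconnected sets are included.
record Cut {n : ℕ} (G : Graph n) (S : Fin n → Set) : Set₁ where
  open Paths G
  field
    D K : V → Set
    D⊂ : ∀ {x} → D x → S x
    K⊂ : ∀ {x} → K x → S x
    c e : V
    c∈D : D c
    e∈S : S e
    e∉D : ¬ D e
    e∉K : ¬ K e
    clique : ∀ {a b} → K a → K b → a # b → ⊥
    sep : ∀ {d x} → D d → S x → d ~ x → ¬ ¬ (D x ⊎ K x)

module Component {n : ℕ} (G : Graph n) where
  open Paths G

  data Reachable (W : V → Set) (p : V) : V → Set where
    start : W p → Reachable W p p
    next : ∀ {x z} → Reachable W p x → x ~ z → W z → Reachable W p z

  reachable⊂ : ∀ {W p x} → Reachable W p x → W x
  reachable⊂ (start w) = w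
  reachable⊂ (next _ _ w) = w

  to-start : ∀ {W p d z} → Reachable W p d → z ~ d → Path W z p
  to-start (start w) zd = edge zd
  to-start (next r e w) zd = step zd w (to-start r (~sym e))

  connect : ∀ {W p d d' a b} → Reachable W p d → Reachable W p d' → a ~ d → b ~ d' → Path W a b
  connect r r' e e' = path-++ (to-start r e) (first r) (path-sym (to-start r' e'))
    where
    first : ∀ {W p x} → Reachable W p x → W p
    first (start w) = w
    first (next r _ _) = first r

-- Decomposition along a proper wheel

module Wheel {n : ℕ} (G : Graph n) (cf : CapFree G) (ehf : EvenHoleFree G) (U : Paths.V G → Set)
             (v₀ : Paths.V G) (P₀ : List (Paths.V G)) (H₀ : Paths.Hol G v₀ P₀)
             (C⊂U : ∀ {h} → h ∈ v₀ ∷ P₀ → U h) (y : Paths.V G) (Uy : U y) (y∉C : ∀ {h} → h ∈ v₀ ∷ P₀ → y ≢ h)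
             (proper : ∀ {c d} → c ∈ v₀ ∷ P₀ → d ∈ v₀ ∷ P₀ → adj G y c ≡ true → adj G y d ≡ true → adj G c d ≡ false) where
  open Twins G cf ehf v₀ P₀ H₀ public

  -- Only the spokes of `y` have to be seen; a hub may have further neighbours on the rim.
  Hub : V → Set
  Hub q = Off q × (∀ {h} → h ∈ C → y ~ h → q ~ h)

  record Sector : Set where
    field
      u : V
      I : List V
      u' : V
      B : List V
      isHol : Hol u (I ++ u' ∷ B)
      to : ∀ {x} → x ∈ C → x ∈ u ∷ I ++ u' ∷ B
      from : ∀ {x} → x ∈ u ∷ I ++ u' ∷ B → x ∈ C
      yu : y ~ u
      yu' : y ~ u'
      yI : ∀ {i} → i ∈ I → y ≁ i
      w : V
      w∈B : w ∈ B
      yw : y ~ w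

  mirror-hol : ∀ {u I u' B} → Hol u (I ++ u' ∷ B) → Hol u' (reverse I ++ u ∷ reverse B)
  mirror-hol {u} {I} {u'} {B} h = hol-rot (reverse B) (subst (Hol u) (rev-mid I) (hol-rev h))

  mirror-∈ : ∀ {u u' x : V} I {B} → x ∈ u ∷ I ++ u' ∷ B → x ∈ u' ∷ reverse I ++ u ∷ reverse B
  mirror-∈ {u' = u'} I (here e) = ∈r (u' ∷ reverse I) (here e)
  mirror-∈ {u' = u'} I (there i) with ∈-++ I i
  ... | inj₁ j = there (∈l (∈-rev j))
  ... | inj₂ (here e) = here e
  ... | inj₂ (there j) = ∈r (u' ∷ reverse I) (there (∈-rev j))

  mirror : Sector → Sector
  mirror s = record
    { u = u' ; I = reverse I ; u' = u ; B = reverse B ; isHol = mirror-hol isHol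
    ; to = mirror-∈ I ∘ to
    ; from = λ {x} i → from (subst₂ (λ I B → x ∈ u ∷ I ++ u' ∷ B) (Listₚ.reverse-involutive I)
                (Listₚ.reverse-involutive B) (mirror-∈ (reverse I) i))
    ; yu = yu' ; yu' = yu ; yI = yI ∘ ∈-rev⁻ ; w = w ; w∈B = ∈-rev w∈B ; yw = yw }
    where
    open Sector s

  module Sec (s : Sector) where
    open Sector s public

    u∈ : u ∈ C
    u∈ = from (here refl)
    u'∈ : u' ∈ C
    u'∈ = from (∈m (u ∷ I))
    I∈ : ∀ {i} → i ∈ I → i ∈ C
    I∈ i = from (there (∈l i))
    B∈ : ∀ {b} → b ∈ B → b ∈ C
    B∈ i = from (∈r (u ∷ I) (there i))

    I#B : ∀ {i b} → i ∈ I → b ∈ B → i # b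
    I#B = ind-cross I (hol-ind isHol)

    u#u' : u # u'
    u#u' = at (hol-≢ isHol) (∈m I) , proper u∈ u'∈ yu yu'

    in-C : ∀ {x} → x ∈ C → (x ≡ u ⊎ x ≡ u') ⊎ (x ∈ I ⊎ x ∈ B)
    in-C i with to i
    ... | here e = inj₁ (inj₁ e)
    ... | there j with ∈-++ I j
    ...   | inj₁ k = inj₂ (inj₁ k)
    ...   | inj₂ (here e) = inj₁ (inj₂ e)
    ...   | inj₂ (there k) = inj₂ (inj₂ k)

    rim : Ind (u ∷ I ++ u' ∷ [])
    rim with split∈ w∈B
    ... | split A D = ind-take (u ∷ I ++ u' ∷ []) (subst Ind (cong (u ∷_) (≡-sym (snoc-assoc I)))
            (hol-pre (I ++ u' ∷ A) (subst (Hol u) (≡-sym (Listₚ.++-assoc I (u' ∷ A) (w ∷ D))) isHol)))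

    u~B : ∃ λ b → b ∈ B × u ~ b
    u~B with snoc? B | w∈B | isHol
    ... | A ∷ʳ b | _ | h = b , ∈m A , hol-last (I ++ u' ∷ A) (subst (Hol u) (≡-sym (Listₚ.++-assoc I (u' ∷ A) (b ∷ []))) h)

    u'~B : ∃ λ b → b ∈ B × u' ~ b
    u'~B with B | w∈B | isHol
    ... | b ∷ B' | _ | h = b , here refl , ind-link I (hol-ind h)

    u'~I : ∃ λ i → i ∈ I × u' ~ i
    u'~I with snoc? I | rim
    ... | [] | (p , _) , _ = ⊥-elim (~# p u#u')
    ... | A ∷ʳ i | r = i , ∈m A , ~sym (ind-link (u ∷ A) (subst Ind (cong (u ∷_) (snoc-assoc A)) r))

    -- As `#` includes inequality, this excludes `B` itself; `u` and `u'` are excluded since each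
    -- has a neighbour in `B`, and `y` since it sees `w`.
    X : V → Set
    X p = U p × (∀ {b} → b ∈ B → p # b)

    ¬Xu : ∀ {p} → X p → p ≢ u
    ¬Xu (_ , f) refl = let b , i , e = u~B in ~# e (f i)

    ¬Xu' : ∀ {p} → X p → p ≢ u'
    ¬Xu' (_ , f) refl = let b , i , e = u'~B in ~# e (f i)

    ¬XB : ∀ {p} → X p → p ∉ B
    ¬XB (_ , f) i = proj₁ (f i) refl

    ¬Xy : ∀ {p} → X p → p ≢ y
    ¬Xy (_ , f) refl = ~# yw (f w∈B)

    X-off : ∀ {p} → X p → p ∉ I → Off p
    X-off x j i e with in-C i
    ... | inj₁ (inj₁ f) = ¬Xu x (trans e f)
    ... | inj₁ (inj₂ f) = ¬Xu' x (trans e f)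
    ... | inj₂ (inj₁ k) = j (subst (_∈ I) (≡-sym e) k)
    ... | inj₂ (inj₂ k) = ¬XB x (subst (_∈ B) (≡-sym e) k)

    inner-hol : ∀ {k} → Twin u k → y ~ k → Hol y (k ∷ I ++ u' ∷ [])
    inner-hol {k} t yk with split∈ w∈B
    ... | split A D = hol (ind-take (k ∷ I ++ u' ∷ []) (subst Ind (cong (k ∷_) (≡-sym (snoc-assoc I)))
            (hol-pre (I ++ u' ∷ A) (subst (Hol k) (≡-sym (Listₚ.++-assoc I (u' ∷ A) (w ∷ D))) h))))
          yk yu' (tab λ i → y∉C (I∈ i) , yI i) (twin-# t u'∈ u#u')
      where
      h = twin-hol t (from ∘ there) isHol

    O : Hol y (u ∷ I ++ u' ∷ [])
    O = inner-hol (inj₁ refl) yu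

    ¬twin-y : ¬ Twin u y
    ¬twin-y t = ~≁ yw (trans (twin-adj t (B∈ w∈B) w≢u) (proper u∈ (B∈ w∈B) yu yw))
      where
      w≢u : w ≢ u
      w≢u e = at (hol-≢ isHol) (∈r I (there w∈B)) (≡-sym e)

    hub-adj : ∀ {k} → Twin u k → y ~ k
    hub-adj {k} t = trans (twin-see u∈ t y∉C (λ { refl → ¬twin-y t }) u'∈ (proj₁ (#sym u#u')) yu') yu

    -- On the hole k I u' B such a p has an odd number of neighbours, all outside B;
    -- then p has an even number on the hole y k I u'.
    no-twin-hub : ∀ {p k} → X p → p ~ y → Twin u k → p ~ k → ⊥
    no-twin-hub {p} {k} x py t pk = true≢false {b = lc (adj G p) (y ∷ k ∷ I ++ u' ∷ [])} e₂
        (trans (cong₂ _xor_ py (trans (≡-sym e₀) e₁)) refl)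
      where
      p∉I : p ∉ I
      p∉I i = ~≁ (~sym py) (yI i)
      off : Off p
      off = X-off x p∉I
      e₁ : lc (adj G p) (k ∷ I ++ u' ∷ B) ≡ true
      e₁ = odd-contacts (twin-hol t (from ∘ there) isHol)
             (λ { (here refl) → ~⇒≢ pk ; (there j) → off (from (there j)) }) (here refl) pk
      e₀ : lc (adj G p) (k ∷ I ++ u' ∷ B) ≡ lc (adj G p) (k ∷ I ++ u' ∷ [])
      e₀ = cong (adj G p k xor_) (trans (cong (lc (adj G p)) (≡-sym (snoc-assoc I)))
             (trans (lc-++ (adj G p) (I ++ u' ∷ []))
               (trans (cong (lc (adj G p) (I ++ u' ∷ []) xor_) (lc-none (tab λ i → proj₂ (proj₂ x i)))) (xor-comm _ false))))
      e₂ : lc (adj G p) (y ∷ k ∷ I ++ u' ∷ []) ≡ true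
      e₂ = odd-contacts (inner-hol t (hub-adj t))
             (λ { (here refl) → ~⇒≢ py ; (there (here refl)) → ~⇒≢ pk ; (there (there j)) → off' j }) (here refl) py
        where
        off' : ∀ {h} → h ∈ I ++ u' ∷ [] → p ≢ h
        off' j with ∈-++ I j
        ... | inj₁ i = off (I∈ i)
        ... | inj₂ (here refl) = off u'∈

    data Cell : V → Set where
      base : ∀ {i} → i ∈ I → Cell i
      ext : ∀ {p r} → Cell p → p ~ r → X r → Cell r

    Cell⊂X : ∀ {p} → Cell p → X p
    Cell⊂X (base i) = C⊂U (I∈ i) , I#B i
    Cell⊂X (ext _ _ x) = x

    data End : List V → Set where
      end : ∀ {p i} → i ∈ I → p ~ i → End (p ∷ [])
      _∷_ : ∀ {c d l} → (∀ {i} → i ∈ I → c # i) → End (d ∷ l) → End (c ∷ d ∷ l)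

    end-drop : ∀ A {x D} → End (A ++ x ∷ D) → End (x ∷ D)
    end-drop [] e = e
    end-drop (a ∷ []) (_ ∷ e) = e
    end-drop (a ∷ b ∷ A) (_ ∷ e) = end-drop (b ∷ A) e

    Reach : V → Set
    Reach c = Σ (List V) λ Q → Ind (c ∷ Q) × End (c ∷ Q) × (∀ {x} → x ∈ Q → X x × x ∉ I)

    -- The derivation of `Cell a` is a walk to `I`. It is shortened on the way: a new first vertex
    -- attaches directly to `I` if it can, and otherwise jumps to the last path vertex that it
    -- equals or sees.
    reach : ∀ {c a} → c ∉ I → Cell a → c ~ a → Reach c
    reach {c} c∉I (base i) ca = [] , (tt , tt) , end i ca , λ ()
    reach {c} {a} c∉I (ext Ap pa xa) ca with first? (~? c) I
    ... | some J j _ refl _ cj = [] , (tt , tt) , end (∈m J) cj , λ ()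
    ... | none nI with ∈? a I
    ...   | inj₁ i = ⊥-elim (~≁ ca (at nI i))
    ...   | inj₂ a∉I with reach a∉I Ap (~sym pa)
    ...     | Q , p , e , xs = cut (last? {P = λ x → c ≡ x ⊎ c ~ x} {Q = c #_} (cmp c) (a ∷ Q))
      where
      xs' : ∀ {x} → x ∈ a ∷ Q → X x × x ∉ I
      xs' (here refl) = xa , a∉I
      xs' (there i) = xs i
      c#I : ∀ {i} → i ∈ I → c # i
      c#I i = (λ { refl → c∉I i }) , at nI i
      cut : Last (λ x → c ≡ x ⊎ c ~ x) (c #_) (a ∷ Q) → Reach c
      cut (none (q ∷ _)) = ⊥-elim (~# ca q)
      cut (some A x D eq r ps) = go r (subst Ind eq p) (subst End eq e) (λ i → xs' (∈≡ i (≡-sym eq)))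
        where
        go : c ≡ x ⊎ c ~ x → Ind (A ++ x ∷ D) → End (A ++ x ∷ D) → (∀ {z} → z ∈ A ++ x ∷ D → X z × z ∉ I) → Reach c
        go (inj₁ refl) p e xs = D , ind-drop A p , end-drop A e , λ i → xs (∈r A (there i))
        go (inj₂ cx) p e xs = x ∷ D , ((cx , ps) , ind-drop A p) , c#I ∷ end-drop A e , λ i → xs (∈r A i)

  -- A vertex that sees the centre, one spoke, but not another one: some sector has
  -- one end seen and the other not, and there the vertex sees an edge of the rim.
  sees-edge : ∀ {q c L d} → Off q → q ≢ y → q ~ y → Ind (c ∷ L ++ d ∷ []) → (∀ {x} → x ∈ c ∷ L ++ d ∷ [] → x ∈ C) →
              y ~ c → q ~ c → y ~ d → q ≁ d → ∃ λ e → e ∈ C × q ~ e × ∃ λ f → f ∈ C × q ~ f × e ~ f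
  sees-edge {q} {c} {L} {d} off q≢y qy p sub yc qc yd qd = go [] L p sub yc qc (λ ())
    where
    go : ∀ {c} M L → Ind (c ∷ M ++ L ++ d ∷ []) → (∀ {x} → x ∈ c ∷ M ++ L ++ d ∷ [] → x ∈ C) → y ~ c → q ~ c →
         (∀ {i} → i ∈ M → y ≁ i) → ∃ λ e → e ∈ C × q ~ e × ∃ λ f → f ∈ C × q ~ f × e ~ f
    fin : ∀ {c d} M → Ind (c ∷ M ++ d ∷ []) → (∀ {x} → x ∈ c ∷ M ++ d ∷ [] → x ∈ C) → y ~ c → q ~ c →
         (∀ {i} → i ∈ M → y ≁ i) → y ~ d → q ≁ d → ∃ λ e → e ∈ C × q ~ e × ∃ λ f → f ∈ C × q ~ f × e ~ f
    go M (x ∷ L) p sub yc qc yM with ~? y x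
    ... | inj₂ yx = go (M ++ x ∷ []) L (subst Ind eq p) (λ i → sub (∈≡ i (≡-sym eq))) yc qc
          λ i → case ∈-++ M i of λ { (inj₁ j) → yM j ; (inj₂ (here refl)) → yx }
      where
      eq : _ ∷ M ++ x ∷ L ++ d ∷ [] ≡ _ ∷ (M ++ x ∷ []) ++ L ++ d ∷ []
      eq = cong (_ ∷_) (≡-sym (snoc-assoc M))
    ... | inj₁ yx with ~? q x
    ...   | inj₁ qx = go [] L (ind-drop (_ ∷ M) p) (λ i → sub (there (∈r M i))) yx qx λ ()
    ...   | inj₂ qx = fin M (ind-take (_ ∷ M ++ x ∷ []) (subst Ind eq p)) (λ i → sub (∈≡ (∈l i) (≡-sym eq))) yc qc yM yx qx
      where
      eq : _ ∷ M ++ x ∷ L ++ d ∷ [] ≡ (_ ∷ M ++ x ∷ []) ++ L ++ d ∷ []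
      eq = cong (_ ∷_) (≡-sym (snoc-assoc M))
    go M [] p sub yc qc yM = fin M p sub yc qc yM yd qd
    fin [] p sub yc qc yM yd qd = ⊥-elim (~≁ (ind-link [] p) (proper (sub (here refl)) (sub (there (here refl))) yc yd))
    -- Between consecutive spokes, `O'` is a hole through `y`. As `q` sees its edge from `y` to `c`
    -- but not `d`, it is a star on `O'`. The centre can only be `c`, so `q` also sees the next rim
    -- vertex `m`.
    fin {c} {d} M@(m ∷ M') p sub yc qc yM yd qd
      with star {e = d} O' (λ { (here refl) → q≢y ; (there j) → off (sub j) }) (here refl) (there (here refl)) yc qy qc
             (∈m (y ∷ c ∷ M)) qd
      where
      O' : Hol y (c ∷ M ++ d ∷ [])
      O' = hol p yc yd (tab λ i → y∉C (sub (there (∈l i))) , yM i) (ind-cross (c ∷ []) p (here refl) (∈m M'))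
    ... | t , here refl , qt , f , g = ⊥-elim (~≁ (g (∈m (y ∷ c ∷ M)) (~sym yd)) qd)
    ... | t , there i , qt , f , g with f (here refl) qy
    ...   | inj₁ refl = ⊥-elim (y∉C (sub i) refl)
    ...   | inj₂ yt with i
    ...     | here refl = c , sub (here refl) , qc , m , sub (there (here refl)) , g (there (there (here refl))) (~sym (ind-link [] p))
                 , ind-link [] p
    ...     | there j with ∈-++ M j
    ...       | inj₁ k = ⊥-elim (~≁ yt (yM k))
    ...       | inj₂ (here refl) = ⊥-elim (~≁ qt qd)

  hub-edge : ∀ {q c d} → Off q → q ≢ y → q ~ y → c ∈ C → y ~ c → q ~ c → d ∈ C → y ~ d → q ≁ d →
             ∃ λ e → e ∈ C × q ~ e × ∃ λ f → f ∈ C × q ~ f × e ~ f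
  hub-edge {q} {c} {d} off q≢y qy ic yc qc id' yd qd = go P' isHol (to id') from
    where
    open Rebase (rebase H₀ ic)
    go : ∀ P → Hol c P → d ∈ c ∷ P → (∀ {x} → x ∈ c ∷ P → x ∈ C) → ∃ λ e → e ∈ C × q ~ e × ∃ λ f → f ∈ C × q ~ f × e ~ f
    go P h (here refl) sub = ⊥-elim (~≁ qc qd)
    go P h (there i) sub with split∈ i
    ... | split A [] = ⊥-elim (~≁ (hol-last A h) (proper ic id' yc yd))
    ... | split A (e ∷ D) = sees-edge off q≢y qy (hol-pre (A ++ d ∷ []) (subst (Hol c) (≡-sym (snoc-assoc A)) h))
           (λ { (here refl) → ic ; (there j) → sub (there (∈≡ (∈l j) (snoc-assoc A))) }) yc qc yd qd

  -- First, `q` sees `y`, since otherwise `q`, `c`, `y`, `d` form a 4-hole. If `q` missed a spoke,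
  -- it would see an edge of the rim and be a star with some centre `m`. The nonadjacent `c` and `d`
  -- would both be next to `m`, which is then no spoke, and `c`, `m`, `d`, `y` would form a 4-hole.
  two-spokes : ∀ {q c d} → Off q → q ≢ y → c ∈ C → y ~ c → q ~ c → d ∈ C → y ~ d → q ~ d → c ≢ d → Hub q
  two-spokes {q} {c} {d} off q≢y ic yc qc id' yd qd c≢d = off , λ {h} ih yh → case ~? q h of λ where
      (inj₁ e) → e
      (inj₂ qh) → ⊥-elim (case hub-edge off q≢y qy ic yc qc ih yh qh of λ where
        (e , ie , qe , f , jf , qf , ef) → case star H₀ off ie jf ef qe qf ih qh of λ where
          (m , im , qm , sf , sg) → case sf ic qc , sf id' qd of λ where
            (inj₁ refl , inj₁ refl) → c≢d refl
            (inj₁ refl , inj₂ p) → ~≁ p (≁sym c≁d)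
            (inj₂ p , inj₁ refl) → ~≁ p c≁d
            (inj₂ p , inj₂ r) → no-C₄ p (~sym r) (~sym yd) yc (c≢d , c≁d)
              ((λ e → y∉C im (≡-sym e)) , ¬~ λ my → ~≁ p (proper ic im yc (~sym my))))
    where
    c≁d : c ≁ d
    c≁d = proper ic id' yc yd
    qy : q ~ y
    qy with ~? q y
    ... | inj₁ e = e
    ... | inj₂ e = ⊥-elim (no-C₄ qc (~sym yc) yd (~sym qd) (q≢y , e) (c≢d , c≁d))

  record Seg (p q : V) (l : List V) : Set where
    constructor seg
    field
      E : List V
      c : V
      D : List V
      d : V
      F : List V
      eq : l ≡ E ++ c ∷ D ++ d ∷ F
      pc : p ~ c
      q≁c : q ≁ c
      qd : q ~ d
      p≁d : p ≁ d
      pD : ∀ {x} → x ∈ D → p ≁ x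
      qD : ∀ {x} → x ∈ D → q ≁ x

  Both : V → V → List V → Set
  Both p q l = ∃ λ x → x ∈ l × p ~ x × q ~ x

  seg-from : ∀ {p q x} E c D l → p ~ c → q ≁ c → (∀ {x} → x ∈ D → p ≁ x) → (∀ {x} → x ∈ D → q ≁ x) → x ∈ l → q ~ x →
             Both p q (E ++ c ∷ D ++ l) ⊎ Seg p q (E ++ c ∷ D ++ l)
  seg-from {p} {q} E c D (a ∷ l) pc qc pD qD i qx with ~? p a | ~? q a
  ... | inj₁ pa | inj₁ qa = inj₁ (a , ∈r E (there (∈m D)) , pa , qa)
  ... | inj₂ pa | inj₁ qa = inj₂ (seg E c D a l refl pc qc qa pa pD qD)
  seg-from {p} {q} E c D (a ∷ l) pc qc pD qD (here refl) qx | _ | inj₂ qa = ⊥-elim (~≁ qx qa)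
  seg-from {p} {q} E c D (a ∷ l) pc qc pD qD (there i) qx | inj₁ pa | inj₂ qa =
    subst (λ z → Both p q z ⊎ Seg p q z) (Listₚ.++-assoc E (c ∷ D) (a ∷ l))
      (seg-from (E ++ c ∷ D) a [] l pa qa (λ ()) (λ ()) i qx)
  seg-from {p} {q} E c D (a ∷ l) pc qc pD qD (there i) qx | inj₂ pa | inj₂ qa =
    subst (λ z → Both p q (E ++ c ∷ z) ⊎ Seg p q (E ++ c ∷ z)) (snoc-assoc D)
      (seg-from E c (D ++ a ∷ []) l pc qc (snoc pD pa) (snoc qD qa) i qx)
    where
    snoc : ∀ {r} → (∀ {x} → x ∈ D → r ≁ x) → r ≁ a → ∀ {x} → x ∈ D ++ a ∷ [] → r ≁ x
    snoc f g j with ∈-++ D j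
    ... | inj₁ k = f k
    ... | inj₂ (here refl) = g

  -- For lack of a common neighbour there is a shortest stretch from a neighbour of one vertex to a
  -- neighbour of the other. It supplies the induced path that `arc` requires.
  segment : ∀ {p q x z} E l → x ∈ l → p ~ x → z ∈ l → q ~ z →
            Both p q (E ++ l) ⊎ (Seg p q (E ++ l) ⊎ Seg q p (E ++ l))
  segment {p} {q} E (a ∷ l) i px j qz with ~? p a | ~? q a
  ... | inj₁ pa | inj₁ qa = inj₁ (a , ∈m E , pa , qa)
  segment E (a ∷ l) i px (here refl) qz | inj₁ pa | inj₂ qa = ⊥-elim (~≁ qz qa)
  segment E (a ∷ l) i px (there j) qz | inj₁ pa | inj₂ qa with seg-from E a [] l pa qa (λ ()) (λ ()) j qz
  ... | inj₁ b = inj₁ b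
  ... | inj₂ s = inj₂ (inj₁ s)
  segment E (a ∷ l) (here refl) px j qz | inj₂ pa | inj₁ qa = ⊥-elim (~≁ px pa)
  segment E (a ∷ l) (there i) px j qz | inj₂ pa | inj₁ qa with seg-from E a [] l qa pa (λ ()) (λ ()) i px
  ... | inj₁ (x , k , b , c) = inj₁ (x , k , c , b)
  ... | inj₂ s = inj₂ (inj₂ s)
  segment E (a ∷ l) (here refl) px j qz | inj₂ pa | inj₂ qa = ⊥-elim (~≁ px pa)
  segment E (a ∷ l) (there i) px (here refl) qz | inj₂ pa | inj₂ qa = ⊥-elim (~≁ qz qa)
  segment {p} {q} E (a ∷ l) (there i) px (there j) qz | inj₂ pa | inj₂ qa =
    subst (λ z → Both p q z ⊎ (Seg p q z ⊎ Seg q p z)) (snoc-assoc E) (segment (E ++ a ∷ []) l i px j qz)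

  module Attach (s : Sector) where
    open Sec s

    -- Here `q` has a neighbour in `B`, so it is outside `X`. It is refuted that such a vertex is
    -- attached to `I` by a path on which nobody, `q` included, sees `u` or `u'`.
    module Avoiding {q b₀} (offq : Off q) (q≢y : q ≢ y) (b₀∈ : b₀ ∈ B) (qb₀ : q ~ b₀) (q≁u : q ≁ u) (q≁u' : q ≁ u') where

      B≁u : ∀ {b} → b ∈ B → y ~ b → b ≁ u
      B≁u i e = proper (B∈ i) u∈ e yu

      -- A common rim neighbour `z` of `q` and `y` must lie in `B`. On the hole from `q` through `y`
      -- and `u` to the first neighbour of `q` in `I`, it sees exactly `q` and `y`: a cap.
      one-hub : ∀ {i} → i ∈ I → q ~ i → q ~ y → ⊥
      one-hub {i} i∈ qi qy with common H₀ qy offq y∉C (I∈ i∈) qi u∈ yu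
      ... | z , z∈ , qz , yz with in-C z∈
      ...   | inj₁ (inj₁ refl) = ~≁ qz q≁u
      ...   | inj₁ (inj₂ refl) = ~≁ qz q≁u'
      ...   | inj₂ (inj₁ k) = ~≁ yz (yI k)
      ...   | inj₂ (inj₂ k) with first? (~? q) I
      ...     | none p = ~≁ qi (at p i∈)
      ...     | some I₁ a I₂ refl p qa = no-cap D zout (~sym qz) (~sym yz) z#
        where
        path : Ind (u ∷ I₁ ++ a ∷ [])
        path = ind-take (u ∷ I₁ ++ a ∷ []) (subst Ind (cong (u ∷_)
                 (trans (Listₚ.++-assoc I₁ (a ∷ I₂) (u' ∷ [])) (≡-sym (snoc-assoc I₁)))) rim)
        ia : ∀ {x} → x ∈ I₁ ++ a ∷ [] → x ∈ I₁ ++ a ∷ I₂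
        ia j = ∈≡ (∈l j) (snoc-assoc I₁)
        D : Hol q (y ∷ (u ∷ I₁) ++ a ∷ [])
        D = hol ((yu , tab λ j → y∉C (I∈ (ia j)) , yI (ia j)) , path) qy qa
              ((offq u∈ , q≁u) ∷ tab λ j → offq (I∈ (∈l j)) , at p j) (y∉C (I∈ (∈m I₁)) , yI (∈m I₁))
        zout : All (z ≢_) (q ∷ y ∷ u ∷ I₁ ++ a ∷ [])
        zout = ~⇒≢ (~sym qz) ∷ ~⇒≢ (~sym yz) ∷ (λ { refl → ~≁ qz q≁u }) ∷
               tab λ j e → proj₁ (I#B (ia j) k) (≡-sym e)
        z# : All (z ≁_) (u ∷ I₁ ++ a ∷ [])
        z# = B≁u k yz ∷ tab λ j → ≁sym (proj₂ (I#B (ia j) k))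

      in-O : ∀ {x} → x ∈ y ∷ u ∷ I ++ u' ∷ [] → (x ≡ y ⊎ x ∈ I) ⊎ (x ≡ u ⊎ x ≡ u')
      in-O (here e) = inj₁ (inj₁ e)
      in-O (there (here e)) = inj₂ (inj₁ e)
      in-O (there (there i)) with ∈-++ I i
      ... | inj₁ j = inj₁ (inj₂ j)
      ... | inj₂ (here e) = inj₂ (inj₂ e)

      offO : ∀ {z} → Off z → z ≢ y → ∀ {h} → h ∈ y ∷ u ∷ I ++ u' ∷ [] → z ≢ h
      offO o d i e with in-O i
      ... | inj₁ (inj₁ f) = d (trans e f)
      ... | inj₁ (inj₂ k) = o (I∈ k) e
      ... | inj₂ (inj₁ f) = o u∈ (trans e f)
      ... | inj₂ (inj₂ f) = o u'∈ (trans e f)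

      offOB : ∀ {z} → z ∈ B → ∀ {h} → h ∈ y ∷ u ∷ I ++ u' ∷ [] → z ≢ h
      offOB k i e with in-O i
      ... | inj₁ (inj₁ f) = y∉C (B∈ k) (≡-sym (trans e f))
      ... | inj₁ (inj₂ j) = proj₁ (I#B j k) (≡-sym e)
      ... | inj₂ (inj₁ f) = at (hol-≢ isHol) (∈r I (there k)) (≡-sym (trans e f))
      ... | inj₂ (inj₂ f) = ind-hd≢ (ind-drop I (hol-ind isHol)) k (≡-sym (trans e f))

      -- The adjacent `q` and `b` both have neighbours on `O`, hence a common one. But `q` misses
      -- `y`, `u` and `u'`, and `b` misses `I`.
      touch : ∀ {i b h} → i ∈ I → q ~ i → q ≁ y → b ∈ B → q ~ b → h ∈ y ∷ u ∷ I ++ u' ∷ [] → b ~ h → ⊥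
      touch i∈ qi q≁y b∈ qb h∈ bh with common O qb (offO offq q≢y) (offOB b∈) (there (there (∈l i∈))) qi h∈ bh
      ... | z , z∈ , qz , bz with in-O z∈
      ...   | inj₁ (inj₁ refl) = ~≁ qz q≁y
      ...   | inj₁ (inj₂ k) = ~# (~sym bz) (I#B k b∈)
      ...   | inj₂ (inj₁ refl) = ~≁ qz q≁u
      ...   | inj₂ (inj₂ refl) = ~≁ qz q≁u'

      -- If `b` misses `O`, then `two-ends` applies to `O` and the path from `q` through `b` to the
      -- spoke `v`. Since `q` sees `i` and `v` sees `y`, it would make `i` and `y` adjacent.
      arc : ∀ {i b v} M → i ∈ I → q ~ i → q ≁ y → Ind (b ∷ M ++ v ∷ []) → q ~ b → q ≁ v → y ~ v → b ∈ B → v ∈ B →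
            (∀ {m} → m ∈ M → m ∈ B × q ≁ m × y ≁ m × m ≁ u × m ≁ u') → ⊥
      arc {i} {b} {v} M i∈ qi q≁y p qb q≁v yv b∈ v∈ fM
        with first? {P = b ~_} {Q = b ≁_} (~? b) (y ∷ u ∷ I ++ u' ∷ [])
      ... | some E z F eq _ bz = touch i∈ qi q≁y b∈ qb (∈≡ (∈m E) (≡-sym eq)) bz
      ... | none b≁ with two-ends {M = b ∷ M} ((qb , tab q#) , p) O (offO offq q≢y) (offOB v∈) mid dis
                        (there (there (∈l i∈))) qi (here refl) (~sym yv)
        where
        q# : ∀ {x} → x ∈ M ++ v ∷ [] → q # x
        q# j with ∈-++ M j
        ... | inj₁ k = offq (B∈ (proj₁ (fM k))) , proj₁ (proj₂ (fM k))
        ... | inj₂ (here refl) = offq (B∈ v∈) , q≁v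
        M# : ∀ {h m} → h ∈ y ∷ u ∷ I ++ u' ∷ [] → m ∈ M → m # h
        M# {h} {m} i k = offOB (proj₁ (fM k)) i , go (in-O i)
          where
          go : (h ≡ y ⊎ h ∈ I) ⊎ (h ≡ u ⊎ h ≡ u') → m ≁ h
          go (inj₁ (inj₁ refl)) = ≁sym (proj₁ (proj₂ (proj₂ (fM k))))
          go (inj₁ (inj₂ j)) = ≁sym (proj₂ (I#B j (proj₁ (fM k))))
          go (inj₂ (inj₁ refl)) = proj₁ (proj₂ (proj₂ (proj₂ (fM k))))
          go (inj₂ (inj₂ refl)) = proj₂ (proj₂ (proj₂ (proj₂ (fM k))))
        mid : ∀ {h} → h ∈ y ∷ u ∷ I ++ u' ∷ [] → All (_# h) (b ∷ M)
        mid i = (offOB b∈ i , at b≁ i) ∷ tab (M# i)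
        dis : ∀ {h} → h ∈ y ∷ u ∷ I ++ u' ∷ [] → q ~ h → v ~ h → ⊥
        dis i qh vh with in-O i
        ... | inj₁ (inj₁ refl) = ~≁ qh q≁y
        ... | inj₁ (inj₂ k) = ~# (~sym vh) (I#B k v∈)
        ... | inj₂ (inj₁ refl) = ~≁ qh q≁u
        ... | inj₂ (inj₂ refl) = ~≁ qh q≁u'
      ...   | iy , _ = ~≁ (~sym iy) (yI i∈)

      iB : Ind B
      iB = ind-drop (u' ∷ []) (ind-drop I (hol-ind isHol))

      mid≁ : ∀ E c D d F → B ≡ E ++ c ∷ D ++ d ∷ F → ∀ {m} → m ∈ D → m ≁ u × m ≁ u'
      mid≁ E c D d F eq {m} k = proj₂ (ind-cross (E ++ c ∷ D) (subst Ind eq₂ (hol-ind (hol-rot I isHol))) (∈r E (there k))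
                                        (∈r F (here refl)))
        , ≁sym (proj₂ (ind-cross (u' ∷ E) (ind-drop I (subst (λ z → Ind (I ++ u' ∷ z)) eq (hol-ind isHol))) (here refl) (∈l k)))
        where
        eq₂ : B ++ u ∷ I ≡ (E ++ c ∷ D) ++ d ∷ F ++ u ∷ I
        eq₂ = trans (cong (_++ u ∷ I) (trans eq (≡-sym (Listₚ.++-assoc E (c ∷ D) (d ∷ F)))))
                (Listₚ.++-assoc (E ++ c ∷ D) (d ∷ F) (u ∷ I))

      one-nonhub : ∀ {i} → i ∈ I → q ~ i → q ≁ y → ⊥
      one-nonhub {i} i∈ qi q≁y with segment {p = q} {y} [] B b₀∈ qb₀ w∈B yw
      ... | inj₁ (x , x∈ , qx , yx) = touch i∈ qi q≁y x∈ qx (here refl) (~sym yx)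
      ... | inj₂ (inj₁ (seg E c D d F refl qc y≁c yd q≁d qD yD)) =
        arc D i∈ qi q≁y (ind-take (c ∷ D ++ d ∷ []) (subst Ind (cong (c ∷_) (≡-sym (snoc-assoc D))) (ind-drop E iB)))
          qc q≁d yd (∈m E) (∈r E (there (∈m D)))
          λ k → ∈r E (there (∈l k)) , qD k , yD k , mid≁ E c D d F refl k
      ... | inj₂ (inj₂ (seg E c D d F refl yc q≁c qd y≁d yD qD)) =
        arc (reverse D) i∈ qi q≁y (subst Ind eq₁ (ind-rev _ (ind-take (c ∷ D ++ d ∷ [])
             (subst Ind (cong (c ∷_) (≡-sym (snoc-assoc D))) (ind-drop E iB)))))
          qd q≁c yc (∈r E (there (∈m D))) (∈m E)
          λ k → let k' = ∈-rev⁻ k in ∈r E (there (∈l k')) , qD k' , yD k' , mid≁ E c D d F refl k'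
        where
        eq₁ : reverse (c ∷ D ++ d ∷ []) ≡ d ∷ reverse D ++ c ∷ []
        eq₁ = trans (rev-snoc (c ∷ D)) (cong (d ∷_) (rev-cons c D))

      -- By `two-ends` on the rim, `b₀` and `i` would be adjacent, although one lies in `B` and the
      -- other in `I`.
      long : ∀ {p i} M → Ind (q ∷ M ++ p ∷ []) → (∀ {x} → x ∈ M ++ p ∷ [] → X x × x ≁ u × x ≁ u') → (∀ {x} → x ∈ M → ∀ {i} → i ∈ I → x # i) →
             (∀ {i} → i ∈ I → q # i) → p ∉ I → i ∈ I → p ~ i → ⊥
      long {p} {i} M pa xs M# q# p∉I i∈ pi with two-ends {M = M} pa H₀ offq (X-off xp p∉I) mid dis (B∈ b₀∈) qb₀ (I∈ i∈) pi
        where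
        xp : X p
        xp = proj₁ (xs (∈m M))
        mid : ∀ {h} → h ∈ C → All (_# h) M
        mid {h} hc = tab λ {m} j → let x , mu , mu' = xs (∈l j) in
          case in-C hc of λ where
            (inj₁ (inj₁ refl)) → ¬Xu x , mu
            (inj₁ (inj₂ refl)) → ¬Xu' x , mu'
            (inj₂ (inj₁ k)) → M# j k
            (inj₂ (inj₂ k)) → proj₂ x k
        dis : ∀ {h} → h ∈ C → q ~ h → p ~ h → ⊥
        dis hc qh ph with in-C hc
        ... | inj₁ (inj₁ refl) = ~≁ qh q≁u
        ... | inj₁ (inj₂ refl) = ~≁ qh q≁u'
        ... | inj₂ (inj₁ k) = ~# qh (q# k)
        ... | inj₂ (inj₂ k) = ~# ph (proj₂ xp k)
      ... | bi , _ = ~# (~sym bi) (I#B i∈ b₀∈)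

      avoiding : ∀ Q → Ind (q ∷ Q) → End (q ∷ Q) → (∀ {x} → x ∈ Q → X x × x ≁ u × x ≁ u') → (∀ {x} → x ∈ Q → x ∉ I) → ⊥
      avoiding [] p (end i∈ qi) xs nI with ~? q y
      ... | inj₁ e = one-hub i∈ qi e
      ... | inj₂ e = one-nonhub i∈ qi e
      avoiding (c ∷ Q) p (q# ∷ e) xs nI with last-end Q e
        where
        last-end : ∀ {c} Q → End (c ∷ Q) → Σ (List V) λ N → ∃ λ r → c ∷ Q ≡ N ++ r ∷ [] ×
                   (∀ {x} → x ∈ N → ∀ {i} → i ∈ I → x # i) × ∃ λ i → i ∈ I × r ~ i
        last-end [] (end i∈ ri) = [] , _ , refl , (λ ()) , _ , i∈ , ri
        last-end {c} (d ∷ Q) (f ∷ e) with last-end Q e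
        ... | N , r , eq , g , z = c ∷ N , r , cong (c ∷_) eq , (λ { (here refl) → f ; (there j) → g j }) , z
      ... | N , r , eq , g , i , i∈ , ri = long N (subst (λ z → Ind (q ∷ z)) eq p) (λ j → xs (∈≡ j (≡-sym eq))) g q#
              (nI (∈≡ (∈m N) (≡-sym eq))) i∈ ri

  module Crossing (s : Sector) where
    open Sec s

    end-# : ∀ tl {p rest a i} → End (tl ++ p ∷ rest) → a ∈ tl → i ∈ I → a # i
    end-# (a ∷ []) (f ∷ e) (here refl) j = f j
    end-# (a ∷ b ∷ tl) (f ∷ e) (here refl) j = f j
    end-# (a ∷ b ∷ tl) (f ∷ e) (there i) j = end-# (b ∷ tl) e i j

    rev-hol : Hol u (reverse B ++ u' ∷ reverse I)
    rev-hol = subst (Hol u) (rev-mid I) (hol-rev isHol)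

    to-u : ∀ {Y : V → Set} {i} → (∀ {x} → x ∈ I → Y x) → i ∈ I → Path Y i u
    to-u {Y} {i} f j with split∈ j
    ... | split D E = path-sym (ind-path D (ind-take (u ∷ D ++ i ∷ []) (subst Ind (cong (u ∷_)
          (trans (Listₚ.++-assoc D (i ∷ E) (u' ∷ [])) (≡-sym (snoc-assoc D)))) rim)) (tab (f ∘ ∈l)))

    walk : ∀ {Y : V → Set} c l → Ind (c ∷ l) → End (c ∷ l) → (∀ {x} → x ∈ l → Y x) → (∀ {x} → x ∈ I → Y x) → Path Y c u
    walk c [] p (end j cj) f g = step cj (g j) (to-u g j)
    walk c (d ∷ l) ((cd , _) , p) (_ ∷ e) f g = step cd (f (here refl)) (walk d l p e (f ∘ there) g)

    -- A new hole leads from `u` backwards along `B` to a neighbour of `q`, through `q` to `p`, and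
    -- inside the sector back to `u`. The adjacent `y` and `u'` both see it, at `u` and at `p`, so
    -- they have a common neighbour on it. Every candidate is excluded: on the rim because spokes
    -- are nonadjacent and `y` misses `I`, at `q` by hypothesis, in `X` by `no-twin-hub`.
    crossing : ∀ {q b₀ Q} tl {p rest} → Off q → q ≢ y → b₀ ∈ B → q ~ b₀ → (q ~ y → q ~ u' → ⊥) → (q ~ u → q ~ u' → ⊥) →
               q ∷ Q ≡ tl ++ p ∷ rest → Ind (q ∷ Q) → End (q ∷ Q) → (∀ {x} → x ∈ Q → X x × x ∉ I) →
               (∀ {x} → x ∈ tl → x ≁ u × x ≁ u') → p ~ u' → ⊥
    crossing {q} {b₀} {Q} tl {p} {rest} offq q≢y b₀∈ qb₀ q¬yu' q¬uu' eq ind en xs tl≁ pu'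
      with induce (walk {Y = λ x → x ∈ rest ⊎ x ∈ I} p rest (ind-drop tl (subst Ind eq ind)) (end-drop tl (subst End eq en)) inj₁ inj₂)
         | first? (~? q) (reverse B)
    ... | inj₁ refl | _ = ~# pu' u#u'
    ... | inj₂ _ | none n = ~≁ qb₀ (at n (∈-rev b₀∈))
    ... | inj₂ (L , YL , indL) | some N b N' eqB nN qb = final
      where
      ind' : Ind (tl ++ p ∷ rest)
      ind' = subst Ind eq ind
      en' : End (tl ++ p ∷ rest)
      en' = subst End eq en
      K : List V
      K = tl ++ p ∷ L
      kind : ∀ {x} → x ∈ q ∷ Q → x ≡ q ⊎ (X x × x ∉ I)
      kind (here e) = inj₁ e
      kind (there i) = inj₂ (xs i)
      tl≢u : ∀ {x} → x ∈ tl → x ≢ u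
      tl≢u i e with kind (∈≡ (∈l i) (≡-sym eq))
      ... | inj₁ f = offq u∈ (trans (≡-sym f) e)
      ... | inj₂ (x , _) = ¬Xu x e
      indK' : Ind (tl ++ p ∷ L ++ u ∷ [])
      indK' = ind-join tl (ind-take (tl ++ p ∷ []) (subst Ind (≡-sym (snoc-assoc tl)) ind')) indL cross
        where
        cross : ∀ {a c} → a ∈ tl → c ∈ L ++ u ∷ [] → a # c
        cross i j with ∈-++ L j
        ... | inj₂ (here refl) = tl≢u i , proj₁ (tl≁ i)
        ... | inj₁ k with at YL k
        ...   | inj₁ r = ind-cross tl ind' i r
        ...   | inj₂ r = end-# tl en' i r
      indK : Ind (K ++ u ∷ [])
      indK = subst Ind (≡-sym (Listₚ.++-assoc tl (p ∷ L) (u ∷ []))) indK'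
      T-ind : ∃ λ T → K ≡ q ∷ T × (∀ {x} → x ∈ T → (X x × x ∉ I) ⊎ x ∈ I) × q ≁ u
      T-ind = go tl eq tl≁
        where
        go : ∀ tl → q ∷ Q ≡ tl ++ p ∷ rest → (∀ {x} → x ∈ tl → x ≁ u × x ≁ u') →
             ∃ λ T → tl ++ p ∷ L ≡ q ∷ T × (∀ {x} → x ∈ T → (X x × x ∉ I) ⊎ x ∈ I) × q ≁ u
        go [] refl _ = L , refl , (λ i → case at YL i of λ { (inj₁ j) → inj₁ (xs j) ; (inj₂ j) → inj₂ j })
                         , ¬~ λ qu → q¬uu' qu pu'
        go (a ∷ tl) refl f = tl ++ p ∷ L , refl , (λ i → case ∈-++ tl i of λ where
          (inj₁ j) → inj₁ (xs (∈l j))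
          (inj₂ (here refl)) → inj₁ (xs (∈m tl))
          (inj₂ (there j)) → case at YL j of λ { (inj₁ k) → inj₁ (xs (∈r tl (there k))) ; (inj₂ k) → inj₂ k })
          , proj₁ (f (here refl))
      final : ⊥
      final with T-ind
      ... | T , eqK , Tk , q≁u = bad
        where
        inB : ∀ {x} → x ∈ N ++ b ∷ [] → x ∈ B
        inB i = ∈-rev⁻ (∈≡ (∈≡ (∈l i) (snoc-assoc N)) (≡-sym eqB))
        T#B : ∀ {x a} → x ∈ T → a ∈ B → x # a
        T#B i j with Tk i
        ... | inj₁ ((_ , f) , _) = f j
        ... | inj₂ k = I#B k j
        indR : Ind (u ∷ N ++ b ∷ [])
        indR = ind-take (u ∷ N ++ b ∷ []) (subst Ind (cong (u ∷_) (trans eqB (≡-sym (snoc-assoc N)))) (hol-pre (reverse B) rev-hol))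
        indqT : Ind (q ∷ T ++ u ∷ [])
        indqT = subst (λ z → Ind (z ++ u ∷ [])) eqK indK
        whole : Ind ((N ++ b ∷ []) ++ q ∷ T)
        whole = subst Ind (≡-sym (snoc-assoc N)) (ind-join N (proj₂ indR)
          ((~sym qb , tab λ i → #sym (T#B i (inB (∈m N)))) , ind-take (q ∷ T) indqT)
          λ { i (here refl) → #sym (offq (B∈ (inB (∈l i))) , at nN i) ; i (there j) → #sym (T#B j (inB (∈l i))) })
        H'' : Hol u ((N ++ b ∷ []) ++ q ∷ T)
        H'' = hol-cyc indR indqT whole (∈m N) (here refl) λ where
          i (here refl) _ uq → ⊥-elim (~≁ (~sym uq) q≁u)
          i (there j) _ _ → #sym (T#B j (inB i))
        sort : ∀ {x} → x ∈ u ∷ (N ++ b ∷ []) ++ q ∷ T → (x ≡ u ⊎ x ∈ B) ⊎ (x ≡ q ⊎ ((X x × x ∉ I) ⊎ x ∈ I))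
        sort (here e) = inj₁ (inj₁ e)
        sort (there i) with ∈-++ (N ++ b ∷ []) i
        ... | inj₁ j = inj₁ (inj₂ (inB j))
        ... | inj₂ (here e) = inj₂ (inj₁ e)
        ... | inj₂ (there j) = inj₂ (inj₂ (Tk j))
        offy : ∀ {h} → h ∈ u ∷ (N ++ b ∷ []) ++ q ∷ T → y ≢ h
        offy i e with sort i
        ... | inj₁ (inj₁ f) = y∉C u∈ (trans e f)
        ... | inj₁ (inj₂ j) = y∉C (B∈ j) e
        ... | inj₂ (inj₁ f) = q≢y (≡-sym (trans e f))
        ... | inj₂ (inj₂ (inj₁ (x , _))) = ¬Xy x (≡-sym e)
        ... | inj₂ (inj₂ (inj₂ j)) = y∉C (I∈ j) e
        offu' : ∀ {h} → h ∈ u ∷ (N ++ b ∷ []) ++ q ∷ T → u' ≢ h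
        offu' i e with sort i
        ... | inj₁ (inj₁ f) = proj₁ u#u' (≡-sym (trans e f))
        ... | inj₁ (inj₂ j) = ind-hd≢ (ind-drop I (hol-ind isHol)) j e
        ... | inj₂ (inj₁ f) = offq u'∈ (≡-sym (trans e f))
        ... | inj₂ (inj₂ (inj₁ (x , _))) = ¬Xu' x (≡-sym e)
        ... | inj₂ (inj₂ (inj₂ j)) = ~≁ yu' (subst (y ≁_) (≡-sym e) (yI j))
        bad : ⊥
        bad with common H'' yu' offy offu' (here refl) yu (there (∈r (N ++ b ∷ []) (∈≡ (∈m tl) eqK))) (~sym pu')
        ... | z , z∈ , yz , u'z with sort z∈
        ...   | inj₁ (inj₁ refl) = ~≁ u'z (≁sym (proj₂ u#u'))
        ...   | inj₁ (inj₂ j) = ~≁ u'z (proper u'∈ (B∈ j) yu' yz)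
        ...   | inj₂ (inj₁ refl) = q¬yu' (~sym yz) (~sym u'z)
        ...   | inj₂ (inj₂ (inj₂ j)) = ~≁ yz (yI j)
        ...   | inj₂ (inj₂ (inj₁ ((Uz , z#) , _))) =
          Sec.no-twin-hub (mirror s) (Uz , λ i → z# (∈-rev⁻ i)) (~sym yz) (inj₁ refl) (~sym u'z)

    -- If `q` misses `u`, it is a star on `O` with centre `u'` and so sees the neighbour of `u'` in
    -- `I`. Then it is a star on the rim too, and having neighbours in both `I` and `B` forces the
    -- centre `u'`.
    touching : ∀ {q b₀} → Off q → q ≢ y → b₀ ∈ B → q ~ b₀ → q ~ y → q ~ u' → Hub q ⊎ Twin u' q
    touching {q} {b₀} offq q≢y b₀∈ qb₀ qy qu' with ~? q u
    ... | inj₁ qu = inj₁ (two-spokes offq q≢y u∈ yu qu u'∈ yu' qu' (proj₁ u#u'))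
    ... | inj₂ qu with star O (λ { (here refl) → q≢y ; (there i) → offR i }) (here refl) (∈m (y ∷ u ∷ I)) yu' qy qu' (there (here refl)) qu
      where
      offR : ∀ {h} → h ∈ u ∷ I ++ u' ∷ [] → q ≢ h
      offR (here refl) = offq u∈
      offR (there i) with ∈-++ I i
      ... | inj₁ j = offq (I∈ j)
      ... | inj₂ (here refl) = offq u'∈
    ...   | m , m∈ , qm , f , g with u'~I
    ...     | i , i∈ , u'i = inj₂ (case star H₀ offq u'∈ (I∈ i∈) u'i qu' qi u∈ qu of λ where
                (t , st@(t∈ , qt , f' , _)) → subst (λ z → Twin z q) (centre t∈ qt f') (star-twin offq st))
      where
      m≡u' : m ≡ u'
      m≡u' with f (here refl) qy
      ... | inj₁ refl = ⊥-elim (~≁ (g (there (here refl)) (~sym yu)) qu)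
      ... | inj₂ ym = place m∈ qm ym
        where
        place : ∀ {m} → m ∈ y ∷ u ∷ I ++ u' ∷ [] → q ~ m → y ~ m → m ≡ u'
        place (here refl) qm ym = ⊥-elim (~⇒≢ ym refl)
        place (there (here refl)) qm ym = ⊥-elim (~≁ qm qu)
        place (there (there j)) qm ym with ∈-++ I j
        ... | inj₁ k = ⊥-elim (~≁ ym (yI k))
        ... | inj₂ (here e) = e
      qi : q ~ i
      qi = g (there (there (∈l i∈))) (subst (i ~_) (≡-sym m≡u') (~sym u'i))
      centre : ∀ {t} → t ∈ C → q ~ t → (∀ {h} → h ∈ C → q ~ h → h ≡ t ⊎ h ~ t) → t ≡ u'
      centre t∈ qt f with in-C t∈
      ... | inj₁ (inj₁ refl) = ⊥-elim (~≁ qt qu)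
      ... | inj₁ (inj₂ e) = e
      ... | inj₂ (inj₁ k) with f (B∈ b₀∈) qb₀
      ...   | inj₁ refl = ⊥-elim (proj₁ (I#B k b₀∈) refl)
      ...   | inj₂ e = ⊥-elim (~# (~sym e) (I#B k b₀∈))
      centre t∈ qt f | inj₂ (inj₂ k) with f (I∈ i∈) qi
      ...   | inj₁ refl = ⊥-elim (proj₁ (I#B i∈ k) refl)
      ...   | inj₂ e = ⊥-elim (~# e (I#B i∈ k))

  module Boundary (s : Sector) where
    open Sec s

    mirror-End : ∀ {l} → End l → Sec.End (mirror s) l
    mirror-End (end i e) = Sec.end (∈-rev i) e
    mirror-End (f ∷ e) = (λ i → f (∈-rev⁻ i)) Sec.∷ mirror-End e

    -- If `q` is none of the named vertices and not in `X`, it has a neighbour in `B`. The path from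
    -- `q` to `I` is examined up to its first vertex that sees `u` or `u'`. If there is none,
    -- `avoiding` applies; otherwise `crossing`, in the mirrored sector when that vertex sees `u`.
    boundary : ∀ {a q} → U q → Cell a → q ~ a → ¬ ¬ (Cell q ⊎ ((q ≡ y ⊎ Hub q) ⊎ (Twin u q ⊎ Twin u' q)))
    boundary {a} {q} Uq Aa qa k = do
      no ¬X ← em (X q)
        where yes x → k (inj₁ (ext Aa (~sym qa) x))
      no q≢y ← em (q ≡ y)
        where yes e → k (inj₂ (inj₁ (inj₁ e)))
      no q≢u ← em (q ≡ u)
        where yes e → k (inj₂ (inj₂ (inj₁ (inj₁ e))))
      no q≢u' ← em (q ≡ u')
        where yes e → k (inj₂ (inj₂ (inj₂ (inj₁ e))))
      main q≢y q≢u q≢u' (first? (cmp q) B) ¬X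
      where
      q∉B : q ∉ B
      q∉B i = ~# (~sym qa) (proj₂ (Cell⊂X Aa) i)
      main : q ≢ y → q ≢ u → q ≢ u' → First (λ b → q ≡ b ⊎ q ~ b) (q #_) B → ¬ X q → ⊥
      main q≢y q≢u q≢u' (none p) ¬X = ¬X (Uq , at p)
      main q≢y q≢u q≢u' (some D b₀ E eq _ (inj₁ refl)) ¬X = q∉B (∈≡ (∈m D) (≡-sym eq))
      main q≢y q≢u q≢u' (some D b₀ E eq _ (inj₂ qb₀)) ¬X = go (reach q∉I Aa qa)
        where
        b₀∈ : b₀ ∈ B
        b₀∈ = ∈≡ (∈m D) (≡-sym eq)
        q∉I : q ∉ I
        q∉I i = ~# qb₀ (I#B i b₀∈)
        offq : Off q
        offq i e with in-C i
        ... | inj₁ (inj₁ f) = q≢u (trans e f)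
        ... | inj₁ (inj₂ f) = q≢u' (trans e f)
        ... | inj₂ (inj₁ j) = q∉I (subst (_∈ I) (≡-sym e) j)
        ... | inj₂ (inj₂ j) = q∉B (subst (_∈ B) (≡-sym e) j)
        hub₂ : q ~ u → q ~ u' → ⊥
        hub₂ qu qu' = k (inj₂ (inj₁ (inj₂ (two-spokes offq q≢y u∈ yu qu u'∈ yu' qu' (proj₁ u#u')))))
        hub₁ : q ~ y → q ~ u' → ⊥
        hub₁ qy qu' with Crossing.touching s offq q≢y b₀∈ qb₀ qy qu'
        ... | inj₁ h = k (inj₂ (inj₁ (inj₂ h)))
        ... | inj₂ t = k (inj₂ (inj₂ (inj₂ t)))
        hub₀ : q ~ y → q ~ u → ⊥
        hub₀ qy qu with Crossing.touching (mirror s) offq q≢y (∈-rev b₀∈) qb₀ qy qu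
        ... | inj₁ h = k (inj₂ (inj₁ (inj₂ h)))
        ... | inj₂ t = k (inj₂ (inj₂ (inj₁ t)))
        ends? : ∀ x → (x ~ u ⊎ x ~ u') ⊎ (x ≁ u × x ≁ u')
        ends? x with ~? x u | ~? x u'
        ... | inj₁ e | _ = inj₁ (inj₁ e)
        ... | inj₂ e | inj₁ f = inj₁ (inj₂ f)
        ... | inj₂ e | inj₂ f = inj₂ (e , f)
        go : Reach q → ⊥
        go (Q , ind , en , xs) with first? ends? (q ∷ Q)
        ... | none (q≁ ∷ Q≁) = Attach.Avoiding.avoiding s offq q≢y b₀∈ qb₀ (proj₁ q≁) (proj₂ q≁) Q ind en
                (λ i → proj₁ (xs i) , at Q≁ i) λ i → proj₂ (xs i)
        ... | some tl p rest eq tl≁ (inj₂ pu') = Crossing.crossing s tl offq q≢y b₀∈ qb₀ hub₁ hub₂ eq ind en xs (at tl≁) pu'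
        ... | some tl p rest eq tl≁ (inj₁ pu) = Crossing.crossing (mirror s) tl offq q≢y (∈-rev b₀∈) qb₀ hub₀ (λ a b → hub₂ b a) eq ind
                (mirror-End en) (λ i → let (Ux , f) , n = xs i in (Ux , λ j → f (∈-rev⁻ j)) , λ j → n (∈-rev⁻ j))
                (λ i → let a , b = at tl≁ i in b , a) pu

  open Completions G

  Hub⁺ : V → Set
  Hub⁺ z = U z × (z ≡ y ⊎ Hub z)

  Spoke : V → Set
  Spoke w = w ∈ C × y ~ w

  K : V → V → Set
  K w p = U p × Twin w p

  Piece : Sector → V → Set
  Piece s p = Sec.Cell s p ⊎ (Hub⁺ p ⊎ (K (Sector.u s) p ⊎ K (Sector.u' s) p))

  sort : ∀ {L : List V} {P Q : V → Set} → (∀ {x} → x ∈ L → P x ⊎ Q x) → (∃ λ x → x ∈ L × P x) ⊎ (∀ {x} → x ∈ L → Q x)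
  sort {[]} f = inj₂ λ ()
  sort {x ∷ L} f with f (here refl) | sort {L} (f ∘ there)
  ... | inj₁ p | _ = inj₁ (x , here refl , p)
  ... | inj₂ _ | inj₁ (z , i , p) = inj₁ (z , there i , p)
  ... | inj₂ q | inj₂ g = inj₂ λ { (here refl) → q ; (there i) → g i }

  spoke-# : ∀ {a b} → Spoke a → Spoke b → a ≢ b → a # b
  spoke-# (a , ya) (b , yb) ne = ne , proper a b ya yb

  twin-same : ∀ {a b p q} → Spoke a → Spoke b → Twin a p → Twin b q → p ≡ q ⊎ p ~ q → a ≡ b
  twin-same {a} {b} sa sb tp tq e with a Finₚ.≟ b
  ... | yes r = r
  ... | no ne with twin-twin (proj₁ sa) (proj₁ sb) (spoke-# sa sb ne) tp tq | e
  ...   | p≢q , _ | inj₁ r = ⊥-elim (p≢q r)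
  ...   | _ , p≁q | inj₂ r = ⊥-elim (~≁ r p≁q)

  twin-self : ∀ {a p q} → Spoke a → Twin a p → Twin a q → p ≡ q ⊎ p ~ q
  twin-self sa tp tq with cmp _ _
  ... | inj₁ e = e
  ... | inj₂ (ne , na) = inj₂ (twin-clique (proj₁ sa) tp tq ne)

  hub-off : ∀ {z} → Hub⁺ z → Off z
  hub-off (_ , inj₁ refl) = y∉C
  hub-off (_ , inj₂ (o , _)) = o

  hub-spoke : ∀ {z w} → Hub⁺ z → Spoke w → z ~ w
  hub-spoke (_ , inj₁ refl) (_ , yw) = yw
  hub-spoke (_ , inj₂ (_ , f)) (i , yw) = f i yw

  module Parts (s : Sector) where
    open Sec s

    su : Spoke u
    su = u∈ , yu
    su' : Spoke u'
    su' = u'∈ , yu'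

    -- Two nonadjacent hubs and the spokes `u` and `u'` would form a 4-hole.
    hub-hub : ∀ {z z'} → Hub⁺ z → Hub⁺ z' → z ≡ z' ⊎ z ~ z'
    hub-hub hz hz' with cmp _ _
    ... | inj₁ e = e
    ... | inj₂ n = ⊥-elim (no-C₄ (hub-spoke hz su) (~sym (hub-spoke hz' su)) (hub-spoke hz' su') (~sym (hub-spoke hz su')) n u#u')

    hub-twin : ∀ {z w k} → Hub⁺ z → Spoke w → Twin w k → z ~ k
    hub-twin {z} {w} {k} hz sw t with w Finₚ.≟ u
    ... | yes refl = go su' (proj₁ (#sym u#u'))
      where
      go : ∀ {x} → Spoke x → x ≢ w → z ~ k
      go sx ne = trans (twin-see (proj₁ sw) t (hub-off hz)
        (λ { refl → ~≁ (hub-spoke hz sx) (proj₂ (twin-# t (proj₁ sx) (spoke-# sw sx (ne ∘ ≡-sym)))) }) (proj₁ sx) ne (hub-spoke hz sx))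
        (hub-spoke hz sw)
    ... | no ne' = go su (ne' ∘ ≡-sym)
      where
      go : ∀ {x} → Spoke x → x ≢ w → z ~ k
      go sx ne = trans (twin-see (proj₁ sw) t (hub-off hz)
        (λ { refl → ~≁ (hub-spoke hz sx) (proj₂ (twin-# t (proj₁ sx) (spoke-# sw sx (ne ∘ ≡-sym)))) }) (proj₁ sx) ne (hub-spoke hz sx))
        (hub-spoke hz sw)

    hub-¬twin : ∀ {z w} → Hub⁺ z → Spoke w → ¬ Twin w z
    hub-¬twin hz sw t = ~⇒≢ (hub-twin hz sw t) refl

    X-¬hub : ∀ {p} → X p → ¬ Hub⁺ p
    X-¬hub (_ , f) hz = ~# (hub-spoke hz (B∈ w∈B , yw)) (f w∈B)

    X-¬twin : ∀ {p a} → X p → Spoke a → ¬ Twin a p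
    X-¬twin {p} {a} x@(_ , f) (a∈ , ya) t with in-C a∈
    ... | inj₁ (inj₁ refl) = let b , i , e = u~B in ~# (twin-~ t (B∈ i) e) (f i)
    ... | inj₁ (inj₂ refl) = let b , i , e = u'~B in ~# (twin-~ t (B∈ i) e) (f i)
    ... | inj₂ (inj₁ i) = ~≁ ya (yI i)
    X-¬twin {p} x@(_ , f) (a∈ , ya) (inj₁ refl) | inj₂ (inj₂ i) = proj₁ (f i) refl
    X-¬twin {p} x@(_ , f) (a∈ , ya) (inj₂ (_ , e , _)) | inj₂ (inj₂ i) = ~# e (f i)

    twin-head : ∀ {m a P} → Twin m a → (∀ {x} → x ∈ P → x ∈ C) → Ind (m ∷ P) → Ind (a ∷ P)
    twin-head {P = []} t f p = tt , tt
    twin-head {P = x ∷ P} t f ((e , es) , p) = (twin-~ t (f (here refl)) e , tab λ i → twin-# t (f (there i)) (at es i)) , p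

    to-B : ∀ {a} → Twin u a → Ind (B ++ a ∷ [])
    to-B {a} t = subst Ind (trans (rev-cons a (reverse B)) (cong (_++ a ∷ []) (Listₚ.reverse-involutive B)))
      (ind-rev _ (twin-head t (B∈ ∘ ∈-rev⁻) (hol-pre (reverse B) (Crossing.rev-hol s))))

    around : ∀ {a b M} → Twin u a → Twin u' b → (∀ {x} → x ∈ M → X x) → Ind (a ∷ M ++ b ∷ []) → Hol a (M ++ b ∷ B)
    around {a} {b} {M} ta tb xM p = subst (Hol a) (snoc-assoc M) (hol-cyc p (to-B ta)
        (subst Ind (≡-sym (snoc-assoc M)) (ind-join M (proj₂ p) (twin-head tb B∈ (ind-drop I (hol-ind isHol))) λ i j → proj₂ (xM i) j))
        (∈m M) w∈B λ i j ai aj → case ∈-++ M i of λ where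
          (inj₁ k) → proj₂ (xM k) j
          (inj₂ (here refl)) → ⊥-elim (~# ai (twin-twin u∈ u'∈ u#u' ta tb)))

    par-I : par I ≡ false
    par-I = eq (par I) (trans (cong not (≡-sym (lc-++ _ I))) (even-path O))
      where
      eq : ∀ p → not (p xor (true xor false)) ≡ false → p ≡ false
      eq false e = refl
      eq true ()

    -- `M` and `I` can both be completed by `B` to a hole, so they have the same parity; and `I` is
    -- even because of the hole `O` through `y`.
    par-inside : ∀ {a b M} → Twin u a → Twin u' b → (∀ {x} → x ∈ M → X x) → Ind (a ∷ M ++ b ∷ []) → par M ≡ false
    par-inside {a} {b} {M} ta tb xM p = eq (par M) (par I) (par B) par-I
        (trans (≡-sym (lc-++ _ M)) (even-path (around ta tb xM p)))
        (trans (≡-sym (lc-++ _ I)) (even-path isHol))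
      where
      eq : ∀ m i b → i ≡ false → m xor (true xor b) ≡ false → i xor (true xor b) ≡ false → m ≡ false
      eq false i b e f g = refl
      eq true false false e f ()
      eq true false true e () g

    lc-B : lc (adj G u) B ≡ true
    lc-B = go I u'~I isHol
      where
      go : ∀ I → (∃ λ i → i ∈ I × u' ~ i) → Hol u (I ++ u' ∷ B) → lc (adj G u) B ≡ true
      go [] (_ , () , _)
      go (i ∷ I) _ h with snoc? B | w∈B
      ... | B' ∷ʳ b | _ with hol-inv i (I ++ u' ∷ B') b h (cong (i ∷_) (≡-sym (Listₚ.++-assoc I (u' ∷ B') (b ∷ []))))
      ...   | ub , u# , _ = trans (lc-++ (adj G u) B')
                (cong₂ _xor_ (lc-none (All.map proj₂ (All.tail (All-r I u#)))) (cong (_xor false) ub))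

    -- a would see exactly two vertices of the hole k M b B, namely k and the last vertex of B
    no-double : ∀ {a k b M} → Twin u a → Twin u k → a ~ k → (∀ {x} → x ∈ M → X x) → Twin u' b → Ind (k ∷ M ++ b ∷ []) →
                (∀ {x} → x ∈ M → a # x) → a # b → ⊥
    no-double {a} {k} {b} {M} ta tk ak xM tb p a#M a#b = true≢false {b = lc (adj G a) (k ∷ M ++ b ∷ B)}
      (odd-contacts (around tk tb xM p) (λ { (here refl) → ~⇒≢ ak ; (there i) → off i }) (here refl) ak)
      (trans (cong₂ _xor_ ak (trans (lc-++ (adj G a) M) (cong₂ _xor_ (lc-none (tab λ i → proj₂ (a#M i)))
        (cong₂ _xor_ (proj₂ a#b) (trans (lc-cong (tab λ i → twin-adj ta (B∈ i) (λ e → at (hol-≢ isHol) (∈r I (there i)) (≡-sym e)))) lc-B))))) refl)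
      where
      off : ∀ {h} → h ∈ M ++ b ∷ B → a ≢ h
      off i with ∈-++ M i
      ... | inj₁ j = proj₁ (a#M j)
      ... | inj₂ (here refl) = proj₁ a#b
      ... | inj₂ (there j) = twin-≢ ta (B∈ j) (at (hol-≢ isHol) (∈r I (there j)))

    -- Twins of one spoke are adjacent, so on an induced path a twin of `u` must come right after
    -- `a`, and a twin of `u'` right before `b`. Everything between them is in `X`, and `no-double`
    -- applies.
    no-twin-inside : ∀ {a b k L} → Twin u a → Twin u' b → Ind (a ∷ L ++ b ∷ []) → (∀ {x} → x ∈ L → X x ⊎ (Twin u x ⊎ Twin u' x)) →
                     k ∈ L → Twin u k → ⊥
    no-twin-inside {a} {b} {k} {L} ta tb p f k∈ tk with split∈ k∈
    ... | split (e ∷ E) F = near (ind-cross (a ∷ []) p (here refl) (∈l (∈m E))) (twin-self su ta tk)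
      where
      near : ∀ {a k} → a # k → a ≡ k ⊎ a ~ k → ⊥
      near n (inj₁ e) = proj₁ n e
      near n (inj₂ e) = ~# e n
    ... | split [] F = go (sort {P = Twin u'} {Q = X} sortF)
      where
      near : ∀ {a k} → a # k → a ≡ k ⊎ a ~ k → ⊥
      near n (inj₁ e) = proj₁ n e
      near n (inj₂ e) = ~# e n
      ak : a ~ k
      ak = proj₁ (proj₁ p)
      a#F : ∀ {x} → x ∈ F → a # x
      a#F i = ind-cross (a ∷ []) p (here refl) (∈l i)
      sortF : ∀ {x} → x ∈ F → Twin u' x ⊎ X x
      sortF i with f (there i)
      ... | inj₁ x = inj₂ x
      ... | inj₂ (inj₁ t) = ⊥-elim (near (a#F i) (twin-self su ta t))
      ... | inj₂ (inj₂ t) = inj₁ t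
      go : (∃ λ x → x ∈ F × Twin u' x) ⊎ (∀ {x} → x ∈ F → X x) → ⊥
      go (inj₂ x) = no-double ta tk ak x tb (proj₂ p) a#F (twin-twin u∈ u'∈ u#u' ta tb)
      go (inj₁ (b' , i , t)) with split∈ i
      ... | split M (c ∷ F') = near (ind-cross (k ∷ M ++ b' ∷ []) (subst Ind eq (proj₂ p)) (there (∈m M)) (∈m F')) (twin-self su' t tb)
        where
        eq : k ∷ (M ++ b' ∷ c ∷ F') ++ b ∷ [] ≡ (k ∷ M ++ b' ∷ []) ++ c ∷ F' ++ b ∷ []
        eq = cong (k ∷_) (trans (cong (_++ b ∷ []) (≡-sym (snoc-assoc M))) (Listₚ.++-assoc (M ++ b' ∷ []) (c ∷ F') (b ∷ [])))
      ... | split M [] = no-double ta tk ak xM t (ind-take (k ∷ M ++ b' ∷ []) (proj₂ p)) (λ j → a#F (∈l j)) (a#F (∈m M))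
        where
        xM : ∀ {x} → x ∈ M → X x
        xM j with sortF (∈l j)
        ... | inj₂ x = x
        ... | inj₁ t' = ⊥-elim (near (ind-cross (k ∷ M) (subst Ind (cong (k ∷_) (snoc-assoc M)) (proj₂ p)) (there j) (here refl)) (twin-self su' t' tb))

  module Ends (s : Sector) where
    open Sec s
    open Parts s

    -- The witness is the hole through `y` and `I`. On a path with at least two interior vertices, a
    -- hub would see both ends and a twin is excluded by `no-twin-inside`. So the interior is in
    -- `X`, where it is even.
    ends-nice : ∀ {a b} → K u a → K u' b → Nice (Piece s) a b
    ends-nice {a} {b} (Ua , ta) (Ub , tb) = y , I ,
        (inj₂ (inj₁ (Uy , inj₁ refl)) , inj₂ (inj₂ (inj₁ (Ua , ta))) , inj₂ (inj₂ (inj₂ (Ub , tb))) , tab (inj₁ ∘ base)) ,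
        hol path (hub-twin (Uy , inj₁ refl) su ta) (hub-twin (Uy , inj₁ refl) su' tb) (tab λ i → y∉C (I∈ i) , yI i) a#b , odd
      where
      a#b : a # b
      a#b = twin-twin u∈ u'∈ u#u' ta tb
      path : Ind (a ∷ I ++ b ∷ [])
      path = subst Ind (trans (rev-snoc (b ∷ reverse I)) (cong (a ∷_) (trans (rev-cons b (reverse I)) (cong (_++ b ∷ []) (Listₚ.reverse-involutive I)))))
          (ind-rev _ (flip (subst Ind (trans (rev-snoc (a ∷ I)) (cong (u' ∷_) (rev-cons a I)))
            (ind-rev _ (twin-head ta (λ i → case ∈-++ I i of λ { (inj₁ j) → I∈ j ; (inj₂ (here refl)) → u'∈ }) rim)))))
        where
        flip : Ind (u' ∷ reverse I ++ a ∷ []) → Ind (b ∷ reverse I ++ a ∷ [])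
        flip p = go (reverse I) ∈-rev⁻ (λ i → ∈-rev i) p
          where
          go : ∀ J → (∀ {x} → x ∈ J → x ∈ I) → (∀ {x} → x ∈ I → x ∈ J) → Ind (u' ∷ J ++ a ∷ []) → Ind (b ∷ J ++ a ∷ [])
          go [] f g p = ⊥-elim (case g (proj₁ (proj₂ u'~I)) of λ ())
          go (j ∷ J) f g ((e , es) , p) = (twin-~ tb (I∈ (f (here refl))) e ,
            All-++ (tab λ i → twin-# tb (I∈ (f (there i))) (at es (∈l i))) (#sym a#b ∷ [])) , p
      odd : ∀ L → All (Piece s) L → Ind (a ∷ L ++ b ∷ []) → par L ≡ true → ∃ λ m → L ≡ m ∷ []
      odd [] ps p ()
      odd (m ∷ []) ps p e = m , refl
      odd L@(m ∷ m' ∷ L') ps p e = ⊥-elim (go₁ (sort {P = Hub⁺} hubs))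
        where
        hubs : ∀ {x} → x ∈ L → Hub⁺ x ⊎ (X x ⊎ (Twin u x ⊎ Twin u' x))
        hubs i with at ps i
        ... | inj₁ c = inj₂ (inj₁ (Cell⊂X c))
        ... | inj₂ (inj₁ h) = inj₁ h
        ... | inj₂ (inj₂ (inj₁ (_ , t))) = inj₂ (inj₂ (inj₁ t))
        ... | inj₂ (inj₂ (inj₂ (_ , t))) = inj₂ (inj₂ (inj₂ t))
        twins : ∀ {x} → X x ⊎ (Twin u x ⊎ Twin u' x) → (Twin u x ⊎ Twin u' x) ⊎ X x
        twins (inj₁ x) = inj₂ x
        twins (inj₂ t) = inj₁ t
        mirror-kind : ∀ {x} → X x ⊎ (Twin u x ⊎ Twin u' x) → Sec.X (mirror s) x ⊎ (Twin u' x ⊎ Twin u x)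
        mirror-kind (inj₁ (Ux , f)) = inj₁ (Ux , λ i → f (∈-rev⁻ i))
        mirror-kind (inj₂ t) = inj₂ (swap t)
        go₂ : (∀ {x} → x ∈ L → X x ⊎ (Twin u x ⊎ Twin u' x)) → (∃ λ x → x ∈ L × (Twin u x ⊎ Twin u' x)) ⊎ (∀ {x} → x ∈ L → X x) → ⊥
        go₂ f (inj₂ x) = true≢false e (par-inside ta tb x p)
        go₂ f (inj₁ (k , i , inj₁ t)) = no-twin-inside ta tb p f i t
        go₂ f (inj₁ (k , i , inj₂ t)) = mirrored i t
          where
          mirrored : k ∈ L → Twin u' k → ⊥
          mirrored = λ i t → Parts.no-twin-inside (mirror s) tb ta
            (subst Ind (trans (rev-snoc (a ∷ L)) (cong (b ∷_) (rev-cons a L))) (ind-rev _ p))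
            (λ j → mirror-kind (f (∈-rev⁻ j))) (∈-rev i) t
        go₁ : (∃ λ x → x ∈ L × Hub⁺ x) ⊎ (∀ {x} → x ∈ L → X x ⊎ (Twin u x ⊎ Twin u' x)) → ⊥
        go₁ (inj₂ f) = go₂ f (sort {P = λ x → Twin u x ⊎ Twin u' x} (twins ∘ f))
        go₁ (inj₁ (z , here refl , h)) = ~# (hub-twin h su' tb) (ind-cross (z ∷ []) (proj₂ p) (here refl) (∈m L'))
        go₁ (inj₁ (z , there i , h)) = ~# (~sym (hub-twin h su ta)) (ind-cross (a ∷ []) p (here refl) (∈l i))

    ends-req : ∀ {a b} → Hub⁺ a ⊎ (K u a ⊎ K u' a) → Hub⁺ b ⊎ (K u b ⊎ K u' b) → Req (Piece s) a b
    ends-req (inj₁ h) (inj₁ h') = inj₁ (hub-hub h h')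
    ends-req (inj₁ h) (inj₂ (inj₁ (_ , t))) = inj₁ (inj₂ (hub-twin h su t))
    ends-req (inj₁ h) (inj₂ (inj₂ (_ , t))) = inj₁ (inj₂ (hub-twin h su' t))
    ends-req (inj₂ (inj₁ (_ , t))) (inj₁ h) = inj₁ (inj₂ (~sym (hub-twin h su t)))
    ends-req (inj₂ (inj₂ (_ , t))) (inj₁ h) = inj₁ (inj₂ (~sym (hub-twin h su' t)))
    ends-req (inj₂ (inj₁ (_ , t))) (inj₂ (inj₁ (_ , t'))) = inj₁ (twin-self su t t')
    ends-req (inj₂ (inj₂ (_ , t))) (inj₂ (inj₂ (_ , t'))) = inj₁ (twin-self su' t t')
    ends-req (inj₂ (inj₁ k)) (inj₂ (inj₂ k')) = inj₂ (ends-nice k k')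
    ends-req (inj₂ (inj₂ k)) (inj₂ (inj₁ k')) = inj₂ (nice-sym (ends-nice k' k))

  piece-adj : ∀ s {a q} → U q → Sec.Cell s a → q ~ a → ¬ ¬ Piece s q
  piece-adj s Uq c e k = Boundary.boundary s Uq c e λ where
    (inj₁ c) → k (inj₁ c)
    (inj₂ (inj₁ h)) → k (inj₂ (inj₁ (Uq , h)))
    (inj₂ (inj₂ (inj₁ t))) → k (inj₂ (inj₂ (inj₁ (Uq , t))))
    (inj₂ (inj₂ (inj₂ t))) → k (inj₂ (inj₂ (inj₂ (Uq , t))))

  cell-core : ∀ s t {p} → Sec.X t p → Piece s p → Sec.Cell s p
  cell-core s t x (inj₁ c) = c
  cell-core s t x (inj₂ (inj₁ h)) = ⊥-elim (Parts.X-¬hub t x h)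
  cell-core s t x (inj₂ (inj₂ (inj₁ (_ , k)))) = ⊥-elim (Parts.X-¬twin t x (Parts.su s) k)
  cell-core s t x (inj₂ (inj₂ (inj₂ (_ , k)))) = ⊥-elim (Parts.X-¬twin t x (Parts.su' s) k)

  -- From a common vertex the derivation of the cell of `t` is traced back to the rim. Each earlier
  -- vertex is adjacent to the cell of `s` but is neither hub nor twin, so it lies in that cell as
  -- well. The trace ends in `I` of `t`, which is part of `B` of `s`.
  disjoint : ∀ s t {p} → (∀ {i} → i ∈ Sector.I t → i ∈ Sector.B s) → Sec.Cell s p → Sec.Cell t p → ⊥
  disjoint s t f c (Sec.base i) = proj₁ (proj₂ (Sec.Cell⊂X s c) (f i)) refl
  disjoint s t f c (Sec.ext c' e x) = do
    p ← piece-adj s (proj₁ (Sec.Cell⊂X t c')) c e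
    disjoint s t f (cell-core s t (Sec.Cell⊂X t c') p) c'

  Ints Ends : List Sector → V → Set
  Ints l i = Any (λ s → i ∈ Sector.I s) l
  Ends l w = Any (λ s → w ≡ Sector.u s ⊎ w ≡ Sector.u' s) l

  -- consecutive sectors, from the spoke in the second argument on to u₀
  data Chain (u₀ : V) : V → List Sector → Set where
    last : ∀ {s u} → u ≡ Sector.u s → Sector.u' s ≡ u₀ → Chain u₀ u (s ∷ [])
    link : ∀ {s l u} → u ≡ Sector.u s → (∀ {i} → Ints l i → i ∈ Sector.B s) → (Ends l (Sector.u s) → Sector.u s ≡ u₀) →
           Chain u₀ (Sector.u' s) l → Chain u₀ u (s ∷ l)

  record Sectors (u₀ u : V) (J R : List V) : Set where
    field
      l : List Sector
      chain : Chain u₀ u l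
      ints : ∀ {i} → Ints l i → i ∈ J ++ R
      ends : ∀ {w} → Ends l w → w ≡ u₀ ⊎ w ∈ u ∷ R
      cover : ∀ {h} → h ∈ u ∷ J ++ R → Ints l h ⊎ Ends l h

  -- The rim is read once around: `J` is what has been read since the spoke `u`, all of it unseen by
  -- `y`; `R` is unread; `S` is finished and starts with `u₀`. The alternative with empty `S` is the
  -- start, where a second spoke must still be ahead.
  sectors : ∀ {u₀ u} J R S → Hol u (J ++ R ++ S) → (∀ {x} → x ∈ C → x ∈ u ∷ J ++ R ++ S) → (∀ {x} → x ∈ u ∷ J ++ R ++ S → x ∈ C) →
            y ~ u → (∀ {j} → j ∈ J → y ≁ j) → (∃ λ S' → S ≡ u₀ ∷ S') ⊎ (u ≡ u₀ × S ≡ [] × ∃ λ x → x ∈ R × y ~ x) → y ~ u₀ →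
            Sectors u₀ u J R
  private
    mkSector : ∀ {u u'} I B → Hol u (I ++ u' ∷ B) → (∀ {x} → x ∈ C → x ∈ u ∷ I ++ u' ∷ B) → (∀ {x} → x ∈ u ∷ I ++ u' ∷ B → x ∈ C) →
               y ~ u → y ~ u' → (∀ {j} → j ∈ I → y ≁ j) → Sector
    mkSector {u} {u'} I B h to from yu yu' yI = record { u = u ; I = I ; u' = u' ; B = B ; isHol = h ; to = to ; from = from
        ; yu = yu ; yu' = yu' ; yI = yI ; w = proj₁ third ; w∈B = proj₁ (proj₂ third) ; yw = proj₂ (proj₂ third) }
      where
      -- The number of spokes is odd. Two of them are `u` and `u'`, none lies in `I`, so there are
      -- oddly many in `B`.
      third : ∃ λ w → w ∈ B × y ~ w
      third = lc-true (adj G y) B (eq (lc (adj G y) B) (trans (≡-sym (cong₂ _xor_ yu (trans (lc-++ (adj G y) I)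
                (cong₂ _xor_ (lc-none (tab yI)) (cong (_xor lc (adj G y) B) yu'))))) (odd-contacts h (λ i → y∉C (from i)) (here refl) yu)))
        where
        eq : ∀ b → true xor (true xor b) ≡ true → b ≡ true
        eq true e = refl
        eq false ()

  sectors J [] S h to from yu yJ (inj₂ (_ , _ , _ , () , _)) yu₀
  sectors {u₀} {u} J [] _ h to from yu yJ (inj₁ (S' , refl)) yu₀ = record
    { l = mkSector J S' h to from yu yu₀ yJ ∷ [] ; chain = last refl refl ; ints = λ { (here i) → ∈l i ; (there ()) }
    ; ends = λ { (here (inj₁ e)) → inj₂ (here e) ; (here (inj₂ e)) → inj₁ e ; (there ()) }
    ; cover = λ { (here e) → inj₂ (here (inj₁ e)) ; (there i) → case ∈-++ J i of λ { (inj₁ j) → inj₁ (here j) ; (inj₂ ()) } } }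
  sectors {u₀} {u} J (x ∷ R) S h to from yu yJ st yu₀ with ~? y x
  ... | inj₂ yx = record
      { l = l ; chain = chain ; ints = λ i → ∈≡ (ints i) (snoc-assoc J)
      ; ends = λ e → case ends e of λ { (inj₁ f) → inj₁ f ; (inj₂ (here f)) → inj₂ (here f) ; (inj₂ (there i)) → inj₂ (there (there i)) }
      ; cover = λ i → cover (∈≡ i (cong (u ∷_) (≡-sym (snoc-assoc J)))) }
    where
    eq : u ∷ J ++ x ∷ R ++ S ≡ u ∷ (J ++ x ∷ []) ++ R ++ S
    eq = cong (u ∷_) (≡-sym (snoc-assoc J))
    st' : (∃ λ S' → S ≡ u₀ ∷ S') ⊎ (u ≡ u₀ × S ≡ [] × ∃ λ x → x ∈ R × y ~ x)
    st' = case st of λ where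
      (inj₁ e) → inj₁ e
      (inj₂ (e , f , z , there i , yz)) → inj₂ (e , f , z , i , yz)
      (inj₂ (e , f , z , here refl , yz)) → ⊥-elim (~≁ yz yx)
    rest : Sectors u₀ u (J ++ x ∷ []) R
    rest = sectors (J ++ x ∷ []) R S (subst (Hol u) (≡-sym (snoc-assoc J)) h) (λ i → ∈≡ (to i) eq) (λ i → from (∈≡ i (≡-sym eq))) yu
                  (λ i → case ∈-++ J i of λ { (inj₁ j) → yJ j ; (inj₂ (here refl)) → yx }) st' yu₀
    open Sectors rest
  ... | inj₁ yx = record
      { l = s ∷ l ; chain = link refl (λ i → ∈l (ints i)) fresh chain
      ; ints = λ { (here i) → ∈l i ; (there i) → ∈r J (there (ints i)) }
      ; ends = λ { (here (inj₁ e)) → inj₂ (here e) ; (here (inj₂ e)) → inj₂ (there (here e))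
                 ; (there e) → case ends e of λ { (inj₁ f) → inj₁ f ; (inj₂ i) → inj₂ (there i) } }
      ; cover = λ { (here e) → inj₂ (here (inj₁ e))
                  ; (there i) → case ∈-++ J i of λ where
                      (inj₁ j) → inj₁ (here j)
                      (inj₂ j) → case cover j of λ { (inj₁ k) → inj₁ (there k) ; (inj₂ k) → inj₂ (there k) } } }
    where
    s : Sector
    s = mkSector J (R ++ S) h to from yu yx yJ
    assoc : (R ++ S) ++ u ∷ J ≡ R ++ S ++ u ∷ J
    assoc = Listₚ.++-assoc R S (u ∷ J)
    st' : ∃ λ S' → S ++ u ∷ J ≡ u₀ ∷ S'
    st' = case st of λ where
      (inj₁ (S' , e)) → S' ++ u ∷ J , cong (_++ u ∷ J) e
      (inj₂ (e , f , _)) → J , trans (cong (_++ u ∷ J) f) (cong (_∷ J) e)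
    rest : Sectors u₀ x [] R
    rest = sectors {u₀} {x} [] R (S ++ u ∷ J) (subst (Hol x) assoc (hol-rot J h))
      (λ i → ∈≡ (rot-∈ J (to i)) (cong (x ∷_) assoc)) (λ i → from (rot-∈ (R ++ S) (∈≡ i (cong (x ∷_) (≡-sym assoc))))) yx (λ ()) (inj₁ st') yu₀
    open Sectors rest
    fresh : Ends l u → u ≡ u₀
    fresh e with ends e
    ... | inj₁ f = f
    ... | inj₂ i = ⊥-elim (at (hol-≢ h) (∈r J (∈≡ (∈l {B = S} i) refl)) refl)

  ends-spoke : ∀ {l w} → Ends l w → Spoke w
  ends-spoke (here {x = s} (inj₁ refl)) = Parts.su s
  ends-spoke (here {x = s} (inj₂ refl)) = Parts.su' s
  ends-spoke (there e) = ends-spoke e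

  module Fold (pieces : ∀ s → Comp (Piece s) (Req (Piece s))) (u₀ : V) (su₀ : Spoke u₀) where

    Core : V → V → Set
    Core u p = Hub⁺ p ⊎ (K u₀ p ⊎ K u p)

    All-of : V → List Sector → V → Set
    All-of u l p = Core u p ⊎ Any (λ s → Piece s p) l

    Within : V → List Sector → V → V → Set
    Within u l a b = (Core u a × Core u b) ⊎ Any (λ s → Piece s a × Piece s b × Req (Piece s) a b) l

    module Step (s : Sector) (l : List Sector) (I⊂B : ∀ {i} → Ints l i → i ∈ Sector.B s) (fresh : Ends l (Sector.u s) → Sector.u s ≡ u₀) where
      open Sec s
      open Parts s

      Bag : V → Set
      Bag p = Hub⁺ p ⊎ (K u₀ p ⊎ (K u p ⊎ K u' p))

      Cl : Fin 6 → V → Set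
      Cl fz = Hub⁺
      Cl (fs fz) = K u₀
      Cl (fs (fs fz)) = K u
      -- Four cliques suffice for this bag; the spare indices repeat the last one.
      Cl (fs (fs (fs _))) = K u'

      bag : Comp Bag (λ _ _ → ⊤)
      bag = leaf Cl (λ { (inj₁ h) k → k (fz , h) ; (inj₂ (inj₁ h)) k → k (fs fz , h) ; (inj₂ (inj₂ (inj₁ h))) k → k (fs (fs fz) , h)
                       ; (inj₂ (inj₂ (inj₂ h))) k → k (fs (fs (fs fz)) , h) }) (λ {c} → clique {c})
        where
        near : ∀ {a b} → a ≡ b ⊎ a ~ b → a # b → ⊥
        near (inj₁ e) n = proj₁ n e
        near (inj₂ e) n = ~# e n
        clique : ∀ {c a b} → Bag a → Bag b → Cl c a → Cl c b → a # b → ⊥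
        clique {fz} _ _ h h' = near (hub-hub h h')
        clique {fs fz} _ _ (_ , t) (_ , t') = near (twin-self su₀ t t')
        clique {fs (fs fz)} _ _ (_ , t) (_ , t') = near (twin-self su t t')
        clique {fs (fs (fs _))} _ _ (_ , t) (_ , t') = near (twin-self su' t t')

      twin-later : ∀ {a l} → (Ends l u → u ≡ u₀) → K u a → Any (λ t → Piece t a) l → Core u' a
      twin-later f (Ua , t) (here {x = r} (inj₁ c)) = ⊥-elim (Parts.X-¬twin r (Sec.Cell⊂X r c) su t)
      twin-later f k (here (inj₂ (inj₁ h))) = inj₁ h
      twin-later f (Ua , t) (here {x = r} (inj₂ (inj₂ (inj₁ (_ , t'))))) =
        inj₂ (inj₁ (Ua , subst (λ z → Twin z _) (f (here (inj₁ (twin-same su (Parts.su r) t t' (inj₁ refl))))) t))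
      twin-later f (Ua , t) (here {x = r} (inj₂ (inj₂ (inj₂ (_ , t'))))) =
        inj₂ (inj₁ (Ua , subst (λ z → Twin z _) (f (here (inj₂ (twin-same su (Parts.su' r) t t' (inj₁ refl))))) t))
      twin-later f k (there i) = twin-later (f ∘ there) k i

      inter : ∀ {a} → Bag a → All-of u' l a → Core u' a
      inter _ (inj₁ c) = c
      inter (inj₁ h) _ = inj₁ h
      inter (inj₂ (inj₁ k)) _ = inj₂ (inj₁ k)
      inter (inj₂ (inj₂ (inj₂ k))) _ = inj₂ (inj₂ k)
      inter (inj₂ (inj₂ (inj₁ k))) (inj₂ i) = twin-later fresh k i

      no-cell : ∀ {a l} → (∀ {i} → Ints l i → i ∈ B) → Cell a → Any (λ t → Piece t a) l → ⊥
      no-cell f c (here {x = t} p) = disjoint s t (f ∘ here) c (cell-core t s (Cell⊂X c) p)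
      no-cell f c (there i) = no-cell (f ∘ there) c i

      inter' : ∀ {a} → Bag a ⊎ All-of u' l a → Piece s a → Hub⁺ a ⊎ (K u a ⊎ K u' a)
      inter' _ (inj₂ e) = e
      inter' (inj₁ (inj₁ h)) (inj₁ c) = inj₁ h
      inter' (inj₁ (inj₂ (inj₁ (_ , t)))) (inj₁ c) = ⊥-elim (X-¬twin (Cell⊂X c) su₀ t)
      inter' (inj₁ (inj₂ (inj₂ k))) (inj₁ c) = inj₂ k
      inter' (inj₂ (inj₁ (inj₁ h))) (inj₁ c) = inj₁ h
      inter' (inj₂ (inj₁ (inj₂ (inj₁ (_ , t))))) (inj₁ c) = ⊥-elim (X-¬twin (Cell⊂X c) su₀ t)
      inter' (inj₂ (inj₁ (inj₂ (inj₂ k)))) (inj₁ c) = inj₂ (inj₂ k)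
      inter' (inj₂ (inj₂ i)) (inj₁ c) = ⊥-elim (no-cell I⊂B c i)

      in-bag : ∀ {a} → Hub⁺ a ⊎ (K u a ⊎ K u' a) → Bag a
      in-bag (inj₁ h) = inj₁ h
      in-bag (inj₂ k) = inj₂ (inj₂ k)

    -- The bag of a sector consists of the hubs and the twins of `u₀`, `u` and `u'`. It meets the
    -- later part of the fan in `Core u'`, and the piece of the sector meets their union only in
    -- hubs and twins of `u` and `u'`, which the piece has made a clique by `ends-req`. For the last
    -- sector `u'` is `u₀` and its piece alone is enough.
    fold : ∀ {u l} → Chain u₀ u l → Comp (All-of u l) (Within u l)
    fold (last {s} refl refl) ret = do
        c ← pieces s
        ret (mono (λ p → inj₂ (here p)) back (λ { _ _ (inj₁ (a , b)) → Ends.ends-req s (conv a) (conv b)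
                                                  ; _ _ (inj₂ (here (_ , _ , r))) → r ; _ _ (inj₂ (there ())) }) c)
      where
      open Sec s
      conv : ∀ {a} → Core u a → Hub⁺ a ⊎ (K u a ⊎ K u' a)
      conv (inj₁ h) = inj₁ h
      conv (inj₂ k) = inj₂ (swap k)
      back : ∀ {p} → All-of u (s ∷ []) p → Piece s p
      back (inj₁ c) = inj₂ (conv c)
      back (inj₂ (here p)) = p
      back (inj₂ (there ()))
    fold (link {s} {l} refl I⊂B fresh ch) ret = do
        c₁ ← bag
        c₂ ← fold ch
        c₃ ← glue (λ _ _ _ _ → tt) (λ a a' b b' → inj₁ (inter a a' , inter b b')) c₁ c₂
        c₄ ← pieces s
        c₅ ← glue (λ a a' b b' → inj₁ (in-bag (inter' a a') , in-bag (inter' b b') , tt))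
                  (λ a a' b b' → Ends.ends-req s (inter' a a') (inter' b b')) c₃ c₄
        ret (mono forth back req c₅)
      where
      open Sec s
      open Step s l I⊂B fresh
      forth : ∀ {p} → (Bag p ⊎ All-of u' l p) ⊎ Piece s p → All-of u (s ∷ l) p
      forth (inj₁ (inj₁ (inj₁ h))) = inj₁ (inj₁ h)
      forth (inj₁ (inj₁ (inj₂ (inj₁ k)))) = inj₁ (inj₂ (inj₁ k))
      forth (inj₁ (inj₁ (inj₂ (inj₂ (inj₁ k))))) = inj₁ (inj₂ (inj₂ k))
      forth (inj₁ (inj₁ (inj₂ (inj₂ (inj₂ k))))) = inj₂ (here (inj₂ (inj₂ (inj₂ k))))
      forth (inj₁ (inj₂ (inj₁ (inj₁ h)))) = inj₁ (inj₁ h)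
      forth (inj₁ (inj₂ (inj₁ (inj₂ (inj₁ k))))) = inj₁ (inj₂ (inj₁ k))
      forth (inj₁ (inj₂ (inj₁ (inj₂ (inj₂ k))))) = inj₂ (here (inj₂ (inj₂ (inj₂ k))))
      forth (inj₁ (inj₂ (inj₂ i))) = inj₂ (there i)
      forth (inj₂ p) = inj₂ (here p)
      core-bag : ∀ {p} → Core u p → Bag p
      core-bag (inj₁ h) = inj₁ h
      core-bag (inj₂ (inj₁ k)) = inj₂ (inj₁ k)
      core-bag (inj₂ (inj₂ k)) = inj₂ (inj₂ (inj₁ k))
      back : ∀ {p} → All-of u (s ∷ l) p → (Bag p ⊎ All-of u' l p) ⊎ Piece s p
      back (inj₁ c) = inj₁ (inj₁ (core-bag c))
      back (inj₂ (here p)) = inj₂ p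
      back (inj₂ (there i)) = inj₁ (inj₂ (inj₂ i))
      left : ∀ {l a b} → Any (λ s → Piece s a × Piece s b × Req (Piece s) a b) l → Any (λ s → Piece s a) l × Any (λ s → Piece s b) l
      left (here (p , q , _)) = here p , here q
      left (there i) = there (proj₁ (left i)) , there (proj₂ (left i))
      req : ∀ {a b} → (Bag a ⊎ All-of u' l a) ⊎ Piece s a → (Bag b ⊎ All-of u' l b) ⊎ Piece s b → Within u (s ∷ l) a b → _
      req _ _ (inj₁ (a , b)) = inj₁ (inj₁ (core-bag a) , inj₁ (core-bag b) , inj₁ (core-bag a , core-bag b , tt))
      req _ _ (inj₂ (here r)) = inj₂ r
      req _ _ (inj₂ (there i)) = let p , q = left i in inj₁ (inj₂ (inj₂ p) , inj₂ (inj₂ q) , inj₂ (inj₂ p , inj₂ q , inj₂ i))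

  piece-U : ∀ s {p} → Piece s p → U p
  piece-U s (inj₁ c) = proj₁ (Sec.Cell⊂X s c)
  piece-U s (inj₂ (inj₁ (Up , _))) = Up
  piece-U s (inj₂ (inj₂ (inj₁ (Up , _)))) = Up
  piece-U s (inj₂ (inj₂ (inj₂ (Up , _)))) = Up

  Tw : V → Set
  Tw p = ∃ λ w → Spoke w × K w p

  tw-same : ∀ {s t t' w} → Spoke w → Tw t → Tw t' → s ≡ t ⊎ s ~ t → s ≡ t' ⊎ s ~ t' → Twin w s → t # t' → ⊥
  tw-same sw (a , sa , _ , ta) (b , sb , _ , tb) e f ts n with twin-same sw sa ts ta e | twin-same sw sb ts tb f
  ... | refl | refl with twin-self sw ta tb
  ...   | inj₁ g = proj₁ n g
  ...   | inj₂ g = ~# g n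

  module Localise (s₀ : Sector) (l : List Sector) (cls : ∀ {p} → U p → (Hub⁺ p ⊎ Tw p) ⊎ Σ Sector λ s → s ∈ l × Sec.Cell s p)  where
    open Parts s₀ using (hub-hub; hub-twin; hub-¬twin)

    hub-near : ∀ {z p} → Hub⁺ z → Hub⁺ p ⊎ Tw p → p ≡ z ⊎ p ~ z
    hub-near hz (inj₁ h) = hub-hub h hz
    hub-near hz (inj₂ (w , sw , _ , t)) = inj₂ (~sym (hub-twin hz sw t))

    cell-hub-twin : ∀ s {m t} → Sec.Cell s m → m ~ y → Tw t → m ~ t → ⊥
    cell-hub-twin s {m} {t} c my (w , sw , Ut , tw) mt = piece-adj s Ut c (~sym mt) λ where
        (inj₁ c') → Parts.X-¬twin s (Sec.Cell⊂X s c') sw tw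
        (inj₂ (inj₁ h)) → hub-¬twin h sw tw
        (inj₂ (inj₂ (inj₁ (_ , t')))) → Sec.no-twin-hub s x my t' mt
        (inj₂ (inj₂ (inj₂ (_ , t')))) → Sec.no-twin-hub (mirror s) (proj₁ x , λ i → proj₂ x (∈-rev⁻ i)) my t' mt
      where
      x = Sec.Cell⊂X s c

    spread : ∀ s m L → Ind (m ∷ L) → Sec.Cell s m → (∀ {x} → x ∈ L → U x × ¬ (Hub⁺ x ⊎ Tw x)) → ¬ ¬ (∀ {x} → x ∈ m ∷ L → Sec.Cell s x)
    spread s m [] p c f k = k λ { (here refl) → c ; (there ()) }
    spread s m (a ∷ L) ((ma , _) , p) c f k = do
        pa ← piece-adj s (proj₁ (f (here refl))) c (~sym ma)
        g ← spread s a L p (cell pa) (f ∘ there)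
        k λ { (here refl) → c ; (there i) → g i }
      where
      cell : Piece s a → Sec.Cell s a
      cell (inj₁ c) = c
      cell (inj₂ (inj₁ h)) = ⊥-elim (proj₂ (f (here refl)) (inj₁ h))
      cell (inj₂ (inj₂ (inj₁ k))) = ⊥-elim (proj₂ (f (here refl)) (inj₂ (_ , Parts.su s , k)))
      cell (inj₂ (inj₂ (inj₂ k))) = ⊥-elim (proj₂ (f (here refl)) (inj₂ (_ , Parts.su' s , k)))

    -- The vertices of the hole that `t` misses avoid all separators and form a path, so they stay
    -- in one cell. The two neighbours of `t` are adjacent to that cell and hence in its piece.
    -- Finally `t` is adjacent to the cell, or a separator vertex seen from a separator vertex of
    -- the same piece.
    gather : ∀ {v P t} → Hol v P → (∀ {x} → x ∈ v ∷ P → U x) → t ∈ v ∷ P →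
             (∀ {x} → x ∈ v ∷ P → Hub⁺ x ⊎ Tw x → x ≡ t ⊎ x ~ t) →
             ((Hub⁺ t ⊎ Tw t) ⊎ (∀ {x} → x ∈ v ∷ P → ¬ (Hub⁺ x ⊎ Tw x))) → ¬ ¬ (Σ Sector λ s → s ∈ l × (∀ {x} → x ∈ v ∷ P → Piece s x))
    gather {v} {P} {t} h₀ UP t∈ near st ret = go isHol from to
      where
      open Rebase (rebase h₀ t∈)
      go : ∀ {P'} → Hol t P' → (∀ {x} → x ∈ t ∷ P' → x ∈ v ∷ P) → (∀ {x} → x ∈ v ∷ P → x ∈ t ∷ P') → ⊥
      go (hol {a} {[]} {b} ((e , _) , _) _ _ _ ab) from to = ~# e ab
      go (hol {a} {m ∷ L} {b} p ta tb (tm ∷ tL) ab) from to = start (cls (UP m∈))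
        where
        a∈ = from (there (here refl))
        m∈ = from (there (there (here refl)))
        b∈ = from (∈m (t ∷ a ∷ m ∷ L))
        away : ∀ {x} → x ∈ v ∷ P → t # x → ¬ (Hub⁺ x ⊎ Tw x)
        away i n T with near i T
        ... | inj₁ e = proj₁ n (≡-sym e)
        ... | inj₂ e = ~# (~sym e) n
        start : (Hub⁺ m ⊎ Tw m) ⊎ (Σ Sector λ s → s ∈ l × Sec.Cell s m) → ⊥
        start (inj₁ T) = away m∈ tm T
        start (inj₂ (s , s∈ , cm)) = do
            cells ← spread s m L (proj₂ (ind-take (a ∷ m ∷ L) p)) cm
                      (λ i → let j = from (there (there (there (∈l i)))) in UP j , away j (at tL i))
            pa ← piece-adj s (UP a∈) cm (proj₁ (proj₁ p))
            pb ← last-piece cells (snoc? (m ∷ L)) refl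
            pt ← centre pa pb
            ret (s , s∈ , λ i → case to i of λ where
              (here refl) → pt
              (there (here refl)) → pa
              (there (there j)) → case ∈-++ (m ∷ L) j of λ { (inj₁ k) → inj₁ (cells k) ; (inj₂ (here refl)) → pb })
          where
          last-piece : (∀ {x} → x ∈ m ∷ L → Sec.Cell s x) → ∀ {R} → Snoc R → R ≡ m ∷ L → ¬ ¬ Piece s b
          last-piece cells [] ()
          last-piece cells (R ∷ʳ r) eq = piece-adj s (UP b∈) (cells (∈≡ (∈m R) eq))
            (~sym (ind-link (a ∷ R) (subst Ind (cong (a ∷_) (trans (cong (_++ b ∷ []) (≡-sym eq)) (snoc-assoc R))) p)))
          tw : Tw t → ∀ {c x} → Spoke c → Twin c x → (c ≡ Sector.u s ⊎ c ≡ Sector.u' s) → x ~ t → Piece s t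
          tw (w , sw , Ut , tt') sc tc e xt with twin-same sc sw tc tt' (inj₂ xt) | e
          ... | refl | inj₁ refl = inj₂ (inj₂ (inj₁ (Ut , tt')))
          ... | refl | inj₂ refl = inj₂ (inj₂ (inj₂ (Ut , tt')))
          T-of : ∀ {x} → Hub⁺ x ⊎ (K (Sector.u s) x ⊎ K (Sector.u' s) x) → Hub⁺ x ⊎ Tw x
          T-of (inj₁ h) = inj₁ h
          T-of (inj₂ (inj₁ k)) = inj₂ (_ , Parts.su s , k)
          T-of (inj₂ (inj₂ k)) = inj₂ (_ , Parts.su' s , k)
          via : (Hub⁺ t ⊎ Tw t) → ∀ {x} → K (Sector.u s) x ⊎ K (Sector.u' s) x → x ~ t → Piece s t
          via (inj₁ h) _ _ = inj₂ (inj₁ h)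
          via (inj₂ T) (inj₁ (_ , k)) e = tw T (Parts.su s) k (inj₁ refl) e
          via (inj₂ T) (inj₂ (_ , k)) e = tw T (Parts.su' s) k (inj₂ refl) e
          centre : Piece s a → Piece s b → ¬ ¬ Piece s t
          centre (inj₁ c) _ = piece-adj s (UP t∈) c ta
          centre (inj₂ _) (inj₁ c) = piece-adj s (UP t∈) c tb
          centre (inj₂ ka) (inj₂ kb) k = k (corner st ka kb)
            where
            corner : (Hub⁺ t ⊎ Tw t) ⊎ (∀ {x} → x ∈ v ∷ P → ¬ (Hub⁺ x ⊎ Tw x)) → Hub⁺ a ⊎ (K (Sector.u s) a ⊎ K (Sector.u' s) a) →
                     Hub⁺ b ⊎ (K (Sector.u s) b ⊎ K (Sector.u' s) b) → Piece s t
            corner (inj₂ f) ka _ = ⊥-elim (f a∈ (T-of ka))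
            corner (inj₁ T) (inj₂ k') _ = via T k' (~sym ta)
            corner (inj₁ T) (inj₁ _) (inj₂ k') = via T k' (~sym tb)
            corner (inj₁ T) (inj₁ h) (inj₁ h') = case hub-hub h h' of λ { (inj₁ e) → ⊥-elim (proj₁ ab e) ; (inj₂ e) → ⊥-elim (~# e ab) }

    -- Hubs are adjacent to all separator vertices. So `gather` finds its centre, unless the hole
    -- contains no hub but two nonadjacent twins, necessarily at different spokes. In that case the
    -- hole is rerouted through `y`, which sees both of them.
    localise : ∀ {x z} → Nice U x z → ¬ ¬ (Σ Sector λ s → s ∈ l × Nice (Piece s) x z)
    localise {x} {z} (v , L , (Uv , Ux , Uz , UL) , h , odd) ret = do
        no ¬hub ← em (∃ λ q → q ∈ v ∷ P × Hub⁺ q)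
          where yes (q , i , hq) → gather h UΩ i (λ _ → hub-near hq) (inj₁ (inj₁ hq)) (finish {L} h)
        no ¬two ← em (∃ λ t → ∃ λ t' → (t ∈ v ∷ P × Tw t) × (t' ∈ v ∷ P × Tw t') × t # t')
          where yes (t , t' , (i , T) , (i' , T') , n) → reroute ¬hub i T i' T' n
        no ¬tw ← em (∃ λ t → t ∈ v ∷ P × Tw t)
          where yes (t , i , T) → gather h UΩ i (λ {x} j → λ where
                          (inj₁ hx) → ⊥-elim (¬hub (x , j , hx))
                          (inj₂ Tx) → case cmp x t of λ { (inj₁ e) → e ; (inj₂ n) → ⊥-elim (¬two (x , t , (j , Tx) , (i , T) , n)) })
                        (inj₁ (inj₂ T)) (finish {L} h)
        gather h UΩ (here refl) (λ {x} j T → ⊥-elim (coreless ¬hub ¬tw j T)) (inj₂ (coreless ¬hub ¬tw)) (finish {L} h)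
      where
      P = x ∷ L ++ z ∷ []
      UΩ : ∀ {q} → q ∈ v ∷ P → U q
      UΩ (here refl) = Uv
      UΩ (there (here refl)) = Ux
      UΩ (there (there i)) with ∈-++ L i
      ... | inj₁ j = at UL j
      ... | inj₂ (here refl) = Uz
      finish : ∀ {L'} → Hol v (x ∷ L' ++ z ∷ []) → (Σ Sector λ s → s ∈ l × (∀ {q} → q ∈ v ∷ x ∷ L' ++ z ∷ [] → Piece s q)) → ⊥
      finish {L'} h (s , s∈ , f) = ret (s , s∈ , v , L' ,
        (f (here refl) , f (there (here refl)) , f (∈m (v ∷ x ∷ L')) , tab (λ i → f (there (there (∈l i))))) , h ,
        λ K sK → odd K (All.map (piece-U s) sK))
      coreless : ¬ (∃ λ q → q ∈ v ∷ P × Hub⁺ q) → ¬ (∃ λ t → t ∈ v ∷ P × Tw t) → ∀ {q} → q ∈ v ∷ P → ¬ (Hub⁺ q ⊎ Tw q)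
      coreless f g i (inj₁ h) = f (_ , i , h)
      coreless f g i (inj₂ t) = g (_ , i , t)

      module Through {t t'} (¬hub : ¬ (∃ λ q → q ∈ v ∷ P × Hub⁺ q)) (t∈ : t ∈ v ∷ P) (T : Tw t) (t'∈ : t' ∈ v ∷ P) (T' : Tw t') (tt' : t # t') where
        Hy : Hub⁺ y
        Hy = Uy , inj₁ refl
        yt : ∀ {q} → Tw q → y ~ q
        yt (w , sw , _ , tw) = hub-twin Hy sw tw
        y∉ : ∀ {q} → q ∈ v ∷ P → y ≢ q
        y∉ i refl = ¬hub (y , i , Hy)

        seen : ∀ {m} → m ∈ v ∷ P → y ~ m → m ≡ t ⊎ m ~ t → m ≡ t' ⊎ m ~ t' → ⊥
        seen {m} m∈ ym e f with cls (UΩ m∈)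
        ... | inj₁ (inj₁ hm) = ¬hub (m , m∈ , hm)
        ... | inj₁ (inj₂ (w , sw , _ , tw)) = tw-same sw T T' e f tw tt'
        ... | inj₂ (s , _ , c) with e | f
        ...   | inj₂ mt | _ = cell-hub-twin s c (~sym ym) T mt
        ...   | inj₁ _ | inj₂ mt = cell-hub-twin s c (~sym ym) T' mt
        ...   | inj₁ refl | inj₁ g = proj₁ tt' g

        -- If `y` sees an edge of the hole but not all of it, it is a star whose centre is near both
        -- `t` and `t'`, against `seen`. If it sees everything, the two neighbours of `t` on the
        -- hole are twins at the same spoke as `t`, hence adjacent, which they are not.
        stable : ∀ {c d} → c ∈ v ∷ P → d ∈ v ∷ P → y ~ c → y ~ d → c ~ d → ⊥
        stable {c} {d} c∈ d∈ yc yd cd = do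
          no all ← em (∃ λ e → e ∈ v ∷ P × y ≁ e)
            where yes (e , e∈ , ye) → case star h y∉ c∈ d∈ cd yc yd e∈ ye of λ where
                    (m , m∈ , ym , f , _) → seen m∈ ym (flip≡ (f t∈ (yt T))) (flip≡ (f t'∈ (yt T')))
          everywhere λ i → case ~? y _ of λ { (inj₁ e) → e ; (inj₂ n) → ⊥-elim (all (_ , i , n)) }
          where
          flip≡ : ∀ {a b} → a ≡ b ⊎ a ~ b → b ≡ a ⊎ b ~ a
          flip≡ (inj₁ e) = inj₁ (≡-sym e)
          flip≡ (inj₂ e) = inj₂ (~sym e)
          everywhere : (∀ {q} → q ∈ v ∷ P → y ~ q) → ⊥
          everywhere f with rebase h t∈
          ... | record { isHol = hol {a} {L'} {b} _ ta tb _ ab ; from = from } = both (class (from (there (here refl))) (~sym ta))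
                  (class (from (∈m (t ∷ a ∷ L'))) (~sym tb))
            where
            class : ∀ {q} → q ∈ v ∷ P → q ~ t → Twin (proj₁ T) q
            class {q} i qt with cls (UΩ i)
            ... | inj₁ (inj₁ hq) = ⊥-elim (¬hub (q , i , hq))
            ... | inj₁ (inj₂ (w , sw , _ , tw)) = subst (λ z → Twin z q) (twin-same sw (proj₁ (proj₂ T)) tw (proj₂ (proj₂ (proj₂ T))) (inj₂ qt)) tw
            ... | inj₂ (s , _ , c) = ⊥-elim (cell-hub-twin s c (~sym (f i)) T qt)
            both : Twin (proj₁ T) a → Twin (proj₁ T) b → ⊥
            both ta tb = case twin-self (proj₁ (proj₂ T)) ta tb of λ { (inj₁ e) → proj₁ ab e ; (inj₂ e) → ~# e ab }

        module Split₂ A p M p' D (eq : P ≡ A ++ p ∷ M ++ p' ∷ D) (yA : All (y ≁_) A) (yp : y ~ p) (yp' : y ~ p') (yD : All (y ≁_) D) where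
          h₂ : Hol v (A ++ p ∷ M ++ p' ∷ D)
          h₂ = subst (Hol v) eq h
          ∈Ω : ∀ {q} → q ∈ A ++ p ∷ M ++ p' ∷ D → q ∈ v ∷ P
          ∈Ω i = there (∈≡ i (≡-sym eq))
          p∈ = ∈Ω (∈m A)
          p'∈ = ∈Ω (∈r A (there (∈m M)))
          yA# : ∀ {a} → a ∈ A → y # a
          yA# i = y∉ (∈Ω (∈l i)) , at yA i
          yD# : ∀ {a} → a ∈ D → y # a
          yD# i = y∉ (∈Ω (∈r A (there (∈r M (there i))))) , at yD i
          p#p' : p # p'
          p#p' = ind-hd≢ (ind-drop A (hol-ind h₂)) (∈m M) , ¬~ λ e → stable p∈ p'∈ yp yp' e
          Q : List V
          Q = A ++ p ∷ y ∷ p' ∷ D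
          indAp : Ind (A ++ p ∷ [])
          indAp = ind-take (A ++ p ∷ []) (subst Ind (≡-sym (snoc-assoc A)) (hol-ind h₂))
          tail' : Ind (y ∷ p' ∷ D)
          tail' = (yp' , tab yD#) , ind-drop (p ∷ M) (ind-drop A (hol-ind h₂))
          indQ : Ind Q
          indQ = ind-join A indAp ((~sym yp , p#p' ∷ tab λ i → ind-cross (p ∷ M) (ind-drop A (hol-ind h₂)) (here refl) i) , tail')
            λ { i (here refl) → #sym (yA# i) ; i (there j) → ind-cross A (hol-ind h₂) i (∈r M j) }
          UQ : ∀ {q} → q ∈ Q → U q
          UQ i with ∈-++ A i
          ... | inj₁ j = UΩ (∈Ω (∈l j))
          ... | inj₂ (here refl) = UΩ p∈
          ... | inj₂ (there (here refl)) = Uy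
          ... | inj₂ (there (there j)) = UΩ (∈Ω (∈r A (there (∈r M j))))
          ends : ∃ λ L' → Q ≡ x ∷ L' ++ z ∷ []
          ends = front A eq
            where
            back : ∀ N D {q} → L ++ z ∷ [] ≡ N ++ q ∷ M ++ p' ∷ D ⊎ L ++ z ∷ [] ≡ M ++ p' ∷ D → ∃ λ R → p' ∷ D ≡ R ++ z ∷ []
            back N D {q} e with snoc? D
            back N D {q} (inj₁ e) | [] = [] , cong (_∷ []) (≡-sym (proj₂ (snoc-inj L (N ++ q ∷ M) (trans e (≡-sym (Listₚ.++-assoc N (q ∷ M) (p' ∷ [])))))))
            back N D {q} (inj₂ e) | [] = [] , cong (_∷ []) (≡-sym (proj₂ (snoc-inj L M e)))
            back N D {q} (inj₁ e) | E ∷ʳ d = p' ∷ E , cong (λ w → p' ∷ E ++ w ∷ []) (≡-sym (proj₂ (snoc-inj L (N ++ q ∷ M ++ p' ∷ E)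
              (trans e (≡-sym (trans (Listₚ.++-assoc N (q ∷ M ++ p' ∷ E) (d ∷ [])) (cong (λ w → N ++ q ∷ w) (Listₚ.++-assoc M (p' ∷ E) (d ∷ [])))))))))
            back N D {q} (inj₂ e) | E ∷ʳ d = p' ∷ E , cong (λ w → p' ∷ E ++ w ∷ []) (≡-sym (proj₂ (snoc-inj L (M ++ p' ∷ E)
              (trans e (≡-sym (Listₚ.++-assoc M (p' ∷ E) (d ∷ [])))))))
            front : ∀ A → P ≡ A ++ p ∷ M ++ p' ∷ D → ∃ λ L' → A ++ p ∷ y ∷ p' ∷ D ≡ x ∷ L' ++ z ∷ []
            front [] e with Listₚ.∷-injective e
            ... | refl , e' = let R , r = back [] D {p} (inj₂ e') in y ∷ R , cong (λ w → p ∷ y ∷ w) r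
            front (a ∷ A) e with Listₚ.∷-injective e
            ... | refl , e' = let R , r = back A D {p} (inj₁ e') in A ++ p ∷ y ∷ R ,
                    cong (a ∷_) (trans (cong (λ w → A ++ p ∷ y ∷ w) r) (≡-sym (Listₚ.++-assoc A (p ∷ y ∷ R) (z ∷ []))))

          -- `Q` goes from the first to the last neighbour of `y` through `y`. As `y` misses `v`,
          -- closing `Q` with `v` gives a hole for the same pair `x`, `z`, and this hole contains
          -- the hub `y`.
          off-v : y ≁ v → ⊥
          off-v yv with ends
          ... | L' , eqL = gather {t = y} hQ UQv (there (∈r A (there (here refl)))) (λ _ → hub-near Hy) (inj₁ (inj₁ Hy))
                  λ (s , s∈ , f) → finish {L'} (subst (Hol v) eqL hQ) (s , s∈ , λ {q} i → f (∈≡ i (cong (v ∷_) (≡-sym eqL))))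
            where
            UQv : ∀ {q} → q ∈ v ∷ Q → U q
            UQv (here refl) = Uv
            UQv (there i) = UQ i
            y#v : y # v
            y#v = y∉ (here refl) , yv
            around' : Ind (p' ∷ D ++ v ∷ A)
            around' = ind-drop M (subst Ind (Listₚ.++-assoc M (p' ∷ D) (v ∷ A)) (hol-ind (hol-rot A h₂)))
            hQ : Hol v Q
            hQ = subst (Hol v) (snoc-assoc A) (hol-cyc (pre M) ((yp' , tab yD∷v) , ind-take (p' ∷ D ++ v ∷ []) (subst Ind (cong (p' ∷_) (≡-sym (snoc-assoc D))) around'))
                (subst Ind (≡-sym (snoc-assoc A)) indQ) (∈m A) (here refl) cross)
              where
              pre : ∀ M → Ind (v ∷ A ++ p ∷ [])
              pre _ = ind-take (v ∷ A ++ p ∷ []) (subst Ind (cong (v ∷_) (≡-sym (snoc-assoc A)))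
                        (hol-pre (A ++ p ∷ M) (subst (Hol v) (≡-sym (Listₚ.++-assoc A (p ∷ M) (p' ∷ D))) h₂)))
              yD∷v : ∀ {q} → q ∈ D ++ v ∷ [] → y # q
              yD∷v i = case ∈-++ D i of λ { (inj₁ j) → yD# j ; (inj₂ (here refl)) → y#v }
              cross : ∀ {a c} → a ∈ A ++ p ∷ [] → c ∈ y ∷ p' ∷ D → v ~ a → v ~ c → a # c
              cross i (here refl) va vy = ⊥-elim (~≁ (~sym vy) yv)
              cross i (there j) va vc with ∈-++ A i
              ... | inj₁ k = ind-cross A (hol-ind h₂) k (∈r M j)
              cross i (there (here refl)) va vc | inj₂ (here refl) = p#p'
              cross i (there (there j)) va vc | inj₂ (here refl) = ind-cross (p ∷ M) (ind-drop A (hol-ind h₂)) (here refl) j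

          even-side : ∀ {P'} A {p R} → Hol v P' → (∀ {q} → q ∈ P' → q ∈ P) → P' ≡ A ++ p ∷ R → R ≢ [] → y ~ v → y ~ p → All (y ≁_) A → par A ≡ false × A ≢ []
          even-side [] {p} hP sub refl R≢ yv yp yA = ⊥-elim (stable (here refl) (there (sub (here refl))) yv yp (hol-hd hP))
          even-side A@(a ∷ A') {p} {[]} hP sub refl R≢ yv yp yA = ⊥-elim (R≢ refl)
          even-side A@(a ∷ A') {p} {r ∷ R} hP sub refl R≢ yv yp yA = trans (eq' (par A)) (trans (cong not (≡-sym (lc-++ _ A))) (even-path
              (hol {L = A} pre yv yp (tab λ i → y∉ (there (sub (∈l i))) , at yA i) (ind-cross (v ∷ []) pre (here refl) (∈m A'))))) , λ ()
            where
            eq' : ∀ b → b ≡ not (b xor (true xor false))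
            eq' true = refl
            eq' false = refl
            pre : Ind (v ∷ A ++ p ∷ [])
            pre = hol-pre (A ++ p ∷ []) (subst (Hol v) (≡-sym (snoc-assoc A)) hP)

          -- Now the stretches before `p` and after `p'` close to holes with `y` and `v`, so they
          -- are even, and they are not empty. Thus `Q` is a path from `x` to `z` with an odd
          -- number, greater than one, of interior vertices. This is what the parity clause of
          -- `Nice` forbids.
          on-v : y ~ v → ⊥
          on-v yv with ends | even-side A h id eq (λ { e → case ∈≡ (∈m M) e of λ () }) yv yp yA
               | even-side (reverse D) (hol-rev h) ∈-rev⁻ (trans (cong reverse eq) revD) (λ e → case ∈≡ (∈m (reverse M)) e of λ ()) yv yp' (tab λ i → at yD (∈-rev⁻ i))
            where
            revD : reverse (A ++ p ∷ M ++ p' ∷ D) ≡ reverse D ++ p' ∷ reverse M ++ p ∷ reverse A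
            revD = trans (rev-mid A) (trans (cong (_++ p ∷ reverse A) (rev-mid M)) (Listₚ.++-assoc (reverse D) (p' ∷ reverse M) (p ∷ reverse A)))
          ... | L' , eqL | eA , A≢ | eD , _ with odd L' (tab λ i → UQ (∈≡ (there (∈l i)) (≡-sym eqL))) (subst Ind eqL indQ) odd-L
            where
            odd-L : par L' ≡ true
            odd-L = trans (bl (par L') ) (trans (cong not (≡-sym (lc-++ _ L'))) (trans (cong par (≡-sym eqL)) (trans (lc-++ _ A)
                      (cong₂ _xor_ eA (cong (λ w → true xor (true xor (true xor w))) (trans (≡-sym (lc-rev _ D)) eD))))))
              where
              bl : ∀ b → b ≡ not (b xor (true xor false))
              bl true = refl
              bl false = refl
          ...   | m , refl = short A A≢ (cong length eqL)
            where
            short : ∀ A → A ≢ [] → length (A ++ p ∷ y ∷ p' ∷ D) ≡ 3 → ⊥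
            short [] n _ = n refl
            short (a ∷ A) n e rewrite Listₚ.length-++ A {p ∷ y ∷ p' ∷ D} | ℕₚ.+-suc (length A) (suc (suc (length D)))
              | ℕₚ.+-suc (length A) (suc (length D)) | ℕₚ.+-suc (length A) (length D) with e
            ... | ()

        second : ∀ A p R → P ≡ A ++ p ∷ R → All (y ≁_) A → y ~ p → (∃ λ q → q ∈ R × y ~ q) → ⊥
        second A p R eq yA yp (q , i , yq) with last? (~? y) R
        ... | none n = ~≁ yq (at n i)
        ... | some M p' D refl yp' yD with ~? y v
        ...   | inj₁ yv = Split₂.on-v A p M p' D eq yA yp yp' yD yv
        ...   | inj₂ yv = Split₂.off-v A p M p' D eq yA yp yp' yD yv

        through : ⊥
        through with first? (~? y) P
        ... | none n = proj₁ tt' (trans (only t∈ (yt T)) (≡-sym (only t'∈ (yt T'))))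
          where
          only : ∀ {q} → q ∈ v ∷ P → y ~ q → q ≡ v
          only (here e) _ = e
          only (there i) yq = ⊥-elim (~≁ yq (at n i))
        ... | some A p R eq yA yp with ~? y v
        -- `y` sees `v` and `p`, nothing in `A`, and an odd number of vertices in all, so it sees
        -- one in `R`.
        ...   | inj₁ yv = second A p R eq yA yp (lc-true (adj G y) R (bl (trans (≡-sym (cong₂ _xor_ yv (trans (cong (lc (adj G y)) eq)
                   (trans (lc-++ (adj G y) A) (cong₂ _xor_ (lc-none yA) (cong (_xor lc (adj G y) R) yp)))))) (odd-contacts h y∉ t∈ (yt T)))))
          where
          bl : ∀ {b} → true xor (false xor (true xor b)) ≡ true → b ≡ true
          bl {true} e = refl
          bl {false} ()
        ...   | inj₂ yv = second A p R eq yA yp (pick (place t∈ (yt T)) (place t'∈ (yt T')))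
          where
          place : ∀ {q} → q ∈ v ∷ P → y ~ q → q ≡ p ⊎ (q ∈ R × y ~ q)
          place (here refl) yq = ⊥-elim (~≁ yq yv)
          place (there i) yq with ∈-++ A (∈≡ i eq)
          ... | inj₁ j = ⊥-elim (~≁ yq (at yA j))
          ... | inj₂ (here e) = inj₁ e
          ... | inj₂ (there j) = inj₂ (j , yq)
          pick : t ≡ p ⊎ (t ∈ R × y ~ t) → t' ≡ p ⊎ (t' ∈ R × y ~ t') → ∃ λ q → q ∈ R × y ~ q
          pick (inj₂ r) _ = t , r
          pick (inj₁ _) (inj₂ r) = t' , r
          pick (inj₁ e) (inj₁ f) = ⊥-elim (proj₁ tt' (trans e (≡-sym f)))

      reroute : ∀ {t t'} → ¬ (∃ λ q → q ∈ v ∷ P × Hub⁺ q) → t ∈ v ∷ P → Tw t → t' ∈ v ∷ P → Tw t' → t # t' → ⊥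
      reroute = Through.through

  module Cover (u₀ : V) (su₀ : Spoke u₀) (l : List Sector) (chain : Chain u₀ u₀ l) (cover : ∀ {h} → h ∈ C → Ints l h ⊎ Ends l h)
               (no-cut : ¬ Cut G U) where

    first-sector : ∀ {u l} → Chain u₀ u l → ∃ λ s → s ∈ l
    first-sector (last _ _) = _ , here refl
    first-sector (link _ _ _ _) = _ , here refl

    s₀ : Sector
    s₀ = proj₁ (first-sector chain)
    open Parts s₀ using (hub-hub; hub-twin; hub-¬twin)

    Covered : V → Set
    Covered p = Σ Sector λ s → s ∈ l × Piece s p

    ints-cell : ∀ {h l} → Ints l h → Σ Sector λ s → s ∈ l × Sec.Cell s h
    ints-cell i = let s , s∈ , j = find i in s , s∈ , Sec.base j

    ends-piece : ∀ {w p} → Ends l w → K w p → Covered p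
    ends-piece e k with find e
    ... | s , s∈ , inj₁ refl = s , s∈ , inj₂ (inj₂ (inj₁ k))
    ... | s , s∈ , inj₂ refl = s , s∈ , inj₂ (inj₂ (inj₂ k))

    hub-piece : ∀ {z} → Hub⁺ z → Covered z
    hub-piece h = s₀ , proj₂ (first-sector chain) , inj₂ (inj₁ h)

    spoke-end : ∀ {w} → Spoke w → Ends l w
    spoke-end (i , yw) with cover i
    ... | inj₂ e = e
    ... | inj₁ j = let s , _ , k = find j in ⊥-elim (~≁ yw (Sector.yI s k))

    T-of : ∀ {s p} → Piece s p → Sec.Cell s p ⊎ (Hub⁺ p ⊎ Tw p)
    T-of (inj₁ c) = inj₁ c
    T-of (inj₂ (inj₁ h)) = inj₂ (inj₁ h)
    T-of {s} (inj₂ (inj₂ (inj₁ k))) = inj₂ (inj₂ (_ , Parts.su s , k))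
    T-of {s} (inj₂ (inj₂ (inj₂ k))) = inj₂ (inj₂ (_ , Parts.su' s , k))

    C-covered : ∀ {h} → h ∈ C → Covered h
    C-covered i with cover i
    ... | inj₁ j = let s , s∈ , c = ints-cell j in s , s∈ , inj₁ c
    ... | inj₂ e = ends-piece e (C⊂U i , inj₁ refl)

    Missed : V → Set
    Missed x = U x × ¬ Covered x

    beside : ∀ {x s a} → Missed x → s ∈ l → Sec.Cell s a → x ~ a → ⊥
    beside {s = s} (Ux , nc) s∈ c e = piece-adj s Ux c e λ p → nc (s , s∈ , p)

    -- The other rim vertices belong to cells, and whatever is adjacent to a cell is covered.
    contact : ∀ {x c} → Missed x → c ∈ C → x ~ c → Spoke c
    contact m c∈ e with cover c∈
    ... | inj₁ j = let s , s∈ , c = ints-cell j in ⊥-elim (beside m s∈ c e)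
    ... | inj₂ k = ends-spoke k

    missed-off : ∀ {x} → Missed x → Off x
    missed-off (_ , nc) i refl = nc (C-covered i)

    thin : ∀ {x} → Missed x → Detour.Thin G cf ehf v₀ P₀ x
    thin {x} m@(Ux , nc) = missed-off m , λ {c} {d} c∈ d∈ xc xd → case c Finₚ.≟ d of λ where
        (yes e) → e
        (no ne) → ⊥-elim (nc (hub-piece (Ux , inj₂ (two-spokes (missed-off m) (λ { refl → nc (hub-piece (Uy , inj₁ refl)) })
                    c∈ (proj₂ (contact m c∈ xc)) xc d∈ (proj₂ (contact m d∈ xd)) xd ne))))

    private module Comp = Component G

    module Around (p : V) (mp : Missed p) where
      D : V → Set
      D = Comp.Reachable Missed p

      N : V → Set
      N x = U x × ¬ Missed x × ∃ λ d → D d × x ~ d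

      -- On the hole with `a'` and `b'` exchanged in, missed vertices see only `a'`, `b'` and other
      -- spokes, which are pairwise nonadjacent. But the interior of a bypass sees two adjacent
      -- vertices of the hole, its end `a` and the skipped `w`.
      twins-apart : ∀ {a' b'} → N a' → N b' → a' # b' → Tw a' → Tw b' → ⊥
      twins-apart {a'} {b'} (_ , _ , d , Dd , e) (_ , _ , d' , Dd' , e') n (a , sa , _ , ta) (b , sb , _ , tb) =
          Detours.detour G cf ehf v₀ P₀ H₀ thin (proj₁ sa) (proj₁ sb) (spoke-# sa sb a≢b) ta tb n (Comp.connect Dd Dd' e e') meet
        where
        a≢b : a ≢ b
        a≢b refl = case twin-self sa ta tb of λ { (inj₁ e) → proj₁ n e ; (inj₂ e) → ~# e n }
        head-contact : ∀ L {x α β} → x ∈ L → All Missed L → Ind (α ∷ L ++ β ∷ []) → ∃ λ q → Missed q × q ~ α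
        head-contact (q ∷ L) _ (m ∷ _) ((e , _) , _) = q , m , ~sym e
        Kind : V → Set
        Kind h = (h ≡ a' ⊎ h ≡ b') ⊎ (h ∈ C × h ≢ a × h ≢ b)
        Class : V → Set
        Class h = Kind h → (h ≡ a' ⊎ h ≡ b') ⊎ (Spoke h × h ≢ a × h ≢ b)
        class : ∀ {P : Set} {h x} → P → Missed x × x ~ h → Class h
        class _ (m , e) (inj₁ k) = inj₁ k
        class _ (m , e) (inj₂ (h∈ , p , q)) = inj₂ (contact m h∈ e , p , q)
        clash : ∀ {g h} → Class g → Class h → Kind g → Kind h → g ~ h → ⊥
        clash f f' k k' e with f k | f' k'
        ... | inj₁ (inj₁ refl) | inj₁ (inj₁ refl) = ~⇒≢ e refl
        ... | inj₁ (inj₁ refl) | inj₁ (inj₂ refl) = ~# e n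
        ... | inj₁ (inj₂ refl) | inj₁ (inj₁ refl) = ~# (~sym e) n
        ... | inj₁ (inj₂ refl) | inj₁ (inj₂ refl) = ~⇒≢ e refl
        ... | inj₁ (inj₁ refl) | inj₂ (s , p , q) = p (≡-sym (twin-same sa s ta (inj₁ refl) (inj₂ e)))
        ... | inj₁ (inj₂ refl) | inj₂ (s , p , q) = q (≡-sym (twin-same sb s tb (inj₁ refl) (inj₂ e)))
        ... | inj₂ (s , p , q) | inj₁ (inj₁ refl) = p (twin-same s sa (inj₁ refl) ta (inj₂ e))
        ... | inj₂ (s , p , q) | inj₁ (inj₂ refl) = q (twin-same s sb (inj₁ refl) tb (inj₂ e))
        ... | inj₂ (s , _) | inj₂ (s' , _) = ~≁ e (proper (proj₁ s) (proj₁ s') (proj₂ s) (proj₂ s'))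
        meet : Detours.Result G cf ehf v₀ P₀ H₀ Missed a b a' b' → ⊥
        meet r = clash (class a∈ (proj₂ (head-contact L x∈ missed path))) (class w∈ (at missed x∈ , x~w)) (kind a∈) (kind w∈) (~sym w~a)
          where
          open Detours.Result r
          open Detour.Bypass found using (L; path; x∈; x~w; w~a; a∈; w∈) renaming (thin to missed)

      N-core : ∀ {x} → N x → ¬ ¬ (Hub⁺ x ⊎ Tw x)
      N-core {x} (Ux , nm , d , Dd , e) k = nm (Ux , λ (s , s∈ , p) → case T-of p of λ where
        (inj₁ c) → beside (Comp.reachable⊂ Dd) s∈ c (~sym e)
        (inj₂ T) → k T)

      clique : ∀ {a b} → N a → N b → a # b → ⊥
      clique {a} {b} na nb n = do
        Ta ← N-core na
        Tb ← N-core nb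
        go Ta Tb
        where
        near : ∀ {a b} → a ≡ b ⊎ a ~ b → a # b → ⊥
        near (inj₁ e) n = proj₁ n e
        near (inj₂ e) n = ~# e n
        go : Hub⁺ a ⊎ Tw a → Hub⁺ b ⊎ Tw b → ⊥
        go (inj₁ h) (inj₁ h') = near (hub-hub h h') n
        go (inj₁ h) (inj₂ (_ , sw , _ , t)) = ~# (hub-twin h sw t) n
        go (inj₂ (_ , sw , _ , t)) (inj₁ h) = ~# (~sym (hub-twin h sw t)) n
        go (inj₂ t) (inj₂ t') = twins-apart na nb n t t'

      cut : Cut G U
      cut = record
        { D = D ; K = N ; D⊂ = λ d → proj₁ (Comp.reachable⊂ d) ; K⊂ = proj₁ ; c = p ; e = i ; c∈D = Comp.start mp ; e∈S = C⊂U i∈C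
        ; e∉D = λ d → proj₂ (Comp.reachable⊂ d) (C-covered i∈C)
        ; e∉K = λ (_ , _ , d , Dd , e) → beside (Comp.reachable⊂ Dd) (proj₂ (first-sector chain)) (Sec.base i∈I) (~sym e)
        ; clique = clique
        ; sep = λ {d} {x} Dd Ux e k → do
            no nm ← em (Missed x)
              where yes m → k (inj₁ (Comp.next Dd e m))
            k (inj₂ (Ux , nm , d , Dd , ~sym e)) }
        where
        i = proj₁ (Sec.u'~I s₀)
        i∈I = proj₁ (proj₂ (Sec.u'~I s₀))
        i∈C = Sec.I∈ s₀ i∈I

    covered : ∀ {p} → U p → ¬ ¬ Covered p
    covered {p} Up k = no-cut (Around.cut p (Up , k))

    covered-all : ¬ ¬ (∀ {p} → U p → Covered p)
    covered-all k = fin-choice {P = λ p → U p → Covered p} (λ p k' → do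
        yes Up ← em (U p)
          where no n → k' λ u → ⊥-elim (n u)
        c ← covered Up
        k' λ _ → c) λ f → k (f _)

    module Final (cov : ∀ {p} → U p → Covered p) where
      cls : ∀ {p} → U p → (Hub⁺ p ⊎ Tw p) ⊎ Σ Sector λ s → s ∈ l × Sec.Cell s p
      cls Up with cov Up
      ... | s , s∈ , p with T-of p
      ...   | inj₁ c = inj₂ (s , s∈ , c)
      ...   | inj₂ T = inj₁ T

      Together : V → V → Set
      Together a b = Σ Sector λ s → s ∈ l × Piece s a × Piece s b × Req (Piece s) a b

      adjacent : ∀ {a b} → U a → U b → a ~ b → ¬ ¬ Together a b
      adjacent {a} {b} Ua Ub ab k with cls Ua | cls Ub
      ... | inj₂ (s , s∈ , c) | _ = piece-adj s Ub c (~sym ab) λ p → k (s , s∈ , inj₁ c , p , inj₁ (inj₂ ab))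
      ... | inj₁ _ | inj₂ (s , s∈ , c) = piece-adj s Ua c ab λ p → k (s , s∈ , p , inj₁ c , inj₁ (inj₂ ab))
      ... | inj₁ (inj₁ h) | inj₁ _ = let s , s∈ , p = cov Ub in k (s , s∈ , inj₂ (inj₁ h) , p , inj₁ (inj₂ ab))
      ... | inj₁ (inj₂ _) | inj₁ (inj₁ h) = let s , s∈ , p = cov Ua in k (s , s∈ , p , inj₂ (inj₁ h) , inj₁ (inj₂ ab))
      ... | inj₁ (inj₂ (w , sw , _ , t)) | inj₁ (inj₂ (w' , sw' , _ , t')) with twin-same sw sw' t t' (inj₂ ab)
      ...   | refl with find (spoke-end sw)
      ...     | s , s∈ , inj₁ refl = k (s , s∈ , inj₂ (inj₂ (inj₁ (Ua , t))) , inj₂ (inj₂ (inj₁ (Ub , t'))) , inj₁ (inj₂ ab))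
      ...     | s , s∈ , inj₂ refl = k (s , s∈ , inj₂ (inj₂ (inj₂ (Ua , t))) , inj₂ (inj₂ (inj₂ (Ub , t'))) , inj₁ (inj₂ ab))

      together : ∀ {a b} → U a → U b → Req U a b → ¬ ¬ Together a b
      together Ua Ub (inj₁ (inj₁ refl)) k = let s , s∈ , p = cov Ua in k (s , s∈ , p , p , inj₁ (inj₁ refl))
      together Ua Ub (inj₁ (inj₂ e)) = adjacent Ua Ub e
      together Ua Ub (inj₂ n) k = Localise.localise s₀ l cls n λ { (s , s∈ , m@(_ , _ , (_ , sx , sz , _) , _)) →
        k (s , s∈ , sx , sz , inj₂ m) }

      complete : (∀ s → Comp (Piece s) (Req (Piece s))) → Comp U (Req U)
      complete pieces ret = do
        f ← fin-choice {P = λ a → ∀ b → U a → U b → Req U a b → Together a b} λ a → fin-choice λ b k → do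
              yes (Ua , Ub , r) ← em (U a × U b × Req U a b)
                where no n → k λ Ua Ub r → ⊥-elim (n (Ua , Ub , r))
              t ← together Ua Ub r
              k λ _ _ _ → t
        c ← Fold.fold pieces u₀ su₀ chain
        ret (mono to-U (λ Up → let s , s∈ , p = cov Up in inj₂ (lose s∈ p))
               (λ a b r → let s , s∈ , t = f _ _ (to-U a) (to-U b) r in inj₂ (lose s∈ t)) c)
        where
        to-U : ∀ {p} → Fold.All-of pieces u₀ su₀ u₀ l p → U p
        to-U (inj₁ (inj₁ (Up , _))) = Up
        to-U (inj₁ (inj₂ (inj₁ (Up , _)))) = Up
        to-U (inj₁ (inj₂ (inj₂ (Up , _)))) = Up
        to-U (inj₂ i) = let s , _ , p = find i in piece-U s p

  -- The third spoke is the vertex by which the piece is smaller than `U`, as the induction demands.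
  piece-misses : ∀ s → ¬ Piece s (Sector.w s)
  piece-misses s (inj₁ c) = Sec.¬XB s (Sec.Cell⊂X s c) (Sector.w∈B s)
  piece-misses s (inj₂ (inj₁ h)) = hub-off h (Sec.B∈ s (Sector.w∈B s)) refl
  piece-misses s (inj₂ (inj₂ (inj₁ (_ , inj₁ e)))) = at (hol-≢ (Sector.isHol s)) (∈r (Sector.I s) (there (Sector.w∈B s))) (≡-sym e)
  piece-misses s (inj₂ (inj₂ (inj₁ (_ , inj₂ (o , _))))) = o (Sec.B∈ s (Sector.w∈B s)) refl
  piece-misses s (inj₂ (inj₂ (inj₂ (_ , inj₁ e)))) =
    ind-hd≢ (ind-drop (Sector.I s) (hol-ind (Sector.isHol s))) (Sector.w∈B s) (≡-sym e)
  piece-misses s (inj₂ (inj₂ (inj₂ (_ , inj₂ (o , _))))) = o (Sec.B∈ s (Sector.w∈B s)) refl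

  wheel-completion : ∀ {c d} → c ∈ C → d ∈ C → c ≢ d → y ~ c → y ~ d → ¬ Cut G U →
    (∀ (S : V → Set) w → (∀ {x} → S x → U x) → U w → ¬ S w → Comp S (Req S)) → Comp U (Req U)
  wheel-completion {c} {d} c∈ d∈ c≢d yc yd no-cut IH ret = do
      cov ← Cover.covered-all c sc l chain covers no-cut
      Cover.Final.complete c sc l chain covers no-cut cov
        (λ s → IH (Piece s) (Sector.w s) (piece-U s) (C⊂U (Sec.B∈ s (Sector.w∈B s))) (piece-misses s)) ret
    where
    sc : Spoke c
    sc = c∈ , yc
    open Rebase (rebase H₀ c∈)
    d∈P : d ∈ P'
    d∈P with to d∈
    ... | here e = ⊥-elim (c≢d (≡-sym e))
    ... | there i = i
    id≡ : P' ++ [] ≡ P'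
    id≡ = Listₚ.++-identityʳ P'
    whole : Sectors c c [] P'
    whole = sectors {c} {c} [] P' [] (subst (Hol c) (≡-sym id≡) isHol) (λ i → ∈≡ (to i) (cong (c ∷_) (≡-sym id≡)))
                   (λ i → from (∈≡ i (cong (c ∷_) id≡))) yc (λ ()) (inj₂ (refl , refl , d , d∈P , yd)) yc
    open Sectors whole
    covers : ∀ {h} → h ∈ C → Ints l h ⊎ Ends l h
    covers i = cover (to i)

-- Graphs with a hole but no proper wheel and no clique cutset

record ProperWheel {n : ℕ} (G : Graph n) (U : Fin n → Set) : Set where
  open Paths G
  field
    v : V
    P : List V
    isHol : Hol v P
    C⊂U : ∀ {h} → h ∈ v ∷ P → U h
    y : V
    Uy : U y
    y∉C : ∀ {h} → h ∈ v ∷ P → y ≢ h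
    c d : V
    c∈ : c ∈ v ∷ P
    d∈ : d ∈ v ∷ P
    c≢d : c ≢ d
    yc : y ~ c
    yd : y ~ d
    proper : ∀ {c d} → c ∈ v ∷ P → d ∈ v ∷ P → y ~ c → y ~ d → c ≁ d

-- Without proper wheels and clique cutsets, a graph with a hole is the hole with its
-- vertices blown up to cliques, plus a universal clique.
module BlownUpHole {n : ℕ} (G : Graph n) (cf : CapFree G) (ehf : EvenHoleFree G) (U : Paths.V G → Set)
             (v₀ : Paths.V G) (P₀ : List (Paths.V G)) (H₀ : Paths.Hol G v₀ P₀) (C⊂U : ∀ {h} → h ∈ v₀ ∷ P₀ → U h)
             (no-wheel : ¬ ProperWheel G U) (no-cut : ¬ Cut G U) where
  open Twins G cf ehf v₀ P₀ H₀
  open Completions G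
  open Detour G cf ehf using (Thin; Bypass)
  private module Comp = Component G

  Univ : V → Set
  Univ q = Off q × (∀ {h} → h ∈ C → q ~ h)

  Tw : V → Set
  Tw q = ∃ λ w → w ∈ C × Twin w q

  away : ∀ {a} → a ∈ C → ∃ λ b → ∃ λ c → b ∈ C × c ∈ C × a ~ b × a ~ c × b # c
  away a∈ with rebase H₀ a∈
  ... | record { isHol = hol {b} {L} {c} _ ab ac _ bc ; from = from } =
    b , c , from (there (here refl)) , from (∈m (_ ∷ b ∷ L)) , ab , ac , bc

  beyond : ∀ {a b} → a ∈ C → b ∈ C → a ~ b → ∃ λ c → c ∈ C × a ~ c × b # c
  beyond {a} {b} a∈ b∈ ab with rebase H₀ a∈
  ... | record { isHol = hol {p} {L} {q} ind ap aq aL pq ; from = from ; to = to } with to b∈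
  ...   | here refl = ⊥-elim (~⇒≢ ab refl)
  ...   | there (here refl) = q , from (∈m (a ∷ p ∷ L)) , aq , pq
  ...   | there (there i) with ∈-++ L i
  ...     | inj₁ j = ⊥-elim (~# ab (at aL j))
  ...     | inj₂ (here refl) = p , from (there (here refl)) , ap , #sym pq

  twin-same : ∀ {a b p q} → a ∈ C → b ∈ C → Twin a p → Twin b q → p ≡ q → a ≡ b
  twin-same {a} {b} {p} a∈ b∈ ta tb refl with cmp a b
  ... | inj₁ (inj₁ e) = e
  ... | inj₂ n = ⊥-elim (proj₁ (twin-twin a∈ b∈ n ta tb) refl)
  ... | inj₁ (inj₂ e) with beyond a∈ b∈ e
  ...   | c , c∈ , ac , bc = ⊥-elim (~# (twin-~ ta c∈ ac) (twin-# tb c∈ bc))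

  twin-near : ∀ {a b p q} → a ∈ C → b ∈ C → Twin a p → Twin b q → p ~ q → a ≡ b ⊎ a ~ b
  twin-near {a} {b} a∈ b∈ ta tb e with cmp a b
  ... | inj₁ f = f
  ... | inj₂ n = ⊥-elim (~# e (twin-twin a∈ b∈ n ta tb))

  twin-edge : ∀ {a b p q} → a ∈ C → b ∈ C → a ~ b → Twin a p → Twin b q → p ~ q
  twin-edge a∈ b∈ ab ta (inj₁ refl) = twin-~ ta b∈ ab
  twin-edge {a} {b} {p} {q} a∈ b∈ ab ta tb@(inj₂ (off , _)) with beyond b∈ a∈ (~sym ab)
  ... | c , c∈ , bc , ac = ~sym (trans (twin-see a∈ ta off q≢p c∈ (proj₁ (#sym ac)) (twin-~ tb c∈ bc)) (twin-~ tb a∈ (~sym ab)))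
    where
    q≢p : q ≢ p
    q≢p e = ~⇒≢ ab (twin-same a∈ b∈ ta tb (≡-sym e))

  twin-self : ∀ {a p q} → a ∈ C → Twin a p → Twin a q → p # q → ⊥
  twin-self a∈ tp tq n = ~# (twin-clique a∈ tp tq (proj₁ n)) n

  univ-twin : ∀ {z a p} → Univ z → a ∈ C → Twin a p → z ~ p
  univ-twin {z} {a} {p} (off , all) a∈ t with away a∈
  ... | b , c , b∈ , c∈ , ab , ac , bc = trans (twin-see a∈ t off z≢p b∈ (~⇒≢ (~sym ab)) (all b∈)) (all a∈)
    where
    z≢p : z ≢ p
    z≢p refl with beyond b∈ a∈ (~sym ab)
    ... | d , d∈ , _ , ad = ~# (all d∈) (twin-# t d∈ ad)

  univ-univ : ∀ {z z'} → Univ z → Univ z' → z # z' → ⊥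
  univ-univ (_ , f) (_ , g) n with away (here refl)
  ... | b , c , b∈ , c∈ , _ , _ , bc = no-C₄ (f b∈) (~sym (g b∈)) (g c∈) (~sym (f c∈)) n bc

  core-near : ∀ {p q} → Univ p ⊎ Tw p → Univ q → p # q → ⊥
  core-near (inj₁ u) u' = univ-univ u u'
  core-near (inj₂ (_ , w∈ , t)) u n = ~# (~sym (univ-twin u w∈ t)) n

  -- A vertex that sees an edge of the hole sees all of it or is a twin by `star`. One that sees two
  -- of its vertices but no edge would be the centre of a proper wheel.
  classify : ∀ {q} → U q → ¬ ¬ ((Univ q ⊎ Tw q) ⊎ Thin v₀ P₀ q)
  classify {q} Uq k with ∈? q C
  ... | inj₁ i = k (inj₁ (inj₂ (q , i , inj₁ refl)))
  ... | inj₂ q∉ = do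
      no ¬edge ← em (∃ λ c → ∃ λ d → (c ∈ C × d ∈ C) × c ~ d × q ~ c × q ~ d)
        where yes (c , d , (c∈ , d∈) , cd , qc , qd) → do
                no all ← em (∃ λ e → e ∈ C × q ≁ e)
                  where yes (e , e∈ , qe) → let m , st = star H₀ off c∈ d∈ cd qc qd e∈ qe in k (inj₁ (inj₂ (m , proj₁ st , star-twin off st)))
                k (inj₁ (inj₁ (off , λ {h} h∈ → case ~? q h of λ { (inj₁ e) → e ; (inj₂ e) → ⊥-elim (all (h , h∈ , e)) })))
      k (inj₂ (off , λ {c} {d} c∈ d∈ qc qd → case c Finₚ.≟ d of λ where
        (yes e) → e
        (no ne) → ⊥-elim (no-wheel (record { isHol = H₀ ; C⊂U = C⊂U ; y = q ; Uy = Uq ; y∉C = off ; c∈ = c∈ ; d∈ = d∈ ; c≢d = ne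
          ; yc = qc ; yd = qd ; proper = λ {a} {b} a∈ b∈ qa qb → ¬~ λ ab → ¬edge (a , b , (a∈ , b∈) , ab , qa , qb) }))))
    where
    off : Off q
    off i refl = q∉ i

  Missed : V → Set
  Missed x = U x × Thin v₀ P₀ x

  -- the bypass replaces w on the hole; w is then the centre of a proper wheel
  wheel-from : ∀ {v P} → Hol v P → (∀ {h} → h ∈ v ∷ P → U h) → (∀ {x} → Missed x → Thin v P x) → Bypass Missed v P → ⊥
  wheel-from {v} {P} h sub thin bp = go (isHol)
      (λ i → to i) (λ i → from i) (to a∈) (to b∈)
    where
    open Bypass bp renaming (thin to missed)
    open Rebase (rebase h w∈)
    build : ∀ L' → Hol w (a ∷ L' ++ b ∷ []) → (∀ {x} → x ∈ a ∷ L' ++ b ∷ [] → x ∈ v ∷ P) → ⊥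
    build L' hw sub' with hol-inv a L' b hw refl
    ... | _ , wL' , _ = no-wheel (record { isHol = O ; C⊂U = UO ; y = w ; Uy = sub w∈ ; y∉C = offw ; c∈ = here refl
          ; d∈ = there (∈l (∈m L')) ; c≢d = proj₁ a#b ; yc = w~a ; yd = w~b ; proper = λ c∈ d∈ wc wd → ¬~ λ cd → stable c∈ d∈ wc wd cd })
      where
      aL'b : Ind (a ∷ L' ++ b ∷ [])
      aL'b = hol-ind hw
      rpath : Ind (b ∷ reverse L ++ a ∷ [])
      rpath = subst Ind (trans (rev-snoc (a ∷ L)) (cong (b ∷_) (rev-cons a L))) (ind-rev _ path)
      cross : ∀ {c z} → c ∈ L' → z ∈ L → c # z
      cross {c} {z} i j = (λ { refl → proj₁ tz cC refl }) , ¬~ λ cz → case only j cC (~sym cz) of λ where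
          (inj₁ (inj₁ refl)) → ind-hd≢ aL'b (∈l i) refl
          (inj₁ (inj₂ refl)) → ind-hd≢ bL'a (∈l (∈-rev i)) refl
          -- A second common neighbour of `a` and `b` on the hole would form a 4-hole with `w`.
          (inj₂ (ca , cb)) → no-C₄ (~sym w~a) w~b (~sym cb) ca a#b (at wL' i)
        where
        tz = thin (at missed j)
        cC = sub' (there (∈l i))
        bL'a : Ind (b ∷ reverse L' ++ a ∷ [])
        bL'a = subst Ind (trans (rev-snoc (a ∷ L')) (cong (b ∷_) (rev-cons a L'))) (ind-rev _ aL'b)
      O : Hol a ((L' ++ b ∷ []) ++ reverse L)
      O = hol-cyc aL'b (proj₂ rpath) (subst Ind (≡-sym (snoc-assoc L'))
            (ind-join L' (proj₂ aL'b) (ind-take (b ∷ reverse L) rpath) λ i j → cross i (∈-rev⁻ j))) (∈m L') (∈-rev x∈)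
            λ i j aa ac → case ∈-++ L' i of λ where
              (inj₁ k) → cross k (∈-rev⁻ j)
              (inj₂ (here refl)) → ⊥-elim (~# aa a#b)
      sortO : ∀ {q} → q ∈ a ∷ (L' ++ b ∷ []) ++ reverse L → (q ≡ a ⊎ q ≡ b) ⊎ (q ∈ L' ⊎ q ∈ L)
      sortO (here e) = inj₁ (inj₁ e)
      sortO (there i) with ∈-++ (L' ++ b ∷ []) i
      ... | inj₂ j = inj₂ (inj₂ (∈-rev⁻ j))
      ... | inj₁ j with ∈-++ L' j
      ...   | inj₁ k = inj₂ (inj₁ k)
      ...   | inj₂ (here e) = inj₁ (inj₂ e)
      UO : ∀ {q} → q ∈ a ∷ (L' ++ b ∷ []) ++ reverse L → U q
      UO i with sortO i
      ... | inj₁ (inj₁ refl) = sub a∈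
      ... | inj₁ (inj₂ refl) = sub b∈
      ... | inj₂ (inj₁ k) = sub (sub' (there (∈l k)))
      ... | inj₂ (inj₂ k) = proj₁ (at missed k)
      offw : ∀ {q} → q ∈ a ∷ (L' ++ b ∷ []) ++ reverse L → w ≢ q
      offw i e with sortO i
      ... | inj₁ (inj₁ f) = ~⇒≢ w~a (trans e f)
      ... | inj₁ (inj₂ f) = ~⇒≢ w~b (trans e f)
      ... | inj₂ (inj₁ k) = proj₁ (at wL' k) e
      ... | inj₂ (inj₂ k) = proj₁ (thin (at missed k)) w∈ (≡-sym e)
      first-unseen : ∃ λ q → q ∈ L × w ≁ q
      first-unseen = go L id missed x∈ path
        where
        go : ∀ M → (∀ {z} → z ∈ M → z ∈ L) → All Missed M → x ∈ M → Ind (a ∷ M ++ b ∷ []) → ∃ λ q → q ∈ L × w ≁ q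
        go (q ∷ M) f (m ∷ _) _ ((aq , _) , _) = q , f (here refl) , ¬~ λ wq → ~⇒≢ w~a (proj₂ (thin m) w∈ a∈ (~sym wq) (~sym aq))
      -- The first vertex of `L` is missed by `w`, being thin and adjacent to `a`. So if `w` saw an
      -- edge of `O`, it would be a star, and its centre would be next to both `a` and `b`: not in
      -- `L'`, which `w` misses, and not in `L`, whose vertices are thin.
      stable : ∀ {c d} → c ∈ a ∷ (L' ++ b ∷ []) ++ reverse L → d ∈ a ∷ (L' ++ b ∷ []) ++ reverse L → w ~ c → w ~ d → c ~ d → ⊥
      stable c∈ d∈ wc wd cd with first-unseen
      ... | e , e∈ , we with star O offw c∈ d∈ cd wc wd (there (∈r (L' ++ b ∷ []) (∈-rev e∈))) we
      ...   | m , m∈ , wm , f , _ with f (here refl) w~a | f (there (∈l (∈m L'))) w~b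
      ...     | inj₁ refl | inj₁ e = proj₁ a#b (≡-sym e)
      ...     | inj₁ refl | inj₂ e = ~# (~sym e) a#b
      ...     | inj₂ e | inj₁ refl = ~# e a#b
      ...     | inj₂ am | inj₂ bm with sortO m∈
      ...       | inj₁ (inj₁ refl) = ~⇒≢ am refl
      ...       | inj₁ (inj₂ refl) = ~⇒≢ bm refl
      ...       | inj₂ (inj₁ k) = ~# wm (at wL' k)
      ...       | inj₂ (inj₂ k) = proj₁ a#b (proj₂ (thin (at missed k)) a∈ b∈ (~sym am) (~sym bm))
    go : ∀ {P'} → Hol w P' → (∀ {x} → x ∈ v ∷ P → x ∈ w ∷ P') → (∀ {x} → x ∈ w ∷ P' → x ∈ v ∷ P) → a ∈ w ∷ P' → b ∈ w ∷ P' → ⊥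
    go (hol {p} {L'} {q} ind wp wq wL pq) to from ia ib with end ia w~a | end ib w~b
      where
      end : ∀ {z} → z ∈ w ∷ p ∷ L' ++ q ∷ [] → w ~ z → z ≡ p ⊎ z ≡ q
      end (here refl) e = ⊥-elim (~⇒≢ e refl)
      end (there (here e)) _ = inj₁ e
      end (there (there i)) e with ∈-++ L' i
      ... | inj₁ j = ⊥-elim (~# e (at wL j))
      ... | inj₂ (here f) = inj₂ f
    ... | inj₁ refl | inj₁ refl = proj₁ a#b refl
    ... | inj₂ refl | inj₂ refl = proj₁ a#b refl
    ... | inj₁ refl | inj₂ refl = build L' (hol ind wp wq wL pq) (from ∘ there)
    ... | inj₂ refl | inj₁ refl = build (reverse L') (subst (Hol w) eq (hol-rev (hol ind wp wq wL pq)))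
            (λ i → from (there (∈-rev⁻ (∈≡ i (≡-sym eq)))))
      where
      eq : reverse (p ∷ L' ++ q ∷ []) ≡ q ∷ reverse L' ++ p ∷ []
      eq = trans (rev-snoc (p ∷ L')) (cong (q ∷_) (rev-cons p L'))

  module Around (p : V) (mp : Missed p) where
    D : V → Set
    D = Comp.Reachable Missed p

    N : V → Set
    N x = U x × ¬ Missed x × ∃ λ d → D d × x ~ d

    N-core : ∀ {x} → N x → ¬ ¬ (Univ x ⊎ Tw x)
    N-core (Ux , nm , _) k = classify Ux λ { (inj₁ c) → k c ; (inj₂ t) → nm (Ux , t) }

    twins-apart : ∀ {a' b'} → N a' → N b' → a' # b' → Tw a' → Tw b' → ⊥
    twins-apart {a'} {b'} (Ua , _ , d , Dd , e) (Ub , _ , d' , Dd' , e') n (a , a∈ , ta) (b , b∈ , tb) with cmp a b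
    ... | inj₁ (inj₁ refl) = twin-self a∈ ta tb n
    ... | inj₁ (inj₂ ab) = ~# (twin-edge a∈ b∈ ab ta tb) n
    ... | inj₂ ab = Detours.detour G cf ehf v₀ P₀ H₀ {T = Missed} proj₂ a∈ b∈ ab ta tb n (Comp.connect Dd Dd' e e') meet
      where
      meet : Detours.Result G cf ehf v₀ P₀ H₀ Missed a b a' b' → ⊥
      meet r = wheel-from isHol sub thin found
        where
        open Detours.Result r
        sub : ∀ {h} → h ∈ v ∷ P → U h
        sub i with kind i
        ... | inj₁ (inj₁ refl) = Ua
        ... | inj₁ (inj₂ refl) = Ub
        ... | inj₂ (j , _) = C⊂U j

    clique : ∀ {a b} → N a → N b → a # b → ⊥
    clique na nb n = do
      ca ← N-core na
      cb ← N-core nb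
      go ca cb
      where
      go : _ → _ → ⊥
      go (inj₁ u) cb = core-near cb u (#sym n)
      go (inj₂ t) (inj₁ u) = core-near (inj₂ t) u n
      go (inj₂ t) (inj₂ t') = twins-apart na nb n t t'

    cut : ⊥
    cut with away (here refl)
    ... | b , c , b∈ , c∈ , _ , _ , bc = do
        no ¬b ← em (N b)
          where yes nb → end c∈ λ nc → clique nb nc bc
        end b∈ ¬b
      where
      end : ∀ {e} → e ∈ C → ¬ N e → ⊥
      end e∈ ne = no-cut (record
        { D = D ; K = N ; D⊂ = λ d → proj₁ (Comp.reachable⊂ d) ; K⊂ = proj₁ ; c∈D = Comp.start mp ; e∈S = C⊂U e∈
        ; e∉D = λ d → proj₁ (proj₂ (Comp.reachable⊂ d)) e∈ refl ; e∉K = ne ; clique = clique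
        ; sep = λ {d} {x} Dd Ux e k → do
            no nm ← em (Missed x)
              where yes m → k (inj₁ (Comp.next Dd e m))
            k (inj₂ (Ux , nm , d , Dd , ~sym e)) })

  covered : ∀ {p} → U p → ¬ ¬ (Univ p ⊎ Tw p)
  covered Up k = classify Up λ { (inj₁ c) → k c ; (inj₂ t) → Around.cut _ (Up , t) }

  -- the fan of bags around the hole, all of them containing the classes of h₀ and h₁
  module Fan (h₀ h₁ : V) (h₀∈ : h₀ ∈ C) (h₁∈ : h₁ ∈ C) where

    Core : V → Set
    Core p = Univ p ⊎ (Twin h₀ p ⊎ Twin h₁ p)

    In : List V → V → Set
    In l p = U p × (Core p ⊎ ∃ λ r → r ∈ l × Twin r p)

    -- The pairs that share a bag. `front` is kept apart from `triple` because a bag meets the rest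
    -- of the fan in its last two classes, which are the front of that rest, so that the gluing
    -- condition is itself a pair of this relation.
    data Near : List V → V → V → Set where
      front : ∀ {r s l a b} → In (r ∷ s ∷ []) a → In (r ∷ s ∷ []) b → Near (r ∷ s ∷ l) a b
      triple : ∀ {r s t l a b} → In (r ∷ s ∷ t ∷ []) a → In (r ∷ s ∷ t ∷ []) b → Near (r ∷ s ∷ t ∷ l) a b
      skip : ∀ {r s l a b} → Near (s ∷ l) a b → Near (r ∷ s ∷ l) a b

    widen : ∀ {l l' a} → (∀ {r} → r ∈ l → r ∈ l') → In l a → In l' a
    widen f (Ua , inj₁ c) = Ua , inj₁ c
    widen f (Ua , inj₂ (r , i , t)) = Ua , inj₂ (r , f i , t)

    near-in : ∀ {l a b} → Near l a b → In l a × In l b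
    near-in (front a b) = widen f a , widen f b
      where
      f : ∀ {r s x : V} {l} → x ∈ r ∷ s ∷ [] → x ∈ r ∷ s ∷ l
      f (here e) = here e
      f (there (here e)) = there (here e)
    near-in (triple a b) = widen f a , widen f b
      where
      f : ∀ {r s t x : V} {l} → x ∈ r ∷ s ∷ t ∷ [] → x ∈ r ∷ s ∷ t ∷ l
      f (here e) = here e
      f (there (here e)) = there (here e)
      f (there (there (here e))) = there (there (here e))
    near-in (skip n) = let a , b = near-in n in widen there a , widen there b

    bag : ∀ r s t → r ∈ C → s ∈ C → t ∈ C → Comp (In (r ∷ s ∷ t ∷ [])) (λ _ _ → ⊤)
    bag r s t r∈ s∈ t∈ = leaf Cl (λ { (_ , inj₁ (inj₁ u)) k → k (fz , u) ; (_ , inj₁ (inj₂ (inj₁ t))) k → k (fs fz , t)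
                          ; (_ , inj₁ (inj₂ (inj₂ t))) k → k (fs (fs fz) , t) ; (_ , inj₂ (_ , here refl , t)) k → k (fs (fs (fs fz)) , t)
                          ; (_ , inj₂ (_ , there (here refl) , t)) k → k (fs (fs (fs (fs fz))) , t)
                          ; (_ , inj₂ (_ , there (there (here refl)) , t)) k → k (fs (fs (fs (fs (fs fz)))) , t) })
                        (λ {c} _ _ → clique {c})
      where
      Cl : Fin 6 → V → Set
      Cl fz = Univ
      Cl (fs fz) = Twin h₀
      Cl (fs (fs fz)) = Twin h₁
      Cl (fs (fs (fs fz))) = Twin r
      Cl (fs (fs (fs (fs fz)))) = Twin s
      Cl (fs (fs (fs (fs (fs fz))))) = Twin t
      clique : ∀ {c a b} → Cl c a → Cl c b → a # b → ⊥
      clique {fz} = univ-univ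
      clique {fs fz} = twin-self h₀∈
      clique {fs (fs fz)} = twin-self h₁∈
      clique {fs (fs (fs fz))} = twin-self r∈
      clique {fs (fs (fs (fs fz)))} = twin-self s∈
      clique {fs (fs (fs (fs (fs fz))))} = twin-self t∈

    fan : ∀ r s l → Ind (r ∷ s ∷ l) → (∀ {x} → x ∈ r ∷ s ∷ l → x ∈ C) → Comp (In (r ∷ s ∷ l)) (Near (r ∷ s ∷ l))
    fan r s [] p sub ret = do
        -- Only two classes are left, so one of them fills two places.
        c ← bag r s s (sub (here refl)) (sub (there (here refl))) (sub (there (here refl)))
        ret (mono (widen f) (widen g) (λ _ _ _ → tt) c)
      where
      f : ∀ {x} → x ∈ r ∷ s ∷ s ∷ [] → x ∈ r ∷ s ∷ []
      f (here e) = here e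
      f (there (here e)) = there (here e)
      f (there (there (here e))) = there (here e)
      g : ∀ {x} → x ∈ r ∷ s ∷ [] → x ∈ r ∷ s ∷ s ∷ []
      g (here e) = here e
      g (there i) = there (there i)
    fan r s (t ∷ l) p sub ret = do
        c₁ ← bag r s t (sub (here refl)) (sub (there (here refl))) (sub (there (there (here refl))))
        c₂ ← fan s t l (proj₂ p) (sub ∘ there)
        c₃ ← glue (λ _ _ _ _ → tt) (λ a a' b b' → front (inter a a') (inter b b')) c₁ c₂
        ret (mono (λ { (inj₁ i) → widen f i ; (inj₂ i) → widen there i }) split' req c₃)
      where
      f : ∀ {x} → x ∈ r ∷ s ∷ t ∷ [] → x ∈ r ∷ s ∷ t ∷ l
      f i = ∈l i
      split' : ∀ {a} → In (r ∷ s ∷ t ∷ l) a → In (r ∷ s ∷ t ∷ []) a ⊎ In (s ∷ t ∷ l) a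
      split' (Ua , inj₁ c) = inj₁ (Ua , inj₁ c)
      split' (Ua , inj₂ (q , here e , tq)) = inj₁ (Ua , inj₂ (q , here e , tq))
      split' (Ua , inj₂ (q , there i , tq)) = inj₂ (Ua , inj₂ (q , i , tq))
      inter : ∀ {a} → In (r ∷ s ∷ t ∷ []) a → In (s ∷ t ∷ l) a → In (s ∷ t ∷ []) a
      inter (Ua , inj₁ c) _ = Ua , inj₁ c
      inter (Ua , inj₂ (q , there i , tq)) _ = Ua , inj₂ (q , i , tq)
      inter (Ua , inj₂ (q , here e , tq)) (_ , inj₁ c) = Ua , inj₁ c
      inter (Ua , inj₂ (q , here refl , tq)) (_ , inj₂ (q' , j , tq')) =
        ⊥-elim (ind-hd≢ p j (twin-same (sub (here refl)) (sub (there j)) tq tq' refl))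
      front-triple : ∀ {a} → In (r ∷ s ∷ []) a → In (r ∷ s ∷ t ∷ []) a
      front-triple = widen λ { (here e) → here e ; (there (here e)) → there (here e) }
      req : ∀ {a b} → In (r ∷ s ∷ t ∷ []) a ⊎ In (s ∷ t ∷ l) a → In (r ∷ s ∷ t ∷ []) b ⊎ In (s ∷ t ∷ l) b → Near (r ∷ s ∷ t ∷ l) a b →
            (In (r ∷ s ∷ t ∷ []) a × In (r ∷ s ∷ t ∷ []) b × ⊤) ⊎ (In (s ∷ t ∷ l) a × In (s ∷ t ∷ l) b × Near (s ∷ t ∷ l) a b)
      req _ _ (front a b) = inj₁ (front-triple a , front-triple b , tt)
      req _ _ (triple a b) = inj₁ (a , b , tt)
      req _ _ (skip n) = let a , b = near-in n in inj₂ (a , b , n)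

    near-core : ∀ {r s l a b c} → c ∈ r ∷ s ∷ l → U a → U b → Core a → Twin c b → Near (r ∷ s ∷ l) a b × Near (r ∷ s ∷ l) b a
    near-core (here refl) Ua Ub ca tb = let x = Ua , inj₁ ca ; y = Ub , inj₂ (_ , here refl , tb) in front x y , front y x
    near-core (there (here refl)) Ua Ub ca tb = let x = Ua , inj₁ ca ; y = Ub , inj₂ (_ , there (here refl) , tb) in front x y , front y x
    near-core {l = t ∷ l} (there (there i)) Ua Ub ca tb = let x , y = near-core (there i) Ua Ub ca tb in skip x , skip y

    near-same : ∀ {r s l a b c} → c ∈ r ∷ s ∷ l → U a → U b → Twin c a → Twin c b → Near (r ∷ s ∷ l) a b
    near-same (here refl) Ua Ub ta tb = front (Ua , inj₂ (_ , here refl , ta)) (Ub , inj₂ (_ , here refl , tb))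
    near-same (there (here refl)) Ua Ub ta tb = front (Ua , inj₂ (_ , there (here refl) , ta)) (Ub , inj₂ (_ , there (here refl) , tb))
    near-same {l = t ∷ l} (there (there i)) Ua Ub ta tb = skip (near-same (there i) Ua Ub ta tb)

    near-edge : ∀ l {a b c d} → Ind l → c ∈ l → d ∈ l → c ~ d → U a → U b → Twin c a → Twin d b → Near l a b × Near l b a
    near-edge (r ∷ []) p (here refl) (here refl) cd = ⊥-elim (~⇒≢ cd refl)
    near-edge (r ∷ s ∷ l) p (here refl) (here refl) cd = ⊥-elim (~⇒≢ cd refl)
    near-edge (r ∷ s ∷ l) p (here refl) (there (here refl)) cd Ua Ub ta tb =
      let x = Ua , inj₂ (_ , here refl , ta) ; y = Ub , inj₂ (_ , there (here refl) , tb) in front x y , front y x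
    near-edge (r ∷ s ∷ l) p (there (here refl)) (here refl) cd Ua Ub ta tb =
      let y = Ub , inj₂ (_ , here refl , tb) ; x = Ua , inj₂ (_ , there (here refl) , ta) in front x y , front y x
    near-edge (r ∷ s ∷ l) ((_ , p) , _) (here refl) (there (there i)) cd = ⊥-elim (~# cd (at p i))
    near-edge (r ∷ s ∷ l) ((_ , p) , _) (there (there i)) (here refl) cd = ⊥-elim (~# (~sym cd) (at p i))
    near-edge (r ∷ s ∷ l) (_ , p) (there i) (there j) cd Ua Ub ta tb =
      let x , y = near-edge (s ∷ l) p i j cd Ua Ub ta tb in skip x , skip y

    near-two : ∀ l {a b c d e} → Ind l → c ∈ l → e ∈ l → d ∈ l → c ~ e → e ~ d → c ≢ d → U a → U b → Twin c a → Twin d b → Near l a b × Near l b a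
    near-two (r ∷ []) p (here refl) (here refl) _ ce = ⊥-elim (~⇒≢ ce refl)
    near-two (r ∷ s ∷ l) p (here refl) (here refl) _ ce = ⊥-elim (~⇒≢ ce refl)
    near-two (r ∷ s ∷ l) p _ (here refl) (here refl) _ ed = ⊥-elim (~⇒≢ ed refl)
    near-two (r ∷ s ∷ l) p (here refl) _ (here refl) _ _ ne = ⊥-elim (ne refl)
    near-two (r ∷ s ∷ l) ((_ , p) , _) (here refl) (there (there j)) _ ce = ⊥-elim (~# ce (at p j))
    near-two (r ∷ s ∷ l) ((_ , p) , _) (there (there i)) (here refl) _ ce = ⊥-elim (~# (~sym ce) (at p i))
    near-two (r ∷ s ∷ l) ((_ , p) , _) _ (here refl) (there (there k)) _ ed = ⊥-elim (~# ed (at p k))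
    near-two (r ∷ s ∷ l) ((_ , p) , _) _ (there (there j)) (here refl) _ ed = ⊥-elim (~# (~sym ed) (at p j))
    near-two (r ∷ s ∷ l) p (there (here refl)) (here refl) (there (here refl)) _ _ ne = ⊥-elim (ne refl)
    near-two (r ∷ s ∷ l) p (here refl) (there (here refl)) (there (here refl)) _ ed = ⊥-elim (~⇒≢ ed refl)
    near-two (r ∷ s ∷ l) p (there (here refl)) (there (here refl)) (here refl) ce = ⊥-elim (~⇒≢ ce refl)
    near-two (r ∷ s ∷ t ∷ l) p (here refl) (there (here refl)) (there (there (here refl))) _ _ _ Ua Ub ta tb =
      let x = Ua , inj₂ (_ , here refl , ta) ; y = Ub , inj₂ (_ , there (there (here refl)) , tb) in triple x y , triple y x
    near-two (r ∷ s ∷ t ∷ l) (_ , (_ , p) , _) (here refl) (there (here refl)) (there (there (there k))) _ ed = ⊥-elim (~# ed (at p k))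
    near-two (r ∷ s ∷ t ∷ l) p (there (there (here refl))) (there (here refl)) (here refl) _ _ _ Ua Ub ta tb =
      let y = Ub , inj₂ (_ , here refl , tb) ; x = Ua , inj₂ (_ , there (there (here refl)) , ta) in triple x y , triple y x
    near-two (r ∷ s ∷ t ∷ l) (_ , (_ , p) , _) (there (there (there k))) (there (here refl)) (here refl) ce = ⊥-elim (~# (~sym ce) (at p k))
    near-two (r ∷ s ∷ l) (_ , p) (there i) (there j) (there k) ce ed ne Ua Ub ta tb =
      let x , y = near-two (s ∷ l) p i j k ce ed ne Ua Ub ta tb in skip x , skip y

  -- The fan runs along the hole without `v₀`, and every bag contains the classes of `v₀` and of its
  -- neighbour `a`. For a nice pair, the vertex closing the witness hole is a twin of some `e`, and
  -- the pair lies in the two classes next to `e`. If `e` is `v₀`, one of these is the class of `a`;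
  -- otherwise a class of the pair is that of `v₀`, or the three classes are consecutive in the fan.
  blown-up-completion : Comp U (Req U)
  blown-up-completion ret = fin-choice {P = λ p → U p → Univ p ⊎ Tw p} (λ p k → do
      yes Up ← em (U p)
        where no n → k λ u → ⊥-elim (n u)
      c ← covered Up
      k λ _ → c) λ cov → go cov H₀ there (λ { (here e) → inj₁ e ; (there i) → inj₂ i })
    where
    go : (∀ p → U p → Univ p ⊎ Tw p) → ∀ {P} → Hol v₀ P → (∀ {x} → x ∈ P → x ∈ C) → (∀ {x} → x ∈ C → x ≡ v₀ ⊎ x ∈ P) → ⊥
    go cov (hol {a} {[]} {b} ((e , _) , _) va vb vL ab) sub all = ~# e ab
    go cov (hol {a} {c ∷ L} {b} ind va vb vL ab) sub all = do
        f ← fan a c (L ++ b ∷ []) ind sub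
        ret (mono proj₁ (λ Up → Up , slot Up) near f)
      where
      open Fan v₀ a (here refl) (sub (here refl))
      l = a ∷ c ∷ L ++ b ∷ []
      slot : ∀ {p} → U p → Core p ⊎ ∃ λ r → r ∈ l × Twin r p
      slot Up with cov _ Up
      ... | inj₁ u = inj₁ (inj₁ u)
      ... | inj₂ (w , w∈ , t) with all w∈
      ...   | inj₁ refl = inj₁ (inj₂ (inj₁ t))
      ...   | inj₂ i = inj₂ (w , i , t)
      ends : ∀ {r} → r ∈ l → v₀ ~ r → r ≡ a ⊎ r ≡ b
      ends (here e) _ = inj₁ e
      ends (there i) e with ∈-++ (c ∷ L) i
      ... | inj₁ j = ⊥-elim (~# e (at vL j))
      ... | inj₂ (here f) = inj₂ f
      near-nice : ∀ {x z r r'} → U x → U z → r ∈ l → Twin r x → r' ∈ l → Twin r' z → Nice U x z → Near l x z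
      near-nice {x} {z} {r} {r'} Ux Uz i tx j tz (v , K , (Uv , _ , _ , UK) , h , _) with hol-inv x K z h refl
      ... | vz , vK , xz with cov v Uv
      ...   | inj₁ u = ⊥-elim (inner K UK vK (hol-ind h))
        where
        inner : ∀ K → All U K → All (v #_) K → Ind (x ∷ K ++ z ∷ []) → ⊥
        inner [] _ _ ((e , _) , _) = ~# e xz
        inner (k ∷ K) (Uk ∷ _) (vk ∷ _) _ = core-near (cov k Uk) u (#sym vk)
      ...   | inj₂ (e , e∈ , te) with twin-near (sub i) e∈ tx te (~sym (hol-hd h)) | twin-near (sub j) e∈ tz te (~sym vz)
      ...     | inj₁ refl | inj₁ refl = ⊥-elim (twin-self (sub i) tx tz xz)
      ...     | inj₁ refl | inj₂ f = ⊥-elim (~# (twin-edge (sub i) (sub j) (~sym f) tx tz) xz)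
      ...     | inj₂ f | inj₁ refl = ⊥-elim (~# (twin-edge (sub i) (sub j) f tx tz) xz)
      ...     | inj₂ f | inj₂ g with r Finₚ.≟ r' | all e∈
      ...       | yes refl | _ = ⊥-elim (twin-self (sub i) tx tz xz)
      ...       | no ne | inj₂ k = proj₁ (near-two l ind i k j f (~sym g) ne Ux Uz tx tz)
      ...       | no ne | inj₁ refl with ends i (~sym f) | ends j (~sym g)
      ...         | inj₁ refl | _ = proj₁ (near-core j Ux Uz (inj₂ (inj₂ tx)) tz)
      ...         | inj₂ _ | inj₁ refl = proj₂ (near-core i Uz Ux (inj₂ (inj₂ tz)) tx)
      ...         | inj₂ p | inj₂ q = ⊥-elim (ne (trans p (≡-sym q)))
      near : ∀ {x z} → In l x → In l z → Req U x z → Near l x z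
      near (Ux , inj₁ cx) (Uz , inj₁ cz) _ = front (Ux , inj₁ cx) (Uz , inj₁ cz)
      near (Ux , inj₁ cx) (Uz , inj₂ (r , i , t)) _ = proj₁ (near-core i Ux Uz cx t)
      near (Ux , inj₂ (r , i , t)) (Uz , inj₁ cz) _ = proj₂ (near-core i Uz Ux cz t)
      near (Ux , inj₂ (r , i , tx)) (Uz , inj₂ (r' , j , tz)) (inj₁ (inj₁ refl)) with twin-same (sub i) (sub j) tx tz refl
      ... | refl = near-same i Ux Uz tx tz
      near (Ux , inj₂ (r , i , tx)) (Uz , inj₂ (r' , j , tz)) (inj₁ (inj₂ e)) with twin-near (sub i) (sub j) tx tz e
      ... | inj₁ refl = near-same i Ux Uz tx tz
      ... | inj₂ f = proj₁ (near-edge l ind i j f Ux Uz tx tz)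
      near (Ux , inj₂ (r , i , tx)) (Uz , inj₂ (r' , j , tz)) (inj₂ n) = near-nice Ux Uz i tx j tz n

-- Clique cutsets and the induction on the vertex set

module Decomposition {n : ℕ} (G : Graph n) (cf : CapFree G) (ehf : EvenHoleFree G) where
  open Free G cf ehf
  open Completions G
  open Detour G cf ehf using (Rebase; rebase)

  data Linked : V → List V → Set where
    []  : ∀ {c} → Linked c []
    _∷_ : ∀ {c a l} → c ~ a → Linked a l → Linked c (a ∷ l)

  ind-linked : ∀ {a l} → Ind (a ∷ l) → Linked a l
  ind-linked {l = []} p = []
  ind-linked {l = x ∷ l} ((e , _) , p) = e ∷ ind-linked p

  hol-linked : ∀ {v P} → Hol v P → Linked v P
  hol-linked (hol p va _ _ _) = va ∷ ind-linked p

  private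
    Known : (S : V → Set) → Set₁
    Known S = ∀ (S' : V → Set) w → (∀ {x} → S' x → S x) → S w → ¬ S' w → Comp S' (Req S')

  module CutStep (S : V → Set) (cut : Cut G S) (IH : Known S) where
    open Cut cut

    leave : ∀ A {c d B} → D c → ¬ D d → ¬ K d → Linked c (A ++ d ∷ B) → (∀ {x} → x ∈ A ++ d ∷ B → S x) → ¬ ¬ (∃ λ k → k ∈ A × K k)
    leave [] Dc nd nk (e ∷ _) sub ret = sep Dc (sub (here refl)) e λ { (inj₁ d) → nd d ; (inj₂ k) → nk k }
    leave (a ∷ A) Dc nd nk (e ∷ w) sub ret = sep Dc (sub (here refl)) e λ where
      (inj₂ k) → ret (a , here refl , k)
      (inj₁ Da) → leave A Da nd nk w (sub ∘ there) λ (k , i , Kk) → ret (k , there i , Kk)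

    -- Going around the hole in both directions from `c` to `d` meets `K` twice, at vertices that
    -- `d` keeps nonadjacent.
    no-cross : ∀ {v P c d} → Hol v P → (∀ {x} → x ∈ v ∷ P → S x) → c ∈ v ∷ P → D c → d ∈ v ∷ P → ¬ D d → ¬ K d → ⊥
    no-cross {c = c} {d} h sub c∈ Dc d∈ nd nk = go isHol (to d∈) (sub ∘ from)
      where
      open Rebase (rebase h c∈)
      go : ∀ {P} → Hol c P → d ∈ c ∷ P → (∀ {x} → x ∈ c ∷ P → S x) → ⊥
      go h (here refl) sub = nd Dc
      go h (there i) sub with split∈ i
      ... | split A B = do
        (k , i , Kk) ← leave A Dc nd nk (hol-linked h) (sub ∘ there)
        (k' , i' , Kk') ← leave (reverse B) Dc nd nk (subst (Linked c) (rev-mid A) (hol-linked (hol-rev h)))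
                            (λ j → sub (there (∈-rev⁻ (∈≡ j (≡-sym (rev-mid A))))))
        clique Kk Kk' (ind-cross A (hol-ind h) i (∈-rev⁻ i'))

    S₁ S₂ : V → Set
    S₁ x = D x ⊎ K x
    S₂ x = S x × ¬ D x

    S₁⊂ : ∀ {x} → S₁ x → S x
    S₁⊂ (inj₁ d) = D⊂ d
    S₁⊂ (inj₂ k) = K⊂ k

    in-K : ∀ {x} → S₁ x → S₂ x → K x
    in-K (inj₁ d) (_ , n) = ⊥-elim (n d)
    in-K (inj₂ k) _ = k

    joined : ∀ {S' : V → Set} {a b} → K a → K b → Req S' a b
    joined ka kb with cmp _ _
    ... | inj₁ e = inj₁ e
    ... | inj₂ n = ⊥-elim (clique ka kb n)

    Side : V → V → Set
    Side a b = (S₁ a × S₁ b × Req S₁ a b) ⊎ (S₂ a × S₂ b × Req S₂ a b)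

    -- The parity clause ranges over the paths inside the set, so it only gets weaker in a smaller
    -- one; just the witness hole has to be contained.
    inherit : ∀ {S' a b} → (∀ {x} → S' x → S x) → (n : Nice S a b) → (∀ {x} → x ∈ proj₁ n ∷ a ∷ proj₁ (proj₂ n) ++ b ∷ [] → S' x) → Nice S' a b
    inherit {a = a} f (v , L , _ , h , odd) sub = v , L ,
      (sub (here refl) , sub (there (here refl)) , sub (∈m (v ∷ a ∷ L)) , tab (λ i → sub (there (there (∈l i))))) , h ,
      λ K sK → odd K (All.map f sK)

    side : (∀ x → Dec (D x)) → (∀ x → Dec (K x)) → ∀ {a b} → S a → S b → Req S a b → ¬ ¬ Side a b
    side D? K? {a} {b} Sa Sb (inj₁ (inj₁ refl)) k with D? a
    ... | yes d = k (inj₁ (inj₁ d , inj₁ d , inj₁ (inj₁ refl)))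
    ... | no d = k (inj₂ ((Sa , d) , (Sb , d) , inj₁ (inj₁ refl)))
    side D? K? {a} {b} Sa Sb (inj₁ (inj₂ e)) k with D? a | D? b
    ... | yes d | _ = sep d Sb e λ s → k (inj₁ (inj₁ d , s , inj₁ (inj₂ e)))
    ... | no _ | yes d = sep d Sa (~sym e) λ s → k (inj₁ (s , inj₁ d , inj₁ (inj₂ e)))
    ... | no d | no d' = k (inj₂ ((Sa , d) , (Sb , d') , inj₁ (inj₂ e)))
    side D? K? {a} {b} Sa Sb (inj₂ nice@(v , L , (Sv , _ , _ , SL) , h , _)) k = do
        yes (c , c∈ , Dc) ← em (∃ λ c → c ∈ Ω × D c)
          where no n → k (inj₂ ((Sa , λ d → n (a , a∈ , d)) , (Sb , λ d → n (b , b∈ , d)) , inj₂ (inherit proj₁ nice λ i → sub i , λ d → n (_ , i , d))))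
        no ¬out ← em (∃ λ c → c ∈ Ω × ¬ D c × ¬ K c)
          where yes (d , d∈ , nd , nk) → no-cross h sub c∈ Dc d∈ nd nk
        let inside : ∀ {x} → x ∈ Ω → S₁ x
            inside {x} i = case D? x of λ where
              (yes d) → inj₁ d
              (no nd) → case K? x of λ where
                (yes q) → inj₂ q
                (no nq) → ⊥-elim (¬out (x , i , nd , nq))
        k (inj₁ (inside a∈ , inside b∈ , inj₂ (inherit S₁⊂ nice inside)))
      where
      Ω = v ∷ a ∷ L ++ b ∷ []
      a∈ : a ∈ Ω
      a∈ = there (here refl)
      b∈ : b ∈ Ω
      b∈ = ∈m (v ∷ a ∷ L)
      sub : ∀ {x} → x ∈ Ω → S x
      sub (here refl) = Sv
      sub (there (here refl)) = Sa
      sub (there (there i)) with ∈-++ L i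
      ... | inj₁ j = at SL j
      ... | inj₂ (here refl) = Sb

    completion : Comp S (Req S)
    completion ret = do
      D? ← decAll D
      K? ← decAll K
      f ← fin-choice {P = λ a → ∀ b → S a → S b → Req S a b → Side a b} λ a → fin-choice λ b k → do
            yes (Sa , Sb , r) ← em (S a × S b × Req S a b)
              where no n → k λ Sa Sb r → ⊥-elim (n (Sa , Sb , r))
            t ← side D? K? Sa Sb r
            k λ _ _ _ → t
      c₁ ← IH S₁ e S₁⊂ e∈S λ { (inj₁ d) → e∉D d ; (inj₂ k) → e∉K k }
      c₂ ← IH S₂ c proj₁ (D⊂ c∈D) λ { (_ , n) → n c∈D }
      c₃ ← glue (λ a a' b b' → joined (in-K a a') (in-K b b')) (λ a a' b b' → joined (in-K a a') (in-K b b')) c₁ c₂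
      ret (mono (λ { (inj₁ s) → S₁⊂ s ; (inj₂ s) → proj₁ s })
             (λ {x} Sx → case D? x of λ { (yes d) → inj₁ (inj₁ d) ; (no d) → inj₂ (Sx , d) })
             (λ {a} {b} sa sb r → f a b (back sa) (back sb) r) c₃)
      where
      back : ∀ {x} → S₁ x ⊎ S₂ x → S x
      back (inj₁ s) = S₁⊂ s
      back (inj₂ s) = proj₁ s

  HoleIn : (V → Set) → Set
  HoleIn S = Σ V λ v → Σ (List V) λ P → Hol v P × (∀ {x} → x ∈ v ∷ P → S x)

  -- the neighbours of a component of S − N[x] are a clique, otherwise x lies on a hole
  complete-graph : ∀ S → ¬ Cut G S → ¬ HoleIn S → ∀ {x z} → S x → S z → x # z → ⊥
  complete-graph S no-cut no-hole {x} {z} Sx Sz xz = no-cut (record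
      { D = Reachable W z ; K = N ; D⊂ = λ d → proj₁ (reachable⊂ d) ; K⊂ = proj₁ ; c∈D = start (Sz , xz) ; e∈S = Sx
      ; e∉D = λ d → proj₁ (proj₂ (reachable⊂ d)) refl ; e∉K = λ (_ , e , _) → ~⇒≢ e refl ; clique = clique ; sep = sep })
    where
    open Component G
    W N : V → Set
    W p = S p × x # p
    N q = S q × x ~ q × ∃ λ d → Reachable W z d × q ~ d
    clique : ∀ {a b} → N a → N b → a # b → ⊥
    clique {a} {b} (Sa , xa , d , r , e) (Sb , xb , d' , r' , e') ab with induce (connect r r' e e')
    ... | inj₁ f = proj₁ ab f
    ... | inj₂ (L , WL , p) = no-hole (x , a ∷ L ++ b ∷ [] , hol p xa xb (All.map proj₂ WL) ab , λ where
      (here refl) → Sx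
      (there (here refl)) → Sa
      (there (there i)) → case ∈-++ L i of λ { (inj₁ j) → proj₁ (at WL j) ; (inj₂ (here refl)) → Sb })
    sep : ∀ {d y} → Reachable W z d → S y → d ~ y → ¬ ¬ (Reachable W z y ⊎ N y)
    sep {d} {y} r Sy e k with cmp x y
    ... | inj₂ n = k (inj₁ (next r e (Sy , n)))
    ... | inj₁ (inj₂ xy) = k (inj₂ (Sy , xy , d , r , ~sym e))
    ... | inj₁ (inj₁ refl) = ~# (~sym e) (proj₂ (reachable⊂ r))

  completion : ∀ k (l : List V) → length l ≤ k → ∀ (S : V → Set) → (∀ {x} → S x → x ∈ l) → Comp S (Req S)
  completion k l le S S⊂l ret = do
      no no-cut ← em (Cut G S)
        where yes cut → CutStep.completion S cut (IH k le) ret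
      no no-wheel ← em (ProperWheel G S)
        where yes w → by-wheel no-cut w
      no no-hole ← em (HoleIn S)
        where yes (v , P , h , sub) → BlownUpHole.blown-up-completion G cf ehf S v P h sub no-wheel no-cut ret
      -- The remaining set is a clique and serves as each of the six.
      leaf {S} (λ _ → S) (λ s k → k (fz , s)) (λ Sa Sb _ _ → complete-graph S no-cut no-hole Sa Sb)
        λ c → ret (mono id id (λ _ _ _ → tt) c)
    where
    IH : ∀ k → length l ≤ k → Known S
    IH k le S' w S'⊂ Sw nw with split∈ (S⊂l Sw)
    IH zero le S' w S'⊂ Sw nw | split A B = ⊥-elim (case subst (_≤ 0) (trans (Listₚ.length-++ A) (ℕₚ.+-suc _ _)) le of λ ())
    IH (suc k) le S' w S'⊂ Sw nw | split A B = completion k (A ++ B) (ℕₚ.≤-pred (subst (_≤ suc k)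
        (trans (Listₚ.length-++ A) (trans (ℕₚ.+-suc _ _) (cong suc (≡-sym (Listₚ.length-++ A))))) le)) S' λ {x} s →
          case ∈-++ A (S⊂l (S'⊂ s)) of λ where
            (inj₁ i) → ∈l i
            (inj₂ (here refl)) → ⊥-elim (nw s)
            (inj₂ (there i)) → ∈r A i
    by-wheel : ¬ Cut G S → ProperWheel G S → ⊥
    by-wheel no-cut w = Wheel.wheel-completion G cf ehf S v P isHol C⊂U y Uy y∉C proper c∈ d∈ c≢d yc yd no-cut (λ S' → IH k le S') ret
      where
      open ProperWheel w

-- Decidable tree decompositions and the removal of double negation

mem? : ∀ {n} (x : Fin n) l → Dec (x ∈ l)
mem? = DecMembership._∈?_ Finₚ._≟_

Searchable : Set → Set₁
Searchable A = ∀ {P : A → Set} → (∀ a → Dec (P a)) → Dec (∃ P)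

search-Bool : Searchable Bool
search-Bool P? with P? true | P? false
... | yes p | _ = yes (true , p)
... | no _ | yes p = yes (false , p)
... | no p | no q = no λ { (true , r) → p r ; (false , r) → q r }

search-Vec : ∀ {A} → Searchable A → ∀ m → Searchable (Vec A m)
search-Vec s zero P? = map′ (λ p → [] , p) (λ { ([] , p) → p }) (P? [])
search-Vec s (suc m) P? = map′ (λ { (a , v , p) → a ∷ v , p }) (λ { (a ∷ v , p) → a , v , p })
  (s λ a → search-Vec s m λ v → P? (a ∷ v))

all-Vec? : ∀ {A} → Searchable A → ∀ m {P : Vec A m → Set} → (∀ v → Dec (P v)) → Dec (∀ v → P v)
all-Vec? s m P? with search-Vec s m (λ v → ¬? (P? v))
... | yes (v , np) = no λ f → np (f v)
... | no n = yes λ v → decidable-stable (P? v) λ np → n (v , np)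

module TreeDecomposition {n : ℕ} (G : Graph n) where
  open Paths G

  -- N x lists the neighbours of x in the chordal graph that are eliminated later than x
  Bag : (V → V → Bool) → V → V → Set
  Bag N x j = j ≡ x ⊎ N x j ≡ true

  -- The alternative makes the bags a forest: all later neighbours of `x` are contained in the bag
  -- of a later parent `p`, unless there are none.
  data Elim (N : V → V → Bool) : List V → Set where
    []   : Elim N []
    elim : ∀ {x l} → x ∉ l → (∀ j → N x j ≡ true → j ∈ l) →
           ((∀ j → N x j ≡ false) ⊎ ∃ λ p → p ∈ l × (∀ j → N x j ≡ true → Bag N p j)) → Elim N l → Elim N (x ∷ l)

  -- Boolean data throughout, and `small` quantifies over vectors instead of functions, so that
  -- `tree?` can decide it by exhaustive search.
  record Tree (N : V → V → Bool) (l : List V) : Set where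
    constructor tree
    field
      isElim : Elim N l
      all : ∀ x → x ∈ l
      edges : ∀ a b → a ~ b → N a b ≡ true ⊎ N b a ≡ true
      small : ∀ x (v : Vec V 7) → (∀ i → Bag N x (Vec.lookup v i)) → ¬ (∀ i j → i ≢ j → Vec.lookup v i # Vec.lookup v j)

  bag? : ∀ N x j → Dec (Bag N x j)
  bag? N x j = (j Finₚ.≟ x) ⊎-dec (N x j ≟ᵇ true)

  elim? : ∀ N l → Dec (Elim N l)
  elim? N [] = yes []
  elim? N (x ∷ l) = map′ (λ (a , b , c , d) → elim a b c d) (λ { (elim a b c d) → a , b , c , d })
    (¬? (mem? x l) ×-dec (Finₚ.all? (λ j → (N x j ≟ᵇ true) →-dec mem? j l) ×-dec
      ((Finₚ.all? (λ j → N x j ≟ᵇ false) ⊎-dec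
        Finₚ.any? (λ p → mem? p l ×-dec Finₚ.all? (λ j → (N x j ≟ᵇ true) →-dec bag? N p j))) ×-dec elim? N l)))

  tree? : ∀ N l → Dec (Tree N l)
  tree? N l = map′ (λ (a , b , c , d) → tree a b c d) (λ { (tree a b c d) → a , b , c , d })
    (elim? N l ×-dec (Finₚ.all? (λ x → mem? x l) ×-dec
      (Finₚ.all? (λ a → Finₚ.all? λ b → (adj G a b ≟ᵇ true) →-dec ((N a b ≟ᵇ true) ⊎-dec (N b a ≟ᵇ true))) ×-dec
        Finₚ.all? (λ x → all-Vec? Finₚ.any? 7 λ v → Finₚ.all? (λ i → bag? N x (Vec.lookup v i)) →-dec
          ¬? (Finₚ.all? λ i → Finₚ.all? λ j → ¬? (i Finₚ.≟ j) →-dec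
            (¬? (Vec.lookup v i Finₚ.≟ Vec.lookup v j) ×-dec (adj G (Vec.lookup v i) (Vec.lookup v j) ≟ᵇ false)))))))

  elim-cong : ∀ {N N' l} → (∀ {a} → a ∈ l → ∀ j → N a j ≡ N' a j) → Elim N l → Elim N' l
  elim-cong f [] = []
  elim-cong {N} {N'} f (elim x∉ down par e) = elim x∉ (λ j p → down j (trans (f (here refl) j) p))
    (case par of λ where
      (inj₁ g) → inj₁ λ j → trans (≡-sym (f (here refl) j)) (g j)
      (inj₂ (p , p∈ , g)) → inj₂ (p , p∈ , λ j q → case g j (trans (f (here refl) j) q) of λ where
        (inj₁ e) → inj₁ e
        (inj₂ r) → inj₂ (trans (≡-sym (f (there p∈) j)) r)))
    (elim-cong (f ∘ there) e)

  elim-unique : ∀ {N l} → Elim N l → ∀ i j → lookup l i ≡ lookup l j → i ≡ j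
  elim-unique (elim x∉ _ _ e) fz fz _ = refl
  elim-unique (elim x∉ _ _ e) fz (fs j) eq = ⊥-elim (x∉ (subst (_∈ _) (≡-sym eq) (∈ₚ.∈-lookup j)))
  elim-unique (elim x∉ _ _ e) (fs i) fz eq = ⊥-elim (x∉ (subst (_∈ _) eq (∈ₚ.∈-lookup i)))
  elim-unique (elim x∉ _ _ e) (fs i) (fs j) eq = cong fs (elim-unique e i j eq)

  -- An elimination order has no repetitions. This bounds the lists among which `tree-stable` has to
  -- search.
  elim-length : ∀ {N l} → Elim N l → length l ≤ n
  elim-length {N} {l} e = Finₚ.injective⇒≤ {f = lookup l} (λ {i} {j} → elim-unique e i j)

  Matrix : Vec (Vec Bool n) n → V → V → Bool
  Matrix M x j = Vec.lookup (Vec.lookup M x) j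

  tree-stable : ¬ ¬ (∃ λ N → ∃ λ l → Tree N l) → ∃ λ N → ∃ λ l → Tree N l
  tree-stable nn = let M , m , v , t = decidable-stable (search-Vec (search-Vec search-Bool n) n λ M → Finₚ.any? λ m →
                         search-Vec Finₚ.any? (toℕ {suc n} m) λ v → tree? (Matrix M) (toList v)) found in Matrix M , toList v , t
    where
    found : ¬ ¬ (∃ λ M → Σ (Fin (suc n)) λ m → Σ (Vec V (toℕ m)) λ v → Tree (Matrix M) (toList v))
    found k = nn λ (N , l , tree e a ed sm) →
      let M = Vec.tabulate λ x → Vec.tabulate (N x)
          eq : ∀ x j → N x j ≡ Matrix M x j
          eq x j = ≡-sym (trans (cong (λ w → Vec.lookup w j) (Vecₚ.lookup∘tabulate (λ x → Vec.tabulate (N x)) x)) (Vecₚ.lookup∘tabulate (N x) j))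
          m = fromℕ< (s≤s (elim-length e))
          len : length l ≡ toℕ m
          len = ≡-sym (Finₚ.toℕ-fromℕ< (s≤s (elim-length e)))
          w = subst (Vec V) len (fromList l)
          lw : toList w ≡ l
          lw = cast-list len (fromList l) (Vecₚ.toList∘fromList l)
      in k (M , m , w , tree (subst (Elim (Matrix M)) (≡-sym lw) (elim-cong (λ _ → eq _) e)) (λ x → ∈≡ (a x) (≡-sym lw))
          (λ a b ab → case ed a b ab of λ { (inj₁ p) → inj₁ (trans (≡-sym (eq a b)) p) ; (inj₂ p) → inj₂ (trans (≡-sym (eq b a)) p) })
          λ x v f → sm x v λ i → case f i of λ { (inj₁ p) → inj₁ p ; (inj₂ p) → inj₂ (trans (eq x _) p) })
      where
      cast-list : ∀ {a b} (e : a ≡ b) (v : Vec V a) {l} → toList v ≡ l → toList (subst (Vec V) e v) ≡ l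
      cast-list refl v e = e

  open Completions G

  module FromCompletion {S : V → Set} {Q : V → V → Set} (c : Completion S Q) (R? : ∀ a b → Dec (Completion.R c a b)) where
    open Completion c

    parents : List V → V → V → Bool
    parents [] a j = false
    parents (x ∷ l) a j = if ⌊ a Finₚ.≟ x ⌋ then ⌊ R? x j ×-dec mem? j l ⌋ else parents l a j

    parents-head : ∀ x l j → parents (x ∷ l) x j ≡ ⌊ R? x j ×-dec mem? j l ⌋
    parents-head x l j with x Finₚ.≟ x
    ... | yes _ = refl
    ... | no ne = ⊥-elim (ne refl)

    parents-tail : ∀ {a x} l j → a ≢ x → parents (x ∷ l) a j ≡ parents l a j
    parents-tail {a} {x} l j ne with a Finₚ.≟ x
    ... | yes e = ⊥-elim (ne e)
    ... | no _ = refl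

    yes-true : ∀ {A : Set} (d : Dec A) → A → ⌊ d ⌋ ≡ true
    yes-true (yes _) _ = refl
    yes-true (no n) a = ⊥-elim (n a)

    true-yes : ∀ {A : Set} (d : Dec A) → ⌊ d ⌋ ≡ true → A
    true-yes (yes a) _ = a

    parents-true : ∀ l a j → parents l a j ≡ true → R a j × a ∈ l × j ∈ l
    parents-true (x ∷ l) a j p with a Finₚ.≟ x
    ... | yes refl = let r , i = true-yes (R? x j ×-dec mem? j l) p in r , here refl , there i
    ... | no _ = let r , i , k = parents-true l a j p in r , there i , there k

    parents-later : ∀ {l} A {p F j} → l ≡ A ++ p ∷ F → PEO R l → j ∈ F → R p j → parents l p j ≡ true
    parents-later [] {p} {F} {j} refl _ i r = trans (parents-head p F j) (yes-true (R? p j ×-dec mem? j F) (r , i))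
    parents-later (a ∷ A) {p} {F} {j} refl (peo a∉ _ q) i r =
      trans (parents-tail (A ++ p ∷ F) j λ { refl → a∉ (∈m A) }) (parents-later A refl q i r)

    -- The parent of `x` is the first later vertex related to it. The other later ones come after
    -- the parent and, the order being perfect, are related to it.
    parents-elim : ∀ {l} → PEO R l → Elim (parents l) l
    parents-elim [] = []
    parents-elim {x ∷ l} p@(peo x∉ cl q) = elim x∉ (λ j e → proj₂ (true-yes (R? x j ×-dec mem? j l) (trans (≡-sym (parents-head x l j)) e))) parent
        (elim-cong (λ {a} i j → ≡-sym (parents-tail l j λ { refl → x∉ i })) (parents-elim q))
      where
      R± : ∀ z → R x z ⊎ ¬ R x z
      R± z with R? x z
      ... | yes r = inj₁ r
      ... | no r = inj₂ r
      parent : (∀ j → parents (x ∷ l) x j ≡ false) ⊎ ∃ λ p → p ∈ l × (∀ j → parents (x ∷ l) x j ≡ true → Bag (parents (x ∷ l)) p j)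
      parent with first? R± l
      ... | none n = inj₁ λ j → case parents (x ∷ l) x j ≟ᵇ true of λ where
            (yes e) → let r , i = true-yes (R? x j ×-dec mem? j l) (trans (≡-sym (parents-head x l j)) e) in ⊥-elim (at n i r)
            (no ne) → ¬-not ne
      ... | some A p F eq n r = inj₂ (p , ∈≡ (∈m A) (≡-sym eq) , λ j e →
              let rj , i = true-yes (R? x j ×-dec mem? j l) (trans (≡-sym (parents-head x l j)) e) in
              case ∈-++ A (∈≡ i eq) of λ where
                (inj₁ k) → ⊥-elim (at n k rj)
                (inj₂ (here e)) → inj₁ e
                (inj₂ (there k)) → inj₂ (trans (parents-tail {p} {x} l j λ e' → x∉ (subst (_∈ l) e' (∈≡ (∈m A) (≡-sym eq))))
                  (parents-later A eq q k (cl (∈≡ (∈m A) (≡-sym eq)) i r rj))))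

    parents-edge : ∀ {l a b} → PEO R l → a ∈ l → b ∈ l → a ≢ b → R a b → parents l a b ≡ true ⊎ parents l b a ≡ true
    parents-edge p (here refl) (here refl) ne r = ⊥-elim (ne refl)
    parents-edge {x ∷ l} {b = b} p (here refl) (there j) ne r = inj₁ (trans (parents-head x l b) (yes-true (R? x b ×-dec mem? b l) (r , j)))
    parents-edge {x ∷ l} {a} p (there i) (here refl) ne r = inj₂ (trans (parents-head x l a) (yes-true (R? x a ×-dec mem? a l) (R-sym r , i)))
    parents-edge {x ∷ l} {a} {b} (peo x∉ _ q) (there i) (there j) ne r with parents-edge q i j ne r
    ... | inj₁ e = inj₁ (trans (parents-tail l b λ { refl → x∉ i }) e)
    ... | inj₂ e = inj₂ (trans (parents-tail l a λ { refl → x∉ j }) e)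

    parents-clique : ∀ {l x a b} → PEO R l → parents l x a ≡ true → parents l x b ≡ true → R a b
    parents-clique {x₀ ∷ l} {x} {a} {b} (peo x∉ cl q) e f with x Finₚ.≟ x₀
    ... | yes refl = let r , i = true-yes (R? x a ×-dec mem? a l) e ; r' , j = true-yes (R? x b ×-dec mem? b l) f in cl i j r r'
    ... | no _ = parents-clique q e f

    from-order : (∀ {a b} → a ~ b → R a b) → ∀ l → PEO R l → (∀ x → x ∈ l) → Tree (parents l) l
    from-order adj⊂ l p all = tree (parents-elim p) all (λ a b ab → parents-edge p (all a) (all b) (~⇒≢ ab) (adj⊂ ab)) λ x v f g →
      no7 (Vec.lookup v) λ i j ne → pair (g i j ne) (f i) (f j) , g i j ne
      where
      pair : ∀ {x a b} → a # b → Bag (parents l) x a → Bag (parents l) x b → R a b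
      pair n (inj₁ refl) (inj₁ refl) = ⊥-elim (proj₁ n refl)
      pair n (inj₁ refl) (inj₂ e) = proj₁ (parents-true l _ _ e)
      pair n (inj₂ e) (inj₁ refl) = R-sym (proj₁ (parents-true l _ _ e))
      pair n (inj₂ e) (inj₂ e') = parents-clique p e e'

  tree-exists : CapFree G → EvenHoleFree G → ∃ λ N → ∃ λ l → Tree N l
  tree-exists cf ehf = tree-stable λ k → do
    c ← Decomposition.completion G cf ehf n (allFin n) (ℕₚ.≤-reflexive (Listₚ.length-tabulate id)) (λ _ → ⊤) (λ {x} _ → ∈ₚ.∈-allFin x)
    R? ← fin-choice λ a → fin-choice λ b → em (Completion.R c a b)
    o ← Completion.order c (λ _ → ⊥) (λ ()) (λ ())
    k (FromCompletion.parents c R? (Order.l o ++ Order.m o) , Order.l o ++ Order.m o ,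
       FromCompletion.from-order c R? (λ ab → Completion.R-req c tt tt (inj₁ (inj₂ ab))) _ (Order.isPEO o) λ x → Order.all o tt)

-- Rational arithmetic and finite sums

infixl 6 _⊕_
infixl 7 _⊗_
infix 8 ⊖_

-- Opaque, since the rational operations unfold even on variables.
opaque
  _⊕_ _⊗_ : ℚ → ℚ → ℚ
  _⊕_ = ℚ._+_
  _⊗_ = ℚ._*_

  ⊖_ : ℚ → ℚ
  ⊖_ = ℚ.-_

  inv : ℚ → ℚ
  inv q with q ℚₚ.≟ 0ℚ
  -- A default. Division by a zero mass happens only where the weight to be distributed is zero as
  -- well; see `cancel`.
  ... | yes _ = 0ℚ
  ... | no ne = ℚ.1/_ q {{ℚ.≢-nonZero ne}}

module Laws where
  opaque
    unfolding _⊕_ _⊗_ ⊖_ inv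

    ⊕-is-+ : ∀ a b → a ⊕ b ≡ a ℚ.+ b
    ⊕-is-+ a b = refl

    ⊗-is-* : ∀ a b → a ⊗ b ≡ a ℚ.* b
    ⊗-is-* a b = refl

    +-isCommutativeMonoid : IsCommutativeMonoid _≡_ _⊕_ 0ℚ
    +-isCommutativeMonoid = ℚₚ.+-0-isCommutativeMonoid

    *-isCommutativeMonoid : IsCommutativeMonoid _≡_ _⊗_ 1ℚ
    *-isCommutativeMonoid = ℚₚ.*-1-isCommutativeMonoid

    *-zeroˡ : ∀ a → 0ℚ ⊗ a ≡ 0ℚ
    *-zeroˡ = ℚₚ.*-zeroˡ

    *-zeroʳ : ∀ a → a ⊗ 0ℚ ≡ 0ℚ
    *-zeroʳ = ℚₚ.*-zeroʳ

    *-distribˡ-+ : ∀ a b c → a ⊗ (b ⊕ c) ≡ a ⊗ b ⊕ a ⊗ c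
    *-distribˡ-+ = ℚₚ.*-distribˡ-+

    *-distribʳ-+ : ∀ a b c → (b ⊕ c) ⊗ a ≡ b ⊗ a ⊕ c ⊗ a
    *-distribʳ-+ = ℚₚ.*-distribʳ-+

    +-inverseˡ : ∀ a → ⊖ a ⊕ a ≡ 0ℚ
    +-inverseˡ = ℚₚ.+-inverseˡ

    +-inverseʳ : ∀ a → a ⊕ ⊖ a ≡ 0ℚ
    +-inverseʳ = ℚₚ.+-inverseʳ

    +-mono-≤ : ∀ {a b c d} → a ≼ b → c ≼ d → a ⊕ c ≼ b ⊕ d
    +-mono-≤ = ℚₚ.+-mono-≤

    neg-antimono-≤ : ∀ {a b} → a ≼ b → ⊖ b ≼ ⊖ a
    neg-antimono-≤ = ℚₚ.neg-antimono-≤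

    neg-distrib-+ : ∀ a b → ⊖ (a ⊕ b) ≡ ⊖ a ⊕ ⊖ b
    neg-distrib-+ = ℚₚ.neg-distrib-+

    neg-distribˡ-* : ∀ a b → ⊖ (a ⊗ b) ≡ ⊖ a ⊗ b
    neg-distribˡ-* = ℚₚ.neg-distribˡ-*

    neg-involutive : ∀ a → ⊖ ⊖ a ≡ a
    neg-involutive = GroupProperties.⁻¹-involutive ℚₚ.+-0-group

    neg-zero : ⊖ 0ℚ ≡ 0ℚ
    neg-zero = refl

    *-nonneg : ∀ {a b} → 0ℚ ≼ a → 0ℚ ≼ b → 0ℚ ≼ a ⊗ b
    *-nonneg {a} {b} p q = ℚₚ.nonNegative⁻¹ (a ℚ.* b) {{ℚₚ.nonNeg*nonNeg⇒nonNeg a {{ℚ.nonNegative p}} b {{ℚ.nonNegative q}}}}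

    inv-* : ∀ {q} → q ≢ 0ℚ → inv q ⊗ q ≡ 1ℚ
    inv-* {q} ne with q ℚₚ.≟ 0ℚ
    ... | yes e = ⊥-elim (ne e)
    ... | no ne' = ℚₚ.*-inverseˡ q {{ℚ.≢-nonZero ne'}}

    inv-nonneg : ∀ {q} → 0ℚ ≼ q → 0ℚ ≼ inv q
    inv-nonneg {q} p with q ℚₚ.≟ 0ℚ
    ... | yes _ = ℚₚ.≤-refl
    ... | no ne = go q p ne
      where
      go : ∀ q → 0ℚ ≼ q → (ne : q ≢ 0ℚ) → 0ℚ ≼ ℚ.1/_ q {{ℚ.≢-nonZero ne}}
      go q@(ℚ.mkℚ ℤ.+[1+ n ] d c) p ne = ℚₚ.nonNegative⁻¹ _
      go (ℚ.mkℚ (ℤ.+ 0) zero c) p ne = ⊥-elim (ne refl)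
      go q@(ℚ.mkℚ (ℤ.+ 0) (suc d) c) p ne = ⊥-elim (ne (ℚₚ.↥p≡0⇒p≡0 q refl))
      go (ℚ.mkℚ ℤ.-[1+ n ] d c) (ℚ.*≤* ()) ne

  +-0-commutativeMonoid *-1-commutativeMonoid : CommutativeMonoid _ _
  +-0-commutativeMonoid = record { isCommutativeMonoid = +-isCommutativeMonoid }
  *-1-commutativeMonoid = record { isCommutativeMonoid = *-isCommutativeMonoid }

  open CommutativeMonoid +-0-commutativeMonoid public using () renaming (assoc to +-assoc; identityˡ to +-identityˡ; identityʳ to +-identityʳ)
  open CommutativeMonoid *-1-commutativeMonoid public using () renaming (assoc to *-assoc; identityˡ to *-identityˡ; identityʳ to *-identityʳ)

opaque
  ∑ : ∀ {X : Set} → List X → (X → ℚ) → ℚ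
  ∑ [] f = 0ℚ
  ∑ (x ∷ xs) f = f x ⊕ ∑ xs f

  sumF : ∀ {k} → (Fin k → ℚ) → ℚ
  sumF {zero} f = 0ℚ
  sumF {suc k} f = f fz ⊕ sumF (f ∘ fs)

ind : Bool → ℚ
ind b = if b then 1ℚ else 0ℚ

-- Proved in an abstract monoid to keep the rational operations from being unfolded.
module Rearrange {c ℓ : Level} (CM : CommutativeMonoid c ℓ) where
  open CommutativeMonoid CM using (_≈_; _∙_; ε) renaming (refl to ≈-refl)
  open MonoidSolver CM using (solve; _⊜_) renaming (_⊕_ to _·_; id to 𝟙)

  swap-inner : ∀ a b c d → (a ∙ b) ∙ (c ∙ d) ≈ (a ∙ c) ∙ (b ∙ d)
  swap-inner = solve 4 (λ a b c d → (a · b) · (c · d) ⊜ (a · c) · (b · d)) ≈-refl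

  r₁ : ∀ w q b c → (w ∙ (q ∙ b)) ∙ c ≈ ((w ∙ q) ∙ c) ∙ b
  r₁ = solve 4 (λ w q b c → (w · (q · b)) · c ⊜ ((w · q) · c) · b) ≈-refl

  r₂ : ∀ w q c m → ((w ∙ q) ∙ c) ∙ m ≈ (w ∙ (q ∙ m)) ∙ c
  r₂ = solve 4 (λ w q c m → ((w · q) · c) · m ⊜ (w · (q · m)) · c) ≈-refl

  r₃ : ∀ w q b a h → (w ∙ (q ∙ (b ∙ a))) ∙ h ≈ b ∙ (((w ∙ q) ∙ a) ∙ h)
  r₃ = solve 5 (λ w q b a h → (w · (q · (b · a))) · h ⊜ b · (((w · q) · a) · h)) ≈-refl

  r₄ : ∀ b h y q z → (((b ∙ h) ∙ y) ∙ q) ∙ z ≈ b ∙ (((h ∙ y) ∙ q) ∙ z)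
  r₄ = solve 5 (λ b h y q z → (((b · h) · y) · q) · z ⊜ b · (((h · y) · q) · z)) ≈-refl

  r₅ : ∀ w q b y h → (w ∙ (q ∙ (b ∙ y))) ∙ h ≈ y ∙ (((w ∙ q) ∙ b) ∙ h)
  r₅ = solve 5 (λ w q b y h → (w · (q · (b · y))) · h ⊜ y · (((w · q) · b) · h)) ≈-refl

  r₆ : ∀ w q b y h → (w ∙ (q ∙ (b ∙ (ε ∙ y)))) ∙ h ≈ (((b ∙ h) ∙ y) ∙ q) ∙ (w ∙ ε)
  r₆ = solve 5 (λ w q b y h → (w · (q · (b · (𝟙 · y)))) · h ⊜ (((b · h) · y) · q) · (w · 𝟙)) ≈-refl

  r₇ : ∀ b h y q z → (((b ∙ h) ∙ y) ∙ q) ∙ z ≈ b ∙ (h ∙ (y ∙ (q ∙ z)))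
  r₇ = solve 5 (λ b h y q z → (((b · h) · y) · q) · z ⊜ b · (h · (y · (q · z)))) ≈-refl

  r₈ : ∀ w q b y h → (w ∙ (q ∙ (b ∙ (ε ∙ y)))) ∙ h ≈ y ∙ (((w ∙ q) ∙ b) ∙ h)
  r₈ = solve 5 (λ w q b y h → (w · (q · (b · (𝟙 · y)))) · h ⊜ y · (((w · q) · b) · h)) ≈-refl

  r₉ : ∀ w q b y h → (((b ∙ h) ∙ y) ∙ q) ∙ (w ∙ ε) ≈ y ∙ (((w ∙ q) ∙ b) ∙ h)
  r₉ = solve 5 (λ w q b y h → (((b · h) · y) · q) · (w · 𝟙) ⊜ y · (((w · q) · b) · h)) ≈-refl

  r₁₀ : ∀ a b w d → (a ∙ b) ∙ (w ∙ d) ≈ w ∙ ((a ∙ d) ∙ b)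
  r₁₀ = solve 4 (λ a b w d → (a · b) · (w · d) ⊜ w · ((a · d) · b)) ≈-refl

module Sums where

  private variable
    S T : Set

  open Laws public using (*-nonneg; inv-*; inv-nonneg)

  opaque
    unfolding ∑ sumF

    ∑-cong : ∀ {xs : List S} {f g} → (∀ {x} → x ∈ xs → f x ≡ g x) → ∑ xs f ≡ ∑ xs g
    ∑-cong {xs = []} h = refl
    ∑-cong {xs = x ∷ xs} h = cong₂ _⊕_ (h (here refl)) (∑-cong (h ∘ there))

    ∑-zero : ∀ (xs : List S) {f : S → ℚ} → (∀ {x} → x ∈ xs → f x ≡ 0ℚ) → ∑ xs f ≡ 0ℚ
    ∑-zero [] h = refl
    ∑-zero (x ∷ xs) h = trans (cong₂ _⊕_ (h (here refl)) (∑-zero xs (h ∘ there))) (Laws.+-identityˡ 0ℚ)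

    ∑-+ : ∀ (xs : List S) (f g : S → ℚ) → ∑ xs (λ x → f x ⊕ g x) ≡ ∑ xs f ⊕ ∑ xs g
    ∑-+ [] f g = ≡-sym (Laws.+-identityˡ 0ℚ)
    ∑-+ (x ∷ xs) f g = trans (cong (f x ⊕ g x ⊕_) (∑-+ xs f g))
      (Rearrange.swap-inner Laws.+-0-commutativeMonoid (f x) (g x) (∑ xs f) (∑ xs g))

    ∑-* : ∀ (xs : List S) c (f : S → ℚ) → ∑ xs (λ x → c ⊗ f x) ≡ c ⊗ ∑ xs f
    ∑-* [] c f = ≡-sym (Laws.*-zeroʳ c)
    ∑-* (x ∷ xs) c f = trans (cong (c ⊗ f x ⊕_) (∑-* xs c f)) (≡-sym (Laws.*-distribˡ-+ c (f x) (∑ xs f)))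

    ∑-neg : ∀ (xs : List S) (f : S → ℚ) → ∑ xs (λ x → ⊖ f x) ≡ ⊖ ∑ xs f
    ∑-neg [] f = ≡-sym Laws.neg-zero
    ∑-neg (x ∷ xs) f = trans (cong (⊖ f x ⊕_) (∑-neg xs f)) (≡-sym (Laws.neg-distrib-+ (f x) (∑ xs f)))

    ∑-single : ∀ (x : S) (f : S → ℚ) → ∑ (x ∷ []) f ≡ f x
    ∑-single x f = Laws.+-identityʳ (f x)

    sumF-neg : ∀ {k} (f : Fin k → ℚ) → sumF (λ l → ⊖ f l) ≡ ⊖ sumF f
    sumF-neg {zero} f = ≡-sym Laws.neg-zero
    sumF-neg {suc k} f = trans (cong (⊖ f fz ⊕_) (sumF-neg (f ∘ fs))) (≡-sym (Laws.neg-distrib-+ (f fz) _))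

    ∑-swap : ∀ (xs : List S) (ys : List T) (f : S → T → ℚ) → ∑ xs (λ x → ∑ ys (f x)) ≡ ∑ ys (λ z → ∑ xs (λ x → f x z))
    ∑-swap [] ys f = ≡-sym (∑-zero ys (λ _ → refl))
    ∑-swap (x ∷ xs) ys f = trans (cong (∑ ys (f x) ⊕_) (∑-swap xs ys f)) (≡-sym (∑-+ ys (f x) (λ z → ∑ xs (λ x → f x z))))

    ∑-++ : ∀ (xs : List S) {ys} (f : S → ℚ) → ∑ (xs ++ ys) f ≡ ∑ xs f ⊕ ∑ ys f
    ∑-++ [] f = ≡-sym (Laws.+-identityˡ _)
    ∑-++ (x ∷ xs) f = trans (cong (f x ⊕_) (∑-++ xs f)) (≡-sym (Laws.+-assoc (f x) _ _))

    ∑-concatMap : ∀ (xs : List S) (k : S → List T) (f : T → ℚ) → ∑ (concatMap k xs) f ≡ ∑ xs (λ x → ∑ (k x) f)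
    ∑-concatMap [] k f = refl
    ∑-concatMap (x ∷ xs) k f = trans (∑-++ (k x) f) (cong (∑ (k x) f ⊕_) (∑-concatMap xs k f))

    ∑-map : ∀ (xs : List S) (k : S → T) (f : T → ℚ) → ∑ (map k xs) f ≡ ∑ xs (f ∘ k)
    ∑-map [] k f = refl
    ∑-map (x ∷ xs) k f = cong (f (k x) ⊕_) (∑-map xs k f)

    ∑-nonneg : ∀ (xs : List S) {f : S → ℚ} → (∀ {x} → x ∈ xs → 0ℚ ≼ f x) → 0ℚ ≼ ∑ xs f
    ∑-nonneg [] h = ℚₚ.≤-refl
    ∑-nonneg (x ∷ xs) {f} h = subst (_≼ f x ⊕ ∑ xs f) (Laws.+-identityˡ 0ℚ) (Laws.+-mono-≤ (h (here refl)) (∑-nonneg xs (h ∘ there)))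

    ∑-member : ∀ {xs : List S} {f : S → ℚ} {x} → (∀ {x} → x ∈ xs → 0ℚ ≼ f x) → x ∈ xs → f x ≼ ∑ xs f
    ∑-member {xs = x ∷ xs} {f} h (here refl) =
      subst (_≼ f x ⊕ ∑ xs f) (Laws.+-identityʳ (f x)) (Laws.+-mono-≤ (ℚₚ.≤-refl {f x}) (∑-nonneg xs (h ∘ there)))
    ∑-member {xs = z ∷ xs} {f} {x} h (there i) =
      subst (_≼ f z ⊕ ∑ xs f) (Laws.+-identityˡ (f x)) (Laws.+-mono-≤ (h (here refl)) (∑-member (h ∘ there) i))

    ind-nonneg : ∀ b → 0ℚ ≼ ind b
    ind-nonneg true = ℚₚ.nonNegative⁻¹ 1ℚ
    ind-nonneg false = ℚₚ.≤-refl

    sumF-∑ : ∀ {k} {X : Set} (g : Fin k → X) (h : X → ℚ) → sumF (h ∘ g) ≡ ∑ (tabulate g) h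
    sumF-∑ {zero} g h = refl
    sumF-∑ {suc k} g h = cong (h (g fz) ⊕_) (sumF-∑ (g ∘ fs) h)

    sumF-cong : ∀ {k} {f g : Fin k → ℚ} → (∀ i → f i ≡ g i) → sumF f ≡ sumF g
    sumF-cong {zero} h = refl
    sumF-cong {suc k} h = cong₂ _⊕_ (h fz) (sumF-cong (h ∘ fs))

    sumF-0 : ∀ {k} {f : Fin k → ℚ} → (∀ i → f i ≡ 0ℚ) → sumF f ≡ 0ℚ
    sumF-0 {zero} h = refl
    sumF-0 {suc k} h = trans (cong₂ _⊕_ (h fz) (sumF-0 (h ∘ fs))) (Laws.+-identityˡ 0ℚ)

    sumF-δ : ∀ {k} (c : Fin k) (f : Fin k → ℚ) → sumF (λ l → ind (does (l Finₚ.≟ c)) ⊗ f l) ≡ f c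
    sumF-δ fz f = trans (cong₂ _⊕_ (Laws.*-identityˡ (f fz)) (sumF-0 λ i → Laws.*-zeroˡ (f (fs i)))) (Laws.+-identityʳ (f fz))
    sumF-δ (fs c) f = trans (cong₂ _⊕_ (Laws.*-zeroˡ (f fz)) (sumF-δ c (f ∘ fs))) (Laws.+-identityˡ (f (fs c)))

    ∑-δ : ∀ {k} (c : Fin k) (f : Fin k → ℚ) → ∑ (allFin k) (λ l → ind (does (l Finₚ.≟ c)) ⊗ f l) ≡ f c
    ∑-δ c f = trans (≡-sym (sumF-∑ id (λ l → ind (does (l Finₚ.≟ c)) ⊗ f l))) (sumF-δ c f)

    -- For `m` equal to zero the bounds leave only zero for `w`, so the default value of `inv` does
    -- no harm.
    cancel : ∀ {w m} → 0ℚ ≼ w → w ≼ m → w ⊗ (inv m ⊗ m) ≡ w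
    cancel {w} {m} p q with m ℚₚ.≟ 0ℚ
    ... | no ne = trans (cong (w ⊗_) (inv-* ne)) (Laws.*-identityʳ w)
    ... | yes e = trans (cong (_⊗ (inv m ⊗ m)) w≡0) (trans (Laws.*-zeroˡ (inv m ⊗ m)) (≡-sym w≡0))
      where
      w≡0 : w ≡ 0ℚ
      w≡0 = ℚₚ.≤-antisym (subst (w ≼_) e q) p

    ∑-is-sumL : ∀ (xs : List S) {f g : S → ℚ} → (∀ x → f x ≡ g x) → ∑ xs f ≡ sumL (map g xs)
    ∑-is-sumL [] h = refl
    ∑-is-sumL (x ∷ xs) h = trans (Laws.⊕-is-+ _ _) (cong₂ ℚ._+_ (h x) (∑-is-sumL xs h))

    sumF-is-sumFin : ∀ {k} {f g : Fin k → ℚ} → (∀ i → f i ≡ g i) → sumF f ≡ sumFin g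
    sumF-is-sumFin {zero} h = refl
    sumF-is-sumFin {suc k} h = trans (Laws.⊕-is-+ _ _) (cong₂ ℚ._+_ (h fz) (sumF-is-sumFin (h ∘ fs)))

-- Gluing the distributions on bags to a distribution on stable sets

true-does : ∀ {A : Set} (d : Dec A) → does d ≡ true → A
true-does (yes a) _ = a

-- Items are indexed subsets of bags; y assigns to each bag a distribution on its items.
module Distributions {n : ℕ} (G : Graph n) (N : Fin n → Fin n → Bool) (l₀ : List (Fin n)) (T : TreeDecomposition.Tree G N l₀)
  {M : ℕ} (block : Fin M → Fin n) (set : Fin M → Fin n → Bool) where
  open Paths G
  open TreeDecomposition G using (Bag; bag?; Elim; []; elim)
  open TreeDecomposition.Tree T
  open Sums

  items : List (Fin M)
  items = allFin M

  Agree : V → (V → Bool) → (V → Bool) → Set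
  Agree x S S' = ∀ j → N x j ≡ true → S j ≡ S' j

  agree? : ∀ x S S' → Dec (Agree x S S')
  agree? x S S' = Finₚ.all? λ j → (N x j ≟ᵇ true) →-dec (S j ≟ᵇ S' j)

  agree : V → (V → Bool) → (V → Bool) → Bool
  agree x S S' = does (agree? x S S')

  agree-iff : ∀ {x y S S' R R'} → (Agree x S S' → Agree y R R') → (Agree y R R' → Agree x S S') → agree x S S' ≡ agree y R R'
  agree-iff {x} {y} {S} {S'} {R} {R'} f g = iff-≡ (λ e → dec-true (agree? y R R') (f (true-does (agree? x S S') e)))
    (λ e → dec-true (agree? x S S') (g (true-does (agree? y R R') e)))

  Bad : Fin M → Set
  Bad m = ∃ λ a → ∃ λ b → (Bag N (block m) a × Bag N (block m) b) × (set m a ≡ true × set m b ≡ true) × a ~ b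

  bad? : ∀ m → Dec (Bad m)
  bad? m = Finₚ.any? λ a → Finₚ.any? λ b → (bag? N (block m) a ×-dec bag? N (block m) b) ×-dec
    (((set m a ≟ᵇ true) ×-dec (set m b ≟ᵇ true)) ×-dec (adj G a b ≟ᵇ true))

  at-block : V → Fin M → ℚ
  at-block i l = ind (does (block l Finₚ.≟ i))

  -- The expectation of `f` in the distribution that `y` assigns to the bag of `i`.
  Marg : (Fin M → ℚ) → V → (Fin M → ℚ) → ℚ
  Marg y i f = ∑ items λ l → at-block i l ⊗ (f l ⊗ y l)

  -- In `consist` the item `m` stands for a pattern on the later neighbours of `i`; the bags of `i`
  -- and `p` must give each such pattern the same probability.
  record Feasible (x : V → ℚ) (y : Fin M → ℚ) : Set where
    field
      nonneg  : ∀ m → 0ℚ ≼ y m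
      no-bad  : ∀ m → Bad m → y m ≡ 0ℚ
      total   : ∀ i → Marg y i (λ _ → 1ℚ) ≡ 1ℚ
      consist : ∀ i p m → (∀ j → N i j ≡ true → Bag N p j) →
                Marg y i (λ l → ind (agree i (set m) (set l))) ≡ Marg y p (λ l → ind (agree i (set m) (set l)))
      project : ∀ i → x i ≡ Marg y i (λ l → ind (set l i))

  module Sound {x : V → ℚ} {y : Fin M → ℚ} (F : Feasible x y) where
    open Feasible F

    Local : V → ((V → Bool) → ℚ) → Set
    Local j g = ∀ S S' → (∀ v → Bag N j v → S v ≡ S' v) → g S ≡ g S'

    record Dist (t : List V) : Set where
      field
        ws : List (ℚ × (V → Bool))
        weight : ∀ {p} → p ∈ ws → 0ℚ ≼ proj₁ p
        stable : ∀ {p} → p ∈ ws → Stable G (proj₂ p)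
        support : ∀ {p v} → p ∈ ws → proj₂ p v ≡ true → v ∈ t
        sums : ∑ ws proj₁ ≡ 1ℚ
        marg : ∀ {j} → j ∈ t → ∀ g → Local j g → ∑ ws (λ p → proj₁ p ⊗ g (proj₂ p)) ≡ Marg y j (g ∘ set)

    start : Dist []
    start = record { ws = (1ℚ , λ _ → false) ∷ [] ; weight = λ { (here refl) → ℚₚ.nonNegative⁻¹ 1ℚ } ; stable = λ { (here refl) _ _ () }
                   ; support = λ { (here refl) () } ; sums = ∑-single (1ℚ , λ _ → false) proj₁ ; marg = λ () }

    module Extend {x : V} {t : List V} (x∉ : x ∉ t) (down : ∀ j → N x j ≡ true → j ∈ t)
                  (par : (∀ j → N x j ≡ false) ⊎ ∃ λ p → p ∈ t × (∀ j → N x j ≡ true → Bag N p j))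
                  (below : ∀ {a} → a ∈ t → ∀ j → N a j ≡ true → j ∈ t) (D : Dist t) where
      open Dist D

      m : (V → Bool) → ℚ
      m S = Marg y x λ l → ind (agree x S (set l))

      free? : ∀ (S : V → Bool) → Dec (∀ j → S j ≡ true → x ≁ j)
      free? S = Finₚ.all? λ j → (S j ≟ᵇ true) →-dec (adj G x j ≟ᵇ false)

      -- `x` is added only if no neighbour of it is present. This keeps every entry stable, even
      -- those of weight zero whose item does not fit to `S`; for a good item of the bag of `x` that
      -- agrees with `S` the test changes nothing, by `ext-good`.
      ext : (V → Bool) → Fin M → V → Bool
      ext S l v = if does (v Finₚ.≟ x) then set l x ∧ does (free? S) else S v

      ext-x : ∀ S l → ext S l x ≡ set l x ∧ does (free? S)
      ext-x S l with x Finₚ.≟ x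
      ... | yes _ = refl
      ... | no ne = ⊥-elim (ne refl)

      ext-≢ : ∀ S l {v} → v ≢ x → ext S l v ≡ S v
      ext-≢ S l {v} ne with v Finₚ.≟ x
      ... | yes e = ⊥-elim (ne e)
      ... | no _ = refl

      a : (V → Bool) → Fin M → ℚ
      a S l = at-block x l ⊗ (ind (agree x S (set l)) ⊗ y l)

      a≥0 : ∀ S l → 0ℚ ≼ a S l
      a≥0 S l = *-nonneg (ind-nonneg _) (*-nonneg (ind-nonneg _) (nonneg l))

      -- The weight of `S` is divided among the items of the new bag by their conditional
      -- probability, given the pattern of `S` on the later neighbours of `x`.
      entry : ℚ × (V → Bool) → Fin M → ℚ × (V → Bool)
      entry (w , S) l = w ⊗ (inv (m S) ⊗ a S l) , ext S l

      ws' : List (ℚ × (V → Bool))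
      ws' = concatMap (λ p → map (entry p) items) ws

      find-entry : ∀ {q} → q ∈ ws' → ∃ λ p → p ∈ ws × ∃ λ l → q ≡ entry p l
      find-entry i with ∈ₚ.∈-concatMap⁻ (λ p → map (entry p) items) {xs = ws} i
      ... | j with find j
      ...   | p , p∈ , k with ∈ₚ.∈-map⁻ (entry p) k
      ...     | l , _ , e = p , p∈ , l , e

      expand : ∀ (h : ℚ × (V → Bool) → ℚ) → ∑ ws' h ≡ ∑ ws (λ p → ∑ items (λ l → h (entry p l)))
      expand h = trans (∑-concatMap ws _ h) (∑-cong λ {p} _ → ∑-map items (entry p) h)

      Marg-0 : ∀ {i f} → (∀ l → f l ≡ 0ℚ) → Marg y i f ≡ 0ℚ
      Marg-0 {i} {f} h = ∑-zero items λ {l} _ → trans (cong (λ z → at-block i l ⊗ (z ⊗ y l)) (h l))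
        (trans (cong (at-block i l ⊗_) (Laws.*-zeroˡ (y l))) (Laws.*-zeroʳ (at-block i l)))

      Marg-cong : ∀ {i f g} → (∀ l → f l ≡ g l) → Marg y i f ≡ Marg y i g
      Marg-cong {i} h = ∑-cong λ {l} _ → cong (λ z → at-block i l ⊗ (z ⊗ y l)) (h l)

      ind-1 : ∀ {b} → b ≡ true → ind b ≡ 1ℚ
      ind-1 refl = refl

      ind-0 : ∀ {b} → b ≡ false → ind b ≡ 0ℚ
      ind-0 refl = refl

      agree-refl : ∀ S → agree x S S ≡ true
      agree-refl S = dec-true (agree? x S S) λ _ _ → refl

      agree-sym : ∀ S S' → agree x S S' ≡ agree x S' S
      agree-sym S S' = agree-iff {x} {x} (λ f j e → ≡-sym (f j e)) (λ f j e → ≡-sym (f j e))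

      agree-trans : ∀ {S S'} R → agree x S S' ≡ true → agree x S R ≡ agree x S' R
      agree-trans {S} {S'} R e = agree-iff {x} {x} (λ f j i → trans (≡-sym (g j i)) (f j i)) (λ f j i → trans (g j i) (f j i))
        where
        g = true-does (agree? x S S') e

      m-cong : ∀ {S S'} → agree x S S' ≡ true → m S ≡ m S'
      m-cong e = Marg-cong λ l → cong ind (agree-trans (set l) e)

      -- The pattern lives in the bag of the parent, whose marginals are right by induction, and
      -- `consist` carries its probability over to the bag of `x`. If no item shows the pattern,
      -- both sides vanish. Without later neighbours, both sides are the total mass one.
      mass : ∀ S → ∑ ws (λ p → proj₁ p ⊗ ind (agree x S (proj₂ p))) ≡ m S
      mass S = case par of λ where
          (inj₁ ¬N) → trans (∑-cong λ {p} _ → trans (cong (proj₁ p ⊗_) (ind-1 (empty ¬N (proj₂ p)))) (Laws.*-identityʳ (proj₁ p)))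
                          (trans sums (trans (≡-sym (total x)) (Marg-cong λ l → ≡-sym (ind-1 (empty ¬N (set l))))))
          (inj₂ (p , p∈ , N⊂)) → trans (marg p∈ (λ R → ind (agree x S R)) (λ R R' h → cong ind
              (agree-iff {x} {x} (λ f j e → trans (f j e) (h j (N⊂ j e))) (λ f j e → trans (f j e) (≡-sym (h j (N⊂ j e)))))))
            (case Finₚ.any? (λ l → agree x S (set l) ≟ᵇ true) of λ where
              (yes (l , e)) → trans (Marg-cong λ k → cong ind (agree-trans (set k) e)) (trans (≡-sym (consist x p l N⊂)) (≡-sym (m-cong e)))
              (no ne) → let z = λ l → ind-0 (¬-not (λ e → ne (l , e))) in trans (Marg-0 z) (≡-sym (Marg-0 z)))
        where
        empty : (∀ j → N x j ≡ false) → ∀ R → agree x S R ≡ true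
        empty ¬N R = dec-true (agree? x S R) λ j e → ⊥-elim (true≢false e (¬N j))

      m≥0 : ∀ S → 0ℚ ≼ m S
      m≥0 S = ∑-nonneg items λ {l} _ → a≥0 S l

      weight≤m : ∀ {w S} → (w , S) ∈ ws → w ≼ m S
      weight≤m {w} {S} i = subst₂ _≼_ (trans (cong (λ b → w ⊗ ind b) (agree-refl S)) (Laws.*-identityʳ w)) (mass S)
        (∑-member {f = λ p → proj₁ p ⊗ ind (agree x S (proj₂ p))} (λ j → *-nonneg (weight j) (ind-nonneg _)) i)

      open Rearrange Laws.*-1-commutativeMonoid

      -- The conditional probabilities of the items add up to one wherever `S` has positive weight,
      -- so functions that ignore `x` keep their expectation.
      old-test : ∀ (h : (V → Bool) → ℚ) → (∀ {p} → p ∈ ws → ∀ l → h (ext (proj₂ p) l) ≡ h (proj₂ p)) →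
             ∑ ws' (λ p → proj₁ p ⊗ h (proj₂ p)) ≡ ∑ ws (λ p → proj₁ p ⊗ h (proj₂ p))
      old-test h same = trans (expand (λ p → proj₁ p ⊗ h (proj₂ p))) (∑-cong λ { {w , S} i →
        trans (∑-cong λ {l} _ → trans (cong (w ⊗ (inv (m S) ⊗ a S l) ⊗_) (same i l))
                (r₁ w (inv (m S)) (a S l) (h S)))
          (trans (∑-* items ((w ⊗ inv (m S)) ⊗ h S) (a S))
            (trans (r₂ w (inv (m S)) (h S) (m S))
              (cong (_⊗ h S) (cancel (weight i) (weight≤m i))))) })

      -- A neighbour of `x` in `S` would come later in the order, so by `edges` it belongs to the
      -- pattern on which `S` and the item agree. The item would then contain both ends of an edge
      -- and be bad.
      ext-good : ∀ {p} → p ∈ ws → ∀ l → block l ≡ x → ¬ Bad l → agree x (proj₂ p) (set l) ≡ true → ∀ v → Bag N x v → ext (proj₂ p) l v ≡ set l v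
      ext-good {w , S} i l refl nb ag v (inj₂ e) = trans (ext-≢ S l λ { refl → x∉ (down v e) }) (true-does (agree? x S (set l)) ag v e)
      ext-good {w , S} i l refl nb ag v (inj₁ refl) = trans (ext-x S l) (go (set l x) refl)
        where
        go : ∀ b → set l x ≡ b → set l x ∧ does (free? S) ≡ set l x
        go false e = trans (cong (_∧ does (free? S)) e) (≡-sym e)
        go true e = trans (cong (_∧ does (free? S)) e) (trans (dec-true (free? S) λ j Sj → ¬~ λ xj → nb
            (x , j , (inj₁ refl , inj₂ (up j Sj xj)) , (e , trans (≡-sym (true-does (agree? x S (set l)) ag j (up j Sj xj))) Sj) , xj)) (≡-sym e))
          where
          up : ∀ j → S j ≡ true → x ~ j → N x j ≡ true
          up j Sj xj with edges x j xj
          ... | inj₁ f = f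
          ... | inj₂ f = ⊥-elim (x∉ (below (support i Sj) x f))

      y≤m : ∀ l → block l ≡ x → y l ≼ m (set l)
      y≤m l e = subst (_≼ m (set l)) (trans (cong₂ (λ b c → ind b ⊗ (ind c ⊗ y l)) (dec-true (block l Finₚ.≟ x) e) (agree-refl (set l)))
                  (trans (Laws.*-identityˡ _) (Laws.*-identityˡ (y l))))
        (∑-member {f = a (set l)} (λ {l'} _ → a≥0 (set l) l') (∈ₚ.∈-allFin l))

      -- With the two sums exchanged, the weights of all sets that agree with a fixed item add up to
      -- the mass of its pattern, which is exactly the denominator of the conditional probability.
      new-test : ∀ h → Local x h → ∑ ws' (λ p → proj₁ p ⊗ h (proj₂ p)) ≡ Marg y x (h ∘ set)
      new-test h loc = trans (expand (λ p → proj₁ p ⊗ h (proj₂ p))) (trans (∑-swap ws items _) (∑-cong λ {l} _ →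
          trans (∑-cong λ {p} i → term p i l (block l Finₚ.≟ x))
            (trans (∑-* ws (c l) _) (trans (cong (c l ⊗_) (mass (set l))) (value l (block l Finₚ.≟ x))))))
        where
        c : Fin M → ℚ
        c l = ((at-block x l ⊗ h (set l)) ⊗ y l) ⊗ inv (m (set l))
        kill : ∀ {z} l → block l ≢ x → at-block x l ⊗ z ≡ 0ℚ
        kill {z} l ne = trans (cong (λ b → ind b ⊗ z) (dec-false (block l Finₚ.≟ x) ne)) (Laws.*-zeroˡ z)
        term : ∀ p → p ∈ ws → ∀ l → Dec (block l ≡ x) → proj₁ (entry p l) ⊗ h (proj₂ (entry p l)) ≡ c l ⊗ (proj₁ p ⊗ ind (agree x (set l) (proj₂ p)))
        term (w , S) i l (no ne) = trans (r₃
              w (inv (m S)) (at-block x l) (ind (agree x S (set l)) ⊗ y l) (h (ext S l)))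
            (trans (kill l ne) (≡-sym (trans (r₄
              (at-block x l) (h (set l)) (y l) (inv (m (set l))) (w ⊗ ind (agree x (set l) S))) (kill l ne))))
        term (w , S) i l (yes e) with agree x S (set l) in ag
        ... | false = trans (r₅
              w (inv (m S)) (at-block x l) (0ℚ ⊗ y l) (h (ext S l)))
            (trans (cong (_⊗ (((w ⊗ inv (m S)) ⊗ at-block x l) ⊗ h (ext S l))) (Laws.*-zeroˡ (y l))) (trans (Laws.*-zeroˡ (((w ⊗ inv (m S)) ⊗ at-block x l) ⊗ h (ext S l)))
              (≡-sym (trans (cong (λ b → c l ⊗ (w ⊗ ind b)) (trans (agree-sym (set l) S) ag)) (trans (cong (c l ⊗_) (Laws.*-zeroʳ w)) (Laws.*-zeroʳ (c l)))))))
        ... | true = trans (cong (λ q → w ⊗ (inv q ⊗ (at-block x l ⊗ (1ℚ ⊗ y l))) ⊗ h (ext S l)) (m-cong ag))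
            (trans (rearrange (bad? l)) (cong (λ b → c l ⊗ (w ⊗ ind b)) (≡-sym (trans (agree-sym (set l) S) ag))))
          where
          q = inv (m (set l))
          rearrange : Dec (Bad l) → w ⊗ (q ⊗ (at-block x l ⊗ (1ℚ ⊗ y l))) ⊗ h (ext S l) ≡ c l ⊗ (w ⊗ 1ℚ)
          rearrange (yes b) = trans (r₈ w q (at-block x l) (y l) (h (ext S l))) (trans (vanish _)
            (≡-sym (trans (r₉ w q (at-block x l) (y l) (h (set l))) (vanish _))))
            where
            vanish : ∀ z → y l ⊗ z ≡ 0ℚ
            vanish z = trans (cong (_⊗ z) (no-bad l b)) (Laws.*-zeroˡ z)
          rearrange (no nb) = trans (cong (w ⊗ (q ⊗ (at-block x l ⊗ (1ℚ ⊗ y l))) ⊗_) (loc _ _ (ext-good i l e nb ag)))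
            (r₆
              w q (at-block x l) (y l) (h (set l)))
        value : ∀ l → Dec (block l ≡ x) → c l ⊗ m (set l) ≡ at-block x l ⊗ (h (set l) ⊗ y l)
        value l (no ne) = trans (r₄
              (at-block x l) (h (set l)) (y l) (inv (m (set l))) (m (set l))) (trans (kill l ne) (≡-sym (kill l ne)))
        value l (yes e) = trans (r₇
              (at-block x l) (h (set l)) (y l) (inv (m (set l))) (m (set l)))
            (cong (λ z → at-block x l ⊗ (h (set l) ⊗ z)) (cancel (nonneg l) (y≤m l e)))

      ext-stable : ∀ {p} → p ∈ ws → ∀ l → Stable G (ext (proj₂ p) l)
      ext-stable {w , S} i l u v eu ev with u Finₚ.≟ x | v Finₚ.≟ x
      ... | yes refl | yes refl = irrefl G u
      ... | no _ | no _ = stable i u v eu ev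
      ... | yes refl | no _ = both (set l u) eu v ev
        where
        both : ∀ b → b ∧ does (free? S) ≡ true → ∀ v → S v ≡ true → u ≁ v
        both true e = true-does (free? S) e
      ... | no _ | yes refl = ≁sym (both (set l v) ev u eu)
        where
        both : ∀ b → b ∧ does (free? S) ≡ true → ∀ u → S u ≡ true → v ≁ u
        both true e = true-does (free? S) e

      extend : Dist (x ∷ t)
      extend = record
        { ws = ws'
        ; weight = λ i → case find-entry i of λ { ((w , S) , p∈ , l , refl) →
            *-nonneg (weight p∈) (*-nonneg (inv-nonneg (m≥0 S)) (a≥0 S l)) }
        ; stable = λ i → case find-entry i of λ { (p , p∈ , l , refl) → ext-stable p∈ l }
        ; support = λ {_} {v} i e → case find-entry i of λ { ((w , S) , p∈ , l , refl) → sup p∈ l v e }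
        ; sums = trans (∑-cong λ {p} _ → ≡-sym (Laws.*-identityʳ (proj₁ p)))
                   (trans (old-test (λ _ → 1ℚ) (λ _ _ → refl)) (trans (∑-cong λ {p} _ → Laws.*-identityʳ (proj₁ p)) sums))
        ; marg = λ where
            (here refl) g loc → new-test g loc
            (there {xs = xs} j) g loc → trans (old-test g λ {p} _ l → loc (ext (proj₂ p) l) (proj₂ p) λ v bv → ext-≢ (proj₂ p) l λ { refl → x∉ (in-t j bv) })
                                  (marg j g loc) }
        where
        in-t : ∀ {j v} → j ∈ t → Bag N j v → v ∈ t
        in-t j (inj₁ refl) = j
        in-t j (inj₂ e) = below j _ e
        sup : ∀ {w S} → (w , S) ∈ ws → ∀ l v → ext S l v ≡ true → v ∈ x ∷ t
        sup {w} {S} i l v e with v Finₚ.≟ x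
        ... | yes f = here f
        ... | no _ = there (support i e)

    below : ∀ {l} → Elim N l → ∀ {a} → a ∈ l → ∀ j → N a j ≡ true → j ∈ l
    below (elim _ down _ e) (here refl) j p = there (down j p)
    below (elim _ down _ e) (there i) j p = there (below e i j p)

    build : ∀ {l} → Elim N l → Dist l
    build [] = start
    build (elim x∉ down par e) = Extend.extend x∉ down par (below e) (build e)

    sound : InSTAB G x
    sound = ws , tab (λ i → weight i , stable i) , trans (≡-sym (∑-is-sumL ws λ _ → refl)) sums , λ i →
        trans (project i) (trans (≡-sym (marg (all i) (λ S → ind (S i)) (λ S S' h → cong ind (h i (inj₁ refl)))))
          (∑-is-sumL ws λ _ → Laws.⊗-is-* _ _))
      where
      open Dist (build isElim)

  module Complete (can : (V → Bool) → V → Fin M) (can-block : ∀ S i → block (can S i) ≡ i)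
                  (can-set : ∀ S → Stable G S → ∀ i v → Bag N i v → set (can S i) v ≡ S v) where

    complete : ∀ {x} → InSTAB G x → ∃ λ y → Feasible x y
    complete {x} (ws , ok , sums₀ , xs₀) = y , record
        { nonneg = λ l → ∑-nonneg ws λ i → *-nonneg (proj₁ (at ok i)) (ind-nonneg _)
        ; no-bad = λ l b → ∑-zero ws λ {p} i → trans (cong (λ z → proj₁ p ⊗ ind z) (dec-false (l Finₚ.≟ _) λ e → good p i l e b)) (Laws.*-zeroʳ (proj₁ p))
        ; total = λ i → trans (key i (λ _ → 1ℚ)) (trans (∑-cong λ {p} _ → Laws.*-identityʳ (proj₁ p)) sums)
        ; consist = λ i p m sub → trans (key i _) (trans (∑-cong λ {q} k → cong (λ b → proj₁ q ⊗ ind b)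
            (agree-iff {i} {i} (λ f j e → trans (f j e) (both q k i p j (inj₂ e) (sub j e)))
                               (λ f j e → trans (f j e) (≡-sym (both q k i p j (inj₂ e) (sub j e)))))) (≡-sym (key p _)))
        ; project = λ i → trans (xs i) (trans (∑-cong λ {p} k → cong (λ b → proj₁ p ⊗ ind b) (≡-sym (can-set (proj₂ p) (proj₂ (at ok k)) i i (inj₁ refl))))
            (≡-sym (key i _))) }
      where
      open Rearrange Laws.*-1-commutativeMonoid using (r₁₀)
      sums : ∑ ws proj₁ ≡ 1ℚ
      sums = trans (∑-is-sumL ws λ _ → refl) sums₀
      xs : ∀ i → x i ≡ ∑ ws (λ p → proj₁ p ⊗ ind (proj₂ p i))
      xs i = trans (xs₀ i) (≡-sym (∑-is-sumL ws λ _ → Laws.⊗-is-* _ _))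
      δ : Fin M → (V → Bool) → ℚ
      δ l S = ind (does (l Finₚ.≟ can S (block l)))
      -- The probability that `l` is the item chosen by `can` for the random stable set in the bag
      -- of `l`. Other items that list the same vertices get nothing, so no set is counted twice.
      y : Fin M → ℚ
      y l = ∑ ws λ p → proj₁ p ⊗ δ l (proj₂ p)
      both : ∀ p → p ∈ ws → ∀ i k v → Bag N i v → Bag N k v → set (can (proj₂ p) i) v ≡ set (can (proj₂ p) k) v
      both p j i k v bi bk = trans (can-set _ (proj₂ (at ok j)) i v bi) (≡-sym (can-set _ (proj₂ (at ok j)) k v bk))
      good : ∀ p → p ∈ ws → ∀ l → l ≡ can (proj₂ p) (block l) → ¬ Bad l
      good (w , S) i l e (a , b , (ba , bb) , (sa , sb) , ab) = ~≁ ab (proj₂ (at ok i) a b (val a ba sa) (val b bb sb))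
        where
        val : ∀ v → Bag N (block l) v → set l v ≡ true → S v ≡ true
        val v bv sv = trans (≡-sym (can-set S (proj₂ (at ok i)) (block l) v bv)) (trans (cong (λ k → set k v) (≡-sym e)) sv)
      pick : ∀ S i l → at-block i l ⊗ δ l S ≡ ind (does (l Finₚ.≟ can S i))
      pick S i l with block l Finₚ.≟ i
      ... | yes refl = Laws.*-identityˡ _
      ... | no ne = trans (Laws.*-zeroˡ _) (cong ind (≡-sym (dec-false (l Finₚ.≟ can S i) λ e → ne (trans (cong block e) (can-block S i)))))
      key : ∀ i f → Marg y i f ≡ ∑ ws (λ p → proj₁ p ⊗ f (can (proj₂ p) i))
      key i f = trans (∑-cong λ {l} _ → trans (≡-sym (Laws.*-assoc (at-block i l) (f l) (y l)))
                  (≡-sym (∑-* ws (at-block i l ⊗ f l) _)))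
        (trans (∑-swap items ws _) (∑-cong λ { {w , S} _ →
          trans (∑-cong λ {l} _ → trans (r₁₀ (at-block i l) (f l) w (δ l S))
                   (cong (λ z → w ⊗ (z ⊗ f l)) (pick S i l)))
            (trans (∑-* items w _) (cong (w ⊗_) (∑-δ (can S i) f))) }))

-- The linear system

unique-lookup : ∀ {X : Set} {l : List X} → Uniq.Unique l → ∀ i j → lookup l i ≡ lookup l j → i ≡ j
unique-lookup (x∉ AllPairs.∷ u) fz fz e = refl
unique-lookup (x∉ AllPairs.∷ u) fz (fs j) e = ⊥-elim (at x∉ (∈ₚ.∈-lookup j) e)
unique-lookup (x∉ AllPairs.∷ u) (fs i) fz e = ⊥-elim (at x∉ (∈ₚ.∈-lookup i) (≡-sym e))
unique-lookup (x∉ AllPairs.∷ u) (fs i) (fs j) e = cong fs (unique-lookup u i j e)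

-- All entries of the system are among these three, so each is encoded with two bits and the size is
-- a mere count of entries.
data Coef : Set where
  neg zer pos : Coef

val : Coef → ℚ
val neg = ℚ.- 1ℚ
val zer = 0ℚ
val pos = 1ℚ

minus : Coef → Coef
minus neg = pos
minus zer = zer
minus pos = neg

pick : Bool → Coef
pick b = if b then pos else zer

diff : Bool → Bool → Coef
diff true true = zer
diff true false = pos
diff false true = neg
diff false false = zer

opaque
  unfolding _⊕_ ⊖_

  val-minus : ∀ c → val (minus c) ≡ ⊖ val c
  val-minus neg = refl
  val-minus zer = refl
  val-minus pos = refl

  val-neg : val neg ≡ ⊖ 1ℚ
  val-neg = refl

  val-pick : ∀ b → val (pick b) ≡ ind b
  val-pick true = refl
  val-pick false = refl

  val-diff : ∀ b c → val (diff b c) ≡ ind b ⊕ ⊖ ind c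
  val-diff true true = refl
  val-diff true false = refl
  val-diff false true = refl
  val-diff false false = refl

ind-∧ : ∀ b c → ind (b ∧ c) ≡ ind b ⊗ ind c
ind-∧ true c = ≡-sym (Laws.*-identityˡ (ind c))
ind-∧ false c = ≡-sym (Laws.*-zeroˡ (ind c))

bits-val : ∀ c → bitsℚ (val c) ≡ 2
bits-val neg = refl
bits-val zer = refl
bits-val pos = refl

-- The encodings of 6-tuples and of row indices are parameters, so that powers of n + 1 are not unfolded.
module Formulation {n : ℕ} (G : Graph n) (N : Fin n → Fin n → Bool) (l₀ : List (Fin n)) (T : TreeDecomposition.Tree G N l₀)
  {M R : ℕ} (item : Fin M → Fin n × (Fin 6 → Fin (suc n))) (pack : Fin n → (Fin 6 → Fin (suc n)) → Fin M)
  (item-block : ∀ i f → proj₁ (item (pack i f)) ≡ i) (item-tuple : ∀ i f k → proj₂ (item (pack i f)) k ≡ f k)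
  (index : Fin R → Fin 8 × Fin n × Fin n × Fin M) (encode : Fin 8 × Fin n × Fin n × Fin M → Fin R)
  (index-encode : ∀ c → index (encode c) ≡ c) where
  open Paths G
  open TreeDecomposition G using (Bag; bag?)
  open TreeDecomposition.Tree T
  open Sums

  block : Fin M → V
  block l = proj₁ (item l)

  -- an item lists at most six vertices; the entry zero stands for no vertex
  tuple : Fin M → Fin 6 → Fin (suc n)
  tuple l = proj₂ (item l)

  lists? : ∀ l v → Dec (∃ λ k → tuple l k ≡ fs v)
  lists? l v = Finₚ.any? λ k → tuple l k Finₚ.≟ fs v

  set : Fin M → V → Bool
  set l v = does (lists? l v)

  open Distributions G N l₀ T block set

  -- Positions beyond the end give zero, the entry that stands for no vertex, so a set of fewer than
  -- six vertices still fills a 6-tuple.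
  nth : List V → ℕ → Fin (suc n)
  nth [] _ = fz
  nth (x ∷ l) zero = fs x
  nth (x ∷ l) (suc k) = nth l k

  nth-∈ : ∀ l k {v} → nth l k ≡ fs v → v ∈ l
  nth-∈ (x ∷ l) zero refl = here refl
  nth-∈ (x ∷ l) (suc k) e = there (nth-∈ l k e)

  ∈-nth : ∀ {l v} → v ∈ l → ∃ λ k → k < length l × nth l k ≡ fs v
  ∈-nth (here refl) = 0 , s≤s z≤n , refl
  ∈-nth (there i) = let k , lt , e = ∈-nth i in suc k , s≤s lt , e

  chosen? : ∀ (S : V → Bool) i v → Dec (S v ≡ true × Bag N i v)
  chosen? S i v = (S v ≟ᵇ true) ×-dec bag? N i v

  chosen : (V → Bool) → V → List V
  chosen S i = filter (chosen? S i) (allFin n)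

  chosen-∈ : ∀ {S i v} → v ∈ chosen S i → S v ≡ true × Bag N i v
  chosen-∈ {S} {i} j = proj₂ (∈ₚ.∈-filter⁻ (chosen? S i) {xs = allFin n} j)

  -- Seven vertices of a stable set in one bag would contradict `small`.
  chosen-≤ : ∀ {S} → Stable G S → ∀ i → length (chosen S i) ≤ 6
  chosen-≤ {S} st i with length (chosen S i) ℕₚ.≤? 6
  ... | yes le = le
  ... | no nle = ⊥-elim (small i (Vec.tabulate f) (λ k → subst (Bag N i) (≡-sym (Vecₚ.lookup∘tabulate f k)) (proj₂ (mem k)))
          λ j k ne → subst₂ _#_ (≡-sym (Vecₚ.lookup∘tabulate f j)) (≡-sym (Vecₚ.lookup∘tabulate f k))
            ((λ e → ne (Finₚ.inject≤-injective lt lt j k (unique-lookup (Uniqₚ.filter⁺ (chosen? S i) (Uniqₚ.allFin⁺ n)) _ _ e))) ,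
             st _ _ (proj₁ (mem j)) (proj₁ (mem k))))
    where
    lt : 7 ≤ length (chosen S i)
    lt = ℕₚ.≰⇒> nle
    f : Fin 7 → V
    f k = lookup (chosen S i) (inject≤ k lt)
    mem : ∀ k → S (f k) ≡ true × Bag N i (f k)
    mem k = chosen-∈ (∈ₚ.∈-lookup (inject≤ k lt))

  can : (V → Bool) → V → Fin M
  can S i = pack i λ k → nth (chosen S i) (toℕ k)

  can-tuple : ∀ S i k → tuple (can S i) k ≡ nth (chosen S i) (toℕ k)
  can-tuple S i k = item-tuple i _ k

  can-set : ∀ S → Stable G S → ∀ i v → Bag N i v → set (can S i) v ≡ S v
  can-set S st i v bv = iff-≡
    (λ e → let k , p = true-does (lists? (can S i) v) e in proj₁ (chosen-∈ {S} {i} (nth-∈ _ (toℕ k) (trans (≡-sym (can-tuple S i k)) p))))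
    (λ e → let k , lt , p = ∈-nth {chosen S i} (∈ₚ.∈-filter⁺ (chosen? S i) (∈ₚ.∈-allFin v) (e , bv))
               k<6 = ℕₚ.≤-trans lt (chosen-≤ st i)
           in dec-true (lists? (can S i) v) (fromℕ< k<6 ,
                trans (can-tuple S i (fromℕ< k<6)) (trans (cong (nth (chosen S i)) (Finₚ.toℕ-fromℕ< k<6)) p)))

  can-block : ∀ S i → block (can S i) ≡ i
  can-block S i = item-block i _

  open Complete can can-block can-set using (complete)

  sub? : ∀ i p → Dec (∀ j → N i j ≡ true → Bag N p j)
  sub? i p = Finₚ.all? λ j → (N i j ≟ᵇ true) →-dec bag? N p j

  -- Where the condition of `c₁` or `c₃` fails, the coefficients are zero and the row reads 0 ≤ 0.
  -- In this way the rows are indexed by a full product and are easily counted.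
  module Base (i p : V) (m : Fin M) where
    c₀ c₁ c₂ c₃ c₄ : Fin M → Coef
    c₀ l = pick (does (l Finₚ.≟ m))
    c₁ l = if does (bad? m) then c₀ l else zer
    c₂ l = pick (does (block l Finₚ.≟ i))
    c₃ l = if does (sub? i p) then diff (does (block l Finₚ.≟ i) ∧ agree i (set m) (set l)) (does (block l Finₚ.≟ p) ∧ agree i (set m) (set l)) else zer
    c₄ l = pick (does (block l Finₚ.≟ i) ∧ set l i)
    e : V → Coef
    e j = pick (does (j Finₚ.≟ i))

  none-x : V → Coef
  none-x _ = zer

  Row : Set
  Row = (V → Coef) × (Fin M → Coef) × Coef

  -- Nonnegativity takes one kind of row. Bad items take one more, since the opposite inequality is
  -- nonnegativity. The equations `total`, `consist` and `project` take two each.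
  row : Fin 8 → V → V → Fin M → Row
  row fz i p m = none-x , minus ∘ Base.c₀ i p m , zer
  row (fs fz) i p m = none-x , Base.c₁ i p m , zer
  row (fs (fs fz)) i p m = none-x , Base.c₂ i p m , pos
  row (fs (fs (fs fz))) i p m = none-x , minus ∘ Base.c₂ i p m , neg
  row (fs (fs (fs (fs fz)))) i p m = none-x , Base.c₃ i p m , zer
  row (fs (fs (fs (fs (fs fz))))) i p m = none-x , minus ∘ Base.c₃ i p m , zer
  row (fs (fs (fs (fs (fs (fs fz)))))) i p m = Base.e i p m , minus ∘ Base.c₄ i p m , zer
  row (fs (fs (fs (fs (fs (fs (fs _))))))) i p m = minus ∘ Base.e i p m , Base.c₄ i p m , zer

  code : Fin R → Row
  code r = let k , i , p , m = index r in row k i p m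

  system : System n
  system = record { rows = R ; aux = M ; A = λ r j → val (proj₁ (code r) j) ; B = λ r l → val (proj₁ (proj₂ (code r)) l)
                  ; d = λ r → val (proj₂ (proj₂ (code r))) }

  module Values (x : V → ℚ) (y : Fin M → ℚ) where
    Holds : Row → Set
    Holds (a , b , c) = sumF (λ j → val (a j) ⊗ x j) ⊕ sumF (λ l → val (b l) ⊗ y l) ≼ val c

    sealed : ((a , b , c) : Row) → sumF (λ j → val (a j) ⊗ x j) ⊕ sumF (λ l → val (b l) ⊗ y l) ≡
             sumFin (λ j → val (a j) ℚ.* x j) ℚ.+ sumFin (λ l → val (b l) ℚ.* y l)
    sealed (a , b , c) = trans (Laws.⊕-is-+ _ _) (cong₂ ℚ._+_ (sumF-is-sumFin λ j → Laws.⊗-is-* _ _) (sumF-is-sumFin λ l → Laws.⊗-is-* _ _))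

    satisfied : Satisfies system x y → ∀ k i p m → Holds (row k i p m)
    satisfied s k i p m = subst (λ (k , i , p , m) → Holds (row k i p m)) (index-encode (k , i , p , m)) (unseal (encode (k , i , p , m)))
      where
      unseal : ∀ r → Holds (code r)
      unseal r = subst (_≼ val (proj₂ (proj₂ (code r)))) (≡-sym (sealed (code r))) (s r)

    satisfy : (∀ k i p m → Holds (row k i p m)) → Satisfies system x y
    satisfy h r = let k , i , p , m = index r in subst (_≼ val (proj₂ (proj₂ (code r)))) (sealed (code r)) (h k i p m)

    on-y : ∀ (c : Fin M → Coef) → sumF (λ l → val (c l) ⊗ y l) ≡ ∑ items (λ l → val (c l) ⊗ y l)
    on-y c = sumF-∑ id (λ l → val (c l) ⊗ y l)

    minus-sum : ∀ {k} (c : Fin k → Coef) (z : Fin k → ℚ) → sumF (λ l → val (minus (c l)) ⊗ z l) ≡ ⊖ sumF (λ l → val (c l) ⊗ z l)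
    minus-sum c z = trans (sumF-cong λ l → trans (cong (_⊗ z l) (val-minus (c l))) (≡-sym (Laws.neg-distribˡ-* (val (c l)) (z l)))) (sumF-neg _)

    zero-sum : sumF (λ j → val (none-x j) ⊗ x j) ≡ 0ℚ
    zero-sum = sumF-0 λ j → Laws.*-zeroˡ (x j)

    module At (i p : V) (m : Fin M) where
      open Base i p m

      f : Fin M → ℚ
      f l = ind (agree i (set m) (set l))

      distribute : ∀ a b g y → (a ⊗ g ⊕ ⊖ (b ⊗ g)) ⊗ y ≡ a ⊗ (g ⊗ y) ⊕ ⊖ (b ⊗ (g ⊗ y))
      distribute a b g y = trans (Laws.*-distribʳ-+ y (a ⊗ g) (⊖ (b ⊗ g))) (cong₂ _⊕_ (Laws.*-assoc a g y)
        (trans (≡-sym (Laws.neg-distribˡ-* (b ⊗ g) y)) (cong ⊖_ (Laws.*-assoc b g y))))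

      v₀ : sumF (λ l → val (c₀ l) ⊗ y l) ≡ y m
      v₀ = trans (sumF-cong λ l → cong (_⊗ y l) (val-pick _)) (sumF-δ m y)

      v₁ : Bad m → sumF (λ l → val (c₁ l) ⊗ y l) ≡ y m
      v₁ b = trans (sumF-cong λ l → cong (λ z → val (if z then c₀ l else zer) ⊗ y l) (dec-true (bad? m) b)) v₀

      v₁' : ¬ Bad m → sumF (λ l → val (c₁ l) ⊗ y l) ≡ 0ℚ
      v₁' b = sumF-0 λ l → trans (cong (λ z → val (if z then c₀ l else zer) ⊗ y l) (dec-false (bad? m) b)) (Laws.*-zeroˡ (y l))

      v₂ : sumF (λ l → val (c₂ l) ⊗ y l) ≡ Marg y i (λ _ → 1ℚ)
      v₂ = trans (on-y c₂) (∑-cong λ {l} _ → trans (cong (_⊗ y l) (val-pick _)) (cong (at-block i l ⊗_) (≡-sym (Laws.*-identityˡ (y l)))))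

      v₃ : (∀ j → N i j ≡ true → Bag N p j) → sumF (λ l → val (c₃ l) ⊗ y l) ≡ Marg y i f ⊕ ⊖ Marg y p f
      v₃ s = trans (on-y c₃) (trans (∑-cong λ {l} _ → trans (cong (λ z → val (if z then diff (does (block l Finₚ.≟ i) ∧ agree i (set m) (set l))
                 (does (block l Finₚ.≟ p) ∧ agree i (set m) (set l)) else zer) ⊗ y l) (dec-true (sub? i p) s))
               (trans (cong (_⊗ y l) (trans (val-diff _ _) (cong₂ (λ a b → a ⊕ ⊖ b) (ind-∧ _ _) (ind-∧ _ _))))
                 (distribute (at-block i l) (at-block p l) (f l) (y l))))
             (trans (∑-+ items _ _) (cong (Marg y i f ⊕_) (∑-neg items _))))

      v₃' : ¬ (∀ j → N i j ≡ true → Bag N p j) → sumF (λ l → val (c₃ l) ⊗ y l) ≡ 0ℚ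
      v₃' s = sumF-0 λ l → trans (cong (λ z → val (if z then diff (does (block l Finₚ.≟ i) ∧ agree i (set m) (set l))
                 (does (block l Finₚ.≟ p) ∧ agree i (set m) (set l)) else zer) ⊗ y l) (dec-false (sub? i p) s)) (Laws.*-zeroˡ (y l))

      v₄ : sumF (λ l → val (c₄ l) ⊗ y l) ≡ Marg y i (λ l → ind (set l i))
      v₄ = trans (on-y c₄) (∑-cong λ {l} _ → trans (cong (_⊗ y l) (trans (val-pick _) (ind-∧ _ _))) (Laws.*-assoc (at-block i l) _ (y l)))

      ve : sumF (λ j → val (e j) ⊗ x j) ≡ x i
      ve = trans (sumF-cong λ j → cong (_⊗ x j) (val-pick _)) (sumF-δ i x)

    lhs : ∀ {a b a' b' c} → a ≡ a' → b ≡ b' → a ⊕ b ≼ c → a' ⊕ b' ≼ c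
    lhs refl refl h = h

    plus₀ : ∀ {a b c} → a ≡ 0ℚ → a ⊕ b ≼ c → b ≼ c
    plus₀ {b = b} {c} refl h = subst (_≼ c) (Laws.+-identityˡ b) h

    plus₀' : ∀ {a b c} → a ≡ 0ℚ → b ≼ c → a ⊕ b ≼ c
    plus₀' {b = b} {c} refl h = subst (_≼ c) (≡-sym (Laws.+-identityˡ b)) h

    neg-≤ : ∀ {a b} → ⊖ a ≼ ⊖ b → b ≼ a
    neg-≤ {a} {b} h = subst₂ _≼_ (Laws.neg-involutive b) (Laws.neg-involutive a) (Laws.neg-antimono-≤ h)

    neg-≤0 : ∀ {a} → ⊖ a ≼ 0ℚ → 0ℚ ≼ a
    neg-≤0 {a} h = neg-≤ (subst (⊖ a ≼_) (≡-sym Laws.neg-zero) h)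

    diff-0 : ∀ {a b} → a ⊕ ⊖ b ≡ 0ℚ → a ≡ b
    diff-0 {a} {b} h = trans (≡-sym (trans (Laws.+-assoc a (⊖ b) b) (trans (cong (a ⊕_) (Laws.+-inverseˡ b)) (Laws.+-identityʳ a)))) (trans (cong (_⊕ b) h) (Laws.+-identityˡ b))

    0-diff : ∀ {a b} → a ≡ b → a ⊕ ⊖ b ≡ 0ℚ
    0-diff {a} refl = Laws.+-inverseʳ a

    feasible : (∀ k i p m → Holds (row k i p m)) → Feasible x y
    feasible h = record
      { nonneg = λ m → neg-≤0 (subst (_≼ 0ℚ) (trans (minus-sum (Base.c₀ (block m) (block m) m) y) (cong ⊖_ (At.v₀ (block m) (block m) m)))
                   (plus₀ zero-sum (h fz (block m) (block m) m)))
      ; no-bad = λ m b → ℚₚ.≤-antisym (subst (_≼ 0ℚ) (At.v₁ (block m) (block m) m b) (plus₀ zero-sum (h (fs fz) (block m) (block m) m)))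
                   (neg-≤0 (subst (_≼ 0ℚ) (trans (minus-sum (Base.c₀ (block m) (block m) m) y) (cong ⊖_ (At.v₀ (block m) (block m) m)))
                     (plus₀ zero-sum (h fz (block m) (block m) m))))
      -- The item merely fills a coordinate of the row index; the one for the empty set always
      -- exists.
      ; total = λ i → let m = can (λ _ → false) i in ℚₚ.≤-antisym
          (subst (_≼ 1ℚ) (At.v₂ i i m) (plus₀ zero-sum (h (fs (fs fz)) i i m)))
          (neg-≤ (subst₂ _≼_ (trans (minus-sum (Base.c₂ i i m) y) (cong ⊖_ (At.v₂ i i m))) val-neg (plus₀ zero-sum (h (fs (fs (fs fz))) i i m))))
      ; consist = λ i p m s → diff-0 (ℚₚ.≤-antisym
          (subst (_≼ 0ℚ) (At.v₃ i p m s) (plus₀ zero-sum (h (fs (fs (fs (fs fz)))) i p m)))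
          (neg-≤0 (subst (_≼ 0ℚ) (trans (minus-sum (Base.c₃ i p m) y) (cong ⊖_ (At.v₃ i p m s))) (plus₀ zero-sum (h (fs (fs (fs (fs (fs fz))))) i p m)))))
      ; project = λ i → let m = can (λ _ → false) i in diff-0 (ℚₚ.≤-antisym
          (lhs (At.ve i i m) (trans (minus-sum (Base.c₄ i i m) y) (cong ⊖_ (At.v₄ i i m))) (h (fs (fs (fs (fs (fs (fs fz)))))) i i m))
          (neg-≤0 (subst (_≼ 0ℚ) (neg-diff (x i) _) (lhs (trans (minus-sum (Base.e i i m) x) (cong ⊖_ (At.ve i i m))) (At.v₄ i i m)
            (h (fs (fs (fs (fs (fs (fs (fs fz))))))) i i m))))) }
      where
      neg-diff : ∀ a b → ⊖ a ⊕ b ≡ ⊖ (a ⊕ ⊖ b)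
      neg-diff a b = ≡-sym (trans (Laws.neg-distrib-+ a (⊖ b)) (cong (⊖ a ⊕_) (Laws.neg-involutive b)))

    holds : Feasible x y → ∀ k i p m → Holds (row k i p m)
    holds F = go
      where
      open Feasible F
      neg0 : ∀ {a} → a ≡ 0ℚ → ⊖ a ≼ 0ℚ
      neg0 refl = ℚₚ.≤-reflexive Laws.neg-zero
      go : ∀ k i p m → Holds (row k i p m)
      go fz i p m = plus₀' zero-sum (subst (_≼ 0ℚ) (≡-sym (trans (minus-sum (Base.c₀ i p m) y) (cong ⊖_ (At.v₀ i p m)))) (subst (⊖ y m ≼_) Laws.neg-zero (Laws.neg-antimono-≤ (nonneg m))))
      go (fs fz) i p m = plus₀' zero-sum (ℚₚ.≤-reflexive (case bad? m of λ where
        (yes b) → trans (At.v₁ i p m b) (no-bad m b)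
        (no nb) → At.v₁' i p m nb))
      go (fs (fs fz)) i p m = plus₀' zero-sum (ℚₚ.≤-reflexive (trans (At.v₂ i p m) (total i)))
      go (fs (fs (fs fz))) i p m = plus₀' zero-sum (ℚₚ.≤-reflexive (trans (minus-sum (Base.c₂ i p m) y) (trans (cong ⊖_ (trans (At.v₂ i p m) (total i))) (≡-sym val-neg))))
      go (fs (fs (fs (fs fz)))) i p m = plus₀' zero-sum (ℚₚ.≤-reflexive (zero₃ i p m))
        where
        zero₃ : ∀ i p m → sumF (λ l → val (Base.c₃ i p m l) ⊗ y l) ≡ 0ℚ
        zero₃ i p m = case sub? i p of λ where
          (yes s) → trans (At.v₃ i p m s) (0-diff (consist i p m s))
          (no ns) → At.v₃' i p m ns
      go (fs (fs (fs (fs (fs fz))))) i p m = plus₀' zero-sum (subst (_≼ 0ℚ) (≡-sym (minus-sum (Base.c₃ i p m) y)) (neg0 (case sub? i p of λ where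
          (yes s) → trans (At.v₃ i p m s) (0-diff (consist i p m s))
          (no ns) → At.v₃' i p m ns)))
      go (fs (fs (fs (fs (fs (fs fz)))))) i p m = lhs (≡-sym (At.ve i p m)) (≡-sym (trans (minus-sum (Base.c₄ i p m) y) (cong ⊖_ (At.v₄ i p m))))
        (ℚₚ.≤-reflexive (0-diff (project i)))
      go (fs (fs (fs (fs (fs (fs (fs fz))))))) i p m = lhs (≡-sym (trans (minus-sum (Base.e i p m) x) (cong ⊖_ (At.ve i p m)))) (≡-sym (At.v₄ i p m))
        (ℚₚ.≤-reflexive (trans (cong (⊖ x i ⊕_) (≡-sym (project i))) (Laws.+-inverseˡ (x i))))

  extended : IsExtendedFormulation G system
  extended x = (λ s → let y , F = complete s in y , Values.satisfy x y (Values.holds x y F)) ,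
    λ (y , s) → Sound.sound (Values.feasible x y (Values.satisfied x y s))

  sumFinℕ-const : ∀ {k c} {f : Fin k → ℕ} → (∀ i → f i ≡ c) → sumFinℕ f ≡ k * c
  sumFinℕ-const {zero} h = refl
  sumFinℕ-const {suc k} h = cong₂ _+_ (h fz) (sumFinℕ-const (h ∘ fs))

  size-system : size system ≡ R + M + R * (n * 2 + M * 2 + 2)
  size-system = cong (R + M +_) (sumFinℕ-const λ r → cong₂ _+_ (cong₂ _+_ (sumFinℕ-const λ j → bits-val (proj₁ (code r) j))
    (sumFinℕ-const λ l → bits-val (proj₁ (proj₂ (code r)) l))) (bits-val (proj₂ (proj₂ (code r)))))

-- Encodings of indices and the bound on the size

split₂ : ∀ a b {X : Set} → (Fin b → X) → Fin (a * b) → Fin a × X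
split₂ a b f r = let i , r₁ = remQuot {a} b r in i , f r₁

split₂-combine : ∀ a b {X : Set} (f : Fin b → X) i j → split₂ a b f (combine i j) ≡ (i , f j)
split₂-combine a b f i j = cong (λ (i , r) → i , f r) (Finₚ.remQuot-combine {a} {b} i j)

split₄ : ∀ a b c d → Fin (a * (b * (c * d))) → Fin a × Fin b × Fin c × Fin d
split₄ a b c d = split₂ a (b * (c * d)) (split₂ b (c * d) (split₂ c d id))

join₄ : ∀ a b c d → Fin a × Fin b × Fin c × Fin d → Fin (a * (b * (c * d)))
join₄ a b c d (i , j , k , l) = combine i (combine j (combine k l))

split-join₄ : ∀ a b c d x → split₄ a b c d (join₄ a b c d x) ≡ x
split-join₄ a b c d (i , j , k , l) = trans (split₂-combine a (b * (c * d)) (split₂ b (c * d) (split₂ c d id)) i (combine j (combine k l)))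
  (cong (i ,_) (trans (split₂-combine b (c * d) (split₂ c d id) j (combine k l)) (cong (j ,_) (split₂-combine c d id k l))))

module Encoding (n K : ℕ) where

  module _ {X : Set} (fun : Fin K → X) (code : X → Fin K) (R : X → X → Set) (law : ∀ f → R (fun (code f)) f) where

    item : Fin (n * K) → Fin n × X
    item l = let i , t = remQuot {n} K l in i , fun t

    pack : Fin n → X → Fin (n * K)
    pack i f = combine i (code f)

    item-block : ∀ i f → proj₁ (item (pack i f)) ≡ i
    item-block i f = cong proj₁ (Finₚ.remQuot-combine {n} {K} i (code f))

    item-tuple : ∀ i f → R (proj₂ (item (pack i f))) f
    item-tuple i f = subst (λ z → R (fun z) f) (≡-sym (cong proj₂ (Finₚ.remQuot-combine {n} {K} i (code f)))) (law f)

-- s stands for n + 1; as a variable it keeps its powers from being unfolded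
module Size (n s : ℕ) (n≤s : n ≤ s) .{{_ : ℕ.NonZero s}} where
  open ℕₚ.≤-Reasoning

  M R : ℕ
  M = n * s ^ 6
  R = 8 * (n * (n * M))

  M≤ : M ≤ s ^ 7
  M≤ = ℕₚ.*-monoˡ-≤ (s ^ 6) n≤s

  R≤ : R ≤ 8 * s ^ 9
  R≤ = ℕₚ.*-monoʳ-≤ 8 (ℕₚ.*-mono-≤ n≤s (ℕₚ.*-mono-≤ n≤s M≤))

  n≤ : n ≤ s ^ 7
  n≤ = ℕₚ.≤-trans n≤s (ℕₚ.≤-trans (ℕₚ.≤-reflexive (≡-sym (ℕₚ.^-identityʳ s))) (ℕₚ.^-monoʳ-≤ s {1} {7} (s≤s z≤n)))

  1≤ : 1 ≤ s ^ 7
  1≤ = ℕₚ.^-monoʳ-≤ s {0} {7} z≤n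

  row≤ : n * 2 + M * 2 + 2 ≤ s ^ 7 * 6
  row≤ = begin
    n * 2 + M * 2 + 2                     ≤⟨ ℕₚ.+-mono-≤ (ℕₚ.+-mono-≤ (ℕₚ.*-monoˡ-≤ 2 n≤) (ℕₚ.*-monoˡ-≤ 2 M≤)) (ℕₚ.*-monoˡ-≤ 2 1≤) ⟩
    s ^ 7 * 2 + s ^ 7 * 2 + s ^ 7 * 2     ≡⟨ cong (_+ s ^ 7 * 2) (≡-sym (ℕₚ.*-distribˡ-+ (s ^ 7) 2 2)) ⟩
    s ^ 7 * 4 + s ^ 7 * 2                 ≡⟨ ≡-sym (ℕₚ.*-distribˡ-+ (s ^ 7) 4 2) ⟩
    s ^ 7 * 6                             ∎

  product≤ : R * (n * 2 + M * 2 + 2) ≤ 48 * s ^ 16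
  product≤ = begin
    R * (n * 2 + M * 2 + 2)    ≤⟨ ℕₚ.*-mono-≤ R≤ row≤ ⟩
    8 * s ^ 9 * (s ^ 7 * 6)    ≡⟨ ≡-sym (ℕₚ.*-assoc (8 * s ^ 9) (s ^ 7) 6) ⟩
    8 * s ^ 9 * s ^ 7 * 6      ≡⟨ cong (_* 6) (trans (ℕₚ.*-assoc 8 (s ^ 9) (s ^ 7)) (cong (8 *_) (≡-sym (ℕₚ.^-distribˡ-+-* s 9 7)))) ⟩
    8 * s ^ 16 * 6             ≡⟨ ℕₚ.*-comm (8 * s ^ 16) 6 ⟩
    6 * (8 * s ^ 16)           ≡⟨ ≡-sym (ℕₚ.*-assoc 6 8 (s ^ 16)) ⟩
    48 * s ^ 16                ∎

  -- 57 is 8 + 1 + 48: rows, variables, and 8 · 6 for the coefficients, where 6 is two bits each for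
  -- the `x` part, the `y` part and the right-hand side.
  total≤ : R + M + R * (n * 2 + M * 2 + 2) ≤ 57 * s ^ 16
  total≤ = begin
    R + M + R * (n * 2 + M * 2 + 2)
      ≤⟨ ℕₚ.+-mono-≤ (ℕₚ.+-mono-≤ (ℕₚ.≤-trans R≤ (ℕₚ.*-monoʳ-≤ 8 (ℕₚ.^-monoʳ-≤ s (ℕₚ.m≤m+n 9 7))))
                       (ℕₚ.≤-trans M≤ (ℕₚ.^-monoʳ-≤ s (ℕₚ.m≤m+n 7 9)))) product≤ ⟩
    8 * s ^ 16 + s ^ 16 + 48 * s ^ 16
      ≡⟨ cong (_+ 48 * s ^ 16) (ℕₚ.+-comm (8 * s ^ 16) (s ^ 16)) ⟩
    9 * s ^ 16 + 48 * s ^ 16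
      ≡⟨ ≡-sym (ℕₚ.*-distribʳ-+ (s ^ 16) 9 48) ⟩
    57 * s ^ 16 ∎

-- For positive `n`, `suc n` is at most `2 * n`; the additive constant takes care of `n` = 0.
suc-power : ∀ n k → suc n ^ k ≤ 2 ^ k * n ^ k + 2 ^ k
suc-power zero k = ℕₚ.≤-trans (ℕₚ.≤-reflexive (ℕₚ.^-zeroˡ k)) (ℕₚ.≤-trans (ℕₚ.^-monoʳ-≤ 2 {0} {k} z≤n) (ℕₚ.m≤n+m (2 ^ k) _))
suc-power n@(suc m) k = ℕₚ.≤-trans (ℕₚ.^-monoˡ-≤ k double) (ℕₚ.≤-trans (ℕₚ.≤-reflexive (split-power k)) (ℕₚ.m≤m+n _ _))
  where
  double : suc n ≤ 2 * n
  double = subst (suc n ≤_) (cong (n +_) (≡-sym (ℕₚ.+-identityʳ n))) (ℕₚ.+-monoˡ-≤ n {1} {n} (s≤s z≤n))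
  split-power : ∀ k → (2 * n) ^ k ≡ 2 ^ k * n ^ k
  split-power zero = refl
  split-power (suc k) = trans (cong (2 * n *_) (split-power k)) (ℕₚ.[m*n]*[o*p]≡[m*o]*[n*p] 2 n (2 ^ k) (n ^ k))

-- the exponent is a variable so that the constants are not evaluated
poly-bound : ∀ k {a b n} → a ≤ b * suc n ^ k → a ≤ b * 2 ^ k * n ^ k + b * 2 ^ k
poly-bound k {a} {b} {n} h = ℕₚ.≤-trans h (ℕₚ.≤-trans (ℕₚ.*-monoʳ-≤ b (suc-power n k))
  (ℕₚ.≤-reflexive (trans (ℕₚ.*-distribˡ-+ b (2 ^ k * n ^ k) (2 ^ k)) (cong (_+ b * 2 ^ k) (≡-sym (ℕₚ.*-assoc b (2 ^ k) (n ^ k)))))))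

module Compact {n : ℕ} (G : Graph n) (cf : CapFree G) (ehf : EvenHoleFree G) (K : ℕ)
  (fun : Fin K → Fin 6 → Fin (suc n)) (code : (Fin 6 → Fin (suc n)) → Fin K) (law : ∀ f k → fun (code f) k ≡ f k) where

  formulation : Σ (System n) λ S → IsExtendedFormulation G S ×
    size S ≡ 8 * (n * (n * (n * K))) + n * K + 8 * (n * (n * (n * K))) * (n * 2 + n * K * 2 + 2)
  formulation = let N , l , T = TreeDecomposition.tree-exists G cf ehf
                    open Encoding n K
                    module F = Formulation G N l T (item fun code (λ f g → ∀ k → f k ≡ g k) law) (pack fun code (λ f g → ∀ k → f k ≡ g k) law)
                      (item-block fun code (λ f g → ∀ k → f k ≡ g k) law) (item-tuple fun code (λ f g → ∀ k → f k ≡ g k) law)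
                      (split₄ 8 n n (n * K)) (join₄ 8 n n (n * K)) (split-join₄ 8 n n (n * K))
                in F.system , F.extended , F.size-system

  bounded : ∀ s → n ≤ s → .{{_ : ℕ.NonZero s}} → K ≡ s ^ 6 → Σ (System n) λ S → IsExtendedFormulation G S × size S ≤ 57 * s ^ 16
  bounded s n≤s refl = let S , ext , sz = formulation in S , ext , ℕₚ.≤-trans (ℕₚ.≤-reflexive sz) (Size.total≤ n s n≤s)

tuples : ∀ m k → Σ (Fin (m ^ k) → Fin k → Fin m) λ fun → Σ ((Fin k → Fin m) → Fin (m ^ k)) λ code → ∀ f i → fun (code f) i ≡ f i
tuples m k = finToFun , funToFin , Finₚ.finToFun-funToFin

choose-constants : ∀ b k → (∀ n (G : Graph n) → CapFree G → EvenHoleFree G → Σ (System n) λ S → IsExtendedFormulation G S × size S ≤ b * suc n ^ k) →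
  ∃ λ c → ∃ λ k → ∀ (n : ℕ) (G : Graph n) → CapFree G → EvenHoleFree G → Σ (System n) λ S → IsExtendedFormulation G S × size S ≤ c * n ^ k + c
choose-constants b k h = b * 2 ^ k , k , λ n G cf ehf → let S , ext , le = h n G cf ehf in S , ext , poly-bound k {size S} {b} {n} le

theorem2 : ∃ λ c → ∃ λ k → ∀ (n : ℕ) (G : Graph n) → CapFree G → EvenHoleFree G →
    Σ (System n) λ S → IsExtendedFormulation G S × size S ≤ c * n ^ k + c
theorem2 = choose-constants 57 16 λ n G cf ehf → let fun , code , law = tuples (suc n) 6 in
  Compact.bounded G cf ehf (suc n ^ 6) fun code law (suc n) (ℕₚ.n≤1+n n) refl
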